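{- Let $\Delta$ be a two-dimensional lattice polygon. Then $\mathrm{ls}_\Sigma(\Delta) = \mathrm{ls}_\Sigma(\Delta^{(1)}) + 3$, except in the following situations, where the values are as stated. 1. $\Delta \simeq \mathrm{conv}\{(0,0),(a,0),(0,1),(b,1)\}$ with either $a=b=1$, or $a \ge 2$ and $a \ge b \ge 0$. Then $\mathrm{ls}_\Sigma(\Delta^{(1)}) = -2$. Moreover $\mathrm{ls}_\Sigma(\Delta) = a+1$ if $a=b$, and $\mathrm{ls}_\Sigma(\Delta) = a$ if $a>b$. 2. $\Delta \simeq \mathrm{conv}\{(0,0),(2,0),(0,2)\}$. Then $\mathrm{ls}_\Sigma(\Delta^{(1)}) = -2$ and $\mathrm{ls}_\Sigma(\Delta) = 2$. 3. $\Delta \simeq \mathrm{conv}\{(0,0),(4,0),(0,2)\}$. Then $\mathrm{ls}_\Sigma(\Delta^{(1)}) = 0$ and $\mathrm{ls}_\Sigma(\Delta) = 4$. 4. $\Delta \simeq [0,a]\times[0,b]$ for some integers $a,b \ge 2$. Then $\mathrm{ls}_\Sigma(\Delta^{(1)}) = a+b-4$ and $\mathrm{ls}_\Sigma(\Delta) = a+b$. 5. There exist an edge $\tau$ of $\Delta$ and an edge $\tau'$ of $\Delta^{(1)}$ that are parallel, whose supporting lines are at integral distance $1$ from each other, and such that $\sharp(\tau\cap\mathbb{Z}^2) - \sharp(\tau'\cap\mathbb{Z}^2) \ge 4$. Then $\mathrm{ls}_\Sigma(\Delta^{(1)}) = \sharp(\tau'\cap\mathbb{Z}^2) - 1$ and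 $\mathrm{ls}_\Sigma(\Delta) = \sharp(\tau\cap\mathbb{Z}^2) - 1$; that is, both lattice sizes equal the integral lengths of $\tau'$ and $\tau$ respectively.
   Context: A lattice polygon is the convex hull of finitely many points of $\mathbb{Z}^2$; it may be empty, a point or a segment. $\Delta^{(1)}$ is the convex hull of the lattice points in the interior of $\Delta$. A unimodular transformation is an affine map $v \mapsto Av+w$ with $A \in \mathrm{GL}_2(\mathbb{Z})$ and $w \in \mathbb{Z}^2$; $\Delta \simeq \Delta'$ means $\Delta' = \varphi(\Delta)$ for such a $\varphi$. Let $\Sigma = \mathrm{conv}\{(0,0),(1,0),(0,1)\}$. For a non-empty lattice polygon $\Gamma$, $\mathrm{ls}_\Sigma(\Gamma)$ is the smallest integer $d \ge 0$ with $\varphi(\Gamma) \subset d\Sigma$ for some unimodular $\varphi$; by convention $\mathrm{ls}_\Sigma(\emptyset) = -2$. An edge is a one-dimensional face; a one-dimensional polygon is an edge of itself. Two parallel lines $aX+bY=c$ and $aX+bY=c'$, with $a,b$ coprime integers and $c,c' \in \mathbb{Z}$, are at integral distance $|c-c'|$. -}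

module Defs where

open import Data.Integer as ℤ using (ℤ; +_)
open import Data.Nat as ℕ using (ℕ)
open import Data.Integer.GCD using (gcd)
open import Data.Rational as ℚ using (ℚ; 0ℚ; 1ℚ; _/_)
open import Data.Product using (Σ; ∃; _×_; _,_; proj₁; proj₂)
open import Data.Sum using (_⊎_)
open import Data.List using (List; []; _∷_; length)
open import Data.List.Relation.Unary.All using (All)
open import Data.List.Relation.Unary.Unique.Propositional using (Unique)
open import Data.List.Membership.Propositional using (_∈_)
open import Relation.Binary.PropositionalEquality using (_≡_)
open import Relation.Nullary using (¬_)

-- Lattice points and points of the plane.  The plane ℝ² is modelled by ℚ².
Pt : Set
Pt = ℤ × ℤ

QPt : Set
QPt = ℚ × ℚ

ι : ℤ → ℚ
ι z = z / 1

emb : Pt → QPt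
emb (x , y) = (ι x , ι y)

QSet : Set₁
QSet = QPt → Set

wsum : List (ℚ × Pt) → ℚ
wsum []             = 0ℚ
wsum ((w , _) ∷ l)  = w ℚ.+ wsum l

wcomb : List (ℚ × Pt) → QPt
wcomb []                  = (0ℚ , 0ℚ)
wcomb ((w , (x , y)) ∷ l) =
  (w ℚ.* ι x ℚ.+ proj₁ (wcomb l) , w ℚ.* ι y ℚ.+ proj₂ (wcomb l))

Conv : (Pt → Set) → QSet
Conv P q = Σ (List (ℚ × Pt)) λ l →
  All (λ wp → (0ℚ ℚ.≤ proj₁ wp) × P (proj₂ wp)) l × wsum l ≡ 1ℚ × wcomb l ≡ q

Poly : List Pt → QSet
Poly S = Conv (λ p → p ∈ S)

TwoDim : QSet → Set
TwoDim C = Σ QPt λ p → Σ QPt λ q → Σ QPt λ r →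
  C p × C q × C r ×
  ¬ ((proj₁ q ℚ.- proj₁ p) ℚ.* (proj₂ r ℚ.- proj₂ p)
      ≡ (proj₂ q ℚ.- proj₂ p) ℚ.* (proj₁ r ℚ.- proj₁ p))

Interior : QSet → QSet
Interior C p = Σ ℚ λ ε → (0ℚ ℚ.< ε) × ((q : QPt) →
  ℚ.∣ proj₁ q ℚ.- proj₁ p ∣ ℚ.≤ ε → ℚ.∣ proj₂ q ℚ.- proj₂ p ∣ ℚ.≤ ε → C q)

Inner : QSet → QSet
Inner C = Conv (λ p → Interior C (emb p))

record Unimod : Set where
  constructor unimod
  field
    a₁₁ a₁₂ a₂₁ a₂₂ w₁ w₂ : ℤ
    det± : (a₁₁ ℤ.* a₂₂ ℤ.- a₁₂ ℤ.* a₂₁ ≡ + 1) ⊎ (a₁₁ ℤ.* a₂₂ ℤ.- a₁₂ ℤ.* a₂₁ ≡ ℤ.- + 1)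

apply : Unimod → QPt → QPt
apply φ (x , y) =
  ( ι a₁₁ ℚ.* x ℚ.+ ι a₁₂ ℚ.* y ℚ.+ ι w₁
  , ι a₂₁ ℚ.* x ℚ.+ ι a₂₂ ℚ.* y ℚ.+ ι w₂ )
  where open Unimod φ

Image : Unimod → QSet → QSet
Image φ C q = Σ QPt λ p → C p × apply φ p ≡ q

_≃_ : QSet → QSet → Set
C ≃ D = Σ Unimod λ φ → (q : QPt) → (D q → Image φ C q) × (Image φ C q → D q)

InDSigma : ℕ → QPt → Set
InDSigma d (x , y) = (0ℚ ℚ.≤ x) × (0ℚ ℚ.≤ y) × (x ℚ.+ y ℚ.≤ ι (+ d))

Fits : QSet → ℕ → Set
Fits C d = Σ Unimod λ φ → (q : QPt) → C q → InDSigma d (apply φ q)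

-- LS C n  :  ls_Σ(C) = n   (with ls_Σ(∅) = -2)
LS : QSet → ℤ → Set
LS C n =
  ((¬ Σ QPt C) × n ≡ ℤ.- + 2)
  ⊎ (Σ QPt C × Σ ℕ λ d → n ≡ + d × Fits C d × ((d' : ℕ) → Fits C d' → d ℕ.≤ d'))

Face : QSet → ℚ → ℚ → ℚ → QSet
Face C α β γ q = C q × (α ℚ.* proj₁ q ℚ.+ β ℚ.* proj₂ q ≡ γ)

IsEdge : QSet → ℚ → ℚ → ℚ → Set
IsEdge C α β γ =
  ¬ (α ≡ 0ℚ × β ≡ 0ℚ)
  × ((q : QPt) → C q → α ℚ.* proj₁ q ℚ.+ β ℚ.* proj₂ q ℚ.≤ γ)
  × (Σ QPt λ p → Σ QPt λ q → Face C α β γ p × Face C α β γ q × ¬ p ≡ q)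

OnLine : QSet → ℤ → ℤ → ℤ → Set
OnLine τ a b c = (q : QPt) → τ q → ι a ℚ.* proj₁ q ℚ.+ ι b ℚ.* proj₂ q ≡ ι c

ParallelDist1 : QSet → QSet → Set
ParallelDist1 τ τ' = Σ ℤ λ a → Σ ℤ λ b → Σ ℤ λ c → Σ ℤ λ c' →
  gcd a b ≡ + 1 × OnLine τ a b c × OnLine τ' a b c' × ℤ.∣ c ℤ.- c' ∣ ≡ 1

LatCount : QSet → ℕ → Set
LatCount τ k = Σ (List Pt) λ L → Unique L × length L ≡ k ×
  ((p : Pt) → (p ∈ L → τ (emb p)) × (τ (emb p) → p ∈ L))

pt : ℕ → ℕ → Pt
pt x y = (+ x , + y)

Trap : ℕ → ℕ → QSet
Trap a b = Poly (pt 0 0 ∷ pt a 0 ∷ pt 0 1 ∷ pt b 1 ∷ [])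

Tri2 : QSet
Tri2 = Poly (pt 0 0 ∷ pt 2 0 ∷ pt 0 2 ∷ [])

Tri42 : QSet
Tri42 = Poly (pt 0 0 ∷ pt 4 0 ∷ pt 0 2 ∷ [])

Rect : ℕ → ℕ → QSet
Rect a b = Poly (pt 0 0 ∷ pt a 0 ∷ pt 0 b ∷ pt a b ∷ [])

module Submission where

-- A lattice point is interior to Δ iff every line through it has points of Δ strictly on both sides.
-- The three inequalities defining dΣ are therefore strict at interior points, so Δ ⊂ dΣ gives
-- Δ⁽¹⁾ ⊂ (1,1) + (d − 3)Σ and ls(Δ) ≥ ls(Δ⁽¹⁾) + 3.
--
-- Conversely, let Δ⁽¹⁾ ⊂ dΣ with d minimal.  If Δ leaves the copy of (d + 3)Σ obtained by moving the sides of dΣ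
-- out by one, let X be the linear form of a violated side, and let v ∈ Δ and p ∈ Δ⁽¹⁾ be extremal for X.
-- Extremality of p makes p − v primitive, so p = v + e₁ + e₂ for a lattice basis with X(e₁), X(e₂) ≥ 1; neither
-- v + e₁ nor v + e₂ is interior, which forces Δ into the cone v + ℝ₊e₁ + ℝ₊e₂.  In the frame (v, e₁, e₂) the
-- inner polygon fits again into a translate of dΣ, and the same argument at the side opposite to v leaves only
-- rectangles, the triangle (0,0), (4,0), (0,2), polygons with a long edge, and polygons contained in (d + 3)Σ.
--
-- If Δ⁽¹⁾ is empty, choose an edge as the x-axis: since no point (t,1) is interior, Δ has width one,
-- or is equivalent to 2Σ.
--
-- The lattice size is computable because the image of a fixed triangle bounds the matrix entries of any frame.

-- The overview speaks of a minimal `d`, but nothing below assumes minimality. An arbitrary inner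
-- fit of size `n` is taken, and wherever minimality would be used a fit of size `n - 1` is produced
-- instead; recursion on `n` then shows that, outside the exceptions, an inner fit of size `k`
-- yields an outer fit of size at most `k + 3`. A least fit has to be searched for only once, for
-- the outer polygon, because the generic clause must exhibit its value. Everything hinges on two
-- facing corners. A violated side leaves a gap of at least 2 between `v` and `p`, which is what
-- allows `p - v` to split into two vectors on which `X` is positive. Let F and G be the coordinate
-- sums of the generators of the second cone, and α, β the cone coordinates of an inner point far
-- from its apex. Then (α - 1)(F - 1) + (β - 1)(G - 1) ≤ 0. So F = G = 1, which leads to rectangles
-- and triangles, or for `n > 0` one of α, β is 1, which leads to a long edge or a fit. For `n = 0`
-- one only gets α = β = 1, so polygons with one interior point are classified by hand.

open import Defs
open import Data.Integer as ℤ using (ℤ; +_)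
open import Data.Nat as ℕ using (ℕ)
open import Data.Rational as ℚ using (ℚ)
open import Data.Product using (Σ; _×_; _,_; proj₁; proj₂)
open import Data.Sum using (_⊎_; inj₁; inj₂; [_,_]′)
open import Data.List using (List; []; _∷_; map)
open import Relation.Binary.PropositionalEquality using (_≡_; refl; sym; trans; cong; cong₂; subst; subst₂)
open import Relation.Nullary using (¬_; Dec; yes; no)
open import Data.Empty using (⊥; ⊥-elim)
import Data.Integer.Properties as ℤₚ
import Data.List.Properties as Listₚ
import Data.Nat.Properties as ℕₚ
import Data.Rational.Properties as ℚₚ
open import Data.List.Membership.Propositional using (_∈_)
open import Data.List.Membership.Propositional.Properties using (∈-map⁺; ∈-map⁻)
open import Relation.Binary.Definitions using (Tri; tri<; tri≈; tri>)

-- A certifying decision procedure for linear arithmetic over ordered rings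

module LinearArithmetic where
  open import Algebra.Structures using (IsCommutativeRing)
  open import Data.Bool using (Bool; true; false; if_then_else_; _∧_; _∨_; not; T)
  open import Data.Bool.Properties using (T-∧)
  open import Data.Integer using (-[1+_])
  open import Data.List using (_++_; concatMap; length; filterᵇ; zipWith)
  open import Data.Maybe using (Maybe; just; nothing)
  open import Data.Nat using (zero; suc; _≡ᵇ_; _<ᵇ_; _≤ᵇ_)
  open import Data.Nat.Properties using (≡ᵇ⇒≡)
  open import Data.Unit using (⊤; tt)
  open import Function using (_∘_)
  open import Function.Bundles using (Equivalence)

  -- One solver serves the integers and the rationals. The stability fields are there because every
  -- goal is proved by refuting its negation; `discrete` and `tighten` record that over the integers
  -- `0 < x` sharpens to `1 ≤ x`.
  record OrderedRing : Set₁ where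
    field
      R     : Set
      plus times : R → R → R
      neg   : R → R
      0# 1# : R
      isCommutativeRing : IsCommutativeRing _≡_ plus times neg 0# 1#
      cast     : ℤ → R
      cast-+   : ∀ a b → cast (a ℤ.+ b) ≡ plus (cast a) (cast b)
      cast-*   : ∀ a b → cast (a ℤ.* b) ≡ times (cast a) (cast b)
      cast-0   : cast (+ 0) ≡ 0#
      cast-1   : cast (+ 1) ≡ 1#
      minus : R → R → R
      minus-def : ∀ x y → minus x y ≡ plus x (neg y)
      _⊑_ _⊏_ : R → R → Set
      ⊏⇒⊑   : ∀ {x y} → x ⊏ y → x ⊑ y
      ⊏-irrefl : ∀ {x} → ¬ (x ⊏ x)
      ⊑-antisym : ∀ {x y} → x ⊑ y → y ⊑ x → x ≡ y
      ⊑-refl : ∀ {x} → x ⊑ x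
      ⊑⇒0   : ∀ {x y} → x ⊑ y → 0# ⊑ plus y (neg x)
      ⊏⇒0   : ∀ {x y} → x ⊏ y → 0# ⊏ plus y (neg x)
      ¬⊑⇒⊏  : ∀ {x y} → ¬ (x ⊑ y) → y ⊏ x
      ⊑-stable : ∀ {x y} → ¬ ¬ (x ⊑ y) → x ⊑ y
      ⊏-stable : ∀ {x y} → ¬ ¬ (x ⊏ y) → x ⊏ y
      ¬⊏⇒⊑  : ∀ {x y} → ¬ (x ⊏ y) → y ⊑ x
      0⊑+   : ∀ {x y} → 0# ⊑ x → 0# ⊑ y → 0# ⊑ plus x y
      0⊏+   : ∀ {x y} → 0# ⊏ x → 0# ⊑ y → 0# ⊏ plus x y
      0⊑*   : ∀ {x y} → 0# ⊑ x → 0# ⊑ y → 0# ⊑ times x y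
      0⊏*   : ∀ {x y} → 0# ⊏ x → 0# ⊏ y → 0# ⊏ times x y
      0⊑cast   : ∀ n → 0# ⊑ cast (+ n)
      0⊏cast   : ∀ n → 0# ⊏ cast (+ suc n)
      0⋢cast   : ∀ n → ¬ (0# ⊑ cast -[1+ n ])
      discrete : Bool
      tighten  : T discrete → ∀ {x} → 0# ⊏ x → 0# ⊑ plus x (cast -[1+ 0 ])

  infixl 6 _:+_ _:-_
  infixl 7 _:*_
  infix  8 :-_
  infix  5 _:≤_ _:<_ _:≡_
  infixr 3 _⇒_
  infix  4 ⊢_ _⊩_
  infix  6 _⊛_ _⊙_

  data Expr : Set where
    var  : ℕ → Expr
    con  : ℤ → Expr
    _:+_ _:*_ _:-_ : Expr → Expr → Expr
    :-_  : Expr → Expr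

  κ : ℕ → Expr
  κ n = con (+ n)

  data Formula : Set where
    _:≤_ _:<_ _:≡_ : Expr → Expr → Formula
    :⊥ : Formula

  -- Row 0 is the negated goal and the hypotheses are numbered from 1:
  -- i ⊛ j adds the product of two rows, i ⊙ e multiplies an equation by e.
  data Hint : Set where
    _⊛_ : ℕ → ℕ → Hint
    _⊙_ : ℕ → Expr → Hint

  data Sequent : Set where
    ⊢_  : Formula → Sequent
    _⊩_ : List Hint → Formula → Sequent
    _⇒_ : Formula → Sequent → Sequent

  -- Sequents are functions of their variables, so that uses of `lin` read with ordinary binders;
  -- `inst` numbers these binders.
  Fun : ℕ → Set
  Fun zero    = Sequent
  Fun (suc n) = Expr → Fun n

  inst : ∀ n → ℕ → Fun n → Sequent
  inst zero    k s = s
  inst (suc n) k f = inst n (suc k) (f (var k))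

  Mono : Set
  Mono = List ℕ

  -- Sparse polynomials, kept sorted so that like monomials meet and cancel. The search treats
  -- distinct monomials as independent unknowns; nonlinear facts enter only through the product rows
  -- named by hints.
  Poly′ : Set
  Poly′ = List (Mono × ℤ)

  eqᵐ : Mono → Mono → Bool
  eqᵐ []       []       = true
  eqᵐ (x ∷ xs) (y ∷ ys) = (x ≡ᵇ y) ∧ eqᵐ xs ys
  eqᵐ _        _        = false

  eqᵐ-sound : ∀ m m′ → T (eqᵐ m m′) → m ≡ m′
  eqᵐ-sound []       []       _ = refl
  eqᵐ-sound (x ∷ xs) (y ∷ ys) t with Equivalence.to T-∧ t
  ... | p , q = cong₂ _∷_ (≡ᵇ⇒≡ x y p) (eqᵐ-sound xs ys q)

  ltᵐ : Mono → Mono → Bool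
  ltᵐ []       []       = false
  ltᵐ []       (_ ∷ _)  = true
  ltᵐ (_ ∷ _)  []       = false
  ltᵐ (x ∷ xs) (y ∷ ys) = (x <ᵇ y) ∨ ((x ≡ᵇ y) ∧ ltᵐ xs ys)

  insVar : ℕ → Mono → Mono
  insVar x []       = x ∷ []
  insVar x (y ∷ ys) = if x ≤ᵇ y then x ∷ y ∷ ys else y ∷ insVar x ys

  mulᵐ : Mono → Mono → Mono
  mulᵐ []       m = m
  mulᵐ (x ∷ xs) m = insVar x (mulᵐ xs m)

  isZero : ℤ → Bool
  isZero (+ 0) = true
  isZero _     = false

  consNZ : Mono → ℤ → Poly′ → Poly′
  consNZ m c p = if isZero c then p else (m , c) ∷ p

  insMono : Mono → ℤ → Poly′ → Poly′
  insMono m c [] = consNZ m c []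
  insMono m c ((m′ , c′) ∷ p) =
    if eqᵐ m m′ then consNZ m′ (c ℤ.+ c′) p
    else if ltᵐ m m′ then consNZ m c ((m′ , c′) ∷ p)
    else (m′ , c′) ∷ insMono m c p

  addᵖ : Poly′ → Poly′ → Poly′
  addᵖ []            q = q
  addᵖ ((m , c) ∷ p) q = insMono m c (addᵖ p q)

  mulMono : Mono → ℤ → Poly′ → Poly′
  mulMono m c []              = []
  mulMono m c ((m′ , c′) ∷ p) = insMono (mulᵐ m m′) (c ℤ.* c′) (mulMono m c p)

  scaleᵖ : ℤ → Poly′ → Poly′
  scaleᵖ c p = mulMono [] c p

  mulᵖ : Poly′ → Poly′ → Poly′
  mulᵖ []            q = []
  mulᵖ ((m , c) ∷ p) q = addᵖ (mulMono m c q) (mulᵖ p q)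

  norm : Expr → Poly′
  norm (var i)  = (i ∷ [] , + 1) ∷ []
  norm (con c)  = consNZ [] c []
  norm (e :+ f) = addᵖ (norm e) (norm f)
  norm (e :* f) = mulᵖ (norm e) (norm f)
  norm (e :- f) = addᵖ (norm e) (scaleᵖ -[1+ 0 ] (norm f))
  norm (:- e)   = scaleᵖ -[1+ 0 ] (norm e)

  data Kind : Set where
    nonneg pos zer : Kind

  Row : Set
  Row = Kind × Poly′

  -- Fourier-Motzkin elimination over the monomials. It carries no correctness proof: its only
  -- output is a list of multipliers, which `combine` applies afresh to the input rows, so an error
  -- here could make a proof fail but never make it wrong.
  module Search where

    -- A row under elimination, with its history as a combination of the input rows.
    record SRow : Set where
      constructor srow
      field
        kind : Kind
        poly : Poly′
        cert : List ℤ

    open SRow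

    isZer : Kind → Bool
    isZer zer = true
    isZer _   = false

    joinK : Kind → Kind → Kind
    joinK pos _   = pos
    joinK _   pos = pos
    joinK zer zer = zer
    joinK _   _   = nonneg

    coeff : Mono → Poly′ → ℤ
    coeff m [] = + 0
    coeff m ((m′ , c) ∷ p) = if eqᵐ m m′ then c else coeff m p

    comb : ℤ → SRow → ℤ → SRow → SRow
    comb a r b s = srow (joinK (kind r) (kind s)) (addᵖ (scaleᵖ a (poly r)) (scaleᵖ b (poly s)))
                        (zipWith ℤ._+_ (map (a ℤ.*_) (cert r)) (map (b ℤ.*_) (cert s)))

    isNeg : ℤ → Bool
    isNeg -[1+ _ ] = true
    isNeg _        = false

    isPosℤ : ℤ → Bool
    isPosℤ (+ suc _) = true
    isPosℤ _         = false

    contradictory : SRow → Bool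
    contradictory (srow zer    (([] , c) ∷ [])       _) = not (isZero c)
    contradictory (srow k      (([] , -[1+ _ ]) ∷ []) _) = true
    contradictory (srow pos    []                    _) = true
    contradictory _ = false

    -- `combine` has to end in a negative constant. A row of kind `zer` combines equations only, so
    -- if its constant is positive all its multipliers may change sign.
    orient : SRow → List ℤ
    orient (srow zer ((_ , + _) ∷ _) c) = map ℤ.-_ c
    orient r                            = cert r

    trivial : SRow → Bool
    trivial (srow _ []              _) = true
    trivial (srow _ (([] , _) ∷ []) _) = true
    trivial _ = false

    findRow : (SRow → Bool) → List SRow → Maybe SRow
    findRow f []       = nothing
    findRow f (r ∷ rs) = if f r then just r else findRow f rs

    firstMono : Poly′ → Maybe (Mono × ℤ)
    firstMono []                     = nothing
    firstMono (([] , _) ∷ p)         = firstMono p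
    firstMono ((m@(_ ∷ _) , c) ∷ _)  = just (m , c)

    splitEq : List SRow → Maybe (SRow × List SRow)
    splitEq [] = nothing
    splitEq (r ∷ rs) with isZer (kind r)
    ... | true  = just (r , rs)
    ... | false with splitEq rs
    ...   | nothing       = nothing
    ...   | just (e , rs′) = just (e , r ∷ rs′)

    sgn∙ : ℤ → ℤ → ℤ
    sgn∙ (+ _)    a = ℤ.- a
    sgn∙ -[1+ _ ] a = a

    elimEq : Mono → ℤ → SRow → List SRow → List SRow
    elimEq m c e [] = []
    elimEq m c e (r ∷ rs) with coeff m (poly r)
    ... | + 0 = r ∷ elimEq m c e rs
    -- The multiplier of `r` is positive, and the equation `e` may be scaled by either sign, so the
    -- kind of `r` survives.
    ... | a   = record (comb (+ ℤ.∣ c ∣) r (sgn∙ c a) e) { kind = kind r } ∷ elimEq m c e rs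

    support : List ℤ → ℕ
    support []          = 0
    support (+ 0 ∷ cs)  = support cs
    support (_   ∷ cs)  = suc (support cs)

    countPN : Mono → List SRow → ℕ × ℕ
    countPN m [] = 0 , 0
    countPN m (r ∷ rs) with coeff m (poly r) | countPN m rs
    ... | + 0      | p , n = p , n
    ... | + suc _  | p , n = suc p , n
    ... | -[1+ _ ] | p , n = p , suc n

    cost : Mono → List SRow → ℕ
    cost m rs with countPN m rs
    ... | p , n = p ℕ.* n

    better : List SRow → Mono → Maybe (Mono × ℕ) → Maybe (Mono × ℕ)
    better rs m nothing        = just (m , cost m rs)
    better rs m (just (m′ , k)) with cost m rs
    ... | k′ = if k′ <ᵇ k then just (m , k′) else just (m′ , k)

    bestIn : List SRow → Poly′ → Maybe (Mono × ℕ) → Maybe (Mono × ℕ)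
    bestIn rs []                  b = b
    bestIn rs (([] , _) ∷ p)      b = bestIn rs p b
    bestIn rs ((m@(_ ∷ _) , _) ∷ p) b = bestIn rs p (better rs m b)

    best : List SRow → List SRow → Maybe (Mono × ℕ)
    best rs []       = nothing
    best rs (r ∷ qs) = bestIn rs (poly r) (best rs qs)

    sel : (ℤ → Bool) → Mono → List SRow → List SRow
    sel f m = filterᵇ (λ r → f (coeff m (poly r)))

    pairUp : Mono → SRow → SRow → SRow
    pairUp m p n = comb (+ ℤ.∣ coeff m (poly n) ∣) p (+ ℤ.∣ coeff m (poly p) ∣) n

    -- Kohler's rule: after k eliminations, rows built from more than k + 1 inputs are redundant.
    elimFM : ℕ → Mono → List SRow → List SRow
    elimFM k m rs =
      filterᵇ (λ r → support (cert r) ≤ᵇ k)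
        (concatMap (λ p → map (pairUp m p) (sel isNeg m rs)) (sel isPosℤ m rs))
      ++ sel isZero m rs

    run : ℕ → ℕ → List SRow → Maybe (List ℤ)
    run zero       k rs = nothing
    run (suc fuel) k rs with findRow contradictory rs
    ... | just r = just (orient r)
    ... | nothing with filterᵇ (not ∘ trivial) rs
    ...   | rs₁ with splitEq rs₁
    ...     | just (e , rs₂) with firstMono (poly e)
    ...       | nothing      = nothing
    ...       | just (m , c) = run fuel (suc k) (elimEq m c e rs₂)
    run (suc fuel) k rs | nothing | rs₁ | nothing with best rs₁ rs₁
    ...     | nothing      = nothing
    ...     | just (m , _) = run fuel (suc k) (elimFM (suc (suc k)) m rs₁)

    unit : ℕ → ℕ → List ℤ
    unit zero    _       = []
    unit (suc n) zero    = + 1 ∷ unit n (suc n)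
    unit (suc n) (suc i) = + 0 ∷ unit n i

    initial : ℕ → ℕ → List Row → List SRow
    initial n i []             = []
    initial n i ((k , p) ∷ rs) = srow k p (unit n i) ∷ initial n (suc i) rs

    search : List Row → List ℤ
    -- The fuel caps the number of eliminated monomials. On failure the empty certificate is
    -- returned, which `refutes` rejects.
    search rs with run 60 0 (initial (length rs) 0 rs)
    ... | just c  = c
    ... | nothing = []

  -- Sum of the rows scaled by the certificate; the flag records strict positivity.
  combine : List Row → List ℤ → Bool × Poly′
  combine []              cs        = false , []
  combine rs              []        = false , []
  combine ((zer    , p) ∷ rs) (c ∷ cs) with combine rs cs
  ... | s , q = s , addᵖ (scaleᵖ c p) q
  combine ((nonneg , p) ∷ rs) (+ n ∷ cs) with combine rs cs
  ... | s , q = s , addᵖ (scaleᵖ (+ n) p) q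
  combine ((pos , p) ∷ rs) (+ suc n ∷ cs) with combine rs cs
  ... | s , q = true , addᵖ (scaleᵖ (+ suc n) p) q
  combine (_ ∷ rs) (_ ∷ cs) = combine rs cs

  refutes : Bool × Poly′ → Bool
  refutes (_    , ([] , -[1+ _ ]) ∷ []) = true
  refutes (true , [])                   = true
  refutes _                             = false

  nth : List Row → ℕ → Row
  nth []       _       = nonneg , []
  nth (r ∷ _)  zero    = r
  nth (_ ∷ rs) (suc i) = nth rs i

  mulRow : Row → Row → Row
  mulRow (zer , p) (_   , q) = zer , mulᵖ p q
  mulRow (_   , p) (zer , q) = zer , mulᵖ p q
  mulRow (pos , p) (pos , q) = pos , mulᵖ p q
  mulRow (_   , p) (_   , q) = nonneg , mulᵖ p q

  scaleRow : Row → Expr → Row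
  scaleRow (zer , p) e = zer , mulᵖ p (norm e)
  scaleRow _         e = nonneg , []

  product′ : List Row → Hint → Row
  product′ rs (i ⊛ j) = mulRow (nth rs i) (nth rs j)
  product′ rs (i ⊙ e) = scaleRow (nth rs i) e

  products : List Row → List Hint → List Row
  products rs = map (product′ rs)

  closed : List Row → List Hint → Bool
  closed rs hints = refutes (combine rs′ (Search.search rs′))
    where rs′ = rs ++ products rs hints

  module Linear (𝓡 : OrderedRing) where
    open OrderedRing 𝓡
    open IsCommutativeRing isCommutativeRing
      using (+-assoc; +-comm; +-identityˡ; +-identityʳ; *-assoc; *-comm; *-identityˡ; *-identityʳ; distribˡ; distribʳ; zeroˡ; zeroʳ; -‿inverseˡ; -‿inverseʳ)

    private
      infixl 6 _⊕_
      infixl 7 _⊗_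
      _⊕_ = plus
      _⊗_ = times

    lookup : List R → ℕ → R
    lookup []      _       = 0#
    lookup (x ∷ _) zero    = x
    lookup (_ ∷ ρ) (suc i) = lookup ρ i

    ⟦_⟧ : Expr → List R → R
    ⟦ var i  ⟧ ρ = lookup ρ i
    ⟦ con c  ⟧ ρ = cast c
    ⟦ e :+ f ⟧ ρ = plus (⟦ e ⟧ ρ) (⟦ f ⟧ ρ)
    ⟦ e :* f ⟧ ρ = times (⟦ e ⟧ ρ) (⟦ f ⟧ ρ)
    ⟦ e :- f ⟧ ρ = minus (⟦ e ⟧ ρ) (⟦ f ⟧ ρ)
    ⟦ :- e   ⟧ ρ = neg (⟦ e ⟧ ρ)

    ⟦_⟧ᶠ : Formula → List R → Set
    ⟦ e :≤ f ⟧ᶠ ρ = ⟦ e ⟧ ρ ⊑ ⟦ f ⟧ ρ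
    ⟦ e :< f ⟧ᶠ ρ = ⟦ e ⟧ ρ ⊏ ⟦ f ⟧ ρ
    ⟦ e :≡ f ⟧ᶠ ρ = ⟦ e ⟧ ρ ≡ ⟦ f ⟧ ρ
    ⟦ :⊥     ⟧ᶠ ρ = ⊥

    ⟦_⟧ˢ : Sequent → List R → Set
    ⟦ ⊢ φ   ⟧ˢ ρ = ⟦ φ ⟧ᶠ ρ
    ⟦ _ ⊩ φ ⟧ˢ ρ = ⟦ φ ⟧ᶠ ρ
    ⟦ φ ⇒ s ⟧ˢ ρ = ⟦ φ ⟧ᶠ ρ → ⟦ s ⟧ˢ ρ

    Curried : ℕ → (List R → Set) → Set
    Curried zero    P = P []
    Curried (suc n) P = (x : R) → Curried n (λ ρ → P (x ∷ ρ))

    curried : ∀ n {P : List R → Set} → (∀ ρ → P ρ) → Curried n P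
    curried zero    f = f []
    curried (suc n) f = λ x → curried n (λ ρ → f (x ∷ ρ))

    module _ (ρ : List R) where

      ⟦_⟧ᵐ : Mono → R
      ⟦ []    ⟧ᵐ = 1#
      ⟦ i ∷ m ⟧ᵐ = lookup ρ i ⊗ ⟦ m ⟧ᵐ

      ⟦_⟧ᵖ : Poly′ → R
      ⟦ []          ⟧ᵖ = 0#
      ⟦ (m , c) ∷ p ⟧ᵖ = cast c ⊗ ⟦ m ⟧ᵐ ⊕ ⟦ p ⟧ᵖ

      *-swap : ∀ a b c → a ⊗ (b ⊗ c) ≡ b ⊗ (a ⊗ c)
      *-swap a b c = trans (sym (*-assoc a b c)) (trans (cong (_⊗ c) (*-comm a b)) (*-assoc b a c))

      +-swap : ∀ a b c → a ⊕ (b ⊕ c) ≡ b ⊕ (a ⊕ c)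
      +-swap a b c = trans (sym (+-assoc a b c)) (trans (cong (_⊕ c) (+-comm a b)) (+-assoc b a c))

      insVar-sound : ∀ x m → ⟦ insVar x m ⟧ᵐ ≡ lookup ρ x ⊗ ⟦ m ⟧ᵐ
      insVar-sound x []       = refl
      insVar-sound x (y ∷ ys) with x ≤ᵇ y
      ... | true  = refl
      ... | false = trans (cong (lookup ρ y ⊗_) (insVar-sound x ys)) (*-swap (lookup ρ y) (lookup ρ x) ⟦ ys ⟧ᵐ)

      mulᵐ-sound : ∀ m m′ → ⟦ mulᵐ m m′ ⟧ᵐ ≡ ⟦ m ⟧ᵐ ⊗ ⟦ m′ ⟧ᵐ
      mulᵐ-sound []       m′ = sym (*-identityˡ _)
      mulᵐ-sound (x ∷ xs) m′ = trans (insVar-sound x (mulᵐ xs m′))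
        (trans (cong (lookup ρ x ⊗_) (mulᵐ-sound xs m′)) (sym (*-assoc _ _ _)))

      consNZ-sound : ∀ m c p → ⟦ consNZ m c p ⟧ᵖ ≡ cast c ⊗ ⟦ m ⟧ᵐ ⊕ ⟦ p ⟧ᵖ
      consNZ-sound m (+ 0)     p = sym (trans (cong (λ z → z ⊗ ⟦ m ⟧ᵐ ⊕ ⟦ p ⟧ᵖ) cast-0)
        (trans (cong (_⊕ ⟦ p ⟧ᵖ) (zeroˡ _)) (+-identityˡ _)))
      consNZ-sound m (+ suc n) p = refl
      consNZ-sound m -[1+ n ]  p = refl

      insMono-sound : ∀ m c p → ⟦ insMono m c p ⟧ᵖ ≡ cast c ⊗ ⟦ m ⟧ᵐ ⊕ ⟦ p ⟧ᵖ
      insMono-sound m c [] = consNZ-sound m c []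
      insMono-sound m c ((m′ , c′) ∷ p) with eqᵐ m m′ | eqᵐ-sound m m′
      ... | true | eq with eq tt
      ...   | refl = trans (consNZ-sound m (c ℤ.+ c′) p)
                      (trans (cong (λ z → z ⊗ ⟦ m ⟧ᵐ ⊕ ⟦ p ⟧ᵖ) (cast-+ c c′))
                      (trans (cong (_⊕ ⟦ p ⟧ᵖ) (distribʳ _ _ _)) (+-assoc _ _ _)))
      insMono-sound m c ((m′ , c′) ∷ p) | false | _ with ltᵐ m m′
      ...   | true  = consNZ-sound m c ((m′ , c′) ∷ p)
      ...   | false = trans (cong ((cast c′ ⊗ ⟦ m′ ⟧ᵐ) ⊕_) (insMono-sound m c p)) (+-swap _ _ _)

      addᵖ-sound : ∀ p q → ⟦ addᵖ p q ⟧ᵖ ≡ ⟦ p ⟧ᵖ ⊕ ⟦ q ⟧ᵖ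
      addᵖ-sound []            q = sym (+-identityˡ _)
      addᵖ-sound ((m , c) ∷ p) q = trans (insMono-sound m c (addᵖ p q))
        (trans (cong ((cast c ⊗ ⟦ m ⟧ᵐ) ⊕_) (addᵖ-sound p q)) (sym (+-assoc _ _ _)))

      mulMono-sound : ∀ m c p → ⟦ mulMono m c p ⟧ᵖ ≡ (cast c ⊗ ⟦ m ⟧ᵐ) ⊗ ⟦ p ⟧ᵖ
      mulMono-sound m c []              = sym (zeroʳ _)
      mulMono-sound m c ((m′ , c′) ∷ p) =
        trans (insMono-sound (mulᵐ m m′) (c ℤ.* c′) (mulMono m c p))
        (trans (cong₂ _⊕_
          (trans (cong₂ _⊗_ (cast-* c c′) (mulᵐ-sound m m′))
          (trans (*-assoc _ _ _) (trans (cong (cast c ⊗_) (*-swap _ _ _)) (sym (*-assoc _ _ _)))))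
          (mulMono-sound m c p))
        (sym (distribˡ _ _ _)))

      scaleᵖ-sound : ∀ c p → ⟦ scaleᵖ c p ⟧ᵖ ≡ cast c ⊗ ⟦ p ⟧ᵖ
      scaleᵖ-sound c p = trans (mulMono-sound [] c p) (cong (_⊗ ⟦ p ⟧ᵖ) (*-identityʳ _))

      mulᵖ-sound : ∀ p q → ⟦ mulᵖ p q ⟧ᵖ ≡ ⟦ p ⟧ᵖ ⊗ ⟦ q ⟧ᵖ
      mulᵖ-sound []            q = sym (zeroˡ _)
      mulᵖ-sound ((m , c) ∷ p) q = trans (addᵖ-sound (mulMono m c q) (mulᵖ p q))
        (trans (cong₂ _⊕_ (mulMono-sound m c q) (mulᵖ-sound p q)) (sym (distribʳ _ _ _)))

      private
        inverse-unique : ∀ a b → a ⊕ b ≡ 0# → a ≡ neg b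
        inverse-unique a b e = trans (sym (+-identityʳ a)) (trans (cong (a ⊕_) (sym (-‿inverseʳ b)))
          (trans (sym (+-assoc _ _ _)) (trans (cong (_⊕ neg b) e) (+-identityˡ _))))

        cast-1⊗ : ∀ x → cast -[1+ 0 ] ⊗ x ≡ neg x
        cast-1⊗ x = inverse-unique _ _ (trans (cong (cast -[1+ 0 ] ⊗ x ⊕_) (trans (sym (*-identityˡ x)) (cong (_⊗ x) (sym cast-1))))
          (trans (sym (distribʳ _ _ _)) (trans (cong (_⊗ x) (trans (sym (cast-+ -[1+ 0 ] (+ 1))) cast-0)) (zeroˡ x))))

      norm-sound : ∀ e → ⟦ norm e ⟧ᵖ ≡ ⟦ e ⟧ ρ
      norm-sound (var i)  = trans (+-identityʳ _) (trans (cong₂ _⊗_ cast-1 (*-identityʳ _)) (*-identityˡ _))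
      norm-sound (con c)  = trans (consNZ-sound [] c []) (trans (+-identityʳ _) (*-identityʳ _))
      norm-sound (e :+ f) = trans (addᵖ-sound (norm e) (norm f)) (cong₂ _⊕_ (norm-sound e) (norm-sound f))
      norm-sound (e :* f) = trans (mulᵖ-sound (norm e) (norm f)) (cong₂ _⊗_ (norm-sound e) (norm-sound f))
      norm-sound (e :- f) = trans (addᵖ-sound (norm e) _)
        (trans (cong₂ _⊕_ (norm-sound e) (trans (scaleᵖ-sound -[1+ 0 ] (norm f)) (trans (cast-1⊗ _) (cong neg (norm-sound f)))))
        (sym (minus-def _ _)))
      norm-sound (:- e)   = trans (scaleᵖ-sound -[1+ 0 ] (norm e)) (trans (cast-1⊗ _) (cong neg (norm-sound e)))

      Holds : Row → Set
      Holds (nonneg , p) = 0# ⊑ ⟦ p ⟧ᵖ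
      Holds (pos    , p) = 0# ⊏ ⟦ p ⟧ᵖ
      Holds (zer    , p) = 0# ≡ ⟦ p ⟧ᵖ

      AllHold : List Row → Set
      AllHold []       = ⊤
      AllHold (r ∷ rs) = Holds r × AllHold rs

      Signed : Bool × Poly′ → Set
      Signed (false , p) = 0# ⊑ ⟦ p ⟧ᵖ
      Signed (true  , p) = 0# ⊏ ⟦ p ⟧ᵖ

      signed-+ : ∀ s p q → 0# ⊑ ⟦ p ⟧ᵖ → Signed (s , q) → Signed (s , addᵖ p q)
      signed-+ false p q hp hq = subst (0# ⊑_) (sym (addᵖ-sound p q)) (0⊑+ hp hq)
      signed-+ true  p q hp hq = subst (0# ⊏_) (trans (+-comm _ _) (sym (addᵖ-sound p q))) (0⊏+ hq hp)

      signed⇒⊑ : ∀ s q → Signed (s , q) → 0# ⊑ ⟦ q ⟧ᵖ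
      signed⇒⊑ false q h = h
      signed⇒⊑ true  q h = ⊏⇒⊑ h

      combine-sound : ∀ rs cs → AllHold rs → Signed (combine rs cs)
      combine-sound []      cs      _ = ⊑-refl
      combine-sound (_ ∷ _) []      _ = ⊑-refl
      combine-sound ((zer , p) ∷ rs) (c ∷ cs) (h , hs) with combine rs cs | combine-sound rs cs hs
      ... | s , q | hq = signed-+ s (scaleᵖ c p) q
        (subst (0# ⊑_) (sym (trans (scaleᵖ-sound c p) (trans (cong (cast c ⊗_) (sym h)) (zeroʳ _)))) ⊑-refl) hq
      combine-sound ((nonneg , p) ∷ rs) (+ n ∷ cs) (h , hs) with combine rs cs | combine-sound rs cs hs
      ... | s , q | hq = signed-+ s (scaleᵖ (+ n) p) q (subst (0# ⊑_) (sym (scaleᵖ-sound (+ n) p)) (0⊑* (0⊑cast n) h)) hq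
      combine-sound ((nonneg , p) ∷ rs) (-[1+ n ] ∷ cs) (h , hs) = combine-sound rs cs hs
      combine-sound ((pos , p) ∷ rs) (+ 0 ∷ cs) (h , hs) = combine-sound rs cs hs
      combine-sound ((pos , p) ∷ rs) (+ suc n ∷ cs) (h , hs) with combine rs cs | combine-sound rs cs hs
      ... | s , q | hq = subst (0# ⊏_) (sym (addᵖ-sound (scaleᵖ (+ suc n) p) q))
        (0⊏+ (subst (0# ⊏_) (sym (scaleᵖ-sound (+ suc n) p)) (0⊏* (0⊏cast n) h)) (signed⇒⊑ s q hq))
      combine-sound ((pos , p) ∷ rs) (-[1+ n ] ∷ cs) (h , hs) = combine-sound rs cs hs

      refutes-sound : ∀ r → T (refutes r) → Signed r → ⊥
      refutes-sound (s , ([] , -[1+ n ]) ∷ []) _ h =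
        0⋢cast n (subst (0# ⊑_) (trans (+-identityʳ _) (*-identityʳ _)) (signed⇒⊑ s _ h))
      refutes-sound (true  , []) _ h = ⊏-irrefl h
      refutes-sound (false , []) () h
      refutes-sound (true  , ([] , + _) ∷ _) () h
      refutes-sound (false , ([] , + _) ∷ _) () h
      refutes-sound (true  , ([] , -[1+ _ ]) ∷ _ ∷ _) () h
      refutes-sound (false , ([] , -[1+ _ ]) ∷ _ ∷ _) () h
      refutes-sound (true  , (_ ∷ _ , _) ∷ _) () h
      refutes-sound (false , (_ ∷ _ , _) ∷ _) () h

      nth-sound : ∀ rs i → AllHold rs → Holds (nth rs i)
      nth-sound []       i       _        = ⊑-refl
      nth-sound (r ∷ rs) zero    (h , _)  = h
      nth-sound (r ∷ rs) (suc i) (_ , hs) = nth-sound rs i hs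

      mulRow-sound : ∀ r s → Holds r → Holds s → Holds (mulRow r s)
      mulRow-sound (zer , p) (_ , q) h k =
        trans (sym (zeroˡ _)) (trans (cong (_⊗ ⟦ q ⟧ᵖ) h) (sym (mulᵖ-sound p q)))
      mulRow-sound (nonneg , p) (zer , q) h k =
        trans (sym (zeroʳ _)) (trans (cong (⟦ p ⟧ᵖ ⊗_) k) (sym (mulᵖ-sound p q)))
      mulRow-sound (pos , p) (zer , q) h k =
        trans (sym (zeroʳ _)) (trans (cong (⟦ p ⟧ᵖ ⊗_) k) (sym (mulᵖ-sound p q)))
      mulRow-sound (pos , p) (pos , q) h k = subst (0# ⊏_) (sym (mulᵖ-sound p q)) (0⊏* h k)
      mulRow-sound (nonneg , p) (pos , q) h k = subst (0# ⊑_) (sym (mulᵖ-sound p q)) (0⊑* h (⊏⇒⊑ k))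
      mulRow-sound (pos , p) (nonneg , q) h k = subst (0# ⊑_) (sym (mulᵖ-sound p q)) (0⊑* (⊏⇒⊑ h) k)
      mulRow-sound (nonneg , p) (nonneg , q) h k = subst (0# ⊑_) (sym (mulᵖ-sound p q)) (0⊑* h k)

      scaleRow-sound : ∀ r e → Holds r → Holds (scaleRow r e)
      scaleRow-sound (zer , p) e h =
        trans (sym (zeroˡ _)) (trans (cong (_⊗ ⟦ norm e ⟧ᵖ) h) (sym (mulᵖ-sound p (norm e))))
      scaleRow-sound (nonneg , p) e h = ⊑-refl
      scaleRow-sound (pos    , p) e h = ⊑-refl

      products-sound : ∀ rs hints → AllHold rs → AllHold (products rs hints)
      products-sound rs []              hs = tt
      products-sound rs (i ⊛ j ∷ hints) hs =
        mulRow-sound (nth rs i) (nth rs j) (nth-sound rs i hs) (nth-sound rs j hs) , products-sound rs hints hs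
      products-sound rs (i ⊙ e ∷ hints) hs =
        scaleRow-sound (nth rs i) e (nth-sound rs i hs) , products-sound rs hints hs

      ++-hold : ∀ rs ss → AllHold rs → AllHold ss → AllHold (rs ++ ss)
      ++-hold []       ss _        k = k
      ++-hold (r ∷ rs) ss (h , hs) k = h , ++-hold rs ss hs k

      closed-sound : ∀ rs hints → T (closed rs hints) → AllHold rs → ⊥
      closed-sound rs hints t hs = refutes-sound _ t
        (combine-sound _ (Search.search (rs ++ products rs hints)) (++-hold rs _ hs (products-sound rs hints hs)))

    -- Elimination reasons over the rationals; writing `0 < e` as `e - 1 ≥ 0`, for hypotheses and
    -- negated goals alike, is the only place where integrality enters.
    strictRow : Expr → Row
    strictRow e = if discrete then (nonneg , norm (e :+ con -[1+ 0 ])) else (pos , norm e)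

    rowOf : Formula → Row
    rowOf (e :≤ f) = nonneg , norm (f :- e)
    rowOf (e :< f) = strictRow (f :- e)
    rowOf (e :≡ f) = zer , norm (f :- e)
    rowOf :⊥       = nonneg , norm (con -[1+ 0 ])

    strictRow-sound : ∀ ρ e → 0# ⊏ ⟦ e ⟧ ρ → Holds ρ (strictRow e)
    strictRow-sound ρ e h with discrete | tighten
    ... | true  | t = subst (0# ⊑_) (sym (norm-sound ρ (e :+ con -[1+ 0 ]))) (t tt h)
    ... | false | _ = subst (0# ⊏_) (sym (norm-sound ρ e)) h

    rowOf-sound : ∀ ρ φ → ⟦ φ ⟧ᶠ ρ → Holds ρ (rowOf φ)
    rowOf-sound ρ (e :≤ f) h = subst (0# ⊑_) (sym (trans (norm-sound ρ (f :- e)) (minus-def _ _))) (⊑⇒0 h)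
    rowOf-sound ρ (e :< f) h = strictRow-sound ρ (f :- e) (subst (0# ⊏_) (sym (minus-def _ _)) (⊏⇒0 h))
    rowOf-sound ρ (e :≡ f) h = trans (sym (-‿inverseʳ _))
      (trans (cong (λ z → plus (⟦ f ⟧ ρ) (neg z)) (sym h)) (sym (trans (norm-sound ρ (f :- e)) (minus-def _ _))))
    rowOf-sound ρ :⊥ ()

    provable : List Row → List Hint → Formula → Bool
    provable hs hints (e :≤ f) = closed (rowOf (f :< e) ∷ hs) hints
    provable hs hints (e :< f) = closed (rowOf (f :≤ e) ∷ hs) hints
    provable hs hints (e :≡ f) = closed (rowOf (f :< e) ∷ hs) hints ∧ closed (rowOf (e :< f) ∷ hs) hints
    -- A trivial row occupies index 0, so that hints number the hypotheses from 1 here as well.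
    provable hs hints :⊥       = closed ((nonneg , []) ∷ hs) hints

    provable-sound : ∀ ρ hs hints φ → T (provable hs hints φ) → AllHold ρ hs → ⟦ φ ⟧ᶠ ρ
    provable-sound ρ hs hints (e :≤ f) t h = ⊑-stable λ ¬g →
      closed-sound ρ (rowOf (f :< e) ∷ hs) hints t (rowOf-sound ρ (f :< e) (¬⊑⇒⊏ ¬g) , h)
    provable-sound ρ hs hints (e :< f) t h = ⊏-stable λ ¬g →
      closed-sound ρ (rowOf (f :≤ e) ∷ hs) hints t (rowOf-sound ρ (f :≤ e) (¬⊏⇒⊑ ¬g) , h)
    provable-sound ρ hs hints (e :≡ f) t h
      with Equivalence.to (T-∧ {closed (rowOf (f :< e) ∷ hs) hints} {closed (rowOf (e :< f) ∷ hs) hints}) t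
    ... | t₁ , t₂ = ⊑-antisym
      (⊑-stable λ ¬g → closed-sound ρ (rowOf (f :< e) ∷ hs) hints t₁ (rowOf-sound ρ (f :< e) (¬⊑⇒⊏ ¬g) , h))
      (⊑-stable λ ¬g → closed-sound ρ (rowOf (e :< f) ∷ hs) hints t₂ (rowOf-sound ρ (e :< f) (¬⊑⇒⊏ ¬g) , h))
    provable-sound ρ hs hints :⊥ t h = closed-sound ρ ((nonneg , []) ∷ hs) hints t (⊑-refl , h)

    valid : List Row → Sequent → Bool
    valid hs (⊢ φ)       = provable hs [] φ
    valid hs (hints ⊩ φ) = provable hs hints φ
    valid hs (φ ⇒ s)     = valid (hs ++ rowOf φ ∷ []) s

    valid-sound : ∀ ρ hs s → T (valid hs s) → AllHold ρ hs → ⟦ s ⟧ˢ ρ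
    valid-sound ρ hs (⊢ φ)       t h = provable-sound ρ hs [] φ t h
    valid-sound ρ hs (hints ⊩ φ) t h = provable-sound ρ hs hints φ t h
    valid-sound ρ hs (φ ⇒ s)     t h = λ x →
      valid-sound ρ (hs ++ rowOf φ ∷ []) s t (++-hold ρ hs _ h (rowOf-sound ρ φ x , tt))

    -- The hidden argument evaluates to the unit type when the search succeeds and is then filled by
    -- eta; otherwise the use of `lin` does not type-check.
    lin : ∀ n (f : Fun n) {_ : T (valid [] (inst n 0 f))} → Curried n ⟦ inst n 0 f ⟧ˢ
    lin n f {t} = curried n (λ ρ → valid-sound ρ [] (inst n 0 f) t tt)

-- The integers and the rationals as ordered rings

module OrderedRings where
  open import Data.Bool using (true; false)
  open import Data.Integer using (-[1+_])
  open import Data.Nat using (suc; z≤n; s≤s)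
  open import Data.Rational using (0ℚ; 1ℚ)
  import Data.Rational.Unnormalised as ℚᵘ
  import Data.Rational.Unnormalised.Properties as ℚᵘₚ
  open import Relation.Nullary.Decidable using (decidable-stable)
  open LinearArithmetic

  ℤ-0≤* : ∀ {x y} → + 0 ℤ.≤ x → + 0 ℤ.≤ y → + 0 ℤ.≤ x ℤ.* y
  ℤ-0≤* {x} {+ y} 0≤x _ = ℤₚ.*-monoʳ-≤-nonNeg (+ y) 0≤x

  ℤ-0<* : ∀ {x y} → + 0 ℤ.< x → + 0 ℤ.< y → + 0 ℤ.< x ℤ.* y
  ℤ-0<* {x} {+ suc y} 0<x _ = ℤₚ.*-monoʳ-<-pos (+ suc y) 0<x
  ℤ-0<* {x} {+ 0} _ (ℤ.+<+ ())

  ℤ-ring : OrderedRing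
  ℤ-ring = record
    { R = ℤ ; plus = ℤ._+_ ; times = ℤ._*_ ; neg = ℤ.-_ ; 0# = + 0 ; 1# = + 1
    ; isCommutativeRing = ℤₚ.+-*-isCommutativeRing
    ; cast = λ z → z ; cast-+ = λ _ _ → refl ; cast-* = λ _ _ → refl ; cast-0 = refl ; cast-1 = refl
    ; minus = ℤ._-_ ; minus-def = λ _ _ → refl
    ; _⊑_ = ℤ._≤_ ; _⊏_ = ℤ._<_
    ; ⊏⇒⊑ = ℤₚ.<⇒≤ ; ⊏-irrefl = ℤₚ.<-irrefl refl ; ⊑-antisym = ℤₚ.≤-antisym ; ⊑-refl = ℤₚ.≤-refl
    ; ⊑⇒0 = ℤₚ.i≤j⇒0≤j-i
    ; ⊏⇒0 = λ {x} {y} h → subst (ℤ._< y ℤ.+ ℤ.- x) (ℤₚ.+-inverseʳ x) (ℤₚ.+-monoˡ-< (ℤ.- x) h)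
    ; ¬⊑⇒⊏ = ℤₚ.≰⇒> ; ⊑-stable = decidable-stable (_ ℤₚ.≤? _) ; ⊏-stable = decidable-stable (_ ℤₚ.<? _) ; ¬⊏⇒⊑ = ℤₚ.≮⇒≥
    ; 0⊑+ = ℤₚ.+-mono-≤ ; 0⊏+ = ℤₚ.+-mono-<-≤ ; 0⊑* = ℤ-0≤* ; 0⊏* = ℤ-0<*
    ; 0⊑cast = λ _ → ℤ.+≤+ z≤n ; 0⊏cast = λ _ → ℤ.+<+ (s≤s z≤n) ; 0⋢cast = λ _ ()
    ; discrete = true
    ; tighten = λ { _ {+ suc n} _ → ℤ.+≤+ z≤n ; _ {+ 0} (ℤ.+<+ ()) }
    }

  -- `ι z` is a normalised fraction, which does not compute for a variable `z`. Unnormalised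
  -- fractions with denominator one do, and the ring laws of `ι` are transferred from them.
  toℚᵘ-ι : ∀ z → ℚ.toℚᵘ (ι z) ℚᵘ.≃ ℚᵘ.mkℚᵘ z 0
  toℚᵘ-ι z = ℚₚ.toℚᵘ-fromℚᵘ (ℚᵘ.mkℚᵘ z 0)

  ι-+ : ∀ a b → ι (a ℤ.+ b) ≡ ι a ℚ.+ ι b
  ι-+ a b = ℚₚ.toℚᵘ-injective (ℚᵘₚ.≃-trans (toℚᵘ-ι (a ℤ.+ b)) (ℚᵘₚ.≃-sym (ℚᵘₚ.≃-trans (ℚₚ.toℚᵘ-homo-+ (ι a) (ι b))
    (ℚᵘₚ.≃-trans (ℚᵘₚ.+-cong (toℚᵘ-ι a) (toℚᵘ-ι b))
      (ℚᵘ.*≡* (cong (ℤ._* + 1) (cong₂ ℤ._+_ (ℤₚ.*-identityʳ a) (ℤₚ.*-identityʳ b))))))))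

  ι-* : ∀ a b → ι (a ℤ.* b) ≡ ι a ℚ.* ι b
  ι-* a b = ℚₚ.toℚᵘ-injective (ℚᵘₚ.≃-trans (toℚᵘ-ι (a ℤ.* b)) (ℚᵘₚ.≃-sym (ℚᵘₚ.≃-trans (ℚₚ.toℚᵘ-homo-* (ι a) (ι b))
    (ℚᵘₚ.*-cong (toℚᵘ-ι a) (toℚᵘ-ι b)))))

  ι-mono-≤ : ∀ a b → a ℤ.≤ b → ι a ℚ.≤ ι b
  ι-mono-≤ a b h = ℚₚ.toℚᵘ-cancel-≤ (ℚᵘₚ.≤-respˡ-≃ (ℚᵘₚ.≃-sym (toℚᵘ-ι a)) (ℚᵘₚ.≤-respʳ-≃ (ℚᵘₚ.≃-sym (toℚᵘ-ι b))
    (ℚᵘ.*≤* (ℤₚ.*-monoʳ-≤-nonNeg (+ 1) h))))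

  ι-cancel-≤ : ∀ a b → ι a ℚ.≤ ι b → a ℤ.≤ b
  ι-cancel-≤ a b h with ℚᵘₚ.≤-respˡ-≃ (toℚᵘ-ι a) (ℚᵘₚ.≤-respʳ-≃ (toℚᵘ-ι b) (ℚₚ.toℚᵘ-mono-≤ h))
  ... | ℚᵘ.*≤* k = ℤₚ.*-cancelʳ-≤-pos a b (+ 1) k

  ι-mono-< : ∀ a b → a ℤ.< b → ι a ℚ.< ι b
  ι-mono-< a b h = ℚₚ.≰⇒> λ k → ℤₚ.<⇒≱ h (ι-cancel-≤ b a k)

  ι-injective : ∀ a b → ι a ≡ ι b → a ≡ b
  ι-injective a b e = ℤₚ.≤-antisym (ι-cancel-≤ a b (ℚₚ.≤-reflexive e)) (ι-cancel-≤ b a (ℚₚ.≤-reflexive (sym e)))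

  ℚ-ring : OrderedRing
  ℚ-ring = record
    { R = ℚ ; plus = ℚ._+_ ; times = ℚ._*_ ; neg = ℚ.-_ ; 0# = 0ℚ ; 1# = 1ℚ
    ; isCommutativeRing = ℚₚ.+-*-isCommutativeRing
    ; cast = ι ; cast-+ = ι-+ ; cast-* = ι-* ; cast-0 = refl ; cast-1 = refl
    ; minus = ℚ._-_ ; minus-def = λ _ _ → refl
    ; _⊑_ = ℚ._≤_ ; _⊏_ = ℚ._<_
    ; ⊏⇒⊑ = ℚₚ.<⇒≤ ; ⊏-irrefl = ℚₚ.<-irrefl refl ; ⊑-antisym = ℚₚ.≤-antisym ; ⊑-refl = ℚₚ.≤-refl
    ; ⊑⇒0 = λ {x} {y} h → subst (ℚ._≤ y ℚ.+ ℚ.- x) (ℚₚ.+-inverseʳ x) (ℚₚ.+-monoˡ-≤ (ℚ.- x) h)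
    ; ⊏⇒0 = λ {x} {y} h → subst (ℚ._< y ℚ.+ ℚ.- x) (ℚₚ.+-inverseʳ x) (ℚₚ.+-monoˡ-< (ℚ.- x) h)
    ; ¬⊑⇒⊏ = ℚₚ.≰⇒> ; ⊑-stable = decidable-stable (_ ℚₚ.≤? _) ; ⊏-stable = decidable-stable (_ ℚₚ.<? _) ; ¬⊏⇒⊑ = ℚₚ.≮⇒≥
    ; 0⊑+ = λ {x} {y} h k → ℚₚ.+-mono-≤ h k
    ; 0⊏+ = λ {x} {y} h k → ℚₚ.+-mono-<-≤ h k
    ; 0⊑* = λ {x} {y} h k → subst (ℚ._≤ x ℚ.* y) (ℚₚ.*-zeroˡ y) (ℚₚ.*-monoʳ-≤-nonNeg y {{ℚ.nonNegative k}} h)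
    ; 0⊏* = λ {x} {y} h k → subst (ℚ._< x ℚ.* y) (ℚₚ.*-zeroˡ y) (ℚₚ.*-monoˡ-<-pos y {{ℚ.positive k}} h)
    ; 0⊑cast = λ n → ι-mono-≤ (+ 0) (+ n) (ℤ.+≤+ z≤n) ; 0⊏cast = λ n → ι-mono-< (+ 0) (+ suc n) (ℤ.+<+ (s≤s z≤n))
    ; 0⋢cast = λ n h → ℤₚ.<⇒≱ ℤ.-<+ (ι-cancel-≤ (+ 0) -[1+ n ] h)
    ; discrete = false
    ; tighten = λ ()
    }

-- Interior lattice points and separating lines

module Lattice where
  open import Data.Integer using (-[1+_]; _+_; _*_; _-_; -_; _≤_; _<_)
  open import Data.List using (filter; upTo; cartesianProduct)
  open import Data.List.Membership.Propositional using (find; lose)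
  open import Data.List.Membership.Propositional.Properties using (∈-filter⁺; ∈-filter⁻; ∈-upTo⁺; ∈-cartesianProduct⁺)
  open import Data.List.Relation.Unary.Any using (here; there; any?)
  open import Data.Nat using (suc; s≤s)
  open import Relation.Unary using (Decidable)
  open LinearArithmetic using (module Linear; κ; _:+_; _:-_; _:*_; :-_; _:≤_; _:<_; _:≡_; :⊥; ⊢_; _⊩_; _⇒_; _⊛_; _⊙_) public
  open OrderedRings

  open Linear ℤ-ring public using (lin)

  infix 7 _∙_

  _∙_ : Pt → Pt → ℤ
  (u₁ , u₂) ∙ (x , y) = u₁ * x + u₂ * y

  det : Pt → Pt → ℤ
  det (a , b) (c , d) = a * d - b * c

  infixl 6 _⊖_
  _⊖_ : Pt → Pt → Pt
  (a , b) ⊖ (c , d) = (a - c , b - d)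

  NonZero : Pt → Set
  NonZero (u₁ , u₂) = ¬ (u₁ ≡ + 0 × u₂ ≡ + 0)

  -- Lattice points of the interior of conv S, described by supporting lines.
  Int : List Pt → Pt → Set
  Int S p = ∀ u → NonZero u → Σ Pt λ s → s ∈ S × u ∙ p < u ∙ s

  -- The negation of `Int` in a form with a witness. Most arguments turn the absence of an interior
  -- point into inequalities by evaluating such a `u` at chosen points of `S`.
  Sep : List Pt → Pt → Set
  Sep S p = Σ Pt λ u → NonZero u × (∀ s → s ∈ S → u ∙ s ≤ u ∙ p)

  int-¬sep : ∀ {S p} → Int S p → Sep S p → ⊥
  int-¬sep i (u , nz , h) with i u nz
  ... | s , s∈ , lt = ℤₚ.<⇒≱ lt (h s s∈)

  int-strict : ∀ {S p} → Int S p → ∀ u → NonZero u → ∀ c → (∀ s → s ∈ S → u ∙ s ≤ c) → u ∙ p < c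
  int-strict i u nz c h with i u nz
  ... | s , s∈ , lt = ℤₚ.<-≤-trans lt (h s s∈)

  search : ∀ {A : Set} {P : A → Set} → Decidable P → (S : List A) → (Σ A λ s → s ∈ S × P s) ⊎ (∀ s → s ∈ S → ¬ P s)
  search P? S with any? P? S
  ... | yes a = inj₁ (find a)
  ... | no ¬a = inj₂ λ s s∈ ps → ¬a (lose s∈ ps)

  argmin : ∀ {A : Set} (f : A → ℤ) (S : List A) {s₀ : A} → s₀ ∈ S → Σ A λ s → s ∈ S × (∀ t → t ∈ S → f s ≤ f t)
  argmin f (x ∷ []) _ = x , here refl , λ { t (here refl) → ℤₚ.≤-refl }
  argmin f (x ∷ S@(_ ∷ _)) _ with argmin f S (here refl)
  ... | m , m∈ , h with f x ℤₚ.≤? f m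
  ...   | yes le = x , here refl , λ { t (here refl) → ℤₚ.≤-refl ; t (there t∈) → ℤₚ.≤-trans le (h t t∈) }
  ...   | no ¬le = m , there m∈ , λ { t (here refl) → ℤₚ.<⇒≤ (ℤₚ.≰⇒> ¬le) ; t (there t∈) → h t t∈ }

  argmax : ∀ {A : Set} (f : A → ℤ) (S : List A) {s₀ : A} → s₀ ∈ S → Σ A λ s → s ∈ S × (∀ t → t ∈ S → f t ≤ f s)
  argmax f S s₀∈ with argmin (λ s → - f s) S s₀∈
  ... | m , m∈ , h = m , m∈ , λ t t∈ → ℤₚ.neg-cancel-≤ (h t t∈)

  argminOn : ∀ {A : Set} {P : A → Set} → Decidable P → (f : A → ℤ) (S : List A) {s₀ : A} → s₀ ∈ S → P s₀ →
             Σ A λ s → s ∈ S × P s × (∀ t → t ∈ S → P t → f s ≤ f t)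
  argminOn P? f S s₀∈ ps₀ with argmin f (filter P? S) (∈-filter⁺ P? s₀∈ ps₀)
  ... | m , m∈ , h with ∈-filter⁻ P? {xs = S} m∈
  ...   | m∈S , pm = m , m∈S , pm , λ t t∈ pt → h t (∈-filter⁺ P? t∈ pt)

  argmaxOn : ∀ {A : Set} {P : A → Set} → Decidable P → (f : A → ℤ) (S : List A) {s₀ : A} → s₀ ∈ S → P s₀ →
             Σ A λ s → s ∈ S × P s × (∀ t → t ∈ S → P t → f t ≤ f s)
  argmaxOn P? f S s₀∈ ps₀ with argminOn P? (λ s → - f s) S s₀∈ ps₀
  ... | m , m∈ , pm , h = m , m∈ , pm , λ t t∈ pt → ℤₚ.neg-cancel-≤ (h t t∈ pt)

  private
    -- The Plücker relation among four plane vectors; it yields the sign of one of the six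
    -- determinants from those of the other five.
    plücker : ∀ e a b c → det e a * det b c ≡ det e b * det a c + det e c * det b a
    plücker (e₁ , e₂) (a₁ , a₂) (b₁ , b₂) (c₁ , c₂) = lin 8 (λ e₁ e₂ a₁ a₂ b₁ b₂ c₁ c₂ → ⊢
      (e₁ :* a₂ :- e₂ :* a₁) :* (b₁ :* c₂ :- b₂ :* c₁)
        :≡ (e₁ :* b₂ :- e₂ :* b₁) :* (a₁ :* c₂ :- a₂ :* c₁) :+ (e₁ :* c₂ :- e₂ :* c₁) :* (b₁ :* a₂ :- b₂ :* a₁)) e₁ e₂ a₁ a₂ b₁ b₂ c₁ c₂

    -- With the letters read as the determinants of `plücker`, this is transitivity of the angular
    -- order among vectors to the left of `e`: if `a` is counterclockwise of `b`, and `c` is not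
    -- clockwise of `a`, then `c` is not clockwise of `b`.
    turn : ∀ A B C D E F → A * B ≡ C * D + E * F → + 0 < A → + 0 < C → + 0 < E → + 0 ≤ D → + 0 < F → + 0 ≤ B
    turn = lin 6 λ A B C D E F →
      A :* B :≡ C :* D :+ E :* F ⇒ κ 0 :< A ⇒ κ 0 :< C ⇒ κ 0 :< E ⇒ κ 0 :≤ D ⇒ κ 0 :< F ⇒ 0 ⊛ 2 ∷ 3 ⊛ 5 ∷ 4 ⊛ 6 ∷ [] ⊩ κ 0 :≤ B

    det-anti : ∀ v w → - det v w ≡ det w v
    det-anti (a , b) (c , d) = lin 4 (λ a b c d → ⊢ :- (a :* d :- b :* c) :≡ c :* b :- d :* a) a b c d

    det-self : ∀ v → + 0 ≤ det v v
    det-self (a , b) = lin 2 (λ a b → ⊢ κ 0 :≤ a :* b :- b :* a) a b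

  module Directions (p : Pt) (e : Pt) where

    d : Pt → ℤ
    d t = det e (t ⊖ p)

    -- Among the points strictly to the left of the ray from `p` along `e`, the one met first when
    -- this ray turns counterclockwise.
    Closest : List Pt → Pt → Set
    Closest L t₀ = t₀ ∈ L × + 0 < d t₀ × (∀ t → t ∈ L → + 0 < d t → + 0 ≤ det (t₀ ⊖ p) (t ⊖ p))

    closest : ∀ L → (Σ Pt (Closest L)) ⊎ (∀ t → t ∈ L → ¬ (+ 0 < d t))
    closest [] = inj₂ λ t ()
    closest (t ∷ L) with + 0 ℤₚ.<? d t | closest L
    ... | no ¬h | inj₂ none = inj₂ λ { s (here refl) → ¬h ; s (there s∈) → none s s∈ }
    ... | no ¬h | inj₁ (t₀ , t₀∈ , h₀ , c) =
      inj₁ (t₀ , there t₀∈ , h₀ , λ { s (here refl) hs → ⊥-elim (¬h hs) ; s (there s∈) hs → c s s∈ hs })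
    ... | yes h | inj₂ none =
      inj₁ (t , here refl , h , λ { s (here refl) hs → det-self (t ⊖ p) ; s (there s∈) hs → ⊥-elim (none s s∈ hs) })
    ... | yes h | inj₁ (t₀ , t₀∈ , h₀ , c) with + 0 ℤₚ.≤? det (t₀ ⊖ p) (t ⊖ p)
    ...   | yes ok = inj₁ (t₀ , there t₀∈ , h₀ , λ { s (here refl) hs → ok ; s (there s∈) hs → c s s∈ hs })
    ...   | no ¬ok = inj₁ (t , here refl , h , λ
              { s (here refl) hs → det-self (t ⊖ p)
              ; s (there s∈) hs → turn (d t₀) (det (t ⊖ p) (s ⊖ p)) (d t) (det (t₀ ⊖ p) (s ⊖ p)) (d s) (det (t ⊖ p) (t₀ ⊖ p))
                  (plücker e (t₀ ⊖ p) (t ⊖ p) (s ⊖ p))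
                  h₀ h hs (c s s∈ hs) (subst (+ 0 <_) (det-anti (t₀ ⊖ p) (t ⊖ p)) (ℤₚ.neg-mono-< (ℤₚ.≰⇒> ¬ok))) })

  -- A positive multiple of e is a nonnegative combination of t − p and r − p.
  record InCone (S : List Pt) (p e : Pt) : Set where
    constructor inCone
    field
      t r   : Pt
      t∈    : t ∈ S
      r∈    : r ∈ S
      z x y : ℤ
      z>0   : + 0 < z
      x>0   : + 0 < x
      y≥0   : + 0 ≤ y
      eq₁   : z * proj₁ e ≡ x * (proj₁ r - proj₁ p) + y * (proj₁ t - proj₁ p)
      eq₂   : z * proj₂ e ≡ x * (proj₂ r - proj₂ p) + y * (proj₂ t - proj₂ p)

  -- Let `t` be the point met first when turning counterclockwise from `e`. Without such a point the
  -- line along `e` separates; if nothing lies strictly to the right of the line from `p` to `t`,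
  -- that line separates. Otherwise some `r` lies to its right, and not to the left of `e` by the
  -- choice of `t`, so `e` is between `r` and `t`; the coefficients are those of Cramer's rule.
  inCone? : ∀ S p e → NonZero e → Sep S p ⊎ InCone S p e
  inCone? S p@(p₁ , p₂) e@(e₁ , e₂) nz with Directions.closest p e S
  ... | inj₂ none = inj₁ ((- e₂ , e₁) , (λ (a , b) → nz (b , trans (sym (ℤₚ.neg-involutive e₂)) (cong -_ a))) ,
          λ (s₁ , s₂) s∈ → bound s₁ s₂ (ℤₚ.≮⇒≥ (none _ s∈)))
    where
      bound : ∀ s₁ s₂ → det e ((s₁ , s₂) ⊖ p) ≤ + 0 → (- e₂ , e₁) ∙ (s₁ , s₂) ≤ (- e₂ , e₁) ∙ p
      bound s₁ s₂ = lin 6 (λ s₁ s₂ p₁ p₂ e₁ e₂ → e₁ :* (s₂ :- p₂) :- e₂ :* (s₁ :- p₁) :≤ κ 0 ⇒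
        ⊢ :- e₂ :* s₁ :+ e₁ :* s₂ :≤ :- e₂ :* p₁ :+ e₁ :* p₂) s₁ s₂ p₁ p₂ e₁ e₂
  ... | inj₁ (t@(t₁ , t₂) , t∈ , h , c) with search (λ r → det (t ⊖ p) (r ⊖ p) ℤₚ.<? + 0) S
  ...   | inj₂ none = inj₁ ((t₂ - p₂ , p₁ - t₁) , nz′ , λ (s₁ , s₂) s∈ →
            lin 6 (λ s₁ s₂ p₁ p₂ t₁ t₂ → κ 0 :≤ (t₁ :- p₁) :* (s₂ :- p₂) :- (t₂ :- p₂) :* (s₁ :- p₁) ⇒
              ⊢ (t₂ :- p₂) :* s₁ :+ (p₁ :- t₁) :* s₂ :≤ (t₂ :- p₂) :* p₁ :+ (p₁ :- t₁) :* p₂) s₁ s₂ p₁ p₂ t₁ t₂ (ℤₚ.≮⇒≥ (none _ s∈)))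
    where
      nz′ : NonZero (t₂ - p₂ , p₁ - t₁)
      nz′ (a , b) = lin 6 (λ p₁ p₂ t₁ t₂ e₁ e₂ → t₂ :- p₂ :≡ κ 0 ⇒ p₁ :- t₁ :≡ κ 0 ⇒
        κ 0 :< e₁ :* (t₂ :- p₂) :- e₂ :* (t₁ :- p₁) ⇒ 1 ⊙ e₁ ∷ 2 ⊙ e₂ ∷ [] ⊩ :⊥) p₁ p₂ t₁ t₂ e₁ e₂ a b h
  ...   | inj₁ (r@(r₁ , r₂) , r∈ , lt) = inj₂ (inCone t r t∈ r∈ (det (r ⊖ p) (t ⊖ p)) (det e (t ⊖ p)) (det (r ⊖ p) e)
            (subst (+ 0 <_) (det-anti (t ⊖ p) (r ⊖ p)) (ℤₚ.neg-mono-< lt)) h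
            (subst (+ 0 ≤_) (det-anti e (r ⊖ p)) (ℤₚ.neg-mono-≤ (ℤₚ.≮⇒≥ λ k → ℤₚ.<⇒≱ lt (c r r∈ k))))
            (cramer₁ (r ⊖ p) (t ⊖ p) e) (cramer₂ (r ⊖ p) (t ⊖ p) e))
    where
      cramer₁ : ∀ v w e → det v w * proj₁ e ≡ det e w * proj₁ v + det v e * proj₁ w
      cramer₁ (a , b) (c , d) (e , f) = lin 6 (λ a b c d e f → ⊢ (a :* d :- b :* c) :* e :≡ (e :* d :- f :* c) :* a :+ (a :* f :- b :* e) :* c) a b c d e f
      cramer₂ : ∀ v w e → det v w * proj₂ e ≡ det e w * proj₂ v + det v e * proj₂ w
      cramer₂ (a , b) (c , d) (e , f) = lin 6 (λ a b c d e f → ⊢ (a :* d :- b :* c) :* f :≡ (e :* d :- f :* c) :* b :+ (a :* f :- b :* e) :* d) a b c d e f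

  -- Four axis directions suffice: every nonzero linear form is positive on one of them, and the
  -- four rays contain the arms of a small cross around `p`, which is what the rational `Interior`
  -- needs.
  Cones : List Pt → Pt → Set
  Cones S p = InCone S p (+ 1 , + 0) × InCone S p (- + 1 , + 0) × InCone S p (+ 0 , + 1) × InCone S p (+ 0 , - + 1)

  cones? : ∀ S p → Sep S p ⊎ Cones S p
  cones? S p with inCone? S p (+ 1 , + 0) (λ ()) | inCone? S p (- + 1 , + 0) (λ ()) | inCone? S p (+ 0 , + 1) (λ ()) | inCone? S p (+ 0 , - + 1) (λ ())
  ... | inj₁ s | _ | _ | _ = inj₁ s
  ... | inj₂ _ | inj₁ s | _ | _ = inj₁ s
  ... | inj₂ _ | inj₂ _ | inj₁ s | _ = inj₁ s
  ... | inj₂ _ | inj₂ _ | inj₂ _ | inj₁ s = inj₁ s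
  ... | inj₂ a | inj₂ b | inj₂ c | inj₂ d = inj₂ (a , b , c , d)

  inCone-above : ∀ {S p e} → InCone S p e → ∀ u → + 0 < u ∙ e → Σ Pt λ s → s ∈ S × u ∙ p < u ∙ s
  inCone-above {S} {p₁ , p₂} {e₁ , e₂} (inCone t@(t₁ , t₂) r@(r₁ , r₂) t∈ r∈ z x y z>0 x>0 y≥0 eq₁ eq₂) u@(u₁ , u₂) pos
    with u ∙ (p₁ , p₂) ℤₚ.<? u ∙ t | u ∙ (p₁ , p₂) ℤₚ.<? u ∙ r
  ... | yes h | _     = t , t∈ , h
  ... | no _  | yes h = r , r∈ , h
  ... | no ¬h | no ¬k = ⊥-elim (below (u ∙ (e₁ , e₂)) (u ∙ (r₁ - p₁ , r₂ - p₂)) (u ∙ (t₁ - p₁ , t₂ - p₂)) x y z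
          pos z>0 x>0 y≥0
          (lin 7 (λ e₁ e₂ u₁ u₂ z R₁ R₂ → z :* e₁ :≡ R₁ ⇒ z :* e₂ :≡ R₂ ⇒ 1 ⊙ u₁ ∷ 2 ⊙ u₂ ∷ [] ⊩ z :* (u₁ :* e₁ :+ u₂ :* e₂) :≡ u₁ :* R₁ :+ u₂ :* R₂)
             e₁ e₂ u₁ u₂ z (x * (r₁ - p₁) + y * (t₁ - p₁)) (x * (r₂ - p₂) + y * (t₂ - p₂)) eq₁ eq₂)
          (lin 8 (λ u₁ u₂ x y a b c d → ⊢ u₁ :* (x :* a :+ y :* b) :+ u₂ :* (x :* c :+ y :* d) :≡ x :* (u₁ :* a :+ u₂ :* c) :+ y :* (u₁ :* b :+ u₂ :* d))
             u₁ u₂ x y (r₁ - p₁) (t₁ - p₁) (r₂ - p₂) (t₂ - p₂))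
          (diff r (ℤₚ.≮⇒≥ ¬k)) (diff t (ℤₚ.≮⇒≥ ¬h)))
    where
      diff : ∀ q → u ∙ q ≤ u ∙ (p₁ , p₂) → u ∙ (proj₁ q - p₁ , proj₂ q - p₂) ≤ + 0
      diff (q₁ , q₂) = lin 6 (λ u₁ u₂ q₁ q₂ p₁ p₂ → u₁ :* q₁ :+ u₂ :* q₂ :≤ u₁ :* p₁ :+ u₂ :* p₂ ⇒ ⊢ u₁ :* (q₁ :- p₁) :+ u₂ :* (q₂ :- p₂) :≤ κ 0) u₁ u₂ q₁ q₂ p₁ p₂
      below : ∀ E R T x y z → + 0 < E → + 0 < z → + 0 < x → + 0 ≤ y → ∀ {M} → z * E ≡ M → M ≡ x * R + y * T → R ≤ + 0 → T ≤ + 0 → ⊥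
      below E R T x y z E>0 z>0 x>0 y≥0 refl eq R≤0 T≤0 =
        lin 6 (λ E R T x y z → κ 0 :< E ⇒ κ 0 :< z ⇒ κ 0 :< x ⇒ κ 0 :≤ y ⇒ z :* E :≡ x :* R :+ y :* T ⇒ R :≤ κ 0 ⇒ T :≤ κ 0 ⇒
          1 ⊛ 2 ∷ 3 ⊛ 6 ∷ 4 ⊛ 7 ∷ [] ⊩ :⊥) E R T x y z E>0 z>0 x>0 y≥0 eq R≤0 T≤0

  cones⇒int : ∀ {S p} → Cones S p → Int S p
  cones⇒int {S} {p} (c₁ , c₂ , c₃ , c₄) u@(u₁ , u₂) nz with ℤₚ.<-cmp (+ 0) u₁ | ℤₚ.<-cmp (+ 0) u₂
  ... | tri< a _ _ | _ = inCone-above c₁ u (lin 2 (λ a b → κ 0 :< a ⇒ ⊢ κ 0 :< a :* κ 1 :+ b :* κ 0) u₁ u₂ a)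
  ... | tri> _ _ a | _ = inCone-above c₂ u (lin 2 (λ a b → a :< κ 0 ⇒ ⊢ κ 0 :< a :* (:- κ 1) :+ b :* κ 0) u₁ u₂ a)
  ... | tri≈ _ _ _ | tri< a _ _ = inCone-above c₃ u (lin 2 (λ a b → κ 0 :< b ⇒ ⊢ κ 0 :< a :* κ 0 :+ b :* κ 1) u₁ u₂ a)
  ... | tri≈ _ _ _ | tri> _ _ a = inCone-above c₄ u (lin 2 (λ a b → b :< κ 0 ⇒ ⊢ κ 0 :< a :* κ 0 :+ b :* (:- κ 1)) u₁ u₂ a)
  ... | tri≈ _ a _ | tri≈ _ b _ = ⊥-elim (nz (sym a , sym b))

  -- This makes interiority decidable, and it turns a proof that a point is interior into the
  -- refutation of a separating line.
  int⊎sep : ∀ S p → Int S p ⊎ Sep S p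
  int⊎sep S p with cones? S p
  ... | inj₁ s = inj₂ s
  ... | inj₂ c = inj₁ (cones⇒int c)

  int? : ∀ S → Decidable (Int S)
  int? S p with int⊎sep S p
  ... | inj₁ i = yes i
  ... | inj₂ s = no λ i → int-¬sep i s

  ints : ℕ → List ℤ
  ints B = map (λ k → + k - + B) (upTo (suc (B ℕ.+ B)))

  ∈-ints : ∀ B z → - + B ≤ z → z ≤ + B → z ∈ ints B
  ∈-ints B z lo hi = subst (_∈ ints B) (eq k refl) (∈-map⁺ (λ k → + k - + B) (∈-upTo⁺ (s≤s k≤)))
    where
      nn : + 0 ≤ z + + B
      nn = lin 2 (λ z B → :- B :≤ z ⇒ ⊢ κ 0 :≤ z :+ B) z (+ B) lo
      k = ℤ.∣ z + + B ∣
      +k : + k ≡ z + + B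
      +k = ℤₚ.0≤i⇒+∣i∣≡i nn
      k≤ : k ℕ.≤ B ℕ.+ B
      k≤ = ℤₚ.drop‿+≤+ (subst (_≤ + B + + B) (sym +k) (ℤₚ.+-monoˡ-≤ (+ B) hi))
      eq : ∀ j → j ≡ k → + j - + B ≡ z
      eq j refl = trans (cong (_- + B) +k) (lin 2 (λ z B → ⊢ z :+ B :- B :≡ z) z (+ B))

  bound : List Pt → ℕ
  bound []            = 0
  bound ((x , y) ∷ S) = (ℤ.∣ x ∣ ℕ.+ ℤ.∣ y ∣) ℕ.+ bound S

  ∣∣≤ : ∀ z B → ℤ.∣ z ∣ ℕ.≤ B → - + B ≤ z × z ≤ + B
  ∣∣≤ (+ n)    B h = ℤₚ.neg-≤-pos {B} {n} , ℤ.+≤+ h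
  ∣∣≤ -[1+ n ] (suc B) (s≤s h) = ℤ.-≤- h , ℤ.-≤+

  bound-∈ : ∀ {s} S → s ∈ S → ℤ.∣ proj₁ s ∣ ℕ.≤ bound S × ℤ.∣ proj₂ s ∣ ℕ.≤ bound S
  bound-∈ ((x , y) ∷ S) (here refl) = ℕₚ.≤-trans (ℕₚ.m≤m+n _ ℤ.∣ y ∣) (ℕₚ.m≤m+n _ _) , ℕₚ.≤-trans (ℕₚ.m≤n+m _ ℤ.∣ x ∣) (ℕₚ.m≤m+n _ _)
  bound-∈ (_ ∷ S) (there s∈) with bound-∈ S s∈
  ... | a , b = ℕₚ.≤-trans a (ℕₚ.m≤n+m _ _) , ℕₚ.≤-trans b (ℕₚ.m≤n+m _ _)

  interiorPoints : List Pt → List Pt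
  interiorPoints S = filter (int? S) (cartesianProduct (ints (bound S)) (ints (bound S)))

  ∈-interiorPoints⁻ : ∀ S {p} → p ∈ interiorPoints S → Int S p
  ∈-interiorPoints⁻ S p∈ = proj₂ (∈-filter⁻ (int? S) {xs = cartesianProduct (ints (bound S)) (ints (bound S))} p∈)

  ∈-interiorPoints⁺ : ∀ S {p} → Int S p → p ∈ interiorPoints S
  ∈-interiorPoints⁺ S {p@(x , y)} i = ∈-filter⁺ (int? S) (∈-cartesianProduct⁺
    (∈-ints (bound S) x
      (lo (i (- + 1 , + 0) (λ ())) λ s h → lin 4 (λ x y s₁ s₂ → :- κ 1 :* x :+ κ 0 :* y :< :- κ 1 :* s₁ :+ κ 0 :* s₂ ⇒ ⊢ s₁ :≤ x) x y (proj₁ s) (proj₂ s) h , inj₁ refl)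
      (hi (i (+ 1 , + 0) (λ ())) λ s h → lin 4 (λ x y s₁ s₂ → κ 1 :* x :+ κ 0 :* y :< κ 1 :* s₁ :+ κ 0 :* s₂ ⇒ ⊢ x :≤ s₁) x y (proj₁ s) (proj₂ s) h , inj₁ refl))
    (∈-ints (bound S) y
      (lo (i (+ 0 , - + 1) (λ ())) λ s h → lin 4 (λ x y s₁ s₂ → κ 0 :* x :+ :- κ 1 :* y :< κ 0 :* s₁ :+ :- κ 1 :* s₂ ⇒ ⊢ s₂ :≤ y) x y (proj₁ s) (proj₂ s) h , inj₂ refl)
      (hi (i (+ 0 , + 1) (λ ())) λ s h → lin 4 (λ x y s₁ s₂ → κ 0 :* x :+ κ 1 :* y :< κ 0 :* s₁ :+ κ 1 :* s₂ ⇒ ⊢ y :≤ s₂) x y (proj₁ s) (proj₂ s) h , inj₂ refl)))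
    i
    where
      coord : ∀ {s c} → s ∈ S → c ≡ proj₁ s ⊎ c ≡ proj₂ s → - + bound S ≤ c × c ≤ + bound S
      coord {s} s∈ (inj₁ refl) = ∣∣≤ _ _ (proj₁ (bound-∈ S s∈))
      coord {s} s∈ (inj₂ refl) = ∣∣≤ _ _ (proj₂ (bound-∈ S s∈))
      lo : ∀ {P : Pt → Set} {z : ℤ} {c : Pt → ℤ} → Σ Pt (λ s → s ∈ S × P s) → (∀ s → P s → c s ≤ z × (c s ≡ proj₁ s ⊎ c s ≡ proj₂ s)) → - + bound S ≤ z
      lo (s , s∈ , h) f with f s h
      ... | le , e = ℤₚ.≤-trans (proj₁ (coord s∈ e)) le
      hi : ∀ {P : Pt → Set} {z : ℤ} {c : Pt → ℤ} → Σ Pt (λ s → s ∈ S × P s) → (∀ s → P s → z ≤ c s × (c s ≡ proj₁ s ⊎ c s ≡ proj₂ s)) → z ≤ + bound S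
      hi (s , s∈ , h) f with f s h
      ... | le , e = ℤₚ.≤-trans le (proj₂ (coord s∈ e))

-- Unimodular maps and their action on points and linear forms

module Frames where
  open import Data.Integer using (_+_; _*_; _-_; -_; _≤_; _<_)
  open Lattice

  act : Unimod → Pt → Pt
  act φ (x , y) = (a₁₁ * x + a₁₂ * y + w₁ , a₂₁ * x + a₂₂ * y + w₂)
    where open Unimod φ

  Det : Unimod → ℤ
  Det φ = a₁₁ * a₂₂ - a₁₂ * a₂₁
    where open Unimod φ

  infixr 9 _∘ᵤ_
  _∘ᵤ_ : Unimod → Unimod → Unimod
  unimod a b c d w₁ w₂ h ∘ᵤ unimod a′ b′ c′ d′ w₁′ w₂′ h′ =
    unimod (a * a′ + b * c′) (a * b′ + b * d′) (c * a′ + d * c′) (c * b′ + d * d′)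
           (a * w₁′ + b * w₂′ + w₁) (c * w₁′ + d * w₂′ + w₂)
           (signs h h′)
    where
      D  = (a * a′ + b * c′) * (c * b′ + d * d′) - (a * b′ + b * d′) * (c * a′ + d * c′)
      D≡ : D ≡ (a * d - b * c) * (a′ * d′ - b′ * c′)
      D≡ = lin 8 (λ a b c d a′ b′ c′ d′ → ⊢ (a :* a′ :+ b :* c′) :* (c :* b′ :+ d :* d′) :- (a :* b′ :+ b :* d′) :* (c :* a′ :+ d :* c′)
                    :≡ (a :* d :- b :* c) :* (a′ :* d′ :- b′ :* c′)) a b c d a′ b′ c′ d′
      signs : _ → _ → (D ≡ + 1) ⊎ (D ≡ - + 1)
      signs (inj₁ p) (inj₁ q) = inj₁ (trans D≡ (cong₂ _*_ p q))
      signs (inj₁ p) (inj₂ q) = inj₂ (trans D≡ (cong₂ _*_ p q))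
      signs (inj₂ p) (inj₁ q) = inj₂ (trans D≡ (cong₂ _*_ p q))
      signs (inj₂ p) (inj₂ q) = inj₁ (trans D≡ (cong₂ _*_ p q))

  act-∘ : ∀ φ ψ p → act (φ ∘ᵤ ψ) p ≡ act φ (act ψ p)
  act-∘ (unimod a b c d w₁ w₂ h) (unimod a′ b′ c′ d′ w₁′ w₂′ h′) (x , y) = cong₂ _,_ (row a b w₁) (row c d w₂)
    where
      row : ∀ a b w → (a * a′ + b * c′) * x + (a * b′ + b * d′) * y + (a * w₁′ + b * w₂′ + w)
                      ≡ a * (a′ * x + b′ * y + w₁′) + b * (c′ * x + d′ * y + w₂′) + w
      row a b w = lin 11 (λ a b w a′ b′ c′ d′ w₁′ w₂′ x y → ⊢
        (a :* a′ :+ b :* c′) :* x :+ (a :* b′ :+ b :* d′) :* y :+ (a :* w₁′ :+ b :* w₂′ :+ w)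
        :≡ a :* (a′ :* x :+ b′ :* y :+ w₁′) :+ b :* (c′ :* x :+ d′ :* y :+ w₂′) :+ w) a b w a′ b′ c′ d′ w₁′ w₂′ x y

  -- The determinant `δ` is its own inverse, so `δ` times the adjugate is the inverse matrix; its
  -- determinant is the cube of `δ`.
  inv : Unimod → Unimod
  inv (unimod a b c d w₁ w₂ h) = unimod (δ * d) (δ * - b) (δ * - c) (δ * a)
      (- (δ * d * w₁ + δ * - b * w₂)) (- (δ * - c * w₁ + δ * a * w₂)) (signs h)
    where
      D = a * d - b * c
      δ = D
      D′ = δ * d * (δ * a) - δ * - b * (δ * - c)
      D′≡ : D′ ≡ D * D * D
      D′≡ = lin 5 (λ D a b c d → D :≡ a :* d :- b :* c ⇒ 1 ⊙ (D :* D) ∷ [] ⊩ D :* d :* (D :* a) :- D :* (:- b) :* (D :* (:- c)) :≡ D :* D :* D) D a b c d refl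
      signs : (D ≡ + 1) ⊎ (D ≡ - + 1) → (D′ ≡ + 1) ⊎ (D′ ≡ - + 1)
      signs (inj₁ e) = inj₁ (trans D′≡ (cong (λ z → z * z * z) e))
      signs (inj₂ e) = inj₂ (trans D′≡ (cong (λ z → z * z * z) e))

  Det² : ∀ φ → Det φ * Det φ ≡ + 1
  Det² φ with Unimod.det± φ
  ... | inj₁ e = cong (λ z → z * z) e
  ... | inj₂ e = cong (λ z → z * z) e

  act-inv : ∀ φ p → act φ (act (inv φ) p) ≡ p
  act-inv φ@(unimod a b c d w₁ w₂ h) (x , y) = cong₂ _,_
    (lin 9 (λ D a b c d w₁ w₂ x y → D :≡ a :* d :- b :* c ⇒ D :* D :≡ κ 1 ⇒ 1 ⊙ (D :* (x :- w₁)) ∷ 2 ⊙ (x :- w₁) ∷ [] ⊩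
       a :* (D :* d :* x :+ D :* (:- b) :* y :+ :- (D :* d :* w₁ :+ D :* (:- b) :* w₂)) :+ b :* (D :* (:- c) :* x :+ D :* a :* y :+ :- (D :* (:- c) :* w₁ :+ D :* a :* w₂)) :+ w₁ :≡ x)
     (Det φ) a b c d w₁ w₂ x y refl (Det² φ))
    (lin 9 (λ D a b c d w₁ w₂ x y → D :≡ a :* d :- b :* c ⇒ D :* D :≡ κ 1 ⇒ 1 ⊙ (D :* (y :- w₂)) ∷ 2 ⊙ (y :- w₂) ∷ [] ⊩
       c :* (D :* d :* x :+ D :* (:- b) :* y :+ :- (D :* d :* w₁ :+ D :* (:- b) :* w₂)) :+ d :* (D :* (:- c) :* x :+ D :* a :* y :+ :- (D :* (:- c) :* w₁ :+ D :* a :* w₂)) :+ w₂ :≡ y)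
     (Det φ) a b c d w₁ w₂ x y refl (Det² φ))

  inv-act : ∀ φ p → act (inv φ) (act φ p) ≡ p
  inv-act φ@(unimod a b c d w₁ w₂ h) (x , y) = cong₂ _,_
    (lin 9 (λ D a b c d w₁ w₂ x y → D :≡ a :* d :- b :* c ⇒ D :* D :≡ κ 1 ⇒ 1 ⊙ (D :* x) ∷ 2 ⊙ x ∷ [] ⊩
       D :* d :* (a :* x :+ b :* y :+ w₁) :+ D :* (:- b) :* (c :* x :+ d :* y :+ w₂) :+ :- (D :* d :* w₁ :+ D :* (:- b) :* w₂) :≡ x)
     (Det φ) a b c d w₁ w₂ x y refl (Det² φ))
    (lin 9 (λ D a b c d w₁ w₂ x y → D :≡ a :* d :- b :* c ⇒ D :* D :≡ κ 1 ⇒ 1 ⊙ (D :* y) ∷ 2 ⊙ y ∷ [] ⊩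
       D :* (:- c) :* (a :* x :+ b :* y :+ w₁) :+ D :* a :* (c :* x :+ d :* y :+ w₂) :+ :- (D :* (:- c) :* w₁ :+ D :* a :* w₂) :≡ y)
     (Det φ) a b c d w₁ w₂ x y refl (Det² φ))

  act-injective : ∀ φ {p q} → act φ p ≡ act φ q → p ≡ q
  act-injective φ {p} {q} e = trans (sym (inv-act φ p)) (trans (cong (act (inv φ)) e) (inv-act φ q))

  map-act-∘ : ∀ φ ψ S → map (act φ) (map (act ψ) S) ≡ map (act (φ ∘ᵤ ψ)) S
  map-act-∘ φ ψ S = trans (sym (Listₚ.map-∘ S)) (Listₚ.map-cong (λ p → sym (act-∘ φ ψ p)) S)

  map-inv-act : ∀ φ S → map (act (inv φ)) (map (act φ) S) ≡ S
  map-inv-act φ S = trans (sym (Listₚ.map-∘ S)) (trans (Listₚ.map-cong (inv-act φ) S) (Listₚ.map-id S))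

  -- The transposed matrix, by which a linear form on the image is read as one on the source.
  pull : Unimod → Pt → Pt
  pull φ (u₁ , u₂) = (u₁ * a₁₁ + u₂ * a₂₁ , u₁ * a₁₂ + u₂ * a₂₂)
    where open Unimod φ

  pull-nonZero : ∀ φ u → NonZero u → NonZero (pull φ u)
  pull-nonZero φ@(unimod a b c d w₁ w₂ h) (u₁ , u₂) nz (e , f) = nz
    ( lin 7 (λ D a b c d u₁ u₂ → D :≡ a :* d :- b :* c ⇒ D :* D :≡ κ 1 ⇒ u₁ :* a :+ u₂ :* c :≡ κ 0 ⇒ u₁ :* b :+ u₂ :* d :≡ κ 0 ⇒
        2 ⊙ u₁ ∷ 1 ⊙ (D :* u₁) ∷ 3 ⊙ (D :* d) ∷ 4 ⊙ (D :* c) ∷ [] ⊩ u₁ :≡ κ 0) (Det φ) a b c d u₁ u₂ refl (Det² φ) e f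
    , lin 7 (λ D a b c d u₁ u₂ → D :≡ a :* d :- b :* c ⇒ D :* D :≡ κ 1 ⇒ u₁ :* a :+ u₂ :* c :≡ κ 0 ⇒ u₁ :* b :+ u₂ :* d :≡ κ 0 ⇒
        2 ⊙ u₂ ∷ 1 ⊙ (D :* u₂) ∷ 3 ⊙ (D :* b) ∷ 4 ⊙ (D :* a) ∷ [] ⊩ u₂ :≡ κ 0) (Det φ) a b c d u₁ u₂ refl (Det² φ) e f )

  pull-∙ : ∀ φ u p → u ∙ act φ p ≡ pull φ u ∙ p + (proj₁ u * Unimod.w₁ φ + proj₂ u * Unimod.w₂ φ)
  pull-∙ (unimod a b c d w₁ w₂ h) (u₁ , u₂) (x , y) =
    lin 10 (λ a b c d w₁ w₂ u₁ u₂ x y → ⊢ u₁ :* (a :* x :+ b :* y :+ w₁) :+ u₂ :* (c :* x :+ d :* y :+ w₂)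
      :≡ (u₁ :* a :+ u₂ :* c) :* x :+ (u₁ :* b :+ u₂ :* d) :* y :+ (u₁ :* w₁ :+ u₂ :* w₂)) a b c d w₁ w₂ u₁ u₂ x y

  int-map⁺ : ∀ φ {S p} → Int S p → Int (map (act φ) S) (act φ p)
  int-map⁺ φ {S} {p} i u nz with i (pull φ u) (pull-nonZero φ u nz)
  ... | s , s∈ , lt = act φ s , ∈-map⁺ (act φ) s∈ ,
    lin 5 (λ A B C P Q → A :≡ P :+ C ⇒ B :≡ Q :+ C ⇒ P :< Q ⇒ ⊢ A :< B)
      (u ∙ act φ p) (u ∙ act φ s) _ (pull φ u ∙ p) (pull φ u ∙ s) (pull-∙ φ u p) (pull-∙ φ u s) lt

  int-map⁻ : ∀ φ {S q} → Int (map (act φ) S) q → Int S (act (inv φ) q)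
  int-map⁻ φ {S} {q} i = subst (λ L → Int L (act (inv φ) q)) (map-inv-act φ S) (int-map⁺ (inv φ) i)

  all-map : ∀ φ {S} {P : Pt → Set} → (∀ s → s ∈ S → P (act φ s)) → ∀ t → t ∈ map (act φ) S → P t
  all-map φ h t t∈ with ∈-map⁻ (act φ) t∈
  ... | s , s∈ , refl = h s s∈

  allInt-map : ∀ φ {S} {P : Pt → Set} → (∀ s → Int S s → P (act φ s)) → ∀ t → Int (map (act φ) S) t → P t
  allInt-map φ {P = P} h t i = subst P (act-inv φ t) (h _ (int-map⁻ φ i))

  -- A separating line at `r` would leave `v` weakly below it and the interior point `p` strictly
  -- below it, against the weighted mean `eq`. Stating the mean through linear forms avoids
  -- division.
  int-mix : ∀ {S v p r α γ} → Int S p → v ∈ S → + 0 ≤ α → + 0 < γ →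
            (∀ u → (α + γ) * (u ∙ r) ≡ α * (u ∙ v) + γ * (u ∙ p)) → Int S r
  int-mix {S} {v} {p} {r} {α} {γ} i v∈ α≥0 γ>0 eq with int⊎sep S r
  ... | inj₁ j = j
  ... | inj₂ (u , nz , h) = ⊥-elim (lin 5 (λ α γ R V P → κ 0 :≤ α ⇒ κ 0 :< γ ⇒ (α :+ γ) :* R :≡ α :* V :+ γ :* P ⇒ V :≤ R ⇒ P :< R ⇒
      1 ⊛ 4 ∷ 2 ⊛ 5 ∷ [] ⊩ :⊥) α γ (u ∙ r) (u ∙ v) (u ∙ p) α≥0 γ>0 (eq u) (h v v∈) (int-strict i u nz (u ∙ r) h))

  InΔ : ℤ → Pt → Set
  InΔ d (x , y) = + 0 ≤ x × + 0 ≤ y × x + y ≤ d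

  Fit : (Pt → Set) → ℤ → Set
  Fit P d = Σ Unimod λ φ → ∀ p → P p → InΔ d (act φ p)

  translate : ℤ → ℤ → Unimod
  translate a b = unimod (+ 1) (+ 0) (+ 0) (+ 1) a b (inj₁ refl)

  idᵤ swapᵤ : Unimod
  idᵤ   = unimod (+ 1) (+ 0) (+ 0) (+ 1) (+ 0) (+ 0) (inj₁ refl)
  swapᵤ = unimod (+ 0) (+ 1) (+ 1) (+ 0) (+ 0) (+ 0) (inj₂ refl)

  act-translate : ∀ a b p → act (translate a b) p ≡ (proj₁ p + a , proj₂ p + b)
  act-translate a b (x , y) = cong₂ _,_ (lin 3 (λ x y a → ⊢ κ 1 :* x :+ κ 0 :* y :+ a :≡ x :+ a) x y a) (lin 3 (λ x y b → ⊢ κ 0 :* x :+ κ 1 :* y :+ b :≡ y :+ b) x y b)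

  act-swap : ∀ p → act swapᵤ p ≡ (proj₂ p , proj₁ p)
  act-swap (x , y) = cong₂ _,_ (lin 2 (λ x y → ⊢ κ 0 :* x :+ κ 1 :* y :+ κ 0 :≡ y) x y) (lin 2 (λ x y → ⊢ κ 1 :* x :+ κ 0 :* y :+ κ 0 :≡ x) x y)

  fit-map : ∀ φ {S d} → Fit (_∈ map (act φ) S) d → Fit (_∈ S) d
  fit-map φ {S} {d} (ψ , h) = ψ ∘ᵤ φ , λ s s∈ → subst (InΔ d) (sym (act-∘ ψ φ s)) (h (act φ s) (∈-map⁺ (act φ) s∈))

  fitInt-map : ∀ φ {S d} → Fit (Int (map (act φ) S)) d → Fit (Int S) d
  fitInt-map φ {S} {d} (ψ , h) = ψ ∘ᵤ φ , λ s i → subst (InΔ d) (sym (act-∘ ψ φ s)) (h (act φ s) (int-map⁺ φ i))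

  -- The frame with origin v and basis e₁, e₂.
  basis : (v e₁ e₂ : Pt) → det e₁ e₂ ≡ + 1 → Unimod
  basis (v₁ , v₂) (a , b) (c , d) h = unimod d (- c) (- b) a (- (v₁ * d - v₂ * c)) (- (a * v₂ - b * v₁))
    (inj₁ (trans (lin 4 (λ a b c d → ⊢ d :* a :- (:- c) :* (:- b) :≡ a :* d :- b :* c) a b c d) h))

  act-basis : ∀ v e₁ e₂ h s → act (basis v e₁ e₂ h) s ≡ (det (s ⊖ v) e₂ , det e₁ (s ⊖ v))
  act-basis (v₁ , v₂) (a , b) (c , d) h (x , y) = cong₂ _,_
    (lin 6 (λ v₁ v₂ c d x y → ⊢ d :* x :+ (:- c) :* y :+ :- (v₁ :* d :- v₂ :* c) :≡ (x :- v₁) :* d :- (y :- v₂) :* c) v₁ v₂ c d x y)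
    (lin 6 (λ v₁ v₂ a b x y → ⊢ (:- b) :* x :+ a :* y :+ :- (a :* v₂ :- b :* v₁) :≡ a :* (y :- v₂) :- b :* (x :- v₁)) v₁ v₂ a b x y)

-- Primitive vectors and the unimodular cone at an extremal vertex

module Cones where
  open import Data.Integer using (-[1+_]; _+_; _*_; _-_; -_; _≤_; _<_)
  import Data.Integer.DivMod as ℤDM
  open import Data.Nat using (zero; suc; z≤n)
  open import Data.Nat.Divisibility using (divides)
  open import Data.Nat.GCD using (module Bézout; module GCD)
  open Lattice
  open Frames

  -- Primitivity of `w′` is witnessed by a vector `e` completing it to a lattice basis, the form in
  -- which it is used. For `w = 0` the factor `g` is 0.
  record Reduced (w : Pt) : Set where
    constructor reduced
    field
      g   : ℤ
      w′  : Pt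
      e   : Pt
      g≥0 : + 0 ≤ g
      w≡₁ : proj₁ w ≡ g * proj₁ w′
      w≡₂ : proj₂ w ≡ g * proj₂ w′
      unit : det e w′ ≡ + 1

  private
    sgn : ∀ z → Σ ℤ λ σ → σ * σ ≡ + 1 × z ≡ σ * + ℤ.∣ z ∣
    sgn (+ n)    = + 1 , refl , sym (ℤₚ.*-identityˡ (+ n))
    sgn -[1+ n ] = - + 1 , refl , sym (ℤₚ.-1*i≡-i (+ suc n))

    -- x m′ − y n′ = 1 is read off from Bézout's identity d + y n = x m with m = m′ d and n = n′ d.
    bezout : ∀ m n → Σ ℕ λ d → Σ ℤ λ m′ → Σ ℤ λ n′ → Σ ℤ λ x → Σ ℤ λ y →
             + m ≡ + d * m′ × + n ≡ + d * n′ × x * m′ - y * n′ ≡ + 1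
    bezout m n with Bézout.lemma m n
    ... | Bézout.result zero g _ with GCD.gcd∣m g | GCD.gcd∣n g
    ...   | divides q p | divides q′ p′ = 0 , + 1 , + 0 , + 1 , + 0 , zeroed q (+ 1) p , zeroed q′ (+ 0) p′ , refl
      where
        zeroed : ∀ {k} q m → k ≡ q ℕ.* 0 → + k ≡ + 0 * m
        zeroed q m e = cong +_ (trans e (ℕₚ.*-zeroʳ q))
    bezout m n | Bézout.result d@(suc d′) g b with GCD.gcd∣m g | GCD.gcd∣n g
    ...   | divides q p | divides q′ p′ = d , + q , + q′ , coeffs b
      where
        ↑ : ∀ {k q} → k ≡ q ℕ.* d → + k ≡ + d * + q
        ↑ {k} {q} e = trans (cong +_ e) (trans (ℤₚ.pos-* q d) (ℤₚ.*-comm (+ q) (+ d)))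
        ↑₂ : ∀ {x m y n} → d ℕ.+ y ℕ.* n ≡ x ℕ.* m → + d + + y * + n ≡ + x * + m
        ↑₂ {x} {m} {y} {n} e = trans (cong (λ z → + d + z) (sym (ℤₚ.pos-* y n))) (trans (cong +_ e) (ℤₚ.pos-* x m))
        cancel : ∀ z → + d * z ≡ + d * + 1 → z ≡ + 1
        cancel z e = ℤₚ.*-cancelˡ-≡ (+ d) z (+ 1) e
        coeffs : Bézout.Identity d m n → Σ ℤ λ x → Σ ℤ λ y → + m ≡ + d * + q × + n ≡ + d * + q′ × x * + q - y * + q′ ≡ + 1
        coeffs (Bézout.+- x y eq) = + x , + y , ↑ p , ↑ p′ , cancel (+ x * + q - + y * + q′)
          (lin 7 (λ d x y m n q q′ → d :+ y :* n :≡ x :* m ⇒ m :≡ d :* q ⇒ n :≡ d :* q′ ⇒ 2 ⊙ x ∷ 3 ⊙ y ∷ [] ⊩ d :* (x :* q :- y :* q′) :≡ d :* κ 1)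
            (+ d) (+ x) (+ y) (+ m) (+ n) (+ q) (+ q′) (↑₂ {x} {m} {y} {n} eq) (↑ p) (↑ p′))
        coeffs (Bézout.-+ x y eq) = - + x , - + y , ↑ p , ↑ p′ , cancel (- + x * + q - - + y * + q′)
          (lin 7 (λ d x y m n q q′ → d :+ x :* m :≡ y :* n ⇒ m :≡ d :* q ⇒ n :≡ d :* q′ ⇒ 2 ⊙ x ∷ 3 ⊙ y ∷ [] ⊩ d :* ((:- x) :* q :- (:- y) :* q′) :≡ d :* κ 1)
            (+ d) (+ x) (+ y) (+ m) (+ n) (+ q) (+ q′) (↑₂ {y} {n} {x} {m} eq) (↑ p) (↑ p′))

  reduce : ∀ w → Reduced w
  reduce (w₁ , w₂) with sgn w₁ | sgn w₂ | bezout ℤ.∣ w₁ ∣ ℤ.∣ w₂ ∣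
  ... | σ , σ² , e | τ , τ² , f | d , m′ , n′ , x , y , em , en , one =
    reduced (+ d) (σ * m′ , τ * n′) (- (τ * y) , - (σ * x)) (ℤ.+≤+ z≤n)
      (trans e (trans (cong (σ *_) em) (lin 3 (λ s d m → ⊢ s :* (d :* m) :≡ d :* (s :* m)) σ (+ d) m′)))
      (trans f (trans (cong (τ *_) en) (lin 3 (λ s d m → ⊢ s :* (d :* m) :≡ d :* (s :* m)) τ (+ d) n′)))
      (lin 6 (λ σ τ x y m n → σ :* σ :≡ κ 1 ⇒ τ :* τ :≡ κ 1 ⇒ x :* m :- y :* n :≡ κ 1 ⇒ 1 ⊙ (x :* m) ∷ 2 ⊙ (y :* n) ∷ [] ⊩
        (:- (τ :* y)) :* (τ :* n) :- (:- (σ :* x)) :* (σ :* m) :≡ κ 1) σ τ x y m′ n′ σ² τ² one)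

  -- The bounds `X₁` and `X₂` serve twice: they put `v + e₁` and `v + e₂` below `p` for the form
  -- `X`, hence outside the interior, and later they bound cone coordinates by values of `X`.
  record UnimodularCone (S : List Pt) (X v p : Pt) : Set where
    field
      e₁ e₂ : Pt
      unit  : det e₁ e₂ ≡ + 1
      sum₁  : proj₁ p ≡ proj₁ v + proj₁ e₁ + proj₁ e₂
      sum₂  : proj₂ p ≡ proj₂ v + proj₂ e₁ + proj₂ e₂
      X₁    : + 1 ≤ X ∙ e₁
      X₂    : + 1 ≤ X ∙ e₂
      side₁ : ∀ s → s ∈ S → + 0 ≤ det (s ⊖ v) e₂
      side₂ : ∀ s → s ∈ S → + 0 ≤ det e₁ (s ⊖ v)

  no-unit : ∀ k m → + 2 ≤ m → k * m ≡ + 1 → ⊥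
  no-unit k m m≥2 e with + 1 ℤₚ.≤? k
  ... | yes h = lin 2 (λ k m → κ 2 :≤ m ⇒ k :* m :≡ κ 1 ⇒ κ 1 :≤ k ⇒ 1 ⊛ 3 ∷ [] ⊩ :⊥) k m m≥2 e h
  ... | no ¬h = lin 2 (λ k m → κ 2 :≤ m ⇒ k :* m :≡ κ 1 ⇒ k :< κ 1 ⇒ 1 ⊛ 3 ∷ [] ⊩ :⊥) k m m≥2 e (ℤₚ.≰⇒> ¬h)

  divide : ∀ x m → + 2 ≤ m → Σ ℤ λ q → Σ ℤ λ ρ → x ≡ ρ + q * m × + 0 ≤ ρ × ρ < m
  divide x (+ suc m) _ = x ℤDM./ℕ suc m , + (x ℤDM.%ℕ suc m) , ℤDM.a≡a%ℕn+[a/ℕn]*n x (suc m) , ℤ.+≤+ z≤n , ℤ.+<+ (ℤDM.n%ℕd<d x (suc m))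
  divide x (+ 0) (ℤ.+≤+ ())

  -- `r` witnesses that `X` is primitive. The gap of 2 is what leaves room for splitting `p - v`
  -- into two vectors on both of which `X` is at least 1.
  module _ {S : List Pt} {X r v p : Pt} (Xr : X ∙ r ≡ + 1)
           (v∈ : v ∈ S) (v-min : ∀ s → s ∈ S → X ∙ v ≤ X ∙ s)
           (ip : Int S p) (p-min : ∀ q → Int S q → X ∙ p ≤ X ∙ q)
           (gap : X ∙ v + + 2 ≤ X ∙ p) where

    private
      v₁ = proj₁ v
      v₂ = proj₂ v
      w = p ⊖ v
      m = X ∙ w

      m≥2 : + 2 ≤ m
      m≥2 = lin 6 (λ a b v₁ v₂ p₁ p₂ → a :* v₁ :+ b :* v₂ :+ κ 2 :≤ a :* p₁ :+ b :* p₂ ⇒ ⊢ κ 2 :≤ a :* (p₁ :- v₁) :+ b :* (p₂ :- v₂))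
        (proj₁ X) (proj₂ X) v₁ v₂ (proj₁ p) (proj₂ p) gap

      -- If w = g w′ with g ≥ 2, then p − w′ is an interior point with a smaller value of X.
      indivisible : ∀ g w′ → + 0 ≤ g → w ≡ (g * proj₁ w′ , g * proj₂ w′) → g ≡ + 1
      indivisible g w′@(a , b) g≥0 eq with ℤₚ.<-cmp g (+ 1)
      ... | tri≈ _ e _ = e
      ... | tri< g<1 _ _ = ⊥-elim (lin 5 (λ g X₁ X₂ a b → g :≡ κ 0 ⇒ κ 2 :≤ X₁ :* (g :* a) :+ X₂ :* (g :* b) ⇒
               1 ⊙ (X₁ :* a :+ X₂ :* b) ∷ [] ⊩ :⊥) g (proj₁ X) (proj₂ X) a b
               (lin 1 (λ g → κ 0 :≤ g ⇒ g :< κ 1 ⇒ ⊢ g :≡ κ 0) g g≥0 g<1) (subst (λ z → + 2 ≤ X ∙ z) eq m≥2))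
      ... | tri> _ _ g>1 = ⊥-elim (ℤₚ.<⇒≱ smaller (p-min (p ⊖ w′) (int-mix {α = + 1} {γ = g - + 1} ip v∈ (ℤ.+≤+ z≤n)
               (lin 1 (λ g → κ 1 :< g ⇒ ⊢ κ 0 :< g :- κ 1) g g>1) mix)))
        where
          e₁ = cong proj₁ eq
          e₂ = cong proj₂ eq
          mix : ∀ u → (+ 1 + (g - + 1)) * (u ∙ (p ⊖ w′)) ≡ + 1 * (u ∙ v) + (g - + 1) * (u ∙ p)
          mix (u₁ , u₂) = lin 9 (λ g u₁ u₂ p₁ p₂ v₁ v₂ a b → p₁ :- v₁ :≡ g :* a ⇒ p₂ :- v₂ :≡ g :* b ⇒ 1 ⊙ u₁ ∷ 2 ⊙ u₂ ∷ [] ⊩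
            (κ 1 :+ (g :- κ 1)) :* (u₁ :* (p₁ :- a) :+ u₂ :* (p₂ :- b)) :≡ κ 1 :* (u₁ :* v₁ :+ u₂ :* v₂) :+ (g :- κ 1) :* (u₁ :* p₁ :+ u₂ :* p₂))
            g u₁ u₂ (proj₁ p) (proj₂ p) v₁ v₂ a b e₁ e₂
          Xw′>0 : + 0 < X ∙ w′
          Xw′>0 = lin 5 (λ g X₁ X₂ a b → κ 1 :< g ⇒ κ 2 :≤ X₁ :* (g :* a) :+ X₂ :* (g :* b) ⇒
               0 ⊛ 1 ∷ [] ⊩ κ 0 :< X₁ :* a :+ X₂ :* b) g (proj₁ X) (proj₂ X) a b g>1 (subst (λ z → + 2 ≤ X ∙ z) eq m≥2)
          smaller : X ∙ (p ⊖ w′) < X ∙ p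
          smaller = lin 6 (λ X₁ X₂ a b p₁ p₂ → κ 0 :< X₁ :* a :+ X₂ :* b ⇒ ⊢ X₁ :* (p₁ :- a) :+ X₂ :* (p₂ :- b) :< X₁ :* p₁ :+ X₂ :* p₂)
            (proj₁ X) (proj₂ X) a b (proj₁ p) (proj₂ p) Xw′>0

      rotate : ∀ x y z → x + y + z ≡ x + z + y
      rotate = lin 3 λ x y z → ⊢ x :+ y :+ z :≡ x :+ z :+ y

      -- Shift e by a multiple of w to make 0 < X e < X w; the value 0 would contradict X r = 1.
      shifted : ∀ e → det e w ≡ + 1 → Σ Pt λ e₁ → det e₁ w ≡ + 1 × + 1 ≤ X ∙ e₁ × X ∙ e₁ < m
      shifted (a , b) h with divide (X ∙ (a , b)) m m≥2
      ... | q , ρ , Xe≡ , ρ≥0 , ρ<m = e₁ , unit₁ , lo , subst (_< m) (sym Xe₁) ρ<m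
        where
          w₁ = proj₁ w
          w₂ = proj₂ w
          e₁ = (a - q * w₁ , b - q * w₂)
          Xe₁ : X ∙ e₁ ≡ ρ
          Xe₁ = lin 8 (λ X₁ X₂ a b q w₁ w₂ ρ → X₁ :* a :+ X₂ :* b :≡ ρ :+ q :* (X₁ :* w₁ :+ X₂ :* w₂) ⇒
            ⊢ X₁ :* (a :- q :* w₁) :+ X₂ :* (b :- q :* w₂) :≡ ρ) (proj₁ X) (proj₂ X) a b q w₁ w₂ ρ Xe≡
          unit₁ : det e₁ w ≡ + 1
          unit₁ = lin 5 (λ a b q w₁ w₂ → a :* w₂ :- b :* w₁ :≡ κ 1 ⇒ ⊢ (a :- q :* w₁) :* w₂ :- (b :- q :* w₂) :* w₁ :≡ κ 1) a b q w₁ w₂ h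
          lo : + 1 ≤ X ∙ e₁
          lo with + 1 ℤₚ.≤? X ∙ e₁
          ... | yes k = k
          ... | no ¬k = ⊥-elim (no-unit (det e₁ r) m m≥2
            (lin 8 (λ X₁ X₂ a b w₁ w₂ r₁ r₂ → X₁ :* r₁ :+ X₂ :* r₂ :≡ κ 1 ⇒ a :* w₂ :- b :* w₁ :≡ κ 1 ⇒ X₁ :* a :+ X₂ :* b :≡ κ 0 ⇒
               2 ⊙ (X₁ :* r₁ :+ X₂ :* r₂) ∷ 3 ⊙ (r₁ :* w₂ :- r₂ :* w₁) ∷ [] ⊩ (a :* r₂ :- b :* r₁) :* (X₁ :* w₁ :+ X₂ :* w₂) :≡ κ 1)
               (proj₁ X) (proj₂ X) (proj₁ e₁) (proj₂ e₁) w₁ w₂ (proj₁ r) (proj₂ r) Xr unit₁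
               (lin 2 (λ x ρ → x :≡ ρ ⇒ κ 0 :≤ ρ ⇒ x :< κ 1 ⇒ ⊢ x :≡ κ 0) (X ∙ e₁) ρ Xe₁ ρ≥0 (ℤₚ.≰⇒> ¬k))))

      -- v + e is not interior, and a supporting line at it keeps S on one side of the ray v + ℝ₊ e.
      half : ∀ e f (a b : Pt → ℤ) → (∀ u s → u ∙ s ≡ u ∙ v + a s * (u ∙ e) + b s * (u ∙ f)) →
             (∀ u → u ∙ p ≡ u ∙ v + u ∙ e + u ∙ f) → + 1 ≤ X ∙ e → + 1 ≤ X ∙ f → ∀ s → s ∈ S → + 0 ≤ b s
      half e f a b coords p≡ Xe Xf s s∈ with int⊎sep S q
        where q = (v₁ + proj₁ e , v₂ + proj₂ e)
      ... | inj₁ i = ⊥-elim (ℤₚ.<⇒≱ (lin 5 (λ Xq Xp Xv Xe Xf → Xq :≡ Xv :+ Xe ⇒ Xp :≡ Xv :+ Xe :+ Xf ⇒ κ 1 :≤ Xf ⇒ ⊢ Xq :< Xp)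
              (X ∙ (v₁ + proj₁ e , v₂ + proj₂ e)) (X ∙ p) (X ∙ v) (X ∙ e) (X ∙ f) (split X) (p≡ X) Xf) (p-min _ i))
        where
          split : ∀ u → u ∙ (v₁ + proj₁ e , v₂ + proj₂ e) ≡ u ∙ v + u ∙ e
          split (u₁ , u₂) = lin 6 (λ u₁ u₂ v₁ v₂ e₁ e₂ → ⊢ u₁ :* (v₁ :+ e₁) :+ u₂ :* (v₂ :+ e₂) :≡ u₁ :* v₁ :+ u₂ :* v₂ :+ (u₁ :* e₁ :+ u₂ :* e₂)) u₁ u₂ v₁ v₂ (proj₁ e) (proj₂ e)
      ... | inj₂ (u , nz , h) = ℤₚ.≮⇒≥ λ bad → contra bad (a≥1 bad)
        where
          split : u ∙ (v₁ + proj₁ e , v₂ + proj₂ e) ≡ u ∙ v + u ∙ e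
          split = lin 6 (λ u₁ u₂ v₁ v₂ e₁ e₂ → ⊢ u₁ :* (v₁ :+ e₁) :+ u₂ :* (v₂ :+ e₂) :≡ u₁ :* v₁ :+ u₂ :* v₂ :+ (u₁ :* e₁ :+ u₂ :* e₂)) (proj₁ u) (proj₂ u) v₁ v₂ (proj₁ e) (proj₂ e)
          Ue≥0 : + 0 ≤ u ∙ e
          Ue≥0 = lin 3 (λ V Q E → V :≤ Q ⇒ Q :≡ V :+ E ⇒ ⊢ κ 0 :≤ E) (u ∙ v) _ (u ∙ e) (h v v∈) split
          Uf<0 : u ∙ f < + 0
          Uf<0 = lin 5 (λ P V Q E F → P :< Q ⇒ Q :≡ V :+ E ⇒ P :≡ V :+ E :+ F ⇒ ⊢ F :< κ 0) (u ∙ p) (u ∙ v) _ (u ∙ e) (u ∙ f) (int-strict ip u nz _ h) split (p≡ u)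
          Us : a s * (u ∙ e) + b s * (u ∙ f) ≤ u ∙ e
          Us = lin 6 (λ s Q V E M N → s :≤ Q ⇒ Q :≡ V :+ E ⇒ s :≡ V :+ M :+ N ⇒ ⊢ M :+ N :≤ E) (u ∙ s) _ (u ∙ v) (u ∙ e) (a s * (u ∙ e)) (b s * (u ∙ f)) (h s s∈) split (coords u s)
          Xs : + 0 ≤ a s * (X ∙ e) + b s * (X ∙ f)
          Xs = lin 4 (λ s V M N → V :≤ s ⇒ s :≡ V :+ M :+ N ⇒ ⊢ κ 0 :≤ M :+ N) (X ∙ s) (X ∙ v) (a s * (X ∙ e)) (b s * (X ∙ f)) (v-min s s∈) (coords X s)
          -- Suppose `b s < 0`. Minimality of `X` at `v` forces `a s ≥ 1`; then `a s * (u ∙ e)` is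
          -- at least `u ∙ e` and `b s * (u ∙ f)` is positive, which puts `s` beyond the supporting
          -- line at `v + e`.
          a≥1 : b s < + 0 → + 1 ≤ a s
          a≥1 = lin 4 (λ a b E F → κ 0 :≤ a :* E :+ b :* F ⇒ κ 1 :≤ E ⇒ κ 1 :≤ F ⇒ b :< κ 0 ⇒ 0 ⊛ 2 ∷ 4 ⊛ 3 ∷ [] ⊩ κ 1 :≤ a) (a s) (b s) (X ∙ e) (X ∙ f) Xs Xe Xf
          contra : b s < + 0 → + 1 ≤ a s → ⊥
          contra = lin 4 (λ a b E F → a :* E :+ b :* F :≤ E ⇒ κ 0 :≤ E ⇒ F :< κ 0 ⇒ b :< κ 0 ⇒ κ 1 :≤ a ⇒ 2 ⊛ 5 ∷ 3 ⊛ 4 ∷ [] ⊩ :⊥) (a s) (b s) (u ∙ e) (u ∙ f) Us Ue≥0 Uf<0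

      fromBasis : ∀ a b c d → det (a , b) (c , d) ≡ + 1 → proj₁ p ≡ v₁ + a + c → proj₂ p ≡ v₂ + b + d →
                  + 1 ≤ X ∙ (a , b) → + 1 ≤ X ∙ (c , d) → UnimodularCone S X v p
      fromBasis a b c d one p₁≡ p₂≡ Xe Xf = record
        { e₁ = (a , b) ; e₂ = (c , d) ; unit = one ; sum₁ = p₁≡ ; sum₂ = p₂≡ ; X₁ = Xe ; X₂ = Xf
        ; side₁ = half (c , d) (a , b) (λ s → det (a , b) (s ⊖ v)) (λ s → det (s ⊖ v) (c , d))
            (λ u s → trans (coords u s) (rotate (u ∙ v) (det (s ⊖ v) (c , d) * (u ∙ (a , b))) (det (a , b) (s ⊖ v) * (u ∙ (c , d)))))
            (λ u → trans (p≡ u) (rotate (u ∙ v) (u ∙ (a , b)) (u ∙ (c , d)))) Xf Xe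
        ; side₂ = half (a , b) (c , d) (λ s → det (s ⊖ v) (c , d)) (λ s → det (a , b) (s ⊖ v)) coords p≡ Xe Xf
        }
        where
          coords : ∀ u s → u ∙ s ≡ u ∙ v + det (s ⊖ v) (c , d) * (u ∙ (a , b)) + det (a , b) (s ⊖ v) * (u ∙ (c , d))
          coords (u₁ , u₂) (x , y) = lin 10 (λ u₁ u₂ x y v₁ v₂ a b c d → a :* d :- b :* c :≡ κ 1 ⇒ 1 ⊙ (u₁ :* (x :- v₁) :+ u₂ :* (y :- v₂)) ∷ [] ⊩
             u₁ :* x :+ u₂ :* y :≡ u₁ :* v₁ :+ u₂ :* v₂ :+ ((x :- v₁) :* d :- (y :- v₂) :* c) :* (u₁ :* a :+ u₂ :* b) :+ (a :* (y :- v₂) :- b :* (x :- v₁)) :* (u₁ :* c :+ u₂ :* d))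
             u₁ u₂ x y v₁ v₂ a b c d one
          p≡ : ∀ u → u ∙ p ≡ u ∙ v + u ∙ (a , b) + u ∙ (c , d)
          p≡ (u₁ , u₂) = lin 10 (λ u₁ u₂ p₁ p₂ v₁ v₂ a b c d → p₁ :≡ v₁ :+ a :+ c ⇒ p₂ :≡ v₂ :+ b :+ d ⇒ 1 ⊙ u₁ ∷ 2 ⊙ u₂ ∷ [] ⊩
            u₁ :* p₁ :+ u₂ :* p₂ :≡ u₁ :* v₁ :+ u₂ :* v₂ :+ (u₁ :* a :+ u₂ :* b) :+ (u₁ :* c :+ u₂ :* d))
             u₁ u₂ (proj₁ p) (proj₂ p) v₁ v₂ a b c d p₁≡ p₂≡

      fromShift : (Σ Pt λ e₁ → det e₁ w ≡ + 1 × + 1 ≤ X ∙ e₁ × X ∙ e₁ < m) → UnimodularCone S X v p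
      fromShift ((a , b) , one , lo , hi) = fromBasis a b (w₁ - a) (w₂ - b)
          (lin 4 (λ a b w₁ w₂ → a :* w₂ :- b :* w₁ :≡ κ 1 ⇒ ⊢ a :* (w₂ :- b) :- b :* (w₁ :- a) :≡ κ 1) a b w₁ w₂ one)
          (lin 3 (λ p v a → ⊢ p :≡ v :+ a :+ (p :- v :- a)) (proj₁ p) v₁ a)
          (lin 3 (λ p v a → ⊢ p :≡ v :+ a :+ (p :- v :- a)) (proj₂ p) v₂ b)
          lo
          (lin 6 (λ X₁ X₂ a b w₁ w₂ → X₁ :* a :+ X₂ :* b :< X₁ :* w₁ :+ X₂ :* w₂ ⇒ ⊢ κ 1 :≤ X₁ :* (w₁ :- a) :+ X₂ :* (w₂ :- b)) (proj₁ X) (proj₂ X) a b w₁ w₂ hi)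
        where
          w₁ = proj₁ w
          w₂ = proj₂ w

      fromReduced : Reduced w → UnimodularCone S X v p
      fromReduced (reduced g (a , b) e g≥0 q₁ q₂ one) = fromShift (shifted e
          (lin 7 (λ g a b e₁ e₂ w₁ w₂ → g :≡ κ 1 ⇒ w₁ :≡ g :* a ⇒ w₂ :≡ g :* b ⇒ e₁ :* b :- e₂ :* a :≡ κ 1 ⇒
              1 ⊙ (e₁ :* b) ∷ 1 ⊙ (e₂ :* a) ∷ 2 ⊙ e₂ ∷ 3 ⊙ e₁ ∷ [] ⊩ e₁ :* w₂ :- e₂ :* w₁ :≡ κ 1) g a b (proj₁ e) (proj₂ e) (proj₁ w) (proj₂ w)
              (indivisible g (a , b) g≥0 (cong₂ _,_ q₁ q₂)) q₁ q₂ one))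

    unimodularCone : UnimodularCone S X v p
    unimodularCone = fromReduced (reduce w)

-- The exceptional configurations, described by inequalities and corners

module Configurations where
  open import Data.Integer using (_+_; _*_; _-_; -_; _≤_; _<_)
  open Lattice
  open Frames
  open Cones

  -- Half-planes together with membership of the corners in the point list: in this form frames and
  -- linear arithmetic apply directly, and the comparison with the hull `Trap a b` is postponed.
  record IsTrap (a b : ℕ) (T : List Pt) : Set where
    field
      shape : (a ≡ 1 × b ≡ 1) ⊎ (2 ℕ.≤ a × b ℕ.≤ a)
      c₀₀   : pt 0 0 ∈ T
      c₁₀   : pt a 0 ∈ T
      c₀₁   : pt 0 1 ∈ T
      c₁₁   : pt b 1 ∈ T
      all   : ∀ t → t ∈ T → + 0 ≤ proj₁ t × + 0 ≤ proj₂ t × proj₂ t ≤ + 1 × proj₁ t + (+ a - + b) * proj₂ t ≤ + a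

  record IsTri2 (T : List Pt) : Set where
    field
      c₀  : pt 0 0 ∈ T
      c₁  : pt 2 0 ∈ T
      c₂  : pt 0 2 ∈ T
      all : ∀ t → t ∈ T → + 0 ≤ proj₁ t × + 0 ≤ proj₂ t × proj₁ t + proj₂ t ≤ + 2

  record IsTri42 (T : List Pt) : Set where
    field
      c₀  : pt 0 0 ∈ T
      c₁  : pt 4 0 ∈ T
      c₂  : pt 0 2 ∈ T
      all : ∀ t → t ∈ T → + 0 ≤ proj₁ t × + 0 ≤ proj₂ t × proj₁ t + + 2 * proj₂ t ≤ + 4

  record IsRect (a b : ℕ) (T : List Pt) : Set where
    field
      a≥2 : 2 ℕ.≤ a
      b≥2 : 2 ℕ.≤ b
      c₀₀ : pt 0 0 ∈ T
      c₁₀ : pt a 0 ∈ T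
      c₀₁ : pt 0 b ∈ T
      c₁₁ : pt a b ∈ T
      all : ∀ t → t ∈ T → + 0 ≤ proj₁ t × proj₁ t ≤ + a × + 0 ≤ proj₂ t × proj₂ t ≤ + b

  -- An edge from (l , 0) to (r , 0) below an edge from (i , 1) to (j , 1) of the inner polygon.
  record LongEdge (l r i j : ℤ) (T : List Pt) : Set where
    field
      left   : (l , + 0) ∈ T
      right  : (r , + 0) ∈ T
      above  : ∀ t → t ∈ T → + 0 ≤ proj₂ t
      edge   : ∀ t → t ∈ T → proj₂ t ≡ + 0 → l ≤ proj₁ t × proj₁ t ≤ r
      ileft  : Int T (i , + 1)
      iright : Int T (j , + 1)
      iedge  : ∀ q → Int T q → proj₂ q ≡ + 1 → i ≤ proj₁ q × proj₁ q ≤ j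
      i<j    : i < j
      long   : j - i + + 4 ≤ r - l

  data Config (T : List Pt) : Set where
    trap  : ∀ a b → IsTrap a b T → Config T
    tri2  : IsTri2 T → Config T
    tri42 : IsTri42 T → Config T
    rect  : ∀ a b → IsRect a b T → Config T
    edge5 : ∀ l r i j → LongEdge l r i j T → Config T

  Exceptional : List Pt → Set
  Exceptional S = Σ Unimod λ φ → Config (map (act φ) S)

  -- The last alternative takes the place of minimality of `n`: it offers a smaller triangle around
  -- the inner polygon, from which the argument can be restarted.
  Outcome : ℤ → List Pt → Set
  Outcome n S = Exceptional S ⊎ Fit (_∈ S) (n + + 3) ⊎ Fit (Int S) (n - + 1)

  exceptional-map : ∀ φ {S} → Exceptional (map (act φ) S) → Exceptional S
  exceptional-map φ {S} (ψ , c) = ψ ∘ᵤ φ , subst Config (map-act-∘ ψ φ S) c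

  viaFrame : ∀ φ {n S} → Outcome n (map (act φ) S) → Outcome n S
  viaFrame φ (inj₁ e)        = inj₁ (exceptional-map φ e)
  viaFrame φ (inj₂ (inj₁ f)) = inj₂ (inj₁ (fit-map φ f))
  viaFrame φ (inj₂ (inj₂ f)) = inj₂ (inj₂ (fitInt-map φ f))

  map-id : ∀ S → map (act idᵤ) S ≡ S
  map-id S = trans (Listₚ.map-cong (λ (x , y) → cong₂ _,_ (lin 2 (λ x y → ⊢ κ 1 :* x :+ κ 0 :* y :+ κ 0 :≡ x) x y) (lin 2 (λ x y → ⊢ κ 0 :* x :+ κ 1 :* y :+ κ 0 :≡ y) x y)) S) (Listₚ.map-id S)

  exceptionalHere : ∀ {S} → Config S → Exceptional S
  exceptionalHere {S} c = idᵤ , subst Config (sym (map-id S)) c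

  fitHere : ∀ {P d} → (∀ s → P s → InΔ d s) → Fit P d
  fitHere {P} {d} h = idᵤ , λ (x , y) s∈ → let (a , b , c) = h (x , y) s∈ in
    lin 2 (λ x y → κ 0 :≤ x ⇒ ⊢ κ 0 :≤ κ 1 :* x :+ κ 0 :* y :+ κ 0) x y a ,
    lin 2 (λ x y → κ 0 :≤ y ⇒ ⊢ κ 0 :≤ κ 0 :* x :+ κ 1 :* y :+ κ 0) x y b ,
    lin 3 (λ x y d → x :+ y :≤ d ⇒ ⊢ κ 1 :* x :+ κ 0 :* y :+ κ 0 :+ (κ 0 :* x :+ κ 1 :* y :+ κ 0) :≤ d) x y d c

  int-x≥1 : ∀ {S q} → (∀ s → s ∈ S → + 0 ≤ proj₁ s) → Int S q → + 1 ≤ proj₁ q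
  int-x≥1 {S} {x , y} h i = lin 2 (λ x y → :- κ 1 :* x :+ κ 0 :* y :< κ 0 ⇒ ⊢ κ 1 :≤ x) x y
    (int-strict i (- + 1 , + 0) (λ ()) (+ 0) λ (a , b) s∈ → lin 2 (λ a b → κ 0 :≤ a ⇒ ⊢ :- κ 1 :* a :+ κ 0 :* b :≤ κ 0) a b (h _ s∈))

  int-y≥1 : ∀ {S q} → (∀ s → s ∈ S → + 0 ≤ proj₂ s) → Int S q → + 1 ≤ proj₂ q
  int-y≥1 {S} {x , y} h i = lin 2 (λ x y → κ 0 :* x :+ :- κ 1 :* y :< κ 0 ⇒ ⊢ κ 1 :≤ y) x y
    (int-strict i (+ 0 , - + 1) (λ ()) (+ 0) λ (a , b) s∈ → lin 2 (λ a b → κ 0 :≤ b ⇒ ⊢ κ 0 :* a :+ :- κ 1 :* b :≤ κ 0) a b (h _ s∈))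

  Quadrant : List Pt → Set
  Quadrant S = ∀ s → s ∈ S → + 0 ≤ proj₁ s × + 0 ≤ proj₂ s

  int-≥1 : ∀ {S q} → Quadrant S → Int S q → + 1 ≤ proj₁ q × + 1 ≤ proj₂ q
  int-≥1 h i = int-x≥1 (λ s s∈ → proj₁ (h s s∈)) i , int-y≥1 (λ s s∈ → proj₂ (h s s∈)) i

  int-x< : ∀ {S q c} → (∀ s → s ∈ S → proj₁ s ≤ c) → Int S q → proj₁ q < c
  int-x< {S} {x , y} {c} h i = lin 3 (λ x y c → κ 1 :* x :+ κ 0 :* y :< c ⇒ ⊢ x :< c) x y c
    (int-strict i (+ 1 , + 0) (λ ()) c λ (a , b) s∈ → lin 3 (λ a b c → a :≤ c ⇒ ⊢ κ 1 :* a :+ κ 0 :* b :≤ c) a b c (h _ s∈))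

  int-y< : ∀ {S q c} → (∀ s → s ∈ S → proj₂ s ≤ c) → Int S q → proj₂ q < c
  int-y< {S} {x , y} {c} h i = lin 3 (λ x y c → κ 0 :* x :+ κ 1 :* y :< c ⇒ ⊢ y :< c) x y c
    (int-strict i (+ 0 , + 1) (λ ()) c λ (a , b) s∈ → lin 3 (λ a b c → b :≤ c ⇒ ⊢ κ 0 :* a :+ κ 1 :* b :≤ c) a b c (h _ s∈))

  int-slope< : ∀ {S q} g c → (∀ s → s ∈ S → proj₁ s + g * proj₂ s ≤ c) → Int S q → proj₁ q + g * proj₂ q < c
  int-slope< {S} {x , y} g c h i = lin 4 (λ x y g c → κ 1 :* x :+ g :* y :< c ⇒ ⊢ x :+ g :* y :< c) x y g c
    (int-strict i (+ 1 , g) (λ ()) c λ (a , b) s∈ → lin 4 (λ a b g c → a :+ g :* b :≤ c ⇒ ⊢ κ 1 :* a :+ g :* b :≤ c) a b g c (h _ s∈))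

  pt≡ : ∀ {S : List Pt} {x y x′ y′} → x ≡ x′ → y ≡ y′ → (x , y) ∈ S → (x′ , y′) ∈ S
  pt≡ refl refl h = h

  intPt≡ : ∀ {S : List Pt} {x y x′ y′} → x ≡ x′ → y ≡ y′ → Int S (x , y) → Int S (x′ , y′)
  intPt≡ refl refl h = h

  toℕ : ∀ {z} k → + k ≤ z → Σ ℕ λ n → z ≡ + n × k ℕ.≤ n
  toℕ k (ℤ.+≤+ h) = _ , refl , h

  module _ {n : ℤ} {S : List Pt} (i₁ : Int S (+ 1 , + 1)) where

    -- A point of the box with `x - y ≥ a` can only be the corner `(a , 0)`. If this corner is
    -- missing, the shear to `(a - 1 - x + y , x)` has coordinate sum `a - 1 + y` and gives a fit;
    -- likewise for `(0 , b)`. With both corners present the polygon is the rectangle.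
    rectCase : ∀ m k → (∀ s → s ∈ S → + 0 ≤ proj₁ s × proj₁ s ≤ m × + 0 ≤ proj₂ s × proj₂ s ≤ k) →
               (+ 0 , + 0) ∈ S → (m , k) ∈ S → m + k ≡ n + + 4 → Outcome n S
    rectCase m k box o∈ v∈ sum with toℕ {m} 2 (ℤₚ.i<j⇒suc[i]≤j (int-x< (λ s s∈ → proj₁ (proj₂ (box s s∈))) i₁))
                                | toℕ {k} 2 (ℤₚ.i<j⇒suc[i]≤j (int-y< (λ s s∈ → proj₂ (proj₂ (proj₂ (box s s∈)))) i₁))
    ... | a , refl , a≥2 | b , refl , b≥2
      with search (λ s → + a ℤₚ.≤? proj₁ s - proj₂ s) S | search (λ s → + b ℤₚ.≤? proj₂ s - proj₁ s) S
    ... | inj₂ none | _ = inj₂ (inj₁ (unimod (- + 1) (+ 1) (+ 1) (+ 0) (+ a - + 1) (+ 0) (inj₂ refl) , λ (x , y) s∈ →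
            let (p , q , r , t) = box _ s∈ in
            lin 3 (λ x y a → x :- y :< a ⇒ ⊢ κ 0 :≤ :- κ 1 :* x :+ κ 1 :* y :+ (a :- κ 1)) x y (+ a) (ℤₚ.≰⇒> (none _ s∈)) ,
            lin 2 (λ x y → κ 0 :≤ x ⇒ ⊢ κ 0 :≤ κ 1 :* x :+ κ 0 :* y :+ κ 0) x y p ,
            lin 5 (λ x y a b n → y :≤ b ⇒ a :+ b :≡ n :+ κ 4 ⇒ ⊢ :- κ 1 :* x :+ κ 1 :* y :+ (a :- κ 1) :+ (κ 1 :* x :+ κ 0 :* y :+ κ 0) :≤ n :+ κ 3) x y (+ a) (+ b) n t sum))
    ... | inj₁ _ | inj₂ none = inj₂ (inj₁ (unimod (+ 1) (- + 1) (+ 0) (+ 1) (+ b - + 1) (+ 0) (inj₁ refl) , λ (x , y) s∈ →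
            let (p , q , r , t) = box _ s∈ in
            lin 3 (λ x y b → y :- x :< b ⇒ ⊢ κ 0 :≤ κ 1 :* x :+ :- κ 1 :* y :+ (b :- κ 1)) x y (+ b) (ℤₚ.≰⇒> (none _ s∈)) ,
            lin 2 (λ x y → κ 0 :≤ y ⇒ ⊢ κ 0 :≤ κ 0 :* x :+ κ 1 :* y :+ κ 0) x y r ,
            lin 5 (λ x y a b n → x :≤ a ⇒ a :+ b :≡ n :+ κ 4 ⇒ ⊢ κ 1 :* x :+ :- κ 1 :* y :+ (b :- κ 1) :+ (κ 0 :* x :+ κ 1 :* y :+ κ 0) :≤ n :+ κ 3) x y (+ a) (+ b) n q sum))
    ... | inj₁ ((x , y) , s∈ , h) | inj₁ ((x′ , y′) , s∈′ , h′) = inj₁ (exceptionalHere (rect a b record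
            { a≥2 = a≥2 ; b≥2 = b≥2 ; c₀₀ = o∈ ; c₁₁ = v∈ ; all = box
            ; c₁₀ = let (p , q , r , t) = box _ s∈ in pt≡
                (lin 3 (λ x y a → a :≤ x :- y ⇒ x :≤ a ⇒ κ 0 :≤ y ⇒ ⊢ x :≡ a) x y (+ a) h q r)
                (lin 3 (λ x y a → a :≤ x :- y ⇒ x :≤ a ⇒ κ 0 :≤ y ⇒ ⊢ y :≡ κ 0) x y (+ a) h q r) s∈
            ; c₀₁ = let (p , q , r , t) = box _ s∈′ in pt≡
                (lin 3 (λ y x a → a :≤ x :- y ⇒ x :≤ a ⇒ κ 0 :≤ y ⇒ ⊢ y :≡ κ 0) x′ y′ (+ b) h′ t p)
                (lin 3 (λ y x a → a :≤ x :- y ⇒ x :≤ a ⇒ κ 0 :≤ y ⇒ ⊢ x :≡ a) x′ y′ (+ b) h′ t p) s∈′ }))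

    -- The inner row `y = 1` runs from 1 to `N - 3`, exactly four shorter than the bottom edge. For
    -- `N > 4` this is a long edge; for `N = 4` the row is a single point and not an edge, which is
    -- why the triangle with legs 4 and 2 is an exception of its own.
    triCase : ∀ N → N ≡ n + + 4 → + 0 ≤ n → (∀ s → s ∈ S → + 0 ≤ proj₁ s × + 0 ≤ proj₂ s × proj₁ s + + 2 * proj₂ s ≤ N) →
              (+ 0 , + 0) ∈ S → (N , + 0) ∈ S → Int S (N - + 3 , + 1) → Exceptional S
    triCase N N≡ n≥0 all o∈ v∈ i₂ with ℤₚ.<-cmp (+ 4) N
    ... | tri> _ _ h = ⊥-elim (lin 2 (λ N n → N :< κ 4 ⇒ N :≡ n :+ κ 4 ⇒ κ 0 :≤ n ⇒ ⊢ :⊥) N n h N≡ n≥0)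
    ... | tri≈ _ refl _ with i₁ (+ 0 , + 1) (λ ())
    ...   | (x , y) , s∈ , h = let (p , q , r) = all _ s∈ in exceptionalHere (tri42 record { c₀ = o∈ ; c₁ = v∈ ; all = all
              ; c₂ = pt≡ (lin 2 (λ x y → κ 1 :< κ 0 :* x :+ κ 1 :* y ⇒ κ 0 :≤ x ⇒ x :+ κ 2 :* y :≤ κ 4 ⇒ ⊢ x :≡ κ 0) x y h p r)
                         (lin 2 (λ x y → κ 1 :< κ 0 :* x :+ κ 1 :* y ⇒ κ 0 :≤ x ⇒ x :+ κ 2 :* y :≤ κ 4 ⇒ ⊢ y :≡ κ 2) x y h p r) s∈ })
    triCase N N≡ n≥0 all o∈ v∈ i₂ | tri< N>4 _ _ = exceptionalHere (edge5 (+ 0) N (+ 1) (N - + 3) record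
      { left = o∈ ; right = v∈ ; above = λ s s∈ → proj₁ (proj₂ (all s s∈))
      ; edge = λ (x , y) s∈ e → let (p , q , r) = all _ s∈ in p , lin 3 (λ x y N → x :+ κ 2 :* y :≤ N ⇒ y :≡ κ 0 ⇒ ⊢ x :≤ N) x y N r e
      ; ileft = i₁ ; iright = i₂
      ; iedge = λ (x , y) i e → int-x≥1 (λ s s∈ → proj₁ (all s s∈)) i ,
          lin 3 (λ x y N → x :+ κ 2 :* y :< N ⇒ y :≡ κ 1 ⇒ ⊢ x :≤ N :- κ 3) x y N (int-slope< (+ 2) N (λ s s∈ → proj₂ (proj₂ (all s s∈))) i) e
      ; i<j = lin 1 (λ N → κ 4 :< N ⇒ ⊢ κ 1 :< N :- κ 3) N N>4
      ; long = lin 1 (λ N → ⊢ N :- κ 3 :- κ 1 :+ κ 4 :≤ N :- κ 0) N })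

-- Polygons whose only interior lattice point is (1 , 1)

module Reflexive where
  open import Data.Integer using (_+_; _*_; _-_; -_; _≤_; _<_)
  open import Data.Nat using (suc; z≤n; s≤s)
  open Lattice
  open Frames
  open Cones
  open Configurations

  ≤⊎> : ∀ x y → x ≤ y ⊎ y < x
  ≤⊎> x y with x ℤₚ.≤? y
  ... | yes h = inj₁ h
  ... | no ¬h = inj₂ (ℤₚ.≰⇒> ¬h)

  split012 : ∀ x → + 0 ≤ x → x ≤ + 2 → x ≡ + 0 ⊎ x ≡ + 1 ⊎ x ≡ + 2
  split012 (+ 0) _ _ = inj₁ refl
  split012 (+ 1) _ _ = inj₂ (inj₁ refl)
  split012 (+ 2) _ _ = inj₂ (inj₂ refl)
  split012 (+ suc (suc (suc _))) _ (ℤ.+≤+ (s≤s (s≤s ())))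

  module _ {S : List Pt} (quad : Quadrant S) (o∈ : (+ 0 , + 0) ∈ S)
           (i₁ : Int S (+ 1 , + 1)) (only : ∀ q → Int S q → proj₁ q + proj₂ q ≤ + 2) where

    private
      notInt : ∀ x y → + 2 < x + y → Sep S (x , y)
      notInt x y h with int⊎sep S (x , y)
      ... | inj₁ i = ⊥-elim (ℤₚ.<⇒≱ h (only _ i))
      ... | inj₂ s = s

    -- The polygon lies in the strip `0 ≤ x ≤ 2`. A separating line at `(1 , 2)` bounds the middle
    -- column by 2 and, by averaging, the outer column heights by `Y₀ + Y₂ ≤ 4`. Heights 4 and 0
    -- give the exceptional triangle, 2 and 2 the square, and all others fit.
    shortEdge : (+ 2 , + 0) ∈ S → (∀ s → s ∈ S → proj₁ s ≤ + 2) → Exceptional S ⊎ Fit (_∈ S) (+ 3)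
    shortEdge v∈ x≤2 with notInt (+ 1) (+ 2) (ℤ.+<+ (s≤s (s≤s (s≤s z≤n))))
                        | argmaxOn (λ s → proj₁ s ℤₚ.≟ + 0) proj₂ S o∈ refl | argmaxOn (λ s → proj₁ s ℤₚ.≟ + 2) proj₂ S v∈ refl
    ... | u@(u₁ , u₂) , nz , h | (_ , Y₀) , s₀∈ , refl , max₀ | (_ , Y₂) , s₂∈ , refl , max₂ = cases
      where
        u₂>0 : + 0 < u₂
        u₂>0 = lin 2 (λ u₁ u₂ → u₁ :* κ 1 :+ u₂ :* κ 1 :< u₁ :* κ 1 :+ u₂ :* κ 2 ⇒ ⊢ κ 0 :< u₂) u₁ u₂ (int-strict i₁ u nz _ h)
        sum : Y₀ + Y₂ ≤ + 4
        sum = lin 4 (λ u₁ u₂ a b → κ 0 :< u₂ ⇒ u₁ :* κ 0 :+ u₂ :* a :≤ u₁ :* κ 1 :+ u₂ :* κ 2 ⇒ u₁ :* κ 2 :+ u₂ :* b :≤ u₁ :* κ 1 :+ u₂ :* κ 2 ⇒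
          0 ⊛ 1 ∷ [] ⊩ a :+ b :≤ κ 4) u₁ u₂ Y₀ Y₂ u₂>0 (h _ s₀∈) (h _ s₂∈)
        Y₀≥0 = proj₂ (quad _ s₀∈)
        Y₂≥0 = proj₂ (quad _ s₂∈)
        middle : ∀ y → (+ 1 , y) ∈ S → y ≤ + 2
        middle y s∈ = lin 3 (λ u₁ u₂ y → κ 0 :< u₂ ⇒ u₁ :* κ 1 :+ u₂ :* y :≤ u₁ :* κ 1 :+ u₂ :* κ 2 ⇒ 0 ⊛ 1 ∷ [] ⊩ y :≤ κ 2) u₁ u₂ y u₂>0 (h _ s∈)
        columns : ∀ {P : Pt → Set} → (∀ y → + 0 ≤ y → y ≤ Y₀ → P (+ 0 , y)) → (∀ y → + 0 ≤ y → y ≤ + 2 → P (+ 1 , y)) →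
                  (∀ y → + 0 ≤ y → y ≤ Y₂ → P (+ 2 , y)) → ∀ s → s ∈ S → P s
        columns p₀ p₁ p₂ (x , y) s∈ with split012 x (proj₁ (quad _ s∈)) (x≤2 _ s∈)
        ... | inj₁ refl        = p₀ y (proj₂ (quad _ s∈)) (max₀ _ s∈ refl)
        ... | inj₂ (inj₁ refl) = p₁ y (proj₂ (quad _ s∈)) (middle y s∈)
        ... | inj₂ (inj₂ refl) = p₂ y (proj₂ (quad _ s∈)) (max₂ _ s∈ refl)

        fit₀ : Y₀ ≤ + 3 → Y₂ ≤ + 1 → Fit (_∈ S) (+ 3)
        fit₀ b₀ b₂ = fitHere (columns
          (λ y y≥0 k → ℤ.+≤+ z≤n , y≥0 , lin 2 (λ y Y → y :≤ Y ⇒ Y :≤ κ 3 ⇒ ⊢ κ 0 :+ y :≤ κ 3) y Y₀ k b₀)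
          (λ y y≥0 k → ℤ.+≤+ z≤n , y≥0 , lin 1 (λ y → y :≤ κ 2 ⇒ ⊢ κ 1 :+ y :≤ κ 3) y k)
          (λ y y≥0 k → ℤ.+≤+ z≤n , y≥0 , lin 2 (λ y Y → y :≤ Y ⇒ Y :≤ κ 1 ⇒ ⊢ κ 2 :+ y :≤ κ 3) y Y₂ k b₂))

        mirror = unimod (- + 1) (+ 0) (+ 0) (+ 1) (+ 2) (+ 0) (inj₂ refl)

        fit₂ : Y₂ ≤ + 3 → Y₀ ≤ + 1 → Fit (_∈ S) (+ 3)
        fit₂ b₂ b₀ = mirror , columns
          (λ y y≥0 k → ℤ.+≤+ z≤n , lin 1 (λ y → κ 0 :≤ y ⇒ ⊢ κ 0 :≤ κ 0 :+ κ 1 :* y :+ κ 0) y y≥0 , lin 2 (λ y Y → y :≤ Y ⇒ Y :≤ κ 1 ⇒ ⊢ κ 2 :+ (κ 0 :+ κ 1 :* y :+ κ 0) :≤ κ 3) y Y₀ k b₀)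
          (λ y y≥0 k → ℤ.+≤+ z≤n , lin 1 (λ y → κ 0 :≤ y ⇒ ⊢ κ 0 :≤ κ 0 :+ κ 1 :* y :+ κ 0) y y≥0 , lin 1 (λ y → y :≤ κ 2 ⇒ ⊢ κ 1 :+ (κ 0 :+ κ 1 :* y :+ κ 0) :≤ κ 3) y k)
          (λ y y≥0 k → ℤ.+≤+ z≤n , lin 1 (λ y → κ 0 :≤ y ⇒ ⊢ κ 0 :≤ κ 0 :+ κ 1 :* y :+ κ 0) y y≥0 , lin 2 (λ y Y → y :≤ Y ⇒ Y :≤ κ 3 ⇒ ⊢ κ 0 :+ (κ 0 :+ κ 1 :* y :+ κ 0) :≤ κ 3) y Y₂ k b₂)

        tall₀ : + 3 < Y₀ → Exceptional S
        tall₀ b = swapᵤ , tri42 record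
          { c₀ = ∈-map⁺ (act swapᵤ) o∈ ; c₂ = ∈-map⁺ (act swapᵤ) v∈
          ; c₁ = pt≡ (lin 2 (λ a b → κ 3 :< a ⇒ a :+ b :≤ κ 4 ⇒ κ 0 :≤ b ⇒ ⊢ κ 0 :+ κ 1 :* a :+ κ 0 :≡ κ 4) Y₀ Y₂ b sum Y₂≥0)
                     (lin 1 (λ a → ⊢ κ 0 :+ κ 0 :* a :+ κ 0 :≡ κ 0) Y₀) (∈-map⁺ (act swapᵤ) s₀∈)
          ; all = all-map swapᵤ λ s s∈ → subst (λ t → + 0 ≤ proj₁ t × + 0 ≤ proj₂ t × proj₁ t + + 2 * proj₂ t ≤ + 4) (sym (act-swap s))
              (columns {λ s → + 0 ≤ proj₂ s × + 0 ≤ proj₁ s × proj₂ s + + 2 * proj₁ s ≤ + 4}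
                (λ y y≥0 k → y≥0 , ℤ.+≤+ z≤n , lin 3 (λ y a b → y :≤ a ⇒ a :+ b :≤ κ 4 ⇒ κ 0 :≤ b ⇒ ⊢ y :+ κ 0 :≤ κ 4) y Y₀ Y₂ k sum Y₂≥0)
                (λ y y≥0 k → y≥0 , ℤ.+≤+ z≤n , lin 1 (λ y → y :≤ κ 2 ⇒ ⊢ y :+ κ 2 :≤ κ 4) y k)
                (λ y y≥0 k → y≥0 , ℤ.+≤+ z≤n , lin 3 (λ y a b → y :≤ b ⇒ a :+ b :≤ κ 4 ⇒ κ 3 :< a ⇒ ⊢ y :+ κ 4 :≤ κ 4) y Y₀ Y₂ k sum b) s s∈) }

        turned = unimod (+ 0) (+ 1) (- + 1) (+ 0) (+ 0) (+ 2) (inj₁ refl)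

        tall₂ : + 3 < Y₂ → Exceptional S
        tall₂ b = turned , tri42 record
          { c₀ = ∈-map⁺ (act turned) v∈ ; c₂ = ∈-map⁺ (act turned) o∈
          ; c₁ = pt≡ (lin 2 (λ b a → κ 3 :< a ⇒ b :+ a :≤ κ 4 ⇒ κ 0 :≤ b ⇒ ⊢ κ 0 :+ κ 1 :* a :+ κ 0 :≡ κ 4) Y₀ Y₂ b sum Y₀≥0)
                     (lin 1 (λ a → ⊢ :- κ 2 :+ κ 0 :* a :+ κ 2 :≡ κ 0) Y₂) (∈-map⁺ (act turned) s₂∈)
          ; all = all-map turned (columns
                (λ y y≥0 k → lin 1 (λ y → κ 0 :≤ y ⇒ ⊢ κ 0 :≤ κ 0 :+ κ 1 :* y :+ κ 0) y y≥0 , ℤ.+≤+ z≤n ,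
                   lin 3 (λ y b a → y :≤ b ⇒ b :+ a :≤ κ 4 ⇒ κ 3 :< a ⇒ ⊢ (κ 0 :+ κ 1 :* y :+ κ 0) :+ κ 4 :≤ κ 4) y Y₀ Y₂ k sum b)
                (λ y y≥0 k → lin 1 (λ y → κ 0 :≤ y ⇒ ⊢ κ 0 :≤ κ 0 :+ κ 1 :* y :+ κ 0) y y≥0 , ℤ.+≤+ z≤n ,
                   lin 1 (λ y → y :≤ κ 2 ⇒ ⊢ (κ 0 :+ κ 1 :* y :+ κ 0) :+ κ 2 :≤ κ 4) y k)
                (λ y y≥0 k → lin 1 (λ y → κ 0 :≤ y ⇒ ⊢ κ 0 :≤ κ 0 :+ κ 1 :* y :+ κ 0) y y≥0 , ℤ.+≤+ z≤n ,
                   lin 3 (λ y b a → y :≤ a ⇒ b :+ a :≤ κ 4 ⇒ κ 0 :≤ b ⇒ ⊢ (κ 0 :+ κ 1 :* y :+ κ 0) :+ κ 0 :≤ κ 4) y Y₀ Y₂ k sum Y₀≥0)) }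

        square : + 1 < Y₀ → + 1 < Y₂ → Exceptional S
        square b₀ b₂ = exceptionalHere (rect 2 2 record
          { a≥2 = s≤s (s≤s z≤n) ; b≥2 = s≤s (s≤s z≤n) ; c₀₀ = o∈ ; c₁₀ = v∈
          ; c₀₁ = pt≡ refl (lin 2 (λ a b → κ 1 :< a ⇒ κ 1 :< b ⇒ a :+ b :≤ κ 4 ⇒ ⊢ a :≡ κ 2) Y₀ Y₂ b₀ b₂ sum) s₀∈
          ; c₁₁ = pt≡ refl (lin 2 (λ a b → κ 1 :< a ⇒ κ 1 :< b ⇒ a :+ b :≤ κ 4 ⇒ ⊢ b :≡ κ 2) Y₀ Y₂ b₀ b₂ sum) s₂∈
          ; all = columns
              (λ y y≥0 k → ℤ.+≤+ z≤n , ℤ.+≤+ z≤n , y≥0 , lin 3 (λ y a b → y :≤ a ⇒ κ 1 :< b ⇒ a :+ b :≤ κ 4 ⇒ ⊢ y :≤ κ 2) y Y₀ Y₂ k b₂ sum)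
              (λ y y≥0 k → ℤ.+≤+ z≤n , ℤ.+≤+ (s≤s z≤n) , y≥0 , k)
              (λ y y≥0 k → ℤ.+≤+ z≤n , ℤ.+≤+ (s≤s (s≤s z≤n)) , y≥0 , lin 3 (λ y a b → y :≤ b ⇒ κ 1 :< a ⇒ a :+ b :≤ κ 4 ⇒ ⊢ y :≤ κ 2) y Y₀ Y₂ k b₀ sum) })

        cases : Exceptional S ⊎ Fit (_∈ S) (+ 3)
        cases with ≤⊎> Y₀ (+ 3) | ≤⊎> Y₂ (+ 3) | ≤⊎> Y₀ (+ 1) | ≤⊎> Y₂ (+ 1)
        ... | inj₂ b | _      | _      | _      = inj₁ (tall₀ b)
        ... | inj₁ _ | inj₂ b | _      | _      = inj₁ (tall₂ b)
        ... | inj₁ a | inj₁ _ | _      | inj₁ d = inj₂ (fit₀ a d)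
        ... | inj₁ _ | inj₁ b | inj₁ c | inj₂ _ = inj₂ (fit₂ b c)
        ... | inj₁ _ | inj₁ _ | inj₂ c | inj₂ d = inj₁ (square c d)

    -- Since `(2 , 1)` is not interior, a longer bottom edge makes the right boundary flatter, while
    -- interiority of `(1 , 1)` demands a point of height at least 2. So the edge has length 2, 3 or
    -- 4: length 3 fits, length 4 is the exceptional triangle, and length 2 is `shortEdge`.
    reflexiveEdge : ∀ L₀ → + 2 ≤ L₀ → (L₀ , + 0) ∈ S → Exceptional S ⊎ Fit (_∈ S) (+ 3)
    reflexiveEdge L₀ L₀≥2 v∈ with notInt (+ 2) (+ 1) (ℤ.+<+ (s≤s (s≤s (s≤s z≤n)))) | argmaxOn (λ s → proj₂ s ℤₚ.≟ + 0) proj₁ S v∈ refl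
                                  | i₁ (+ 0 , + 1) (λ ())
    ... | u@(u₁ , u₂) , nz , h | (L , _) , l∈ , refl , max | (x₀ , y₀) , s₀∈ , y₀> = cases
      where
        L≥2 : + 2 ≤ L
        L≥2 = ℤₚ.≤-trans L₀≥2 (max _ v∈ refl)
        u₁>0 : + 0 < u₁
        u₁>0 = lin 2 (λ u₁ u₂ → u₁ :* κ 1 :+ u₂ :* κ 1 :< u₁ :* κ 2 :+ u₂ :* κ 1 ⇒ ⊢ κ 0 :< u₁) u₁ u₂ (int-strict i₁ u nz _ h)
        -- The edge end `(L , 0)` gives `u₂ ≥ (L - 2) u₁`. Inserting this into the inequality at
        -- `(x , y)`, where `u₂` has the factor `y - 1 ≥ 0`, eliminates `u₂`.
        slope : ∀ x y → (x , y) ∈ S → + 0 < y → x + (L - + 2) * (y - + 1) ≤ + 2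
        slope x y s∈ y>0 = lin 5 (λ u₁ u₂ L x y → κ 0 :< u₁ ⇒ u₁ :* L :+ u₂ :* κ 0 :≤ u₁ :* κ 2 :+ u₂ :* κ 1 ⇒ u₁ :* x :+ u₂ :* y :≤ u₁ :* κ 2 :+ u₂ :* κ 1 ⇒ κ 0 :< y ⇒
          0 ⊛ 1 ∷ 2 ⊛ 4 ∷ [] ⊩ x :+ (L :- κ 2) :* (y :- κ 1) :≤ κ 2) u₁ u₂ L x y u₁>0 (h _ l∈) (h _ s∈) y>0
        rows : ∀ {P : Pt → Set} → (∀ x → + 0 ≤ x → x ≤ L → P (x , + 0)) → (∀ x y → + 0 ≤ x → + 0 < y → x + (L - + 2) * (y - + 1) ≤ + 2 → P (x , y)) →
               ∀ s → s ∈ S → P s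
        rows p₀ p₁ (x , y) s∈ with ℤₚ.<-cmp (+ 0) y
        ... | tri< y>0 _ _ = p₁ x y (proj₁ (quad _ s∈)) y>0 (slope x y s∈ y>0)
        ... | tri≈ _ refl _ = p₀ x (proj₁ (quad _ s∈)) (max _ s∈ refl)
        ... | tri> _ _ y<0 = ⊥-elim (ℤₚ.<⇒≱ y<0 (proj₂ (quad _ s∈)))
        y₀≥2 : + 2 ≤ y₀
        y₀≥2 = lin 2 (λ x y → κ 1 :< κ 0 :* x :+ κ 1 :* y ⇒ ⊢ κ 2 :≤ y) x₀ y₀ y₀>
        slope₀ : x₀ + (L - + 2) * (y₀ - + 1) ≤ + 2
        slope₀ = slope x₀ y₀ s₀∈ (ℤₚ.<-≤-trans (ℤ.+<+ (s≤s z≤n)) y₀≥2)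
        x₀≥0 = proj₁ (quad _ s₀∈)

        cases : Exceptional S ⊎ Fit (_∈ S) (+ 3)
        cases with ℤₚ.<-cmp L (+ 3)
        ... | tri≈ _ L≡3 _ = inj₂ (fitHere (rows
                (λ x x≥0 k → x≥0 , ℤ.+≤+ z≤n , lin 2 (λ x L → x :≤ L ⇒ L :≡ κ 3 ⇒ ⊢ x :+ κ 0 :≤ κ 3) x L k L≡3)
                (λ x y x≥0 y>0 k → x≥0 , ℤₚ.<⇒≤ y>0 , lin 3 (λ x y L → L :≡ κ 3 ⇒ x :+ (L :- κ 2) :* (y :- κ 1) :≤ κ 2 ⇒ 1 ⊙ y ∷ [] ⊩ x :+ y :≤ κ 3) x y L L≡3 k)))
        ... | tri< L<3 _ _ = shortEdge (pt≡ L≡2 refl l∈) (rows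
                (λ x _ k → subst (x ≤_) L≡2 k)
                (λ x y _ _ k → lin 3 (λ x y L → L :≡ κ 2 ⇒ x :+ (L :- κ 2) :* (y :- κ 1) :≤ κ 2 ⇒ 1 ⊙ y ∷ [] ⊩ x :≤ κ 2) x y L L≡2 k))
          where L≡2 = lin 1 (λ L → L :< κ 3 ⇒ κ 2 :≤ L ⇒ ⊢ L :≡ κ 2) L L<3 L≥2
        ... | tri> _ _ L>3 = inj₁ (exceptionalHere (tri42 record { c₀ = o∈ ; c₁ = pt≡ L≡4 refl l∈
              ; c₂ = pt≡ (lin 2 (λ x y → κ 0 :≤ x ⇒ κ 2 :≤ y ⇒ x :+ κ 2 :* y :≤ κ 4 ⇒ ⊢ x :≡ κ 0) x₀ y₀ x₀≥0 y₀≥2 (slope₄ x₀ y₀ slope₀))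
                         (lin 2 (λ x y → κ 0 :≤ x ⇒ κ 2 :≤ y ⇒ x :+ κ 2 :* y :≤ κ 4 ⇒ ⊢ y :≡ κ 2) x₀ y₀ x₀≥0 y₀≥2 (slope₄ x₀ y₀ slope₀)) s₀∈
              ; all = rows (λ x x≥0 k → x≥0 , ℤ.+≤+ z≤n , lin 2 (λ x L → x :≤ L ⇒ L :≡ κ 4 ⇒ ⊢ x :+ κ 0 :≤ κ 4) x L k L≡4)
                           (λ x y x≥0 y>0 k → x≥0 , ℤₚ.<⇒≤ y>0 , slope₄ x y k) }))
          where
            L≡4 : L ≡ + 4
            L≡4 = lin 3 (λ x y L → κ 3 :< L ⇒ κ 2 :≤ y ⇒ κ 0 :≤ x ⇒ x :+ (L :- κ 2) :* (y :- κ 1) :≤ κ 2 ⇒ 1 ⊛ 2 ∷ [] ⊩ L :≡ κ 4) x₀ y₀ L L>3 y₀≥2 x₀≥0 slope₀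
            slope₄ : ∀ x y → x + (L - + 2) * (y - + 1) ≤ + 2 → x + + 2 * y ≤ + 4
            slope₄ x y = lin 3 (λ x y L → L :≡ κ 4 ⇒ x :+ (L :- κ 2) :* (y :- κ 1) :≤ κ 2 ⇒ 1 ⊙ y ∷ [] ⊩ x :+ κ 2 :* y :≤ κ 4) x y L L≡4

-- Two facing unimodular corners: normal forms

module OppositeCorners where
  open import Data.Integer using (_+_; _*_; _-_; -_; _≤_; _<_)
  open Lattice
  open Frames
  open Cones
  open Configurations
  open Reflexive

  record Corner (n : ℤ) (S : List Pt) : Set where
    field
      quad : Quadrant S
      o∈   : (+ 0 , + 0) ∈ S
      i₁   : Int S (+ 1 , + 1)
      top  : ∀ q → Int S q → proj₁ q + proj₂ q ≤ n + + 2

    n≥0 : + 0 ≤ n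
    n≥0 = lin 1 (λ n → κ 2 :≤ n :+ κ 2 ⇒ ⊢ κ 0 :≤ n) n (top _ i₁)

  corner-swap : ∀ {n S} → Corner n S → Corner n (map (act swapᵤ) S)
  corner-swap {n} {S} C = record
    { quad = all-map swapᵤ λ s s∈ → subst (λ t → + 0 ≤ proj₁ t × + 0 ≤ proj₂ t) (sym (act-swap s)) (proj₂ (quad s s∈) , proj₁ (quad s s∈))
    ; o∈ = ∈-map⁺ (act swapᵤ) o∈
    ; i₁ = int-map⁺ swapᵤ i₁
    ; top = allInt-map swapᵤ λ s i → subst (λ t → proj₁ t + proj₂ t ≤ n + + 2) (sym (act-swap s)) (subst (_≤ n + + 2) (ℤₚ.+-comm (proj₁ s) (proj₂ s)) (top s i))
    }
    where open Corner C

  InSpan : (v₁ v₂ a b c d : ℤ) → Pt → Set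
  InSpan v₁ v₂ a b c d (x , y) = Σ ℤ λ α → Σ ℤ λ β → + 0 ≤ α × + 0 ≤ β × x ≡ v₁ - α * a - β * c × y ≡ v₂ - α * b - β * d

  -- A corner at the origin and an opposite one at v, whose cone is spanned by −(a , b) and −(c , d).
  record Opposite (n : ℤ) (S : List Pt) (v₁ v₂ a b c d : ℤ) : Set where
    field
      corner : Corner n S
      v∈     : (v₁ , v₂) ∈ S
      far    : n + + 4 ≤ v₁ + v₂
      p-int  : Int S (v₁ - a - c , v₂ - b - d)
      p-sum  : v₁ + v₂ - (a + b) - (c + d) ≡ n + + 2
      F₁     : + 1 ≤ a + b
      F₂     : + 1 ≤ c + d
      unit   : (a * d - b * c ≡ + 1) ⊎ (a * d - b * c ≡ - + 1)
      span   : ∀ s → s ∈ S → InSpan v₁ v₂ a b c d s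
    open Corner corner public

  opposite-exchange : ∀ {n S v₁ v₂ a b c d} → Opposite n S v₁ v₂ a b c d → Opposite n S v₁ v₂ c d a b
  opposite-exchange {n} {S} {v₁} {v₂} {a} {b} {c} {d} O = record
    { corner = corner ; v∈ = v∈ ; far = far
    ; p-int = intPt≡ (exch v₁ a c) (exch v₂ b d) p-int
    ; p-sum = trans (exch (v₁ + v₂) (c + d) (a + b)) p-sum
    ; F₁ = F₂ ; F₂ = F₁
    ; unit = [ (λ e → inj₂ (trans (anti a b c d) (cong -_ e))) , (λ e → inj₁ (trans (anti a b c d) (cong -_ e))) ]′ unit
    ; span = λ s s∈ → let (α , β , p , q , e , f) = span s s∈ in β , α , q , p , trans e (exch v₁ (α * a) (β * c)) , trans f (exch v₂ (α * b) (β * d))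
    }
    where
      open Opposite O
      exch : ∀ v a c → v - a - c ≡ v - c - a
      exch = lin 3 λ v a c → ⊢ v :- a :- c :≡ v :- c :- a
      anti : ∀ a b c d → c * b - d * a ≡ - (a * d - b * c)
      anti = lin 4 λ a b c d → ⊢ c :* b :- d :* a :≡ :- (a :* d :- b :* c)

  opposite-swap : ∀ {n S v₁ v₂ a b c d} → Opposite n S v₁ v₂ a b c d → Opposite n (map (act swapᵤ) S) v₂ v₁ b a d c
  opposite-swap {n} {S} {v₁} {v₂} {a} {b} {c} {d} O = record
    { corner = corner-swap corner
    ; v∈ = subst (_∈ map (act swapᵤ) S) (act-swap (v₁ , v₂)) (∈-map⁺ (act swapᵤ) v∈)
    ; far = subst (n + + 4 ≤_) (ℤₚ.+-comm v₁ v₂) far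
    ; p-int = subst (Int (map (act swapᵤ) S)) (act-swap _) (int-map⁺ swapᵤ p-int)
    ; p-sum = trans (lin 6 (λ v₁ v₂ a b c d → ⊢ v₂ :+ v₁ :- (b :+ a) :- (d :+ c) :≡ v₁ :+ v₂ :- (a :+ b) :- (c :+ d)) v₁ v₂ a b c d) p-sum
    ; F₁ = subst (+ 1 ≤_) (ℤₚ.+-comm a b) F₁ ; F₂ = subst (+ 1 ≤_) (ℤₚ.+-comm c d) F₂
    ; unit = [ (λ e → inj₂ (trans (anti a b c d) (cong -_ e))) , (λ e → inj₁ (trans (anti a b c d) (cong -_ e))) ]′ unit
    ; span = all-map swapᵤ λ s s∈ → let (α , β , p , q , e , f) = span s s∈ in
        subst (InSpan v₂ v₁ b a d c) (sym (act-swap s)) (α , β , p , q , f , e)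
    }
    where
      open Opposite O
      anti : ∀ a b c d → b * c - a * d ≡ - (a * d - b * c)
      anti = lin 4 λ a b c d → ⊢ b :* c :- a :* d :≡ :- (a :* d :- b :* c)

  opposite-≡ : ∀ {n S v₁ v₂ a b c d a′ b′ c′ d′} → a ≡ a′ → b ≡ b′ → c ≡ c′ → d ≡ d′ →
               Opposite n S v₁ v₂ a b c d → Opposite n S v₁ v₂ a′ b′ c′ d′
  opposite-≡ refl refl refl refl O = O

  -- The generators (c + 1 , −c) and (c , 1 − c) have coordinate sum one.
  module SumOne {n : ℤ} {S : List Pt} {v₁ v₂ : ℤ} (c : ℤ) (O : Opposite n S v₁ v₂ (c + + 1) (- c) c (+ 1 - c)) where
    open Opposite O

    N≡ : v₁ + v₂ ≡ n + + 4
    N≡ = lin 4 (λ v₁ v₂ n c → v₁ :+ v₂ :- (c :+ κ 1 :+ :- c) :- (c :+ (κ 1 :- c)) :≡ n :+ κ 2 ⇒ ⊢ v₁ :+ v₂ :≡ n :+ κ 4) v₁ v₂ n c p-sum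

    v₂≥0 : + 0 ≤ v₂
    v₂≥0 = proj₂ (quad _ v∈)

    -- The origin lies in the cone at `v`. Adding its two coordinate equations gives
    -- `α + β = v₁ + v₂`, and the first one then reads `v₁ = (v₁ + v₂) c + α`.
    lower : (v₁ + v₂) * c ≤ v₁
    lower = let (α , β , α≥0 , β≥0 , x≡ , y≡) = span _ o∈ in
      lin 5 (λ v₁ v₂ c α β → κ 0 :≤ α ⇒ κ 0 :≡ v₁ :- α :* (c :+ κ 1) :- β :* c ⇒ κ 0 :≡ v₂ :- α :* (:- c) :- β :* (κ 1 :- c) ⇒
        2 ⊙ c ∷ 3 ⊙ c ∷ [] ⊩ (v₁ :+ v₂) :* c :≤ v₁) v₁ v₂ c α β α≥0 x≡ y≡

    positive⇒one : + 0 < c → c ≡ + 1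
    positive⇒one c>0 = lin 4 (λ v₁ v₂ c n → κ 0 :< c ⇒ (v₁ :+ v₂) :* c :≤ v₁ ⇒ κ 0 :≤ v₂ ⇒ v₁ :+ v₂ :≡ n :+ κ 4 ⇒ κ 0 :≤ n ⇒ 4 ⊙ c ∷ 0 ⊛ 5 ∷ 1 ⊛ 5 ∷ [] ⊩ c :≡ κ 1)
      v₁ v₂ c n c>0 lower v₂≥0 N≡ n≥0

  triangle : ∀ {n S v₁ v₂} → Opposite n S v₁ v₂ (+ 2) (- + 1) (+ 1) (+ 0) → Exceptional S
  triangle {n} {S} {v₁} {v₂} O = triCase {n} i₁ v₁ N₁≡ n≥0 tri o∈ (pt≡ refl v₂≡0 v∈)
      (intPt≡ (lin 1 (λ v → ⊢ v :- κ 2 :- κ 1 :≡ v :- κ 3) v₁) (cong (λ z → z - - + 1 - + 0) v₂≡0) p-int)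
    where
      open SumOne (+ 1) O using (lower; N≡)
      open Opposite O
      v₂≡0 : v₂ ≡ + 0
      v₂≡0 = lin 2 (λ v₁ v₂ → (v₁ :+ v₂) :* κ 1 :≤ v₁ ⇒ κ 0 :≤ v₂ ⇒ ⊢ v₂ :≡ κ 0) v₁ v₂ lower (proj₂ (quad _ v∈))
      N₁≡ : v₁ ≡ n + + 4
      N₁≡ = lin 3 (λ v₁ v₂ n → v₁ :+ v₂ :≡ n :+ κ 4 ⇒ v₂ :≡ κ 0 ⇒ ⊢ v₁ :≡ n :+ κ 4) v₁ v₂ n N≡ v₂≡0
      tri : ∀ s → s ∈ S → + 0 ≤ proj₁ s × + 0 ≤ proj₂ s × proj₁ s + + 2 * proj₂ s ≤ v₁
      tri (x , y) s∈ = let (α , β , α≥0 , β≥0 , e , f) = span _ s∈ in proj₁ (quad _ s∈) , proj₂ (quad _ s∈) ,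
        lin 6 (λ x y v₁ v₂ α β → v₂ :≡ κ 0 ⇒ κ 0 :≤ β ⇒ x :≡ v₁ :- α :* κ 2 :- β :* κ 1 ⇒ y :≡ v₂ :- α :* (:- κ 1) :- β :* κ 0 ⇒ ⊢ x :+ κ 2 :* y :≤ v₁)
          x y v₁ v₂ α β v₂≡0 β≥0 e f

  private
    at-one : ∀ {n S v₁ v₂ c} → c ≡ + 1 → Opposite n S v₁ v₂ (c + + 1) (- c) c (+ 1 - c) → Opposite n S v₁ v₂ (+ 2) (- + 1) (+ 1) (+ 0)
    at-one refl O = O

    at-zero : ∀ {n S v₁ v₂ c} → c ≡ + 0 → Opposite n S v₁ v₂ (c + + 1) (- c) c (+ 1 - c) → Opposite n S v₁ v₂ (+ 1) (+ 0) (+ 0) (+ 1)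
    at-zero refl O = O

  parallelogram : ∀ {n S v₁ v₂} → Opposite n S v₁ v₂ (+ 1) (+ 0) (+ 0) (+ 1) → Outcome n S
  parallelogram {n} {S} {v₁} {v₂} O = rectCase {n} i₁ v₁ v₂ box o∈ v∈
      (lin 3 (λ v₁ v₂ n → v₁ :+ v₂ :- κ 1 :- κ 1 :≡ n :+ κ 2 ⇒ ⊢ v₁ :+ v₂ :≡ n :+ κ 4) v₁ v₂ n p-sum)
    where
      open Opposite O
      box : ∀ s → s ∈ S → + 0 ≤ proj₁ s × proj₁ s ≤ v₁ × + 0 ≤ proj₂ s × proj₂ s ≤ v₂
      box (x , y) s∈ = let (α , β , α≥0 , β≥0 , e , f) = span _ s∈ in proj₁ (quad _ s∈) ,
        lin 4 (λ x v α β → κ 0 :≤ α ⇒ x :≡ v :- α :* κ 1 :- β :* κ 0 ⇒ ⊢ x :≤ v) x v₁ α β α≥0 e , proj₂ (quad _ s∈) ,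
        lin 4 (λ y v α β → κ 0 :≤ β ⇒ y :≡ v :- α :* κ 0 :- β :* κ 1 ⇒ ⊢ y :≤ v) y v₂ α β β≥0 f

  -- Exchanging the coordinates and then the generators turns `c` into `-c`, so only the values 0, a
  -- box, and 1, a triangle, remain.
  case-sumOne : ∀ {n S v₁ v₂} c → Opposite n S v₁ v₂ (c + + 1) (- c) c (+ 1 - c) → Outcome n S
  case-sumOne {n} {S} {v₁} {v₂} c O = cases (ℤₚ.<-cmp c (+ 0))
    where
      O′ : Opposite n (map (act swapᵤ) S) v₂ v₁ (- c + + 1) (- - c) (- c) (+ 1 - - c)
      O′ = opposite-≡ (lin 1 (λ c → ⊢ κ 1 :- c :≡ :- c :+ κ 1) c) (lin 1 (λ c → ⊢ c :≡ :- (:- c)) c) refl (lin 1 (λ c → ⊢ c :+ κ 1 :≡ κ 1 :- (:- c)) c)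
        (opposite-exchange (opposite-swap O))
      cases : Tri (c < + 0) (c ≡ + 0) (+ 0 < c) → Outcome n S
      cases (tri≈ _ c≡0 _) = parallelogram (at-zero c≡0 O)
      cases (tri> _ _ c>0) = inj₁ (triangle (at-one (SumOne.positive⇒one c O c>0) O))
      cases (tri< c<0 _ _) = inj₁ (exceptional-map swapᵤ (triangle (at-one (SumOne.positive⇒one (- c) O′ (ℤₚ.neg-mono-< c<0)) O′)))

  -- With both coordinate sums equal to one the determinant is `a - c`. So up to order the
  -- generators differ by `(1 , -1)`, which leaves the one-parameter family of `SumOne`.
  case-slopes : ∀ {n S v₁ v₂ a b c d} → Opposite n S v₁ v₂ a b c d → a + b ≡ + 1 → c + d ≡ + 1 → Outcome n S
  case-slopes {a = a} {b} {c} {d} O ab cd with Opposite.unit O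
  ... | inj₁ e = case-sumOne c (opposite-≡ a≡ (lin 3 (λ a b c → a :+ b :≡ κ 1 ⇒ a :≡ c :+ κ 1 ⇒ ⊢ b :≡ :- c) a b c ab a≡) refl (lin 2 (λ c d → c :+ d :≡ κ 1 ⇒ ⊢ d :≡ κ 1 :- c) c d cd) O)
    where
      a≡ : a ≡ c + + 1
      a≡ = lin 4 (λ a b c d → a :+ b :≡ κ 1 ⇒ c :+ d :≡ κ 1 ⇒ a :* d :- b :* c :≡ κ 1 ⇒ 1 ⊙ c ∷ 2 ⊙ a ∷ [] ⊩ a :≡ c :+ κ 1) a b c d ab cd e
  ... | inj₂ e = case-sumOne a (opposite-≡ c≡ (lin 3 (λ a b c → a :+ b :≡ κ 1 ⇒ a :≡ c :+ κ 1 ⇒ ⊢ b :≡ :- c) c d a cd c≡) refl (lin 2 (λ c d → c :+ d :≡ κ 1 ⇒ ⊢ d :≡ κ 1 :- c) a b ab) (opposite-exchange O))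
    where
      c≡ : c ≡ a + + 1
      c≡ = lin 4 (λ a b c d → a :+ b :≡ κ 1 ⇒ c :+ d :≡ κ 1 ⇒ a :* d :- b :* c :≡ :- κ 1 ⇒ 1 ⊙ c ∷ 2 ⊙ a ∷ [] ⊩ c :≡ a :+ κ 1) a b c d ab cd e

  -- The inner polygon reaches from (1 , 1) to (n + 1 , 1).
  module Level {n : ℤ} {S : List Pt} {v₁ v₂ a b : ℤ} (O : Opposite n S v₁ v₂ a b (+ 1) (+ 0)) (n≥1 : + 1 ≤ n)
               (v₁≡ : v₁ ≡ n + + 2 + a) (v₂≡ : v₂ ≡ + 1 + b) where
    open Opposite O

    iₙ : Int S (n + + 1 , + 1)
    iₙ = intPt≡ (lin 3 (λ v n a → v :≡ n :+ κ 2 :+ a ⇒ ⊢ v :- a :- κ 1 :≡ n :+ κ 1) v₁ n a v₁≡)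
                (lin 2 (λ v b → v :≡ κ 1 :+ b ⇒ ⊢ v :- b :- κ 0 :≡ κ 1) v₂ b v₂≡) p-int

    -- The bottom edge has length `v₁ = n + 2 + a` and the inner row above it has length `n`, so
    -- `a ≥ 2` makes the difference at least 4.
    down : b ≡ - + 1 → + 2 ≤ a → Exceptional S
    down refl a≥2 = exceptionalHere (edge5 (+ 0) v₁ (+ 1) (n + + 1) record
      { left = o∈ ; right = pt≡ refl v₂≡ v∈ ; above = λ s s∈ → proj₂ (quad s s∈)
      ; edge = λ (x , y) s∈ e → proj₁ (quad _ s∈) , lin 4 (λ x y v a → x :+ a :* y :≤ v ⇒ y :≡ κ 0 ⇒ 2 ⊙ a ∷ [] ⊩ x :≤ v) x y v₁ a (slope _ s∈) e
      ; ileft = i₁ ; iright = iₙ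
      ; iedge = λ (x , y) i e → proj₁ (int-≥1 quad i) ,
          lin 5 (λ x y v a n → x :+ a :* y :< v ⇒ y :≡ κ 1 ⇒ v :≡ n :+ κ 2 :+ a ⇒ 2 ⊙ a ∷ [] ⊩ x :≤ n :+ κ 1) x y v₁ a n (int-slope< a v₁ slope i) e v₁≡
      ; i<j = lin 1 (λ n → κ 1 :≤ n ⇒ ⊢ κ 1 :< n :+ κ 1) n n≥1
      ; long = lin 3 (λ n v a → v :≡ n :+ κ 2 :+ a ⇒ κ 2 :≤ a ⇒ ⊢ n :+ κ 1 :- κ 1 :+ κ 4 :≤ v :- κ 0) n v₁ a v₁≡ a≥2 })
      where
        slope : ∀ s → s ∈ S → proj₁ s + a * proj₂ s ≤ v₁
        slope (x , y) s∈ = let (α , β , α≥0 , β≥0 , e , f) = span _ s∈ in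
          lin 7 (λ x y v w a α β → κ 0 :≤ β ⇒ x :≡ v :- α :* a :- β :* κ 1 ⇒ y :≡ w :- α :* (:- κ 1) :- β :* κ 0 ⇒ w :≡ κ 0 ⇒ 3 ⊙ a ∷ 4 ⊙ a ∷ [] ⊩ x :+ a :* y :≤ v)
            x y v₁ v₂ a α β β≥0 e f v₂≡

    -- The polygon has height 2, and `r` is the left end of its top row. If `r ≥ a - 1`, the frame
    -- `(2 - y , x + (1 - a) y + a - 1)` is nonnegative and gives a fit. If `r ≤ a - 2`, the top
    -- edge has length at least `n + 4` over an inner row of length `n`, and turning the picture
    -- upside down exhibits a long edge.
    up : b ≡ + 1 → + 1 ≤ a → Outcome n S
    up refl a≥1 with argminOn (λ s → proj₂ s ℤₚ.≟ + 2) proj₁ S v∈ v₂≡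
    ... | (r , _) , r∈ , refl , min = cases
      where
        y≤2 : ∀ s → s ∈ S → proj₂ s ≤ + 2
        y≤2 (x , y) s∈ = let (α , β , α≥0 , β≥0 , e , f) = span _ s∈ in
          lin 4 (λ y w α β → κ 0 :≤ α ⇒ y :≡ w :- α :* κ 1 :- β :* κ 0 ⇒ w :≡ κ 2 ⇒ ⊢ y :≤ κ 2) y v₂ α β α≥0 f v₂≡
        slope : ∀ s → s ∈ S → proj₁ s + - a * proj₂ s ≤ v₁ - + 2 * a
        slope (x , y) s∈ = let (α , β , α≥0 , β≥0 , e , f) = span _ s∈ in
          lin 7 (λ x y v w a α β → κ 0 :≤ β ⇒ x :≡ v :- α :* a :- β :* κ 1 ⇒ y :≡ w :- α :* κ 1 :- β :* κ 0 ⇒ w :≡ κ 2 ⇒ 3 ⊙ a ∷ 4 ⊙ a ∷ [] ⊩ x :+ :- a :* y :≤ v :- κ 2 :* a)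
            x y v₁ v₂ a α β β≥0 e f v₂≡
        nonneg : a - + 1 ≤ r → ∀ x y → (x , y) ∈ S → + 0 ≤ + 1 * x + (+ 1 - a) * y + (a - + 1)
        nonneg r≥ x y s∈ with split012 y (proj₂ (quad _ s∈)) (y≤2 _ s∈)
        ... | inj₁ refl = lin 2 (λ x a → κ 0 :≤ x ⇒ κ 1 :≤ a ⇒ ⊢ κ 0 :≤ κ 1 :* x :+ (κ 1 :- a) :* κ 0 :+ (a :- κ 1)) x a (proj₁ (quad _ s∈)) a≥1
        ... | inj₂ (inj₁ refl) = lin 2 (λ x a → κ 0 :≤ x ⇒ κ 1 :≤ a ⇒ ⊢ κ 0 :≤ κ 1 :* x :+ (κ 1 :- a) :* κ 1 :+ (a :- κ 1)) x a (proj₁ (quad _ s∈)) a≥1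
        ... | inj₂ (inj₂ refl) = lin 3 (λ x a r → r :≤ x ⇒ a :- κ 1 :≤ r ⇒ ⊢ κ 0 :≤ κ 1 :* x :+ (κ 1 :- a) :* κ 2 :+ (a :- κ 1)) x a r (min _ s∈ refl) r≥
        flip = unimod (+ 1) (+ 0) (+ 0) (- + 1) (+ 0) (+ 2) (inj₂ refl)
        act-flip : ∀ p → act flip p ≡ (proj₁ p , + 2 - proj₂ p)
        act-flip (x , y) = cong₂ _,_ (lin 2 (λ x y → ⊢ κ 1 :* x :+ κ 0 :* y :+ κ 0 :≡ x) x y) (lin 2 (λ x y → ⊢ κ 0 :* x :+ :- κ 1 :* y :+ κ 2 :≡ κ 2 :- y) x y)
        cases : Outcome n S
        cases with ≤⊎> (a - + 1) r
        ... | inj₁ r≥ = inj₂ (inj₁ (unimod (+ 0) (- + 1) (+ 1) (+ 1 - a) (+ 2) (a - + 1) (inj₁ (lin 1 (λ a → ⊢ κ 0 :* (κ 1 :- a) :- :- κ 1 :* κ 1 :≡ κ 1) a)) ,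
                λ (x , y) s∈ →
                  lin 2 (λ x y → y :≤ κ 2 ⇒ ⊢ κ 0 :≤ κ 0 :* x :+ :- κ 1 :* y :+ κ 2) x y (y≤2 _ s∈) ,
                  nonneg r≥ x y s∈ ,
                  lin 5 (λ x y a v n → x :+ :- a :* y :≤ v :- κ 2 :* a ⇒ v :≡ n :+ κ 2 :+ a ⇒ ⊢ κ 0 :* x :+ :- κ 1 :* y :+ κ 2 :+ (κ 1 :* x :+ (κ 1 :- a) :* y :+ (a :- κ 1)) :≤ n :+ κ 3)
                    x y a v₁ n (slope _ s∈) v₁≡))
        ... | inj₂ r< = inj₁ (flip , edge5 r v₁ (+ 1) (n + + 1) record
                { left = subst (_∈ map (act flip) S) (act-flip (r , + 2)) (∈-map⁺ (act flip) r∈)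
                ; right = subst (_∈ map (act flip) S) (trans (act-flip (v₁ , v₂)) (cong (λ z → v₁ , + 2 - z) v₂≡)) (∈-map⁺ (act flip) v∈)
                ; above = all-map flip λ s s∈ → subst (λ t → + 0 ≤ proj₂ t) (sym (act-flip s)) (ℤₚ.i≤j⇒0≤j-i (y≤2 s s∈))
                ; edge = all-map flip {P = λ t → proj₂ t ≡ + 0 → r ≤ proj₁ t × proj₁ t ≤ v₁} λ s@(x , y) s∈ → subst (λ t → proj₂ t ≡ + 0 → r ≤ proj₁ t × proj₁ t ≤ v₁) (sym (act-flip s)) λ e →
                    let y≡2 = lin 1 (λ y → κ 2 :- y :≡ κ 0 ⇒ ⊢ y :≡ κ 2) y e in
                    min _ s∈ y≡2 , lin 4 (λ x y a v → x :+ :- a :* y :≤ v :- κ 2 :* a ⇒ y :≡ κ 2 ⇒ 2 ⊙ a ∷ [] ⊩ x :≤ v) x y a v₁ (slope _ s∈) y≡2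
                ; ileft = int-map⁺ flip i₁
                ; iright = subst (Int (map (act flip) S)) (act-flip (n + + 1 , + 1)) (int-map⁺ flip iₙ)
                ; iedge = allInt-map flip {P = λ t → proj₂ t ≡ + 1 → + 1 ≤ proj₁ t × proj₁ t ≤ n + + 1} λ s@(x , y) i → subst (λ t → proj₂ t ≡ + 1 → + 1 ≤ proj₁ t × proj₁ t ≤ n + + 1) (sym (act-flip s)) λ e →
                    proj₁ (int-≥1 quad i) ,
                    lin 5 (λ x y v a n → x :+ :- a :* y :< v :- κ 2 :* a ⇒ κ 2 :- y :≡ κ 1 ⇒ v :≡ n :+ κ 2 :+ a ⇒ 2 ⊙ a ∷ [] ⊩ x :≤ n :+ κ 1) x y v₁ a n (int-slope< (- a) (v₁ - + 2 * a) slope i) e v₁≡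
                ; i<j = lin 1 (λ n → κ 1 :≤ n ⇒ ⊢ κ 1 :< n :+ κ 1) n n≥1
                ; long = lin 4 (λ n v a r → v :≡ n :+ κ 2 :+ a ⇒ r :< a :- κ 1 ⇒ ⊢ n :+ κ 1 :- κ 1 :+ κ 4 :≤ v :- r) n v₁ a r v₁≡ r< })

-- Facing corners: a long inner row, or a single inner point

module OppositeCases where
  open import Data.Integer using (_+_; _*_; _-_; -_; _≤_; _<_)
  open import Function using (_∘_)
  open Lattice
  open Frames
  open Cones
  open Configurations
  open Reflexive
  open OppositeCorners

  -- The two equations say that `n` steps back along `(c , d)` from the inner point
  -- `v - (a , b) - (c , d)` lead to `(1 , 1)`. As that inner point has coordinates at least 1,
  -- neither `c` nor `d` is negative; so `(c , d)` is a unit vector, and the inner row is horizontal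
  -- up to a swap.
  case-level : ∀ {n S v₁ v₂ a b c d} → Opposite n S v₁ v₂ a b c d → + 1 ≤ n → + 2 ≤ a + b → c + d ≡ + 1 →
               v₁ - a - c - n * c ≡ + 1 → v₂ - b - d - n * d ≡ + 1 → Outcome n S
  case-level {n} {S} {v₁} {v₂} {a} {b} {c} {d} O n≥1 ab cd q₁ q₂ = cases (≤⊎> c (+ 0))
    where
      open Opposite O
      horizontal : ∀ {S v₁ v₂ a b c d} → Opposite n S v₁ v₂ a b c d → c ≡ + 1 → d ≡ + 0 → + 2 ≤ a + b →
                   v₁ - a - c - n * c ≡ + 1 → v₂ - b - d - n * d ≡ + 1 → Outcome n S
      horizontal {S} {v₁} {v₂} {a} {b} O refl refl ab q₁ q₂ = by (Opposite.unit O)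
        where
          open Level O n≥1
            (lin 3 (λ v a n → v :- a :- κ 1 :- n :* κ 1 :≡ κ 1 ⇒ ⊢ v :≡ n :+ κ 2 :+ a) v₁ a n q₁)
            (lin 3 (λ v b n → v :- b :- κ 0 :- n :* κ 0 :≡ κ 1 ⇒ ⊢ v :≡ κ 1 :+ b) v₂ b n q₂)
          by : (a * + 0 - b * + 1 ≡ + 1) ⊎ (a * + 0 - b * + 1 ≡ - + 1) → Outcome n S
          by (inj₁ e) = inj₁ (down b≡ (lin 2 (λ a b → κ 2 :≤ a :+ b ⇒ b :≡ :- κ 1 ⇒ ⊢ κ 2 :≤ a) a b ab b≡))
            where b≡ = lin 2 (λ a b → a :* κ 0 :- b :* κ 1 :≡ κ 1 ⇒ ⊢ b :≡ :- κ 1) a b e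
          by (inj₂ e) = up b≡ (lin 2 (λ a b → κ 2 :≤ a :+ b ⇒ b :≡ κ 1 ⇒ ⊢ κ 1 :≤ a) a b ab b≡)
            where b≡ = lin 2 (λ a b → a :* κ 0 :- b :* κ 1 :≡ :- κ 1 ⇒ ⊢ b :≡ κ 1) a b e
      nonneg : ∀ p n c → p - n * c ≡ + 1 → + 1 ≤ p → + 1 ≤ n → + 0 ≤ c
      nonneg = lin 3 λ p n c → p :- n :* c :≡ κ 1 ⇒ κ 1 :≤ p ⇒ κ 1 :≤ n ⇒ 0 ⊛ 3 ∷ [] ⊩ κ 0 :≤ c
      p≥1 = int-≥1 quad p-int
      c≥0 = nonneg (v₁ - a - c) n c q₁ (proj₁ p≥1) n≥1
      d≥0 = nonneg (v₂ - b - d) n d q₂ (proj₂ p≥1) n≥1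
      cases : c ≤ + 0 ⊎ + 0 < c → Outcome n S
      cases (inj₂ c>0) = horizontal O
        (lin 2 (λ c d → κ 0 :< c ⇒ κ 0 :≤ d ⇒ c :+ d :≡ κ 1 ⇒ ⊢ c :≡ κ 1) c d c>0 d≥0 cd)
        (lin 2 (λ c d → κ 0 :< c ⇒ κ 0 :≤ d ⇒ c :+ d :≡ κ 1 ⇒ ⊢ d :≡ κ 0) c d c>0 d≥0 cd) ab q₁ q₂
      cases (inj₁ c≤0) = viaFrame swapᵤ {n} {S} (horizontal (opposite-swap O)
        (lin 2 (λ c d → c :≤ κ 0 ⇒ κ 0 :≤ c ⇒ c :+ d :≡ κ 1 ⇒ ⊢ d :≡ κ 1) c d c≤0 c≥0 cd)
        (ℤₚ.≤-antisym c≤0 c≥0) (subst (+ 2 ≤_) (ℤₚ.+-comm a b) ab) q₂ q₁)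

  module Zero {S : List Pt} {v₁ v₂ a b c d : ℤ} (O : Opposite (+ 0) S v₁ v₂ a b c d) (D : a * d - b * c ≡ + 1) where
    open Opposite O

    p-sum≥ = int-≥1 quad p-int

    v₁≡ : v₁ ≡ + 1 + a + c
    v₁≡ = lin 6 (λ v₁ v₂ a b c d → κ 1 :≤ v₁ :- a :- c ⇒ κ 1 :≤ v₂ :- b :- d ⇒ v₁ :+ v₂ :- (a :+ b) :- (c :+ d) :≡ κ 2 ⇒ ⊢ v₁ :≡ κ 1 :+ a :+ c) v₁ v₂ a b c d
      (proj₁ p-sum≥) (proj₂ p-sum≥) p-sum
    v₂≡ : v₂ ≡ + 1 + b + d
    v₂≡ = lin 6 (λ v₁ v₂ a b c d → κ 1 :≤ v₁ :- a :- c ⇒ κ 1 :≤ v₂ :- b :- d ⇒ v₁ :+ v₂ :- (a :+ b) :- (c :+ d) :≡ κ 2 ⇒ ⊢ v₂ :≡ κ 1 :+ b :+ d) v₁ v₂ a b c d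
      (proj₁ p-sum≥) (proj₂ p-sum≥) p-sum

    -- `d - c` and `a - b` are the coordinates of `(1 , 1)` in the basis `(a , b)`, `(c , d)`. As
    -- `v` is `(1 , 1)` plus both generators, the cone coordinates of the origin are larger by one,
    -- and they are nonnegative.
    g₁≥ : - + 1 ≤ d - c
    g₁≥ = let (α , β , α≥0 , β≥0 , e , f) = span _ o∈ in
      lin 8 (λ v₁ v₂ a b c d α β → κ 0 :≤ α ⇒ κ 0 :≡ v₁ :- α :* a :- β :* c ⇒ κ 0 :≡ v₂ :- α :* b :- β :* d ⇒ a :* d :- b :* c :≡ κ 1 ⇒
        v₁ :≡ κ 1 :+ a :+ c ⇒ v₂ :≡ κ 1 :+ b :+ d ⇒ 2 ⊙ d ∷ 3 ⊙ c ∷ 4 ⊙ α ∷ 5 ⊙ d ∷ 6 ⊙ c ∷ [] ⊩ :- κ 1 :≤ d :- c) v₁ v₂ a b c d α β α≥0 e f D v₁≡ v₂≡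

    -- The coordinate sum of `(1 , 1)`, expanded in the basis `(a , b)`, `(c , d)`.
    two : (d - c) * (a + b) + (a - b) * (c + d) ≡ + 2
    two = lin 4 (λ a b c d → a :* d :- b :* c :≡ κ 1 ⇒ ⊢ (d :- c) :* (a :+ b) :+ (a :- b) :* (c :+ d) :≡ κ 2) a b c d D

    only-one : ∀ q → Int S q → q ≡ (+ 1 , + 1)
    only-one (x , y) i = let (x≥1 , y≥1) = int-≥1 quad i ; h = top _ i in
      cong₂ _,_ (lin 2 (λ x y → κ 1 :≤ x ⇒ κ 1 :≤ y ⇒ x :+ y :≤ κ 2 ⇒ ⊢ x :≡ κ 1) x y x≥1 y≥1 h)
                (lin 2 (λ x y → κ 1 :≤ x ⇒ κ 1 :≤ y ⇒ x :+ y :≤ κ 2 ⇒ ⊢ y :≡ κ 1) x y x≥1 y≥1 h)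

    -- Here `(1 , 1)` is a positive multiple of `(c , d)`, hence equal to it, and `a = b + 1`. It
    -- remains to bound `b`; the cone coordinates at `v` then give the fit.
    flat : d - c ≡ + 0 → Fit (_∈ S) (+ 3)
    flat g₁≡0 = φ , fits
      where
        -- These are the cone coordinates `(α , β)` at `v` in terms of `x` and `y`; their sum is
        -- `(b - 1) x - b y + 3`.
        φ = unimod (- + 1) (+ 1) b (- (b + + 1)) (+ 1) (+ 2) (inj₁ (lin 1 (λ b → ⊢ :- κ 1 :* (:- (b :+ κ 1)) :- κ 1 :* b :≡ κ 1) b))
        d≥1 : + 1 ≤ d
        d≥1 = halve d (lin 2 (λ c d → d :- c :≡ κ 0 ⇒ κ 1 :≤ c :+ d ⇒ ⊢ κ 0 :< κ 2 :* d) c d g₁≡0 F₂)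
          where
            halve : ∀ d → + 0 < + 2 * d → + 1 ≤ d
            halve d h = lin 1 (λ d → κ 0 :< κ 2 :* d ⇒ ⊢ κ 1 :≤ d) d h
        dab : d * (a - b) ≡ + 1
        dab = lin 4 (λ a b c d → a :* d :- b :* c :≡ κ 1 ⇒ d :- c :≡ κ 0 ⇒ 2 ⊙ b ∷ [] ⊩ d :* (a :- b) :≡ κ 1) a b c d D g₁≡0
        ab≥1 : + 1 ≤ a - b
        ab≥1 = lin 3 (λ a b d → κ 1 :≤ d ⇒ d :* (a :- b) :≡ κ 1 ⇒ 0 ⊛ 1 ∷ [] ⊩ κ 1 :≤ a :- b) a b d d≥1 dab
        d≡1 : d ≡ + 1
        d≡1 = lin 3 (λ a b d → κ 1 :≤ d ⇒ d :* (a :- b) :≡ κ 1 ⇒ κ 1 :≤ a :- b ⇒ 1 ⊛ 3 ∷ 0 ⊛ 3 ∷ [] ⊩ d :≡ κ 1) a b d d≥1 dab ab≥1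
        a≡ : a ≡ b + + 1
        a≡ = lin 3 (λ a b d → d :≡ κ 1 ⇒ d :* (a :- b) :≡ κ 1 ⇒ 1 ⊙ (a :- b) ∷ [] ⊩ a :≡ b :+ κ 1) a b d d≡1 dab
        c≡1 : c ≡ + 1
        c≡1 = lin 2 (λ c d → d :- c :≡ κ 0 ⇒ d :≡ κ 1 ⇒ ⊢ c :≡ κ 1) c d g₁≡0 d≡1
        b≥0 : + 0 ≤ b
        b≥0 = lin 2 (λ a b → a :≡ b :+ κ 1 ⇒ κ 1 :≤ a :+ b ⇒ ⊢ κ 0 :≤ b) a b a≡ F₁
        coords : ∀ x y → (x , y) ∈ S → Σ ℤ λ α → Σ ℤ λ β → + 0 ≤ α × + 0 ≤ β × x ≡ b + + 3 - α * (b + + 1) - β × y ≡ b + + 2 - α * b - β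
        coords x y s∈ = let (α , β , α≥0 , β≥0 , e , f) = span _ s∈ in α , β , α≥0 , β≥0 ,
          lin 7 (λ x v α a β b c → x :≡ v :- α :* a :- β :* c ⇒ v :≡ κ 1 :+ a :+ c ⇒ a :≡ b :+ κ 1 ⇒ c :≡ κ 1 ⇒ 3 ⊙ α ∷ 4 ⊙ β ∷ [] ⊩ x :≡ b :+ κ 3 :- α :* (b :+ κ 1) :- β) x v₁ α a β b c e v₁≡ a≡ c≡1 ,
          lin 6 (λ y v α β b d → y :≡ v :- α :* b :- β :* d ⇒ v :≡ κ 1 :+ b :+ d ⇒ d :≡ κ 1 ⇒ 3 ⊙ β ∷ [] ⊩ y :≡ b :+ κ 2 :- α :* b :- β) y v₂ α β b d f v₂≡ d≡1
        -- As `(1 , 1)` is interior, some point lies strictly above the diagonal. It has `α ≥ 2`,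
        -- and its condition `x ≥ 0` excludes `b ≥ 2`.
        b≤1 : b ≤ + 1
        b≤1 = let ((x , y) , s∈ , h) = i₁ (- + 1 , + 1) (λ ())
                  (α , β , α≥0 , β≥0 , e , f) = coords x y s∈
                  α≥2 = lin 5 (λ x y α β b → κ 0 :< :- κ 1 :* x :+ κ 1 :* y ⇒ x :≡ b :+ κ 3 :- α :* (b :+ κ 1) :- β ⇒ y :≡ b :+ κ 2 :- α :* b :- β ⇒ ⊢ κ 2 :≤ α) x y α β b h e f
              in lin 4 (λ x α β b → κ 0 :≤ x ⇒ x :≡ b :+ κ 3 :- α :* (b :+ κ 1) :- β ⇒ κ 2 :≤ α ⇒ κ 0 :≤ β ⇒ κ 0 :≤ b ⇒ 3 ⊛ 5 ∷ [] ⊩ b :≤ κ 1) x α β b (proj₁ (quad _ s∈)) e α≥2 β≥0 b≥0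
        fits : ∀ s → s ∈ S → InΔ (+ 3) (act φ s)
        fits (x , y) s∈ = let (α , β , α≥0 , β≥0 , e , f) = coords x y s∈ ; (x≥0 , y≥0) = quad _ s∈ in
          lin 5 (λ x y α β b → κ 0 :≤ α ⇒ x :≡ b :+ κ 3 :- α :* (b :+ κ 1) :- β ⇒ y :≡ b :+ κ 2 :- α :* b :- β ⇒ ⊢ κ 0 :≤ :- κ 1 :* x :+ κ 1 :* y :+ κ 1) x y α β b α≥0 e f ,
          lin 5 (λ x y α β b → κ 0 :≤ β ⇒ x :≡ b :+ κ 3 :- α :* (b :+ κ 1) :- β ⇒ y :≡ b :+ κ 2 :- α :* b :- β ⇒ 2 ⊙ b ∷ 3 ⊙ (b :+ κ 1) ∷ [] ⊩ κ 0 :≤ b :* x :+ :- (b :+ κ 1) :* y :+ κ 2) x y α β b β≥0 e f ,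
          total b b≥0 b≤1 x y x≥0 y≥0
          where
            total : ∀ b → + 0 ≤ b → b ≤ + 1 → ∀ x y → + 0 ≤ x → + 0 ≤ y → - + 1 * x + + 1 * y + + 1 + (b * x + - (b + + 1) * y + + 2) ≤ + 3
            total b b≥0 b≤1 x y x≥0 y≥0 = lin 3 (λ b x y → κ 0 :≤ b ⇒ b :≤ κ 1 ⇒ κ 0 :≤ x ⇒ κ 0 :≤ y ⇒ 2 ⊛ 3 ∷ 1 ⊛ 4 ∷ [] ⊩
              :- κ 1 :* x :+ κ 1 :* y :+ κ 1 :+ (b :* x :+ :- (b :+ κ 1) :* y :+ κ 2) :≤ κ 3) b x y b≥0 b≤1 x≥0 y≥0

    -- The segment from v to the origin lies on an edge of the cone at v.
    onEdge : d - c ≤ - + 1 → Exceptional S ⊎ Fit (_∈ S) (+ 3)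
    onEdge g₁≤ = back (reflexiveEdge {U} quadᵤ o∈ᵤ i₁ᵤ onlyᵤ (+ 1 + (a - b)) L≥2 l∈)
      where
        e₁ e₂ v : Pt
        e₁ = (- a , - b)
        e₂ = (- c , - d)
        v  = (v₁ , v₂)
        unit′ : det e₁ e₂ ≡ + 1
        unit′ = trans (lin 4 (λ a b c d → ⊢ :- a :* (:- d) :- :- b :* (:- c) :≡ a :* d :- b :* c) a b c d) D
        ψ = swapᵤ ∘ᵤ basis v e₁ e₂ unit′
        act-ψ : ∀ s → act ψ s ≡ (det e₁ (s ⊖ v) , det (s ⊖ v) e₂)
        act-ψ s = trans (act-∘ swapᵤ (basis v e₁ e₂ unit′) s) (trans (cong (act swapᵤ) (act-basis v e₁ e₂ unit′ s)) (act-swap (det (s ⊖ v) e₂ , det e₁ (s ⊖ v))))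
        U = map (act ψ) S
        back : Exceptional U ⊎ Fit (_∈ U) (+ 3) → Exceptional S ⊎ Fit (_∈ S) (+ 3)
        back (inj₁ e) = inj₁ (exceptional-map ψ {S} e)
        back (inj₂ f) = inj₂ (fit-map ψ {S} f)
        g₁≡ : d - c ≡ - + 1
        g₁≡ = ℤₚ.≤-antisym g₁≤ g₁≥
        -- The second cone coordinate of the origin is `1 + (a - b)`. With `d - c = -1` the identity
        -- `two` makes `(a - b) (c + d)` at least 3, so `a - b` is positive.
        L≥2 : + 2 ≤ + 1 + (a - b)
        L≥2 = lin 4 (λ a b c d → (d :- c) :* (a :+ b) :+ (a :- b) :* (c :+ d) :≡ κ 2 ⇒ d :- c :≡ :- κ 1 ⇒ κ 1 :≤ a :+ b ⇒ κ 1 :≤ c :+ d ⇒ 0 ⊛ 4 ∷ 2 ⊙ (a :+ b) ∷ [] ⊩ κ 2 :≤ κ 1 :+ (a :- b)) a b c d two g₁≡ F₁ F₂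
        quadᵤ : Quadrant U
        quadᵤ = all-map ψ λ s@(x , y) s∈ → subst (λ t → + 0 ≤ proj₁ t × + 0 ≤ proj₂ t) (sym (act-ψ s)) (
          let (α , β , α≥0 , β≥0 , e , f) = span _ s∈ in
          lin 10 (λ v₁ v₂ a b c d α β x y → κ 0 :≤ β ⇒ x :≡ v₁ :- α :* a :- β :* c ⇒ y :≡ v₂ :- α :* b :- β :* d ⇒ a :* d :- b :* c :≡ κ 1 ⇒
            2 ⊙ b ∷ 3 ⊙ a ∷ 4 ⊙ β ∷ [] ⊩ κ 0 :≤ :- a :* (y :- v₂) :- :- b :* (x :- v₁)) v₁ v₂ a b c d α β x y β≥0 e f D ,
          lin 10 (λ v₁ v₂ a b c d α β x y → κ 0 :≤ α ⇒ x :≡ v₁ :- α :* a :- β :* c ⇒ y :≡ v₂ :- α :* b :- β :* d ⇒ a :* d :- b :* c :≡ κ 1 ⇒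
            2 ⊙ d ∷ 3 ⊙ c ∷ 4 ⊙ α ∷ [] ⊩ κ 0 :≤ (x :- v₁) :* (:- d) :- (y :- v₂) :* (:- c)) v₁ v₂ a b c d α β x y α≥0 e f D)
        o∈ᵤ : (+ 0 , + 0) ∈ U
        o∈ᵤ = subst (_∈ U) (trans (act-ψ v) (cong₂ _,_
          (lin 4 (λ v₁ v₂ a b → ⊢ :- a :* (v₂ :- v₂) :- :- b :* (v₁ :- v₁) :≡ κ 0) v₁ v₂ a b)
          (lin 4 (λ v₁ v₂ c d → ⊢ (v₁ :- v₁) :* (:- d) :- (v₂ :- v₂) :* (:- c) :≡ κ 0) v₁ v₂ c d))) (∈-map⁺ (act ψ) v∈)
        l∈ : (+ 1 + (a - b) , + 0) ∈ U
        l∈ = subst (_∈ U) (trans (act-ψ (+ 0 , + 0)) (cong₂ _,_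
          (lin 6 (λ v₁ v₂ a b c d → v₁ :≡ κ 1 :+ a :+ c ⇒ v₂ :≡ κ 1 :+ b :+ d ⇒ a :* d :- b :* c :≡ κ 1 ⇒ 1 ⊙ b ∷ 2 ⊙ a ∷ [] ⊩
            :- a :* (κ 0 :- v₂) :- :- b :* (κ 0 :- v₁) :≡ κ 1 :+ (a :- b)) v₁ v₂ a b c d v₁≡ v₂≡ D)
          (lin 6 (λ v₁ v₂ a b c d → v₁ :≡ κ 1 :+ a :+ c ⇒ v₂ :≡ κ 1 :+ b :+ d ⇒ a :* d :- b :* c :≡ κ 1 ⇒ d :- c :≡ :- κ 1 ⇒ 1 ⊙ d ∷ 2 ⊙ c ∷ [] ⊩
            (κ 0 :- v₁) :* (:- d) :- (κ 0 :- v₂) :* (:- c) :≡ κ 0) v₁ v₂ a b c d v₁≡ v₂≡ D g₁≡))) (∈-map⁺ (act ψ) o∈)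
        one-one : act ψ (+ 1 , + 1) ≡ (+ 1 , + 1)
        one-one = trans (act-ψ (+ 1 , + 1)) (cong₂ _,_
          (lin 6 (λ v₁ v₂ a b c d → v₁ :≡ κ 1 :+ a :+ c ⇒ v₂ :≡ κ 1 :+ b :+ d ⇒ a :* d :- b :* c :≡ κ 1 ⇒ 1 ⊙ b ∷ 2 ⊙ a ∷ [] ⊩
            :- a :* (κ 1 :- v₂) :- :- b :* (κ 1 :- v₁) :≡ κ 1) v₁ v₂ a b c d v₁≡ v₂≡ D)
          (lin 6 (λ v₁ v₂ a b c d → v₁ :≡ κ 1 :+ a :+ c ⇒ v₂ :≡ κ 1 :+ b :+ d ⇒ a :* d :- b :* c :≡ κ 1 ⇒ 1 ⊙ d ∷ 2 ⊙ c ∷ [] ⊩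
            (κ 1 :- v₁) :* (:- d) :- (κ 1 :- v₂) :* (:- c) :≡ κ 1) v₁ v₂ a b c d v₁≡ v₂≡ D))
        i₁ᵤ : Int U (+ 1 , + 1)
        i₁ᵤ = subst (Int U) one-one (int-map⁺ ψ i₁)
        onlyᵤ : ∀ q → Int U q → proj₁ q + proj₂ q ≤ + 2
        onlyᵤ = allInt-map ψ λ s i → subst (λ t → proj₁ t + proj₂ t ≤ + 2) (sym (trans (cong (act ψ) (only-one s i)) one-one)) ℤₚ.≤-refl

  reflexive : ∀ {S} → Exceptional S ⊎ Fit (_∈ S) (+ 3) → Outcome (+ 0) S
  reflexive (inj₁ e) = inj₁ e
  reflexive (inj₂ f) = inj₂ (inj₁ f)

  -- The signs of the coordinates `d - c` and `a - b` of `(1 , 1)` decide. A negative one puts the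
  -- origin on an edge of the cone at `v`, a zero one gives a fit, and if both are positive the
  -- identity `two` forces both coordinate sums to be 1.
  case-zero : ∀ {S v₁ v₂ a b c d} → Opposite (+ 0) S v₁ v₂ a b c d → Outcome (+ 0) S
  case-zero {S} {v₁} {v₂} {a} {b} {c} {d} O = [ oriented O , oriented (opposite-exchange O) ∘ anti ]′ (Opposite.unit O)
    where
      anti : a * d - b * c ≡ - + 1 → c * b - d * a ≡ + 1
      anti = lin 4 (λ a b c d → a :* d :- b :* c :≡ :- κ 1 ⇒ ⊢ c :* b :- d :* a :≡ κ 1) a b c d
      oriented : ∀ {a b c d} → Opposite (+ 0) S v₁ v₂ a b c d → a * d - b * c ≡ + 1 → Outcome (+ 0) S
      oriented {a} {b} {c} {d} O D = cases (ℤₚ.<-cmp (d - c) (+ 0)) (ℤₚ.<-cmp (a - b) (+ 0))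
        where
          open Opposite O
          O′ = opposite-exchange (opposite-swap O)
          D′ : d * a - c * b ≡ + 1
          D′ = trans (lin 4 (λ a b c d → ⊢ d :* a :- c :* b :≡ a :* d :- b :* c) a b c d) D
          small : ∀ {z} → z < + 0 → z ≤ - + 1
          small {z} = lin 1 (λ z → z :< κ 0 ⇒ ⊢ z :≤ :- κ 1) z
          cases : Tri (d - c < + 0) (d - c ≡ + 0) (+ 0 < d - c) → Tri (a - b < + 0) (a - b ≡ + 0) (+ 0 < a - b) → Outcome (+ 0) S
          cases (tri< h _ _) _ = reflexive (Zero.onEdge O D (small h))
          cases (tri≈ _ h _) _ = inj₂ (inj₁ (Zero.flat O D h))
          cases _ (tri< h _ _) = viaFrame swapᵤ {+ 0} {S} (reflexive (Zero.onEdge O′ D′ (small h)))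
          cases _ (tri≈ _ h _) = viaFrame swapᵤ {+ 0} {S} (inj₂ (inj₁ (Zero.flat O′ D′ h)))
          cases (tri> _ _ g) (tri> _ _ h) = case-slopes O
            (lin 4 (λ g h F G → κ 0 :< g ⇒ κ 0 :< h ⇒ κ 1 :≤ F ⇒ κ 1 :≤ G ⇒ g :* F :+ h :* G :≡ κ 2 ⇒ 1 ⊛ 3 ∷ 2 ⊛ 4 ∷ [] ⊩ F :≡ κ 1) (d - c) (a - b) (a + b) (c + d) g h F₁ F₂ (Zero.two O D))
            (lin 4 (λ g h F G → κ 0 :< g ⇒ κ 0 :< h ⇒ κ 1 :≤ F ⇒ κ 1 :≤ G ⇒ g :* F :+ h :* G :≡ κ 2 ⇒ 1 ⊛ 3 ∷ 2 ⊛ 4 ∷ [] ⊩ G :≡ κ 1) (d - c) (a - b) (a + b) (c + d) g h F₁ F₂ (Zero.two O D))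

-- From a fit of the inner polygon to a fit of the polygon

module InnerFits where
  open import Data.Integer using (_+_; _*_; _-_; -_; _≤_; _<_)
  open import Data.Nat using (zero; suc)
  open Lattice
  open Frames
  open Cones
  open Configurations
  open Reflexive
  open OppositeCorners
  open OppositeCases

  sum : Pt → ℤ
  sum (x , y) = x + y

  fitInt-shifted : ∀ {n S} → Quadrant S → (∀ q → Int S q → sum q ≤ n + + 1) → Fit (Int S) (n - + 1)
  fitInt-shifted {n} {S} quad top = translate (- + 1) (- + 1) , λ p@(x , y) i →
    let (x≥1 , y≥1) = int-≥1 quad i in
    subst (InΔ (n - + 1)) (sym (act-translate (- + 1) (- + 1) p))
      ( lin 1 (λ x → κ 1 :≤ x ⇒ ⊢ κ 0 :≤ x :+ :- κ 1) x x≥1 , lin 1 (λ x → κ 1 :≤ x ⇒ ⊢ κ 0 :≤ x :+ :- κ 1) y y≥1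
      , lin 3 (λ x y n → x :+ y :≤ n :+ κ 1 ⇒ ⊢ x :+ :- κ 1 :+ (y :+ :- κ 1) :≤ n :- κ 1) x y n (top p i))

  -- `(α , β)` are the cone coordinates of an interior point far from `v`. Its coordinate sum
  -- `n + 2 - (α - 1) F - (β - 1) G` is at least 2 although `α + β ≥ n + 2`. So for `n > 0` a
  -- generator of coordinate sum above 1 forces its own cone coordinate to be 1; for `n = 0` no
  -- information on the generators results.
  opposite-outcome : ∀ {n S v₁ v₂ a b c d} → Opposite n S v₁ v₂ a b c d → ∀ α β → + 1 ≤ α → + 1 ≤ β → n + + 2 ≤ α + β →
                     + 1 ≤ v₁ - α * a - β * c → + 1 ≤ v₂ - α * b - β * d → Outcome n S
  opposite-outcome {n} {S} {v₁} {v₂} {a} {b} {c} {d} O α β α≥1 β≥1 big x≥1 y≥1 = cases (≤⊎> (a + b) (+ 1)) (≤⊎> (c + d) (+ 1)) (≤⊎> n (+ 0))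
    where
      open Opposite O
      zero-case : ∀ {m} → m ≡ + 0 → Opposite m S v₁ v₂ a b c d → Outcome m S
      zero-case refl O = case-zero O
      -- (α − 1) (F − 1) + (β − 1) (G − 1) ≤ 0 for the coordinate sums F, G of the generators.
      level : ∀ {a b c d} α β → Opposite n S v₁ v₂ a b c d → + 1 ≤ α → + 1 ≤ β → n + + 2 ≤ α + β →
              + 1 ≤ v₁ - α * a - β * c → + 1 ≤ v₂ - α * b - β * d → + 1 < a + b → + 0 < n → Outcome n S
      level {a} {b} {c} {d} α β O α≥1 β≥1 big x≥1 y≥1 F>1 n>0 = case-level O (ℤₚ.i<j⇒suc[i]≤j n>0) (ℤₚ.i<j⇒suc[i]≤j F>1) G≡1
          (lin 7 (λ x v a c α β n → x :≡ κ 1 ⇒ x :≡ v :- α :* a :- β :* c ⇒ α :≡ κ 1 ⇒ β :≡ n :+ κ 1 ⇒ 3 ⊙ a ∷ 4 ⊙ c ∷ [] ⊩ v :- a :- c :- n :* c :≡ κ 1) _ v₁ a c α β n x≡1 refl α≡1 β≡)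
          (lin 7 (λ x v a c α β n → x :≡ κ 1 ⇒ x :≡ v :- α :* a :- β :* c ⇒ α :≡ κ 1 ⇒ β :≡ n :+ κ 1 ⇒ 3 ⊙ a ∷ 4 ⊙ c ∷ [] ⊩ v :- a :- c :- n :* c :≡ κ 1) _ v₂ b d α β n y≡1 refl α≡1 β≡)
        where
          F = a + b
          G = c + d
          G≥1 = Opposite.F₂ O
          x = v₁ - α * a - β * c
          y = v₂ - α * b - β * d
          sum≡ : x + y ≡ n + + 2 - (α - + 1) * F - (β - + 1) * G
          sum≡ = lin 9 (λ v₁ v₂ a b c d α β n → v₁ :+ v₂ :- (a :+ b) :- (c :+ d) :≡ n :+ κ 2 ⇒
            ⊢ (v₁ :- α :* a :- β :* c) :+ (v₂ :- α :* b :- β :* d) :≡ n :+ κ 2 :- (α :- κ 1) :* (a :+ b) :- (β :- κ 1) :* (c :+ d)) v₁ v₂ a b c d α β n (Opposite.p-sum O)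
          bound′ : (α - + 1) * F + (β - + 1) * G ≤ n
          bound′ = lin 5 (λ x y n A B → κ 1 :≤ x ⇒ κ 1 :≤ y ⇒ x :+ y :≡ n :+ κ 2 :- A :- B ⇒ ⊢ A :+ B :≤ n) x y n ((α - + 1) * F) ((β - + 1) * G) x≥1 y≥1 sum≡
          α≡1 : α ≡ + 1
          α≡1 = lin 5 (λ α β F G n → κ 1 :≤ α ⇒ κ 1 :≤ β ⇒ n :+ κ 2 :≤ α :+ β ⇒ (α :- κ 1) :* F :+ (β :- κ 1) :* G :≤ n ⇒ κ 1 :< F ⇒ κ 1 :≤ G ⇒
            0 ⊛ 5 ∷ 2 ⊛ 6 ∷ 1 ⊛ 5 ∷ [] ⊩ α :≡ κ 1) α β F G n α≥1 β≥1 big bound′ F>1 G≥1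
          G≡1 : G ≡ + 1
          G≡1 = lin 5 (λ α β F G n → α :≡ κ 1 ⇒ n :+ κ 2 :≤ α :+ β ⇒ (α :- κ 1) :* F :+ (β :- κ 1) :* G :≤ n ⇒ κ 0 :< n ⇒ κ 1 :≤ G ⇒ κ 1 :≤ β ⇒
            1 ⊙ F ∷ 0 ⊛ 6 ∷ 5 ⊛ 6 ∷ [] ⊩ G :≡ κ 1) α β F G n α≡1 big bound′ n>0 G≥1 β≥1
          β≡ : β ≡ n + + 1
          β≡ = lin 5 (λ α β F G n → α :≡ κ 1 ⇒ G :≡ κ 1 ⇒ n :+ κ 2 :≤ α :+ β ⇒ (α :- κ 1) :* F :+ (β :- κ 1) :* G :≤ n ⇒
            1 ⊙ F ∷ 2 ⊙ β ∷ [] ⊩ β :≡ n :+ κ 1) α β F G n α≡1 G≡1 big bound′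
          xy≡2 : x + y ≡ + 2
          xy≡2 = lin 7 (λ x y n α β F G → x :+ y :≡ n :+ κ 2 :- (α :- κ 1) :* F :- (β :- κ 1) :* G ⇒ α :≡ κ 1 ⇒ G :≡ κ 1 ⇒ β :≡ n :+ κ 1 ⇒ 2 ⊙ F ∷ 3 ⊙ β ∷ [] ⊩ x :+ y :≡ κ 2)
            x y n α β F G sum≡ α≡1 G≡1 β≡
          x≡1 : x ≡ + 1
          x≡1 = lin 2 (λ x y → κ 1 :≤ x ⇒ κ 1 :≤ y ⇒ x :+ y :≡ κ 2 ⇒ ⊢ x :≡ κ 1) x y x≥1 y≥1 xy≡2
          y≡1 : y ≡ + 1
          y≡1 = lin 2 (λ x y → κ 1 :≤ x ⇒ κ 1 :≤ y ⇒ x :+ y :≡ κ 2 ⇒ ⊢ y :≡ κ 1) x y x≥1 y≥1 xy≡2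
      exch : ∀ v a c → + 1 ≤ v - a - c → + 1 ≤ v - c - a
      exch = lin 3 λ v a c → κ 1 :≤ v :- a :- c ⇒ ⊢ κ 1 :≤ v :- c :- a
      cases : a + b ≤ + 1 ⊎ + 1 < a + b → c + d ≤ + 1 ⊎ + 1 < c + d → n ≤ + 0 ⊎ + 0 < n → Outcome n S
      cases (inj₁ F≤1) (inj₁ G≤1) _ = case-slopes O (ℤₚ.≤-antisym F≤1 F₁) (ℤₚ.≤-antisym G≤1 F₂)
      cases _ _ (inj₁ n≤0) = zero-case (ℤₚ.≤-antisym n≤0 n≥0) O
      cases (inj₂ F>1) _ (inj₂ n>0) = level α β O α≥1 β≥1 big x≥1 y≥1 F>1 n>0
      cases _ (inj₂ G>1) (inj₂ n>0) = level β α (opposite-exchange O) β≥1 α≥1 (subst (n + + 2 ≤_) (ℤₚ.+-comm α β) big)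
        (exch v₁ (α * a) (β * c) x≥1) (exch v₂ (α * b) (β * d) y≥1) G>1 n>0

  -- A maximal `v` of small coordinate sum means a fit, a maximal `p` of small sum a smaller inner
  -- triangle. Otherwise `v` is at least 2 beyond `p` and has a unimodular cone; measured in that
  -- cone, either the inner polygon again lies in a smaller triangle, or it has a point with
  -- `α + β ≥ n + 2`.
  corner-outcome : ∀ {n S} → Corner n S → Outcome n S
  corner-outcome {n} {S} C = start (argmax sum S o∈) (argmax sum (interiorPoints S) (∈-interiorPoints⁺ S i₁))
    where
      open Corner C
      E = interiorPoints S
      fromCone : ∀ {v p} → v ∈ S → (∀ t → t ∈ S → sum t ≤ sum v) → p ∈ E → n + + 3 < sum v → sum p ≡ n + + 2 →
                 UnimodularCone S (- + 1 , - + 1) v p → Outcome n S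
      fromCone {v@(v₁ , v₂)} {p@(p₁ , p₂)} v∈ v-max p∈ far sum-p K = finish (argmax (λ s → sum (coord s)) E p∈)
        where
          open UnimodularCone K
          e₁x = proj₁ e₁
          e₁y = proj₂ e₁
          e₂x = proj₁ e₂
          e₂y = proj₂ e₂
          coord : Pt → Pt
          coord s = (det (s ⊖ v) e₂ , det e₁ (s ⊖ v))
          φ = basis v e₁ e₂ unit
          x-coord : ∀ s → proj₁ s ≡ v₁ - proj₁ (coord s) * (- e₁x) - proj₂ (coord s) * (- e₂x)
          x-coord (x , y) = lin 8 (λ x y v₁ v₂ a b c d → a :* d :- b :* c :≡ κ 1 ⇒ 1 ⊙ (x :- v₁) ∷ [] ⊩
            x :≡ v₁ :- ((x :- v₁) :* d :- (y :- v₂) :* c) :* (:- a) :- (a :* (y :- v₂) :- b :* (x :- v₁)) :* (:- c)) x y v₁ v₂ e₁x e₁y e₂x e₂y unit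
          y-coord : ∀ s → proj₂ s ≡ v₂ - proj₁ (coord s) * (- e₁y) - proj₂ (coord s) * (- e₂y)
          y-coord (x , y) = lin 8 (λ x y v₁ v₂ a b c d → a :* d :- b :* c :≡ κ 1 ⇒ 1 ⊙ (y :- v₂) ∷ [] ⊩
            y :≡ v₂ :- ((x :- v₁) :* d :- (y :- v₂) :* c) :* (:- b) :- (a :* (y :- v₂) :- b :* (x :- v₁)) :* (:- d)) x y v₁ v₂ e₁x e₁y e₂x e₂y unit
          flipX : ∀ a b → + 1 ≤ (- + 1) * a + (- + 1) * b → + 1 ≤ - a + - b
          flipX = lin 2 λ a b → κ 1 :≤ :- κ 1 :* a :+ :- κ 1 :* b ⇒ ⊢ κ 1 :≤ :- a :+ :- b
          O : Opposite n S v₁ v₂ (- e₁x) (- e₁y) (- e₂x) (- e₂y)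
          O = record
            { corner = C ; v∈ = v∈
            ; far = lin 2 (λ n V → n :+ κ 3 :< V ⇒ ⊢ n :+ κ 4 :≤ V) n (v₁ + v₂) far
            ; p-int = intPt≡ (trans sum₁ (minus v₁ e₁x e₂x)) (trans sum₂ (minus v₂ e₁y e₂y)) (∈-interiorPoints⁻ S p∈)
            ; p-sum = lin 9 (λ p₁ p₂ v₁ v₂ a b c d n → p₁ :≡ v₁ :+ a :+ c ⇒ p₂ :≡ v₂ :+ b :+ d ⇒ p₁ :+ p₂ :≡ n :+ κ 2 ⇒
                ⊢ v₁ :+ v₂ :- (:- a :+ :- b) :- (:- c :+ :- d) :≡ n :+ κ 2) p₁ p₂ v₁ v₂ e₁x e₁y e₂x e₂y n sum₁ sum₂ sum-p
            ; F₁ = flipX e₁x e₁y X₁ ; F₂ = flipX e₂x e₂y X₂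
            ; unit = inj₁ (trans (lin 4 (λ a b c d → ⊢ :- a :* (:- d) :- :- b :* (:- c) :≡ a :* d :- b :* c) e₁x e₁y e₂x e₂y) unit)
            ; span = λ s s∈ → proj₁ (coord s) , proj₂ (coord s) , side₁ s s∈ , side₂ s s∈ , x-coord s , y-coord s
            }
            where
              minus : ∀ v a c → v + a + c ≡ v - - a - - c
              minus = lin 3 λ v a c → ⊢ v :+ a :+ c :≡ v :- (:- a) :- (:- c)
          T = map (act φ) S
          quadT : Quadrant T
          quadT = all-map φ λ s s∈ → subst (λ t → + 0 ≤ proj₁ t × + 0 ≤ proj₂ t) (sym (act-basis v e₁ e₂ unit s)) (side₁ s s∈ , side₂ s s∈)
          finish : (Σ Pt λ q → q ∈ E × (∀ t → t ∈ E → sum (coord t) ≤ sum (coord q))) → Outcome n S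
          finish (q , q∈ , q-max) = decide (≤⊎> (sum (coord q)) (n + + 1))
            where
              iq = ∈-interiorPoints⁻ S q∈
              coord≥1 : + 1 ≤ proj₁ (coord q) × + 1 ≤ proj₂ (coord q)
              coord≥1 = subst (λ t → + 1 ≤ proj₁ t × + 1 ≤ proj₂ t) (act-basis v e₁ e₂ unit q) (int-≥1 quadT (int-map⁺ φ iq))
              decide : sum (coord q) ≤ n + + 1 ⊎ n + + 1 < sum (coord q) → Outcome n S
              decide (inj₁ small) = inj₂ (inj₂ (fitInt-map φ {S} (fitInt-shifted {n} {T} quadT (allInt-map φ λ s i →
                subst (λ t → sum t ≤ n + + 1) (sym (act-basis v e₁ e₂ unit s)) (ℤₚ.≤-trans (q-max s (∈-interiorPoints⁺ S i)) small)))))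
              decide (inj₂ big) = opposite-outcome O (proj₁ (coord q)) (proj₂ (coord q)) (proj₁ coord≥1) (proj₂ coord≥1)
                (lin 2 (λ n s → n :+ κ 1 :< s ⇒ ⊢ n :+ κ 2 :≤ s) n (sum (coord q)) big)
                (subst (+ 1 ≤_) (x-coord q) (proj₁ (int-≥1 quad iq))) (subst (+ 1 ≤_) (y-coord q) (proj₂ (int-≥1 quad iq)))
      start : (Σ Pt λ v → v ∈ S × (∀ t → t ∈ S → sum t ≤ sum v)) → (Σ Pt λ p → p ∈ E × (∀ t → t ∈ E → sum t ≤ sum p)) → Outcome n S
      start (v@(v₁ , v₂) , v∈ , v-max) (p@(p₁ , p₂) , p∈ , p-max) = decide (≤⊎> (sum v) (n + + 3)) (≤⊎> (sum p) (n + + 1))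
        where
          ip = ∈-interiorPoints⁻ S p∈
          negsum : ∀ a b c d → c + d ≤ a + b → (- + 1) * a + (- + 1) * b ≤ (- + 1) * c + (- + 1) * d
          negsum = lin 4 λ a b c d → c :+ d :≤ a :+ b ⇒ ⊢ :- κ 1 :* a :+ :- κ 1 :* b :≤ :- κ 1 :* c :+ :- κ 1 :* d
          decide : sum v ≤ n + + 3 ⊎ n + + 3 < sum v → sum p ≤ n + + 1 ⊎ n + + 1 < sum p → Outcome n S
          decide (inj₁ near) _ = inj₂ (inj₁ (fitHere λ s s∈ → proj₁ (quad s s∈) , proj₂ (quad s s∈) , ℤₚ.≤-trans (v-max s s∈) near))
          decide (inj₂ _) (inj₁ small) = inj₂ (inj₂ (fitInt-shifted {n} {S} quad λ q i → ℤₚ.≤-trans (p-max q (∈-interiorPoints⁺ S i)) small))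
          decide (inj₂ far) (inj₂ big) = fromCone v∈ v-max p∈ far sum-p
              (unimodularCone {S} {r = (- + 1 , + 0)} refl v∈ (λ s s∈ → negsum v₁ v₂ (proj₁ s) (proj₂ s) (v-max s s∈)) ip
                (λ q i → negsum p₁ p₂ (proj₁ q) (proj₂ q) (p-max q (∈-interiorPoints⁺ S i)))
                (lin 5 (λ n v₁ v₂ p₁ p₂ → n :+ κ 3 :< v₁ :+ v₂ ⇒ p₁ :+ p₂ :≡ n :+ κ 2 ⇒ ⊢ :- κ 1 :* v₁ :+ :- κ 1 :* v₂ :+ κ 2 :≤ :- κ 1 :* p₁ :+ :- κ 1 :* p₂) n v₁ v₂ p₁ p₂ far sum-p))
            where
              sum-p : p₁ + p₂ ≡ n + + 2
              sum-p = lin 2 (λ n s → s :≤ n :+ κ 2 ⇒ n :+ κ 1 :< s ⇒ ⊢ s :≡ n :+ κ 2) n (p₁ + p₂) (top p ip) big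

  -- A vertex with x ≤ −2 sees all of S in a unimodular cone.
  violation : ∀ {n S s₀ p₀} → (∀ q → Int S q → InΔ n q) → Int S p₀ → s₀ ∈ S → proj₁ s₀ < - + 1 → Outcome n S
  violation {n} {S} {s₀} {p₀} fit ip₀ s₀∈ bad = start (argmin proj₁ S s₀∈) (argmin proj₁ E (∈-interiorPoints⁺ S ip₀))
    where
      E = interiorPoints S
      fstX : ∀ a b → + 1 * a + + 0 * b ≡ a
      fstX = lin 2 λ a b → ⊢ κ 1 :* a :+ κ 0 :* b :≡ a
      start : (Σ Pt λ v → v ∈ S × (∀ t → t ∈ S → proj₁ v ≤ proj₁ t)) → (Σ Pt λ p → p ∈ E × (∀ t → t ∈ E → proj₁ p ≤ proj₁ t)) → Outcome n S
      start (v@(v₁ , v₂) , v∈ , v-min) (p@(p₁ , p₂) , p∈ , p-min) = build (unimodularCone {S} {X = (+ 1 , + 0)} {r = (+ 1 , + 0)} refl v∈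
          (λ s s∈ → lift v s (v-min s s∈)) ip (λ q i → lift p q (p-min q (∈-interiorPoints⁺ S i)))
          (lin 5 (λ v₁ v₂ p₁ p₂ s → v₁ :≤ s ⇒ s :< :- κ 1 ⇒ κ 0 :≤ p₁ ⇒ ⊢ κ 1 :* v₁ :+ κ 0 :* v₂ :+ κ 2 :≤ κ 1 :* p₁ :+ κ 0 :* p₂) v₁ v₂ p₁ p₂ (proj₁ s₀) (v-min s₀ s₀∈) bad (proj₁ (fit p ip))))
        where
          ip = ∈-interiorPoints⁻ S p∈
          lift : ∀ s t → proj₁ s ≤ proj₁ t → (+ 1 , + 0) ∙ s ≤ (+ 1 , + 0) ∙ t
          lift (a , b) (c , d) = lin 4 (λ a b c d → a :≤ c ⇒ ⊢ κ 1 :* a :+ κ 0 :* b :≤ κ 1 :* c :+ κ 0 :* d) a b c d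
          build : UnimodularCone S (+ 1 , + 0) v p → Outcome n S
          build K = viaFrame φ {n} {S} (corner-outcome C)
            where
              open UnimodularCone K
              e₁x = proj₁ e₁
              e₁y = proj₂ e₁
              e₂x = proj₁ e₂
              e₂y = proj₂ e₂
              φ = basis v e₁ e₂ unit
              T = map (act φ) S
              act-φ = act-basis v e₁ e₂ unit
              quadT : Quadrant T
              quadT = all-map φ λ s s∈ → subst (λ t → + 0 ≤ proj₁ t × + 0 ≤ proj₂ t) (sym (act-φ s)) (side₁ s s∈ , side₂ s s∈)
              one-one : act φ p ≡ (+ 1 , + 1)
              one-one = trans (act-φ p) (cong₂ _,_
                (lin 8 (λ p₁ p₂ v₁ v₂ a b c d → p₁ :≡ v₁ :+ a :+ c ⇒ p₂ :≡ v₂ :+ b :+ d ⇒ a :* d :- b :* c :≡ κ 1 ⇒ 1 ⊙ d ∷ 2 ⊙ c ∷ [] ⊩ (p₁ :- v₁) :* d :- (p₂ :- v₂) :* c :≡ κ 1)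
                  p₁ p₂ v₁ v₂ e₁x e₁y e₂x e₂y sum₁ sum₂ unit)
                (lin 8 (λ p₁ p₂ v₁ v₂ a b c d → p₁ :≡ v₁ :+ a :+ c ⇒ p₂ :≡ v₂ :+ b :+ d ⇒ a :* d :- b :* c :≡ κ 1 ⇒ 1 ⊙ b ∷ 2 ⊙ a ∷ [] ⊩ a :* (p₂ :- v₂) :- b :* (p₁ :- v₁) :≡ κ 1)
                  p₁ p₂ v₁ v₂ e₁x e₁y e₂x e₂y sum₁ sum₂ unit))
              -- With `e₁x`, `e₂x` at least 1, `x = v₁ + α e₁x + β e₂x` and `p₁ = v₁ + e₁x + e₂x`
              -- give `x - p₁ ≥ α + β - 2`; and `x - p₁ ≤ n`, because `x ≤ n` and `p₁ ≥ 0` in the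
              -- old triangle. Hence the size does not grow in the new frame.
              topT : ∀ g → Int S g → det (g ⊖ v) e₂ + det e₁ (g ⊖ v) ≤ n + + 2
              topT g@(x , y) i = lin 8 (λ x α β X₁ X₂ v₁ p₁ n → κ 1 :≤ α ⇒ κ 1 :≤ β ⇒ κ 1 :≤ X₁ ⇒ κ 1 :≤ X₂ ⇒ x :≡ v₁ :+ α :* X₁ :+ β :* X₂ ⇒ p₁ :≡ v₁ :+ X₁ :+ X₂ ⇒ x :≤ n ⇒ κ 0 :≤ p₁ ⇒
                  1 ⊛ 3 ∷ 2 ⊛ 4 ∷ [] ⊩ α :+ β :≤ n :+ κ 2) x (det (g ⊖ v) e₂) (det e₁ (g ⊖ v)) e₁x e₂x v₁ p₁ n (proj₁ αβ) (proj₂ αβ)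
                  (subst (+ 1 ≤_) (fstX e₁x e₁y) X₁) (subst (+ 1 ≤_) (fstX e₂x e₂y) X₂) x≡ sum₁ x≤n (proj₁ (fit p ip))
                where
                  αβ : + 1 ≤ det (g ⊖ v) e₂ × + 1 ≤ det e₁ (g ⊖ v)
                  αβ = subst (λ t → + 1 ≤ proj₁ t × + 1 ≤ proj₂ t) (act-φ g) (int-≥1 quadT (int-map⁺ φ i))
                  x≡ : x ≡ v₁ + det (g ⊖ v) e₂ * e₁x + det e₁ (g ⊖ v) * e₂x
                  x≡ = lin 8 (λ x y v₁ v₂ a b c d → a :* d :- b :* c :≡ κ 1 ⇒ 1 ⊙ (x :- v₁) ∷ [] ⊩
                    x :≡ v₁ :+ ((x :- v₁) :* d :- (y :- v₂) :* c) :* a :+ (a :* (y :- v₂) :- b :* (x :- v₁)) :* c) x y v₁ v₂ e₁x e₁y e₂x e₂y unit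
                  x≤n : x ≤ n
                  x≤n = let (_ , y≥0 , s≤n) = fit g i in lin 3 (λ x y n → κ 0 :≤ y ⇒ x :+ y :≤ n ⇒ ⊢ x :≤ n) x y n y≥0 s≤n
              C : Corner n T
              C = record
                { quad = quadT
                ; o∈ = subst (_∈ T) (trans (act-φ v) (cong₂ _,_
                    (lin 4 (λ v₁ v₂ c d → ⊢ (v₁ :- v₁) :* d :- (v₂ :- v₂) :* c :≡ κ 0) v₁ v₂ e₂x e₂y)
                    (lin 4 (λ v₁ v₂ a b → ⊢ a :* (v₂ :- v₂) :- b :* (v₁ :- v₁) :≡ κ 0) v₁ v₂ e₁x e₁y))) (∈-map⁺ (act φ) v∈)
                ; i₁ = subst (Int T) one-one (int-map⁺ φ ip)
                ; top = allInt-map φ λ g i → subst (λ t → proj₁ t + proj₂ t ≤ n + + 2) (sym (act-φ g)) (topT g i)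
                }

  -- The coordinate swap and `turn` map the triangle of size `n` to itself and permute its sides, so
  -- every violated side can be moved to the side treated by `violation`.
  step : ∀ n S {p₀} → Int S p₀ → (∀ q → Int S q → InΔ n q) → Outcome n S
  step n S {p₀} ip₀ fit = cases
      (search (λ s → proj₁ s ℤₚ.<? - + 1) S) (search (λ s → proj₂ s ℤₚ.<? - + 1) S) (search (λ s → n + + 1 ℤₚ.<? sum s) S)
    where
      turn = unimod (- + 1) (- + 1) (+ 0) (+ 1) n (+ 0) (inj₂ refl)
      act-turn : ∀ p → act turn p ≡ (n - sum p , proj₂ p)
      act-turn (x , y) = cong₂ _,_ (lin 3 (λ x y n → ⊢ :- κ 1 :* x :+ :- κ 1 :* y :+ n :≡ n :- (x :+ y)) x y n) (lin 2 (λ x y → ⊢ κ 0 :* x :+ κ 1 :* y :+ κ 0 :≡ y) x y)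
      cases : (Σ Pt λ s → s ∈ S × proj₁ s < - + 1) ⊎ (∀ s → s ∈ S → ¬ (proj₁ s < - + 1)) → (Σ Pt λ s → s ∈ S × proj₂ s < - + 1) ⊎ (∀ s → s ∈ S → ¬ (proj₂ s < - + 1)) →
              (Σ Pt λ s → s ∈ S × n + + 1 < sum s) ⊎ (∀ s → s ∈ S → ¬ (n + + 1 < sum s)) → Outcome n S
      cases (inj₁ (s , s∈ , h)) _ _ = violation fit ip₀ s∈ h
      cases _ (inj₁ (s , s∈ , h)) _ = viaFrame swapᵤ {n} {S} (violation
        (allInt-map swapᵤ λ q i → subst (InΔ n) (sym (act-swap q)) (let (a , b , c) = fit q i in b , a , subst (_≤ n) (ℤₚ.+-comm (proj₁ q) (proj₂ q)) c))
        (int-map⁺ swapᵤ ip₀) (∈-map⁺ (act swapᵤ) s∈) (subst (λ t → proj₁ t < - + 1) (sym (act-swap s)) h))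
      cases _ _ (inj₁ (s , s∈ , h)) = viaFrame turn {n} {S} (violation
        (allInt-map turn λ q i → subst (InΔ n) (sym (act-turn q)) (let (a , b , c) = fit q i in ℤₚ.i≤j⇒0≤j-i c , b ,
           lin 3 (λ x y n → κ 0 :≤ x ⇒ ⊢ n :- (x :+ y) :+ y :≤ n) (proj₁ q) (proj₂ q) n a))
        (int-map⁺ turn ip₀) (∈-map⁺ (act turn) s∈)
        (subst (λ t → proj₁ t < - + 1) (sym (act-turn s)) (lin 2 (λ s n → n :+ κ 1 :< s ⇒ ⊢ n :- s :< :- κ 1) (sum s) n h)))
      cases (inj₂ a) (inj₂ b) (inj₂ c) = inj₂ (inj₁ (translate (+ 1) (+ 1) , λ s@(x , y) s∈ → subst (InΔ (n + + 3)) (sym (act-translate (+ 1) (+ 1) s))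
        ( lin 1 (λ x → :- κ 1 :≤ x ⇒ ⊢ κ 0 :≤ x :+ κ 1) x (ℤₚ.≮⇒≥ (a s s∈)) , lin 1 (λ x → :- κ 1 :≤ x ⇒ ⊢ κ 0 :≤ x :+ κ 1) y (ℤₚ.≮⇒≥ (b s s∈))
        , lin 3 (λ x y n → x :+ y :≤ n :+ κ 1 ⇒ ⊢ x :+ κ 1 :+ (y :+ κ 1) :≤ n :+ κ 3) x y n (ℤₚ.≮⇒≥ (c s s∈)))))

  -- Recursion on `n` makes every inner fit as good as a minimal one. The third outcome is
  -- impossible for `n = 0`, since there is an interior point, and otherwise lowers `n`; this is why
  -- the bound is some `m ≤ n`.
  interior-fit⇒fit : ∀ n S {p₀} → Int S p₀ → (∀ q → Int S q → InΔ (+ n) q) → Exceptional S ⊎ Σ ℕ λ m → m ℕ.≤ n × Fit (_∈ S) (+ m + + 3)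

  private
    conclude : ∀ n S {p₀} → Int S p₀ → Outcome (+ n) S → Exceptional S ⊎ Σ ℕ λ m → m ℕ.≤ n × Fit (_∈ S) (+ m + + 3)

    weaken : ∀ n φ S → Exceptional (map (act φ) S) ⊎ (Σ ℕ λ m → m ℕ.≤ n × Fit (_∈ map (act φ) S) (+ m + + 3)) →
             Exceptional S ⊎ Σ ℕ λ m → m ℕ.≤ suc n × Fit (_∈ S) (+ m + + 3)
    weaken n φ S (inj₁ e)            = inj₁ (exceptional-map φ {S} e)
    weaken n φ S (inj₂ (m , m≤ , g)) = inj₂ (m , ℕₚ.≤-trans m≤ (ℕₚ.n≤1+n n) , fit-map φ {S} g)

    no-fit : ∀ x y → + 0 ≤ x → + 0 ≤ y → x + y ≤ - + 1 → ⊥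
    no-fit = lin 2 λ x y → κ 0 :≤ x ⇒ κ 0 :≤ y ⇒ x :+ y :≤ :- κ 1 ⇒ ⊢ :⊥

    conclude n S ip₀ (inj₁ e) = inj₁ e
    conclude n S ip₀ (inj₂ (inj₁ f)) = inj₂ (n , ℕₚ.≤-refl , f)
    conclude zero S {p₀} ip₀ (inj₂ (inj₂ (φ , f))) = let (a , b , c) = f p₀ ip₀ in ⊥-elim (no-fit (proj₁ (act φ p₀)) (proj₂ (act φ p₀)) a b c)
    conclude (suc n) S {p₀} ip₀ (inj₂ (inj₂ (φ , f))) =
      weaken n φ S (interior-fit⇒fit n (map (act φ) S) (int-map⁺ φ {S} ip₀) (allInt-map φ {S} {InΔ (+ n)} f))

  interior-fit⇒fit n S ip₀ fit = conclude n S ip₀ (step (+ n) S ip₀ fit)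

-- Polygons without interior lattice points

module HollowPolygons where
  open import Data.Integer using (_+_; _*_; _-_; -_; _≤_; _<_)
  open import Data.Nat using (suc; z≤n; s≤s)
  open import Relation.Nullary.Decidable using (_×-dec_; ¬?)
  open Lattice
  open Frames
  open Cones
  open Configurations
  open Reflexive

  -- Two-dimensionality in dual form, which transports along frames through `pull` and can be
  -- applied to whichever linear form is at hand.
  Full : List Pt → Set
  Full S = ∀ u → NonZero u → Σ Pt λ s → Σ Pt λ t → s ∈ S × t ∈ S × u ∙ s < u ∙ t

  Hollow : List Pt → Set
  Hollow S = ∀ p → Sep S p

  full-map : ∀ φ {S} → Full S → Full (map (act φ) S)
  full-map φ {S} full u nz with full (pull φ u) (pull-nonZero φ u nz)
  ... | s , t , s∈ , t∈ , lt = act φ s , act φ t , ∈-map⁺ (act φ) s∈ , ∈-map⁺ (act φ) t∈ ,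
    lin 5 (λ A B C P Q → A :≡ P :+ C ⇒ B :≡ Q :+ C ⇒ P :< Q ⇒ ⊢ A :< B)
      (u ∙ act φ s) (u ∙ act φ t) _ (pull φ u ∙ s) (pull φ u ∙ t) (pull-∙ φ u s) (pull-∙ φ u t) lt

  noInt⇒hollow : ∀ {S} → (∀ p → ¬ Int S p) → Hollow S
  noInt⇒hollow {S} h p with int⊎sep S p
  ... | inj₁ i = ⊥-elim (h p i)
  ... | inj₂ s = s

  hollow-map : ∀ φ {S} → Hollow S → Hollow (map (act φ) S)
  hollow-map φ {S} h = noInt⇒hollow λ p i → int-¬sep (int-map⁻ φ {S} i) (h (act (inv φ) p))

  HollowOutcome : List Pt → Set
  HollowOutcome S = Exceptional S ⊎ Fit (_∈ S) (+ 1)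

  hollow-viaFrame : ∀ φ S → HollowOutcome (map (act φ) S) → HollowOutcome S
  hollow-viaFrame φ S (inj₁ e) = inj₁ (exceptional-map φ {S} e)
  hollow-viaFrame φ S (inj₂ f) = inj₂ (fit-map φ {S} f)

  record Strip (T : List Pt) (l₀ r₀ l₁ r₁ : ℤ) : Set where
    field
      l₀∈  : (l₀ , + 0) ∈ T
      r₀∈  : (r₀ , + 0) ∈ T
      l₁∈  : (l₁ , + 1) ∈ T
      r₁∈  : (r₁ , + 1) ∈ T
      rows : ∀ t → t ∈ T → (proj₂ t ≡ + 0 × l₀ ≤ proj₁ t × proj₁ t ≤ r₀) ⊎ (proj₂ t ≡ + 1 × l₁ ≤ proj₁ t × proj₁ t ≤ r₁)

  strip-flip : Unimod
  strip-flip = unimod (+ 1) (+ 0) (+ 0) (- + 1) (+ 0) (+ 1) (inj₂ refl)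

  act-strip-flip : ∀ p → act strip-flip p ≡ (proj₁ p , + 1 - proj₂ p)
  act-strip-flip (x , y) = cong₂ _,_ (lin 2 (λ x y → ⊢ κ 1 :* x :+ κ 0 :* y :+ κ 0 :≡ x) x y) (lin 2 (λ x y → ⊢ κ 0 :* x :+ :- κ 1 :* y :+ κ 1 :≡ κ 1 :- y) x y)

  flipped : ∀ {T l₀ r₀ l₁ r₁} → Strip T l₀ r₀ l₁ r₁ → Strip (map (act strip-flip) T) l₁ r₁ l₀ r₀
  flipped {T} {l₀} {r₀} {l₁} {r₁} St = record
    { l₀∈ = to (l₁ , + 1) l₁∈ ; r₀∈ = to (r₁ , + 1) r₁∈ ; l₁∈ = to (l₀ , + 0) l₀∈ ; r₁∈ = to (r₀ , + 0) r₀∈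
    ; rows = all-map strip-flip {T} {Row} λ s s∈ → subst Row (sym (act-strip-flip s)) (exchange s (rows s s∈)) }
    where
      open Strip St
      Row : Pt → Set
      Row t = (proj₂ t ≡ + 0 × l₁ ≤ proj₁ t × proj₁ t ≤ r₁) ⊎ (proj₂ t ≡ + 1 × l₀ ≤ proj₁ t × proj₁ t ≤ r₀)
      to : ∀ p → p ∈ T → (proj₁ p , + 1 - proj₂ p) ∈ map (act strip-flip) T
      to p p∈ = subst (_∈ map (act strip-flip) T) (act-strip-flip p) (∈-map⁺ (act strip-flip) p∈)
      exchange : ∀ s → (proj₂ s ≡ + 0 × l₀ ≤ proj₁ s × proj₁ s ≤ r₀) ⊎ (proj₂ s ≡ + 1 × l₁ ≤ proj₁ s × proj₁ s ≤ r₁) → Row (proj₁ s , + 1 - proj₂ s)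
      exchange s (inj₁ (e , h)) = inj₂ (cong (λ z → + 1 - z) e , h)
      exchange s (inj₂ (e , h)) = inj₁ (cong (λ z → + 1 - z) e , h)

  -- A translation and a shear put the left ends of both rows at `x = 0`, with the longer row at the
  -- bottom. Row lengths 1 and 0 give Σ itself; every other possible pair of lengths is a trapezoid
  -- of the list.
  strip-ordered : ∀ {T l₀ r₀ l₁ r₁} → Full T → Strip T l₀ r₀ l₁ r₁ → r₁ - l₁ ≤ r₀ - l₀ → HollowOutcome T
  strip-ordered {T} {l₀} {r₀} {l₁} {r₁} full St b≤a = decide (toℕ 1 a≥1) (toℕ 0 b≥0)
    where
      open Strip St
      m = l₁ - l₀
      φ = unimod (+ 1) (- m) (+ 0) (+ 1) (- l₀) (+ 0) (inj₁ (lin 1 (λ m → ⊢ κ 1 :* κ 1 :- :- m :* κ 0 :≡ κ 1) m))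
      act-φ : ∀ p → act φ p ≡ (proj₁ p - m * proj₂ p - l₀ , proj₂ p)
      act-φ (x , y) = cong₂ _,_ (lin 4 (λ x y m l → ⊢ κ 1 :* x :+ :- m :* y :+ :- l :≡ x :- m :* y :- l) x y m l₀) (lin 2 (λ x y → ⊢ κ 0 :* x :+ κ 1 :* y :+ κ 0 :≡ y) x y)
      U = map (act φ) T
      to : ∀ p → p ∈ T → (proj₁ p - m * proj₂ p - l₀ , proj₂ p) ∈ U
      to p p∈ = subst (_∈ U) (act-φ p) (∈-map⁺ (act φ) p∈)
      a b : ℤ
      a = r₀ - l₀
      b = r₁ - l₁
      Inside : Pt → Set
      Inside t = + 0 ≤ proj₁ t × + 0 ≤ proj₂ t × proj₂ t ≤ + 1 × proj₁ t + (a - b) * proj₂ t ≤ a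
      inside : ∀ s → s ∈ T → Inside (proj₁ s - m * proj₂ s - l₀ , proj₂ s)
      inside (x , y) s∈ = row (rows _ s∈)
        where
          row : (y ≡ + 0 × l₀ ≤ x × x ≤ r₀) ⊎ (y ≡ + 1 × l₁ ≤ x × x ≤ r₁) → Inside (x - m * y - l₀ , y)
          row (inj₁ (refl , lo , hi)) = lin 3 (λ x l₀ l₁ → l₀ :≤ x ⇒ ⊢ κ 0 :≤ x :- (l₁ :- l₀) :* κ 0 :- l₀) x l₀ l₁ lo , ℤ.+≤+ z≤n , ℤ.+≤+ z≤n ,
            lin 5 (λ x l₀ r₀ l₁ r₁ → x :≤ r₀ ⇒ ⊢ x :- (l₁ :- l₀) :* κ 0 :- l₀ :+ (r₀ :- l₀ :- (r₁ :- l₁)) :* κ 0 :≤ r₀ :- l₀) x l₀ r₀ l₁ r₁ hi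
          row (inj₂ (refl , lo , hi)) = lin 3 (λ x l₀ l₁ → l₁ :≤ x ⇒ ⊢ κ 0 :≤ x :- (l₁ :- l₀) :* κ 1 :- l₀) x l₀ l₁ lo , ℤ.+≤+ z≤n , ℤ.+≤+ (s≤s z≤n) ,
            lin 5 (λ x l₀ r₀ l₁ r₁ → x :≤ r₁ ⇒ ⊢ x :- (l₁ :- l₀) :* κ 1 :- l₀ :+ (r₀ :- l₀ :- (r₁ :- l₁)) :* κ 1 :≤ r₀ :- l₀) x l₀ r₀ l₁ r₁ hi
      all : ∀ t → t ∈ U → Inside t
      all = all-map φ {T} {Inside} λ s s∈ → subst Inside (sym (act-φ s)) (inside s s∈)
      b≥0 : + 0 ≤ b
      b≥0 = nonempty (rows _ r₁∈)
        where
          nonempty : (+ 1 ≡ + 0 × l₀ ≤ r₁ × r₁ ≤ r₀) ⊎ (+ 1 ≡ + 1 × l₁ ≤ r₁ × r₁ ≤ r₁) → + 0 ≤ r₁ - l₁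
          nonempty (inj₂ (_ , h , _)) = ℤₚ.i≤j⇒0≤j-i h
      a≥1 : + 1 ≤ a
      -- If both rows were single points, the form `(1 , -m)` would be constant on `T`.
      a≥1 = wide (full (+ 1 , - m) (λ ()))
        where
          wide : (Σ Pt λ s → Σ Pt λ t → s ∈ T × t ∈ T × (+ 1 , - m) ∙ s < (+ 1 , - m) ∙ t) → + 1 ≤ a
          wide ((x , y) , (x′ , y′) , s∈ , t∈ , lt) = let (p , _ , _ , _) = inside _ s∈ ; (_ , q , _ , r) = inside _ t∈ in
            lin 8 (λ x y x′ y′ m l a b → κ 0 :≤ x :- m :* y :- l ⇒ κ 0 :≤ y′ ⇒ x′ :- m :* y′ :- l :+ (a :- b) :* y′ :≤ a ⇒ b :≤ a ⇒ κ 1 :* x :+ :- m :* y :< κ 1 :* x′ :+ :- m :* y′ ⇒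
              2 ⊛ 4 ∷ [] ⊩ κ 1 :≤ a) x y x′ y′ m l₀ a b p q r b≤a lt
      decide : (Σ ℕ λ n → a ≡ + n × 1 ℕ.≤ n) → (Σ ℕ λ n → b ≡ + n × 0 ℕ.≤ n) → HollowOutcome T
      decide (A , a≡ , A≥1) (B , b≡ , _) = shape (classify A B A≥1 (ℤₚ.drop‿+≤+ (subst₂ _≤_ b≡ a≡ b≤a)))
        where
          classify : ∀ A B → 1 ℕ.≤ A → B ℕ.≤ A → (A ≡ 1 × B ≡ 0) ⊎ ((A ≡ 1 × B ≡ 1) ⊎ (2 ℕ.≤ A × B ℕ.≤ A))
          classify 1 0 _ _ = inj₁ (refl , refl)
          classify 1 1 _ _ = inj₂ (inj₁ (refl , refl))
          classify 1 (suc (suc _)) _ (s≤s ())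
          classify (suc (suc A)) B _ h = inj₂ (inj₂ (s≤s (s≤s z≤n) , h))
          shape : (A ≡ 1 × B ≡ 0) ⊎ ((A ≡ 1 × B ≡ 1) ⊎ (2 ℕ.≤ A × B ℕ.≤ A)) → HollowOutcome T
          shape (inj₁ (refl , refl)) = inj₂ (fit-map φ {T} (fitHere λ t@(x , y) t∈ → let (p , q , r , h) = all t t∈ in p , q ,
            lin 4 (λ x y a b → x :+ (a :- b) :* y :≤ a ⇒ a :≡ κ 1 ⇒ b :≡ κ 0 ⇒ 2 ⊙ y ∷ 3 ⊙ y ∷ [] ⊩ x :+ y :≤ κ 1) x y a b h a≡ b≡))
          shape (inj₂ c) = inj₁ (φ , trap A B record
            { shape = c
            ; c₀₀ = pt≡ (lin 2 (λ l₀ l₁ → ⊢ l₀ :- (l₁ :- l₀) :* κ 0 :- l₀ :≡ κ 0) l₀ l₁) refl (to _ l₀∈)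
            ; c₁₀ = pt≡ (trans (lin 3 (λ l₀ l₁ r₀ → ⊢ r₀ :- (l₁ :- l₀) :* κ 0 :- l₀ :≡ r₀ :- l₀) l₀ l₁ r₀) a≡) refl (to _ r₀∈)
            ; c₀₁ = pt≡ (lin 2 (λ l₀ l₁ → ⊢ l₁ :- (l₁ :- l₀) :* κ 1 :- l₀ :≡ κ 0) l₀ l₁) refl (to _ l₁∈)
            ; c₁₁ = pt≡ (trans (lin 3 (λ l₀ l₁ r₁ → ⊢ r₁ :- (l₁ :- l₀) :* κ 1 :- l₀ :≡ r₁ :- l₁) l₀ l₁ r₁) b≡) refl (to _ r₁∈)
            ; all = subst₂ (λ a b → ∀ t → t ∈ U → + 0 ≤ proj₁ t × + 0 ≤ proj₂ t × proj₂ t ≤ + 1 × proj₁ t + (a - b) * proj₂ t ≤ a) a≡ b≡ all })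

  strip : ∀ T → Full T → (∀ t → t ∈ T → + 0 ≤ proj₂ t × proj₂ t ≤ + 1) → HollowOutcome T
  strip T full band = start (full (+ 0 , + 1) (λ ()))
    where
      zero-or-one : ∀ y → + 0 ≤ y → y ≤ + 1 → y ≡ + 0 ⊎ y ≡ + 1
      zero-or-one (+ 0) _ _ = inj₁ refl
      zero-or-one (+ 1) _ _ = inj₂ refl
      zero-or-one (+ suc (suc _)) _ (ℤ.+≤+ (s≤s ()))
      start : (Σ Pt λ s → Σ Pt λ t → s ∈ T × t ∈ T × (+ 0 , + 1) ∙ s < (+ 0 , + 1) ∙ t) → HollowOutcome T
      start ((x , y) , (x′ , y′) , s∈ , t∈ , lt) = go (argminOn zero? proj₁ T s∈ y≡0) (argmaxOn zero? proj₁ T s∈ y≡0) (argminOn one? proj₁ T t∈ y′≡1) (argmaxOn one? proj₁ T t∈ y′≡1)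
        where
          zero? = λ (s : Pt) → proj₂ s ℤₚ.≟ + 0
          one?  = λ (s : Pt) → proj₂ s ℤₚ.≟ + 1
          y≡0 : y ≡ + 0
          y≡0 = lin 4 (λ x y x′ y′ → κ 0 :* x :+ κ 1 :* y :< κ 0 :* x′ :+ κ 1 :* y′ ⇒ κ 0 :≤ y ⇒ y′ :≤ κ 1 ⇒ ⊢ y :≡ κ 0) x y x′ y′ lt (proj₁ (band _ s∈)) (proj₂ (band _ t∈))
          y′≡1 : y′ ≡ + 1
          y′≡1 = lin 4 (λ x y x′ y′ → κ 0 :* x :+ κ 1 :* y :< κ 0 :* x′ :+ κ 1 :* y′ ⇒ κ 0 :≤ y ⇒ y′ :≤ κ 1 ⇒ ⊢ y′ :≡ κ 1) x y x′ y′ lt (proj₁ (band _ s∈)) (proj₂ (band _ t∈))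
          go : (Σ Pt λ s → s ∈ T × proj₂ s ≡ + 0 × (∀ t → t ∈ T → proj₂ t ≡ + 0 → proj₁ s ≤ proj₁ t)) → (Σ Pt λ s → s ∈ T × proj₂ s ≡ + 0 × (∀ t → t ∈ T → proj₂ t ≡ + 0 → proj₁ t ≤ proj₁ s)) →
               (Σ Pt λ s → s ∈ T × proj₂ s ≡ + 1 × (∀ t → t ∈ T → proj₂ t ≡ + 1 → proj₁ s ≤ proj₁ t)) → (Σ Pt λ s → s ∈ T × proj₂ s ≡ + 1 × (∀ t → t ∈ T → proj₂ t ≡ + 1 → proj₁ t ≤ proj₁ s)) → HollowOutcome T
          go ((l₀ , _) , l₀∈ , refl , ml₀) ((r₀ , _) , r₀∈ , refl , mr₀) ((l₁ , _) , l₁∈ , refl , ml₁) ((r₁ , _) , r₁∈ , refl , mr₁) = order (≤⊎> (r₁ - l₁) (r₀ - l₀))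
            where
              St : Strip T l₀ r₀ l₁ r₁
              St = record { l₀∈ = l₀∈ ; r₀∈ = r₀∈ ; l₁∈ = l₁∈ ; r₁∈ = r₁∈ ; rows = λ t t∈ → row t t∈ (zero-or-one _ (proj₁ (band t t∈)) (proj₂ (band t t∈))) }
                where
                  row : ∀ t → t ∈ T → proj₂ t ≡ + 0 ⊎ proj₂ t ≡ + 1 → (proj₂ t ≡ + 0 × l₀ ≤ proj₁ t × proj₁ t ≤ r₀) ⊎ (proj₂ t ≡ + 1 × l₁ ≤ proj₁ t × proj₁ t ≤ r₁)
                  row t t∈ (inj₁ e) = inj₁ (e , ml₀ t t∈ e , mr₀ t t∈ e)
                  row t t∈ (inj₂ e) = inj₂ (e , ml₁ t t∈ e , mr₁ t t∈ e)
              order : r₁ - l₁ ≤ r₀ - l₀ ⊎ r₀ - l₀ < r₁ - l₁ → HollowOutcome T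
              order (inj₁ h) = strip-ordered full St h
              order (inj₂ h) = hollow-viaFrame strip-flip T (strip-ordered (full-map strip-flip {T} full) (flipped St) (ℤₚ.<⇒≤ h))

  record Base (T : List Pt) (L : ℤ) : Set where
    field
      full   : Full T
      hollow : Hollow T
      above  : ∀ t → t ∈ T → + 0 ≤ proj₂ t
      o∈     : (+ 0 , + 0) ∈ T
      L∈     : (L , + 0) ∈ T
      row₀   : ∀ t → t ∈ T → proj₂ t ≡ + 0 → + 0 ≤ proj₁ t × proj₁ t ≤ L
      L≥1    : + 1 ≤ L

  -- A separating line at `(0 , 1)`, a point between `(0 , 0)` and `(0 , y₀)`, is vertical, so `T`
  -- lies in `x ≥ 0`. A separating line at `(1 , 1)` has `u₁ ≥ u₂ ≥ 0`: for `L = 1` this gives the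
  -- strip `0 ≤ x ≤ 1`, and for `L ≥ 2` it forces `u₁ = u₂` and `L = y₀ = 2`, which is 2Σ.
  column : ∀ {T L} y₀ → Base T L → (+ 0 , y₀) ∈ T → + 2 ≤ y₀ → HollowOutcome T
  column {T} {L} y₀ B y∈ y₀≥2 = second (hollow (+ 1 , + 1))
    where
      open Base B
      x≥0 : ∀ t → t ∈ T → + 0 ≤ proj₁ t
      x≥0 (x , y) t∈ = first (hollow (+ 0 , + 1))
        where
          first : Sep T (+ 0 , + 1) → + 0 ≤ x
          first ((u₁ , u₂) , nz , h) = lin 4 (λ u₁ u₂ x y → u₁ :≤ :- κ 1 ⇒ u₂ :≡ κ 0 ⇒ u₁ :* x :+ u₂ :* y :≤ u₁ :* κ 0 :+ u₂ :* κ 1 ⇒ 2 ⊙ y ∷ 0 ⊛ 1 ∷ [] ⊩ κ 0 :≤ x) u₁ u₂ x y u₁<0 u₂≡0 (h _ t∈)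
            where
              u₂≡0 : u₂ ≡ + 0
              u₂≡0 = ℤₚ.≤-antisym
                (lin 3 (λ u₁ u₂ y → u₁ :* κ 0 :+ u₂ :* y :≤ u₁ :* κ 0 :+ u₂ :* κ 1 ⇒ κ 2 :≤ y ⇒ 0 ⊛ 2 ∷ [] ⊩ u₂ :≤ κ 0) u₁ u₂ y₀ (h _ y∈) y₀≥2)
                (lin 2 (λ u₁ u₂ → u₁ :* κ 0 :+ u₂ :* κ 0 :≤ u₁ :* κ 0 :+ u₂ :* κ 1 ⇒ ⊢ κ 0 :≤ u₂) u₁ u₂ (h _ o∈))
              u₁≤0 : u₁ ≤ + 0
              u₁≤0 = lin 3 (λ u₁ u₂ L → u₁ :* L :+ u₂ :* κ 0 :≤ u₁ :* κ 0 :+ u₂ :* κ 1 ⇒ u₂ :≡ κ 0 ⇒ κ 1 :≤ L ⇒ 0 ⊛ 3 ∷ [] ⊩ u₁ :≤ κ 0) u₁ u₂ L (h _ L∈) u₂≡0 L≥1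
              u₁<0 : u₁ ≤ - + 1
              u₁<0 with ≤⊎> u₁ (- + 1)
              ... | inj₁ k = k
              ... | inj₂ k = ⊥-elim (nz (lin 1 (λ u → :- κ 1 :< u ⇒ u :≤ κ 0 ⇒ ⊢ u :≡ κ 0) u₁ k u₁≤0 , u₂≡0))
      second : Sep T (+ 1 , + 1) → HollowOutcome T
      second ((u₁ , u₂) , nz , h) = byLength (≤⊎> L (+ 1))
        where
          hL : u₁ * L ≤ u₁ + u₂
          hL = lin 3 (λ u₁ u₂ L → u₁ :* L :+ u₂ :* κ 0 :≤ u₁ :* κ 1 :+ u₂ :* κ 1 ⇒ ⊢ u₁ :* L :≤ u₁ :+ u₂) u₁ u₂ L (h _ L∈)
          hy : u₂ * y₀ ≤ u₁ + u₂
          hy = lin 3 (λ u₁ u₂ y → u₁ :* κ 0 :+ u₂ :* y :≤ u₁ :* κ 1 :+ u₂ :* κ 1 ⇒ ⊢ u₂ :* y :≤ u₁ :+ u₂) u₁ u₂ y₀ (h _ y∈)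
          ho : + 0 ≤ u₁ + u₂
          ho = lin 2 (λ u₁ u₂ → u₁ :* κ 0 :+ u₂ :* κ 0 :≤ u₁ :* κ 1 :+ u₂ :* κ 1 ⇒ ⊢ κ 0 :≤ u₁ :+ u₂) u₁ u₂ (h _ o∈)
          u₂≥0 : + 0 ≤ u₂
          u₂≥0 with ≤⊎> (+ 0) u₂
          ... | inj₁ k = k
          ... | inj₂ k = ⊥-elim (lin 3 (λ u₁ u₂ L → u₁ :* L :≤ u₁ :+ u₂ ⇒ κ 0 :≤ u₁ :+ u₂ ⇒ u₂ :< κ 0 ⇒ κ 1 :≤ L ⇒ κ 0 :< u₁ ⇒ 4 ⊛ 5 ∷ [] ⊩ :⊥) u₁ u₂ L hL ho k L≥1
                    (lin 2 (λ u₁ u₂ → κ 0 :≤ u₁ :+ u₂ ⇒ u₂ :< κ 0 ⇒ ⊢ κ 0 :< u₁) u₁ u₂ ho k))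
          u₁≥u₂ : u₂ ≤ u₁
          u₁≥u₂ = lin 3 (λ u₁ u₂ y → u₂ :* y :≤ u₁ :+ u₂ ⇒ κ 2 :≤ y ⇒ κ 0 :≤ u₂ ⇒ 2 ⊛ 3 ∷ [] ⊩ u₂ :≤ u₁) u₁ u₂ y₀ hy y₀≥2 u₂≥0
          u₁>0 : + 0 < u₁
          u₁>0 with ≤⊎> u₁ (+ 0)
          ... | inj₂ k = k
          ... | inj₁ k = ⊥-elim (nz (lin 2 (λ u₁ u₂ → u₁ :≤ κ 0 ⇒ κ 0 :≤ u₂ ⇒ u₂ :≤ u₁ ⇒ ⊢ u₁ :≡ κ 0) u₁ u₂ k u₂≥0 u₁≥u₂ , lin 2 (λ u₁ u₂ → u₁ :≤ κ 0 ⇒ κ 0 :≤ u₂ ⇒ u₂ :≤ u₁ ⇒ ⊢ u₂ :≡ κ 0) u₁ u₂ k u₂≥0 u₁≥u₂))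
          byLength : L ≤ + 1 ⊎ + 1 < L → HollowOutcome T
          byLength (inj₁ L≤1) = hollow-viaFrame swapᵤ T (strip (map (act swapᵤ) T) (full-map swapᵤ {T} full)
              (all-map swapᵤ {T} {λ t → + 0 ≤ proj₂ t × proj₂ t ≤ + 1} λ s s∈ → subst (λ t → + 0 ≤ proj₂ t × proj₂ t ≤ + 1) (sym (act-swap s)) (x≥0 s s∈ , x≤1 s s∈)))
            where
              x≤1 : ∀ t → t ∈ T → proj₁ t ≤ + 1
              x≤1 t@(x , y) t∈ with ≤⊎> y (+ 0)
              ... | inj₁ y≤0 = ℤₚ.≤-trans (proj₂ (row₀ t t∈ (ℤₚ.≤-antisym y≤0 (above t t∈)))) L≤1
              ... | inj₂ y>0 = lin 4 (λ u₁ u₂ x y → κ 0 :< u₁ ⇒ κ 0 :≤ u₂ ⇒ κ 0 :< y ⇒ u₁ :* x :+ u₂ :* y :≤ u₁ :* κ 1 :+ u₂ :* κ 1 ⇒ 0 ⊛ 1 ∷ 2 ⊛ 3 ∷ [] ⊩ x :≤ κ 1) u₁ u₂ x y u₁>0 u₂≥0 y>0 (h t t∈)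
          byLength (inj₂ L>1) = inj₁ (exceptionalHere (tri2 record
            { c₀ = o∈ ; c₁ = pt≡ L≡2 refl L∈ ; c₂ = pt≡ refl y₀≡2 y∈
            ; all = λ t@(x , y) t∈ → x≥0 t t∈ , above t t∈ ,
                lin 4 (λ u₁ u₂ x y → κ 0 :< u₁ ⇒ u₁ :≡ u₂ ⇒ u₁ :* x :+ u₂ :* y :≤ u₁ :* κ 1 :+ u₂ :* κ 1 ⇒ 2 ⊙ y ∷ 0 ⊛ 1 ∷ [] ⊩ x :+ y :≤ κ 2) u₁ u₂ x y u₁>0 u₁≡u₂ (h t t∈) }))
            where
              u₁≤u₂ : u₁ ≤ u₂
              u₁≤u₂ = lin 3 (λ u₁ u₂ L → u₁ :* L :≤ u₁ :+ u₂ ⇒ κ 1 :< L ⇒ κ 0 :< u₁ ⇒ 2 ⊛ 3 ∷ [] ⊩ u₁ :≤ u₂) u₁ u₂ L hL L>1 u₁>0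
              u₁≡u₂ : u₁ ≡ u₂
              u₁≡u₂ = ℤₚ.≤-antisym u₁≤u₂ u₁≥u₂
              L≡2 : L ≡ + 2
              L≡2 = lin 3 (λ u₁ u₂ L → u₁ :* L :≤ u₁ :+ u₂ ⇒ κ 1 :< L ⇒ κ 0 :< u₁ ⇒ u₁ :≡ u₂ ⇒ 0 ⊛ 3 ∷ [] ⊩ L :≡ κ 2) u₁ u₂ L hL L>1 u₁>0 u₁≡u₂
              y₀≡2 : y₀ ≡ + 2
              y₀≡2 = lin 3 (λ u₁ u₂ y → u₂ :* y :≤ u₁ :+ u₂ ⇒ κ 2 :≤ y ⇒ κ 0 :< u₂ ⇒ u₁ :≡ u₂ ⇒ 0 ⊛ 3 ∷ [] ⊩ y :≡ κ 2) u₁ u₂ y₀ hy y₀≥2 (ℤₚ.<-≤-trans u₁>0 u₁≤u₂) u₁≡u₂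

  shearₓ : ℤ → Unimod
  shearₓ t = unimod (+ 1) (- t) (+ 0) (+ 1) (+ 0) (+ 0) (inj₁ (lin 1 (λ t → ⊢ κ 1 :* κ 1 :- :- t :* κ 0 :≡ κ 1) t))

  act-shear : ∀ t p → act (shearₓ t) p ≡ (proj₁ p - t * proj₂ p , proj₂ p)
  act-shear t (x , y) = cong₂ _,_ (lin 3 (λ x y t → ⊢ κ 1 :* x :+ :- t :* y :+ κ 0 :≡ x :- t :* y) x y t) (lin 2 (λ x y → ⊢ κ 0 :* x :+ κ 1 :* y :+ κ 0 :≡ y) x y)

  slanted : ∀ {T L} x₀ y₀ t → Base T L → (x₀ , y₀) ∈ T → + 2 ≤ y₀ → x₀ ≡ t * y₀ → HollowOutcome T
  slanted {T} {L} x₀ y₀ t B y∈ y₀≥2 x₀≡ = hollow-viaFrame φ T (column y₀ B′ (pt≡ (lin 3 (λ x y t → x :≡ t :* y ⇒ ⊢ x :- t :* y :≡ κ 0) x₀ y₀ t x₀≡) refl (to _ y∈)) y₀≥2)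
    where
      open Base B
      φ = shearₓ t
      to : ∀ p → p ∈ T → (proj₁ p - t * proj₂ p , proj₂ p) ∈ map (act φ) T
      to p p∈ = subst (_∈ map (act φ) T) (act-shear t p) (∈-map⁺ (act φ) p∈)
      B′ : Base (map (act φ) T) L
      B′ = record
        { full = full-map φ {T} full ; hollow = hollow-map φ {T} hollow
        ; above = all-map φ {T} {λ p → + 0 ≤ proj₂ p} λ s s∈ → subst (λ p → + 0 ≤ proj₂ p) (sym (act-shear t s)) (above s s∈)
        ; o∈ = pt≡ (lin 1 (λ t → ⊢ κ 0 :- t :* κ 0 :≡ κ 0) t) refl (to _ o∈)
        ; L∈ = pt≡ (lin 2 (λ t L → ⊢ L :- t :* κ 0 :≡ L) t L) refl (to _ L∈)
        ; row₀ = all-map φ {T} {λ p → proj₂ p ≡ + 0 → + 0 ≤ proj₁ p × proj₁ p ≤ L} λ s@(x , y) s∈ →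
            subst (λ p → proj₂ p ≡ + 0 → + 0 ≤ proj₁ p × proj₁ p ≤ L) (sym (act-shear t s)) λ e →
              let (lo , hi) = row₀ s s∈ e in
              lin 3 (λ x y t → κ 0 :≤ x ⇒ y :≡ κ 0 ⇒ 2 ⊙ t ∷ [] ⊩ κ 0 :≤ x :- t :* y) x y t lo e ,
              lin 4 (λ x y t L → x :≤ L ⇒ y :≡ κ 0 ⇒ 2 ⊙ t ∷ [] ⊩ x :- t :* y :≤ L) x y t L hi e
        ; L≥1 = L≥1 }

  mirrorₓ : ℤ → Unimod
  mirrorₓ L = unimod (- + 1) (+ 0) (+ 0) (+ 1) L (+ 0) (inj₂ refl)

  act-mirror : ∀ L p → act (mirrorₓ L) p ≡ (L - proj₁ p , proj₂ p)
  act-mirror L (x , y) = cong₂ _,_ (lin 3 (λ x y L → ⊢ :- κ 1 :* x :+ κ 0 :* y :+ L :≡ L :- x) x y L) (lin 2 (λ x y → ⊢ κ 0 :* x :+ κ 1 :* y :+ κ 0 :≡ y) x y)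

  mirrored : ∀ {T L} → Base T L → Base (map (act (mirrorₓ L)) T) L
  mirrored {T} {L} B = record
    { full = full-map φ {T} full ; hollow = hollow-map φ {T} hollow
    ; above = all-map φ {T} {λ p → + 0 ≤ proj₂ p} λ s s∈ → subst (λ p → + 0 ≤ proj₂ p) (sym (act-mirror L s)) (above s s∈)
    ; o∈ = pt≡ (ℤₚ.+-inverseʳ L) refl (to _ L∈)
    ; L∈ = pt≡ (ℤₚ.+-identityʳ L) refl (to _ o∈)
    ; row₀ = all-map φ {T} {λ p → proj₂ p ≡ + 0 → + 0 ≤ proj₁ p × proj₁ p ≤ L} λ s@(x , y) s∈ →
        subst (λ p → proj₂ p ≡ + 0 → + 0 ≤ proj₁ p × proj₁ p ≤ L) (sym (act-mirror L s)) λ e →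
          let (lo , hi) = row₀ s s∈ e in ℤₚ.i≤j⇒0≤j-i hi , lin 2 (λ x L → κ 0 :≤ x ⇒ ⊢ L :- x :≤ L) x L lo
    ; L≥1 = L≥1 }
    where
      open Base B
      φ = mirrorₓ L
      to : ∀ p → p ∈ T → (L - proj₁ p , proj₂ p) ∈ map (act φ) T
      to p p∈ = subst (_∈ map (act φ) T) (act-mirror L p) (∈-map⁺ (act φ) p∈)

  -- With t = ⌈x₀ / y₀⌉ the point (t , 1) is in the triangle spanned by the base and (x₀ , y₀), hence on its boundary.
  tall : ∀ {T L} x₀ y₀ → Base T L → (x₀ , y₀) ∈ T → + 2 ≤ y₀ → HollowOutcome T
  tall {T} {L} x₀ y₀ B y∈ y₀≥2 = go (divide (- x₀) y₀ y₀≥2)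
    where
      open Base B
      go : (Σ ℤ λ q → Σ ℤ λ j → - x₀ ≡ j + q * y₀ × + 0 ≤ j × j < y₀) → HollowOutcome T
      go (q , j , x₀≡ , j≥0 , j<y₀) = cases (≤⊎> j (+ 0)) (≤⊎> ((y₀ - + 1) * L) j) (hollow (- q , + 1))
        where
          cases : j ≤ + 0 ⊎ + 0 < j → (y₀ - + 1) * L ≤ j ⊎ j < (y₀ - + 1) * L → Sep T (- q , + 1) → HollowOutcome T
          cases (inj₁ j≤0) _ _ = slanted x₀ y₀ (- q) B y∈ y₀≥2 (lin 4 (λ x y q j → :- x :≡ j :+ q :* y ⇒ j :≤ κ 0 ⇒ κ 0 :≤ j ⇒ ⊢ x :≡ :- q :* y) x₀ y₀ q j x₀≡ j≤0 j≥0)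
          -- Here `(-q , 1)` is not strictly inside the triangle, which means `L = 1` and
          -- `j = y₀ - 1`. After reflection the first coordinate `L - x₀` is divisible by `y₀`.
          cases (inj₂ _) (inj₁ k) _ = hollow-viaFrame (mirrorₓ L) T (slanted (L - x₀) y₀ (q + + 1) (mirrored B)
              (subst (_∈ map (act (mirrorₓ L)) T) (act-mirror L (x₀ , y₀)) (∈-map⁺ (act (mirrorₓ L)) y∈)) y₀≥2
              (lin 5 (λ x y q j L → :- x :≡ j :+ q :* y ⇒ L :≡ κ 1 ⇒ (y :- κ 1) :* L :≤ j ⇒ j :< y ⇒ 2 ⊙ y ∷ [] ⊩ L :- x :≡ (q :+ κ 1) :* y) x₀ y₀ q j L x₀≡ L≡1 k j<y₀))
            where
              L≡1 : L ≡ + 1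
              L≡1 = lin 3 (λ y j L → κ 1 :≤ L ⇒ (y :- κ 1) :* L :≤ j ⇒ j :< y ⇒ κ 2 :≤ y ⇒ 0 ⊛ 4 ∷ [] ⊩ L :≡ κ 1) y₀ j L L≥1 k j<y₀ y₀≥2
          cases (inj₂ j>0) (inj₂ k) ((u₁ , u₂) , nz , h) = ⊥-elim (nz (u₁≡0 , u₂≡0))
            where
              P = u₁ * (- q) + u₂
              hA : u₁ * x₀ + u₂ * y₀ ≤ P
              hA = lin 5 (λ u₁ u₂ x y q → u₁ :* x :+ u₂ :* y :≤ u₁ :* (:- q) :+ u₂ :* κ 1 ⇒ ⊢ u₁ :* x :+ u₂ :* y :≤ u₁ :* (:- q) :+ u₂) u₁ u₂ x₀ y₀ q (h _ y∈)
              hB : u₁ * L ≤ P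
              hB = lin 4 (λ u₁ u₂ q L → u₁ :* L :+ u₂ :* κ 0 :≤ u₁ :* (:- q) :+ u₂ :* κ 1 ⇒ ⊢ u₁ :* L :≤ u₁ :* (:- q) :+ u₂) u₁ u₂ q L (h _ L∈)
              hC : + 0 ≤ P
              hC = lin 3 (λ u₁ u₂ q → u₁ :* κ 0 :+ u₂ :* κ 0 :≤ u₁ :* (:- q) :+ u₂ :* κ 1 ⇒ ⊢ κ 0 :≤ u₁ :* (:- q) :+ u₂) u₁ u₂ q (h _ o∈)
              -- The point `(-q , 1)` is the mean of `(x₀ , y₀)`, `(L , 0)` and the origin with
              -- weights `L`, `j` and `(y₀ - 1) L - j`, all positive here. So a supporting form at
              -- it is constant on the triangle, hence zero.
              bary : L * (P - (u₁ * x₀ + u₂ * y₀)) + j * (P - u₁ * L) + ((y₀ - + 1) * L - j) * P ≡ + 0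
              bary = lin 7 (λ u₁ u₂ x y q j L → :- x :≡ j :+ q :* y ⇒ 1 ⊙ (L :* u₁) ∷ [] ⊩
                L :* (u₁ :* (:- q) :+ u₂ :- (u₁ :* x :+ u₂ :* y)) :+ j :* (u₁ :* (:- q) :+ u₂ :- u₁ :* L) :+ ((y :- κ 1) :* L :- j) :* (u₁ :* (:- q) :+ u₂) :≡ κ 0) u₁ u₂ x₀ y₀ q j L x₀≡
              P≡0 : P ≡ + 0
              P≡0 = lin 6 (λ L A j B K P → L :* A :+ j :* B :+ K :* P :≡ κ 0 ⇒ κ 1 :≤ L ⇒ κ 0 :≤ A ⇒ κ 0 :< j ⇒ κ 0 :≤ B ⇒ κ 0 :< K ⇒ κ 0 :≤ P ⇒ 2 ⊛ 3 ∷ 4 ⊛ 5 ∷ 6 ⊛ 7 ∷ [] ⊩ P :≡ κ 0)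
                L (P - (u₁ * x₀ + u₂ * y₀)) j (P - u₁ * L) ((y₀ - + 1) * L - j) P bary L≥1 (ℤₚ.i≤j⇒0≤j-i hA) j>0 (ℤₚ.i≤j⇒0≤j-i hB) (lin 2 (λ a j → j :< a ⇒ ⊢ κ 0 :< a :- j) ((y₀ - + 1) * L) j k) hC
              B≡0 : P - u₁ * L ≡ + 0
              B≡0 = lin 6 (λ L A j B K P → L :* A :+ j :* B :+ K :* P :≡ κ 0 ⇒ κ 1 :≤ L ⇒ κ 0 :≤ A ⇒ κ 0 :< j ⇒ κ 0 :≤ B ⇒ κ 0 :< K ⇒ κ 0 :≤ P ⇒ 2 ⊛ 3 ∷ 4 ⊛ 5 ∷ 6 ⊛ 7 ∷ [] ⊩ B :≡ κ 0)
                L (P - (u₁ * x₀ + u₂ * y₀)) j (P - u₁ * L) ((y₀ - + 1) * L - j) P bary L≥1 (ℤₚ.i≤j⇒0≤j-i hA) j>0 (ℤₚ.i≤j⇒0≤j-i hB) (lin 2 (λ a j → j :< a ⇒ ⊢ κ 0 :< a :- j) ((y₀ - + 1) * L) j k) hC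
              u₁≡0 : u₁ ≡ + 0
              u₁≡0 = ℤₚ.≤-antisym
                (lin 3 (λ P u L → P :≡ κ 0 ⇒ P :- u :* L :≡ κ 0 ⇒ κ 1 :≤ L ⇒ 0 ⊛ 3 ∷ [] ⊩ u :≤ κ 0) P u₁ L P≡0 B≡0 L≥1)
                (lin 3 (λ P u L → P :≡ κ 0 ⇒ P :- u :* L :≡ κ 0 ⇒ κ 1 :≤ L ⇒ 0 ⊛ 3 ∷ [] ⊩ κ 0 :≤ u) P u₁ L P≡0 B≡0 L≥1)
              u₂≡0 : u₂ ≡ + 0
              u₂≡0 = lin 3 (λ u₁ u₂ q → u₁ :* (:- q) :+ u₂ :≡ κ 0 ⇒ u₁ :≡ κ 0 ⇒ 2 ⊙ q ∷ [] ⊩ u₂ :≡ κ 0) u₁ u₂ q P≡0 u₁≡0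

  based : ∀ {T L} → Base T L → HollowOutcome T
  based {T} {L} B with search (λ t → + 2 ℤₚ.≤? proj₂ t) T
  ... | inj₁ ((x₀ , y₀) , y∈ , h) = tall x₀ y₀ B y∈ h
  ... | inj₂ none = strip T full λ t t∈ → above t t∈ , lin 1 (λ y → y :< κ 2 ⇒ ⊢ y :≤ κ 1) (proj₂ t) (ℤₚ.≰⇒> (none t t∈))
    where open Base B

  onLine : ∀ T → Full T → Hollow T → (∀ t → t ∈ T → + 0 ≤ proj₂ t) → ∀ x₁ x₂ → (x₁ , + 0) ∈ T → (x₂ , + 0) ∈ T → x₁ < x₂ → HollowOutcome T
  onLine T full hol above x₁ x₂ m₁ m₂ lt = go (argminOn zero? proj₁ T m₁ refl) (argmaxOn zero? proj₁ T m₁ refl)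
    where
      zero? = λ (s : Pt) → proj₂ s ℤₚ.≟ + 0
      go : (Σ Pt λ s → s ∈ T × proj₂ s ≡ + 0 × (∀ t → t ∈ T → proj₂ t ≡ + 0 → proj₁ s ≤ proj₁ t)) → (Σ Pt λ s → s ∈ T × proj₂ s ≡ + 0 × (∀ t → t ∈ T → proj₂ t ≡ + 0 → proj₁ t ≤ proj₁ s)) → HollowOutcome T
      go ((l , _) , l∈ , refl , ml) ((r , _) , r∈ , refl , mr) = hollow-viaFrame φ T (based {map (act φ) T} {r - l} record
        { full = full-map φ {T} full ; hollow = hollow-map φ {T} hol
        ; above = all-map φ {T} {λ p → + 0 ≤ proj₂ p} λ s s∈ → subst (λ p → + 0 ≤ proj₂ p) (sym (act-φ s)) (above s s∈)
        ; o∈ = pt≡ (ℤₚ.+-inverseʳ l) refl (to _ l∈)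
        ; L∈ = to _ r∈
        ; row₀ = all-map φ {T} {λ p → proj₂ p ≡ + 0 → + 0 ≤ proj₁ p × proj₁ p ≤ r - l} λ s@(x , y) s∈ →
            subst (λ p → proj₂ p ≡ + 0 → + 0 ≤ proj₁ p × proj₁ p ≤ r - l) (sym (act-φ s)) λ e → ℤₚ.i≤j⇒0≤j-i (ml s s∈ e) , ℤₚ.+-monoˡ-≤ (- l) (mr s s∈ e)
        ; L≥1 = lin 4 (λ l r x₁ x₂ → l :≤ x₁ ⇒ x₂ :≤ r ⇒ x₁ :< x₂ ⇒ ⊢ κ 1 :≤ r :- l) l r x₁ x₂ (ml _ m₁ refl) (mr _ m₂ refl) lt })
        where
          φ = translate (- l) (+ 0)
          act-φ : ∀ p → act φ p ≡ (proj₁ p - l , proj₂ p)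
          act-φ p = trans (act-translate (- l) (+ 0) p) (cong (proj₁ p - l ,_) (ℤₚ.+-identityʳ (proj₂ p)))
          to : ∀ p → p ∈ T → (proj₁ p - l , proj₂ p) ∈ map (act φ) T
          to p p∈ = subst (_∈ map (act φ) T) (act-φ p) (∈-map⁺ (act φ) p∈)

  -- One gift-wrapping step finds an edge at a leftmost point `v`: a second leftmost point gives a
  -- vertical edge, and otherwise `v` is joined to the point met first when turning counterclockwise
  -- from the downward direction.
  hollow-outcome : ∀ S → Full S → Hollow S → HollowOutcome S
  hollow-outcome S full hol = start (full (+ 1 , + 0) (λ ()))
    where
      module _ (v : Pt) (v∈ : v ∈ S) (v-min : ∀ t → t ∈ S → proj₁ v ≤ proj₁ t) where
        v₁ = proj₁ v
        v₂ = proj₂ v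

        vertical : ∀ s → s ∈ S → proj₁ s ≡ v₁ × ¬ (proj₂ s ≡ v₂) → HollowOutcome S
        vertical s s∈ (e , ne) = hollow-viaFrame φ S (order (ℤₚ.<-cmp (proj₂ s) v₂))
          where
            φ = unimod (+ 0) (+ 1) (+ 1) (+ 0) (+ 0) (- v₁) (inj₂ refl)
            T = map (act φ) S
            act-φ : ∀ p → act φ p ≡ (proj₂ p , proj₁ p - v₁)
            act-φ (x , y) = cong₂ _,_ (lin 2 (λ x y → ⊢ κ 0 :* x :+ κ 1 :* y :+ κ 0 :≡ y) x y) (lin 3 (λ x y v → ⊢ κ 1 :* x :+ κ 0 :* y :+ :- v :≡ x :- v) x y v₁)
            above : ∀ t → t ∈ T → + 0 ≤ proj₂ t
            above = all-map φ {S} {λ t → + 0 ≤ proj₂ t} λ p p∈ → subst (λ t → + 0 ≤ proj₂ t) (sym (act-φ p)) (ℤₚ.i≤j⇒0≤j-i (v-min p p∈))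
            to : ∀ p → p ∈ S → proj₁ p ≡ v₁ → (proj₂ p , + 0) ∈ T
            to p p∈ e = pt≡ refl (ℤₚ.i≡j⇒i-j≡0 e) (subst (_∈ T) (act-φ p) (∈-map⁺ (act φ) p∈))
            line = onLine T (full-map φ {S} full) (hollow-map φ {S} hol) above
            order : Tri (proj₂ s < v₂) (proj₂ s ≡ v₂) (v₂ < proj₂ s) → HollowOutcome T
            order (tri< lt _ _) = line (proj₂ s) v₂ (to s s∈ e) (to v v∈ refl) lt
            order (tri≈ _ eq _) = ⊥-elim (ne eq)
            order (tri> _ _ gt) = line v₂ (proj₂ s) (to v v∈ refl) (to s s∈ e) gt

        open Directions v (+ 0 , - + 1)

        d≡ : ∀ t → d t ≡ proj₁ t - v₁
        d≡ (x , y) = lin 4 (λ x y v₁ v₂ → ⊢ κ 0 :* (y :- v₂) :- :- κ 1 :* (x :- v₁) :≡ x :- v₁) x y v₁ v₂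

        steepest : (∀ s → s ∈ S → ¬ (proj₁ s ≡ v₁ × ¬ (proj₂ s ≡ v₂))) → ∀ t₀ → Closest S t₀ → HollowOutcome S
        steepest unique t₀ (t₀∈ , d>0 , least) = frame (reduce w)
          where
            w = t₀ ⊖ v
            w₁ = proj₁ w
            w₂ = proj₂ w
            w₁>0 : + 0 < w₁
            w₁>0 = subst (+ 0 <_) (d≡ t₀) d>0
            left : ∀ s → s ∈ S → + 0 ≤ det w (s ⊖ v)
            left s s∈ = side (ℤₚ.<-cmp v₁ (proj₁ s)) (proj₂ s ℤₚ.≟ v₂)
              where
                side : Tri (v₁ < proj₁ s) (v₁ ≡ proj₁ s) (proj₁ s < v₁) → Dec (proj₂ s ≡ v₂) → + 0 ≤ det w (s ⊖ v)
                side (tri< lt _ _) _ = least s s∈ (subst (+ 0 <_) (sym (d≡ s)) (lin 2 (λ a b → a :< b ⇒ ⊢ κ 0 :< b :- a) v₁ (proj₁ s) lt))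
                side (tri≈ _ eq _) (yes eq′) = lin 6 (λ w₁ w₂ x y v₁ v₂ → v₁ :≡ x ⇒ y :≡ v₂ ⇒ 1 ⊙ w₂ ∷ 2 ⊙ w₁ ∷ [] ⊩ κ 0 :≤ w₁ :* (y :- v₂) :- w₂ :* (x :- v₁)) w₁ w₂ (proj₁ s) (proj₂ s) v₁ v₂ eq eq′
                side (tri≈ _ eq _) (no ne) = ⊥-elim (unique s s∈ (sym eq , ne))
                side (tri> _ _ gt) _ = ⊥-elim (ℤₚ.<⇒≱ gt (v-min s s∈))
            frame : Reduced w → HollowOutcome S
            frame (reduced g (a , b) (c , e) g≥0 w₁≡ w₂≡ one) = hollow-viaFrame φ S (onLine T (full-map φ {S} full) (hollow-map φ {S} hol) above (+ 0) g
                (subst (_∈ T) (trans (act-φ v) (cong₂ _,_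
                  (lin 4 (λ v₁ v₂ c e → ⊢ (v₁ :- v₁) :* (:- e) :- (v₂ :- v₂) :* (:- c) :≡ κ 0) v₁ v₂ c e)
                  (lin 4 (λ v₁ v₂ a b → ⊢ a :* (v₂ :- v₂) :- b :* (v₁ :- v₁) :≡ κ 0) v₁ v₂ a b))) (∈-map⁺ (act φ) v∈))
                (subst (_∈ T) (trans (act-φ t₀) (cong₂ _,_
                  (lin 7 (λ w₁ w₂ g a b c e → w₁ :≡ g :* a ⇒ w₂ :≡ g :* b ⇒ c :* b :- e :* a :≡ κ 1 ⇒ 1 ⊙ e ∷ 2 ⊙ c ∷ 3 ⊙ g ∷ [] ⊩ w₁ :* (:- e) :- w₂ :* (:- c) :≡ g) w₁ w₂ g a b c e w₁≡ w₂≡ one)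
                  (lin 5 (λ w₁ w₂ g a b → w₁ :≡ g :* a ⇒ w₂ :≡ g :* b ⇒ 1 ⊙ b ∷ 2 ⊙ a ∷ [] ⊩ a :* w₂ :- b :* w₁ :≡ κ 0) w₁ w₂ g a b w₁≡ w₂≡))) (∈-map⁺ (act φ) t₀∈))
                g>0)
              where
                unit′ : det (a , b) (- c , - e) ≡ + 1
                unit′ = lin 4 (λ a b c e → c :* b :- e :* a :≡ κ 1 ⇒ ⊢ a :* (:- e) :- b :* (:- c) :≡ κ 1) a b c e one
                φ = basis v (a , b) (- c , - e) unit′
                T = map (act φ) S
                act-φ = act-basis v (a , b) (- c , - e) unit′
                g>0 : + 0 < g
                g>0 with ≤⊎> g (+ 0)
                ... | inj₂ k = k
                ... | inj₁ k = ⊥-elim (lin 3 (λ g w a → κ 0 :< w ⇒ g :≡ κ 0 ⇒ w :≡ g :* a ⇒ 2 ⊙ a ∷ [] ⊩ :⊥) g w₁ a w₁>0 (ℤₚ.≤-antisym k g≥0) w₁≡)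
                above : ∀ t → t ∈ T → + 0 ≤ proj₂ t
                above = all-map φ {S} {λ t → + 0 ≤ proj₂ t} λ s s∈ → subst (λ t → + 0 ≤ proj₂ t) (sym (act-φ s))
                  (lin 7 (λ g a b x y w₁ w₂ → κ 0 :< g ⇒ w₁ :≡ g :* a ⇒ w₂ :≡ g :* b ⇒ κ 0 :≤ w₁ :* y :- w₂ :* x ⇒ 2 ⊙ y ∷ 3 ⊙ x ∷ 0 ⊛ 1 ∷ [] ⊩ κ 0 :≤ a :* y :- b :* x)
                    g a b (proj₁ s - v₁) (proj₂ s - v₂) w₁ w₂ g>0 w₁≡ w₂≡ (left s s∈))

        edge : (Σ Pt λ s → s ∈ S × (proj₁ s ≡ v₁ × ¬ (proj₂ s ≡ v₂))) ⊎ (∀ s → s ∈ S → ¬ (proj₁ s ≡ v₁ × ¬ (proj₂ s ≡ v₂))) →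
               (Σ Pt (Closest S)) ⊎ (∀ t → t ∈ S → ¬ (+ 0 < d t)) → (Σ Pt λ t → t ∈ S × v₁ < proj₁ t) → HollowOutcome S
        edge (inj₁ (s , s∈ , h)) _ _ = vertical s s∈ h
        edge (inj₂ unique) (inj₁ (t₀ , c)) _ = steepest unique t₀ c
        edge (inj₂ _) (inj₂ none) (t , t∈ , lt) = ⊥-elim (none t t∈ (subst (+ 0 <_) (sym (d≡ t)) (lin 2 (λ a b → a :< b ⇒ ⊢ κ 0 :< b :- a) v₁ (proj₁ t) lt)))

      start : (Σ Pt λ s → Σ Pt λ t → s ∈ S × t ∈ S × (+ 1 , + 0) ∙ s < (+ 1 , + 0) ∙ t) → HollowOutcome S
      start (s , t , s∈ , t∈ , lt) = go (argmin proj₁ S s∈)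
        where
          go : (Σ Pt λ v → v ∈ S × (∀ t → t ∈ S → proj₁ v ≤ proj₁ t)) → HollowOutcome S
          go (v , v∈ , v-min) = edge v v∈ v-min (search (λ s → (proj₁ s ℤₚ.≟ proj₁ v) ×-dec ¬? (proj₂ s ℤₚ.≟ proj₂ v)) S) (Directions.closest v (+ 0 , - + 1) S)
            (t , t∈ , ℤₚ.≤-<-trans (v-min s s∈) (lin 4 (λ a b c d → κ 1 :* a :+ κ 0 :* b :< κ 1 :* c :+ κ 0 :* d ⇒ ⊢ a :< c) (proj₁ s) (proj₂ s) (proj₁ t) (proj₂ t) lt))

-- Lower bounds for the lattice size and its computability

module LatticeSize where
  open import Data.Integer using (_+_; _*_; _-_; -_; _≤_; _<_; ∣_∣)
  open import Data.List using (cartesianProduct)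
  open import Data.List.Membership.Propositional using (find; lose)
  open import Data.List.Membership.Propositional.Properties using (∈-cartesianProduct⁺)
  open import Data.List.Relation.Unary.Any using (any?)
  open import Data.List.Relation.Unary.All as All using (All; all?)
  open import Data.Nat using (zero; suc; z≤n; s≤s)
  open import Relation.Nullary.Decidable using (_×-dec_; _⊎-dec_)
  open Lattice
  open Frames
  open Configurations
  open Reflexive using (≤⊎>)
  open HollowPolygons using (Full)

  Bit : ℤ → Set
  Bit t = t ≡ + 0 ⊎ t ≡ + 1

  -- max (p + q , 0) − min (p , 0) − min (q , 0) ≥ 1
  bits : ∀ p q → NonZero (p , q) → Σ ℤ λ t₁ → Σ ℤ λ t₂ → Σ ℤ λ t₃ → Bit t₁ × Bit t₂ × Bit t₃ × + 1 ≤ (p + q) * t₃ - p * t₁ - q * t₂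
  bits p q nz with ≤⊎> (+ 0) p | ≤⊎> (+ 0) q
  ... | inj₂ p<0 | _ = + 1 , + 0 , + 0 , inj₂ refl , inj₁ refl , inj₁ refl , lin 2 (λ p q → p :< κ 0 ⇒ ⊢ κ 1 :≤ (p :+ q) :* κ 0 :- p :* κ 1 :- q :* κ 0) p q p<0
  ... | inj₁ _ | inj₂ q<0 = + 0 , + 1 , + 0 , inj₁ refl , inj₂ refl , inj₁ refl , lin 2 (λ p q → q :< κ 0 ⇒ ⊢ κ 1 :≤ (p :+ q) :* κ 0 :- p :* κ 0 :- q :* κ 1) p q q<0
  ... | inj₁ p≥0 | inj₁ q≥0 with ≤⊎> (p + q) (+ 0)
  ...   | inj₁ s≤0 = ⊥-elim (nz (lin 2 (λ p q → κ 0 :≤ p ⇒ κ 0 :≤ q ⇒ p :+ q :≤ κ 0 ⇒ ⊢ p :≡ κ 0) p q p≥0 q≥0 s≤0 , lin 2 (λ p q → κ 0 :≤ p ⇒ κ 0 :≤ q ⇒ p :+ q :≤ κ 0 ⇒ ⊢ q :≡ κ 0) p q p≥0 q≥0 s≤0))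
  ...   | inj₂ s>0 = + 0 , + 0 , + 1 , inj₁ refl , inj₁ refl , inj₂ refl , lin 2 (λ p q → κ 0 :< p :+ q ⇒ ⊢ κ 1 :≤ (p :+ q) :* κ 1 :- p :* κ 0 :- q :* κ 0) p q s>0

  push : Unimod → Pt → Pt
  push φ (x , y) = (a₁₁ * x + a₁₂ * y , a₂₁ * x + a₂₂ * y)
    where open Unimod φ

  push-nonZero : ∀ φ w → NonZero w → NonZero (push φ w)
  push-nonZero φ@(unimod a b c d w₁ w₂ h) (x , y) nz (e , f) = nz
    ( lin 7 (λ D a b c d x y → D :≡ a :* d :- b :* c ⇒ D :* D :≡ κ 1 ⇒ a :* x :+ b :* y :≡ κ 0 ⇒ c :* x :+ d :* y :≡ κ 0 ⇒
        2 ⊙ x ∷ 1 ⊙ (D :* x) ∷ 3 ⊙ (D :* d) ∷ 4 ⊙ (D :* b) ∷ [] ⊩ x :≡ κ 0) (Det φ) a b c d x y refl (Det² φ) e f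
    , lin 7 (λ D a b c d x y → D :≡ a :* d :- b :* c ⇒ D :* D :≡ κ 1 ⇒ a :* x :+ b :* y :≡ κ 0 ⇒ c :* x :+ d :* y :≡ κ 0 ⇒
        2 ⊙ y ∷ 1 ⊙ (D :* y) ∷ 3 ⊙ (D :* c) ∷ 4 ⊙ (D :* a) ∷ [] ⊩ y :≡ κ 0) (Det φ) a b c d x y refl (Det² φ) e f )

  offset : Pt → (a : ℤ) → Pt → (b : ℤ) → Pt → ℤ → ℤ → Pt
  offset (c₁ , c₂) a (w₁ , w₂) b (v₁ , v₂) i j = (c₁ + i * (a * w₁) + j * (b * v₁) , c₂ + i * (a * w₂) + j * (b * v₂))

  -- The quantity max(x + y) - min x - min y is at most `d` on the triangle of size `d` and is
  -- additive over the two sides of a parallelogram; by `bits` it is at least 1 for the image of a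
  -- nonzero lattice vector. The lower bounds for edges and rectangles come from here.
  parallelogram-bound : ∀ φ d c a w b v → + 0 ≤ a → + 0 ≤ b → NonZero w → NonZero v →
                        (∀ i j → Bit i → Bit j → InΔ d (act φ (offset c a w b v i j))) → a + b ≤ d
  parallelogram-bound φ d c@(c₁ , c₂) a w@(w₁ , w₂) b v@(v₁ , v₂) a≥0 b≥0 w≢0 v≢0 h =
      go (bits p q (push-nonZero φ w w≢0)) (bits p′ q′ (push-nonZero φ v v≢0))
    where
      p = proj₁ (push φ w)
      q = proj₂ (push φ w)
      p′ = proj₁ (push φ v)
      q′ = proj₂ (push φ v)
      X = proj₁ (act φ c)
      Y = proj₂ (act φ c)
      open Unimod φ renaming (w₁ to z₁; w₂ to z₂)
      line : ∀ α β γ i j → α * (c₁ + i * (a * w₁) + j * (b * v₁)) + β * (c₂ + i * (a * w₂) + j * (b * v₂)) + γ ≡ (α * c₁ + β * c₂ + γ) + i * a * (α * w₁ + β * w₂) + j * b * (α * v₁ + β * v₂)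
      line α β γ i j = lin 13 (λ α β γ i j a b c₁ c₂ w₁ w₂ v₁ v₂ → ⊢ α :* (c₁ :+ i :* (a :* w₁) :+ j :* (b :* v₁)) :+ β :* (c₂ :+ i :* (a :* w₂) :+ j :* (b :* v₂)) :+ γ
        :≡ (α :* c₁ :+ β :* c₂ :+ γ) :+ i :* a :* (α :* w₁ :+ β :* w₂) :+ j :* b :* (α :* v₁ :+ β :* v₂)) α β γ i j a b c₁ c₂ w₁ w₂ v₁ v₂
      xOf : ∀ i j → proj₁ (act φ (offset c a w b v i j)) ≡ X + i * a * p + j * b * p′
      xOf = line a₁₁ a₁₂ z₁
      yOf : ∀ i j → proj₂ (act φ (offset c a w b v i j)) ≡ Y + i * a * q + j * b * q′
      yOf = line a₂₁ a₂₂ z₂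
      go : (Σ ℤ λ t₁ → Σ ℤ λ t₂ → Σ ℤ λ t₃ → Bit t₁ × Bit t₂ × Bit t₃ × + 1 ≤ (p + q) * t₃ - p * t₁ - q * t₂) →
           (Σ ℤ λ t₁ → Σ ℤ λ t₂ → Σ ℤ λ t₃ → Bit t₁ × Bit t₂ × Bit t₃ × + 1 ≤ (p′ + q′) * t₃ - p′ * t₁ - q′ * t₂) → a + b ≤ d
      go (t₁ , t₂ , t₃ , k₁ , k₂ , k₃ , big) (s₁ , s₂ , s₃ , m₁ , m₂ , m₃ , big′) =
        lin 8 (λ x₁ y₂ z₃ a b A B d → κ 0 :≤ x₁ ⇒ κ 0 :≤ y₂ ⇒ a :≤ A ⇒ b :≤ B ⇒ A :+ B :≤ z₃ :- x₁ :- y₂ ⇒ z₃ :≤ d ⇒ ⊢ a :+ b :≤ d)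
          (proj₁ (act φ (offset c a w b v t₁ s₁))) (proj₂ (act φ (offset c a w b v t₂ s₂))) (proj₁ (act φ (offset c a w b v t₃ s₃)) + proj₂ (act φ (offset c a w b v t₃ s₃)))
          a b (a * ((p + q) * t₃ - p * t₁ - q * t₂)) (b * ((p′ + q′) * s₃ - p′ * s₁ - q′ * s₂)) d
          (proj₁ (h t₁ s₁ k₁ m₁)) (proj₁ (proj₂ (h t₂ s₂ k₂ m₂))) (expand a _ a≥0 big) (expand b _ b≥0 big′)
          (ℤₚ.≤-reflexive total)
          (proj₂ (proj₂ (h t₃ s₃ k₃ m₃)))
        where
          expand : ∀ a z → + 0 ≤ a → + 1 ≤ z → a ≤ a * z
          expand = lin 2 λ a z → κ 0 :≤ a ⇒ κ 1 :≤ z ⇒ 1 ⊛ 2 ∷ [] ⊩ a :≤ a :* z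
          total : a * ((p + q) * t₃ - p * t₁ - q * t₂) + b * ((p′ + q′) * s₃ - p′ * s₁ - q′ * s₂)
                  ≡ proj₁ (act φ (offset c a w b v t₃ s₃)) + proj₂ (act φ (offset c a w b v t₃ s₃)) - proj₁ (act φ (offset c a w b v t₁ s₁)) - proj₂ (act φ (offset c a w b v t₂ s₂))
          total = trans (lin 14 (λ X Y a b p q p′ q′ t₁ t₂ t₃ s₁ s₂ s₃ → ⊢ a :* ((p :+ q) :* t₃ :- p :* t₁ :- q :* t₂) :+ b :* ((p′ :+ q′) :* s₃ :- p′ :* s₁ :- q′ :* s₂)
              :≡ (X :+ t₃ :* a :* p :+ s₃ :* b :* p′) :+ (Y :+ t₃ :* a :* q :+ s₃ :* b :* q′) :- (X :+ t₁ :* a :* p :+ s₁ :* b :* p′) :- (Y :+ t₂ :* a :* q :+ s₂ :* b :* q′))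
              X Y a b p q p′ q′ t₁ t₂ t₃ s₁ s₂ s₃)
            (sym (cong₂ _-_ (cong₂ _-_ (cong₂ _+_ (xOf t₃ s₃) (yOf t₃ s₃)) (xOf t₁ s₁)) (yOf t₂ s₂)))

  segment-bound : ∀ φ d l r y → l ≤ r → InΔ d (act φ (l , y)) → InΔ d (act φ (r , y)) → r - l ≤ d
  segment-bound φ d l r y l≤r hl hr = subst (_≤ d) (ℤₚ.+-identityʳ (r - l))
    (parallelogram-bound φ d (l , y) (r - l) (+ 1 , + 0) (+ 0) (+ 1 , + 0) (ℤₚ.i≤j⇒0≤j-i l≤r) (ℤ.+≤+ z≤n) (λ ()) (λ ()) ends)
    where
      ends : ∀ i j → Bit i → Bit j → InΔ d (act φ (offset (l , y) (r - l) (+ 1 , + 0) (+ 0) (+ 1 , + 0) i j))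
      ends i j (inj₁ refl) _ = subst (λ p → InΔ d (act φ p)) (cong₂ _,_ (lin 3 (λ l r j → ⊢ l :≡ l :+ κ 0 :* ((r :- l) :* κ 1) :+ j :* κ 0) l r j) (lin 4 (λ y l r j → ⊢ y :≡ y :+ κ 0 :* ((r :- l) :* κ 0) :+ j :* κ 0) y l r j)) hl
      ends i j (inj₂ refl) _ = subst (λ p → InΔ d (act φ p)) (cong₂ _,_ (lin 3 (λ l r j → ⊢ r :≡ l :+ κ 1 :* ((r :- l) :* κ 1) :+ j :* κ 0) l r j) (lin 4 (λ y l r j → ⊢ y :≡ y :+ κ 1 :* ((r :- l) :* κ 0) :+ j :* κ 0) y l r j)) hr

  fit⇒fitInt : ∀ S d → Fit (_∈ S) d → Fit (Int S) (d - + 3)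
  fit⇒fitInt S d (φ , h) = fitInt-map φ {S} (translate (- + 1) (- + 1) , λ q@(x , y) i →
      let (x≥1 , y≥1) = int-≥1 {T} quad i in
      subst (InΔ (d - + 3)) (sym (act-translate (- + 1) (- + 1) q))
        ( lin 1 (λ x → κ 1 :≤ x ⇒ ⊢ κ 0 :≤ x :+ :- κ 1) x x≥1 , lin 1 (λ x → κ 1 :≤ x ⇒ ⊢ κ 0 :≤ x :+ :- κ 1) y y≥1
        , lin 3 (λ x y d → x :+ κ 1 :* y :< d ⇒ ⊢ x :+ :- κ 1 :+ (y :+ :- κ 1) :≤ d :- κ 3) x y d (int-slope< {T} (+ 1) d top i)))
    where
      T = map (act φ) S
      quad : Quadrant T
      quad = all-map φ {S} {λ t → + 0 ≤ proj₁ t × + 0 ≤ proj₂ t} λ s s∈ → proj₁ (h s s∈) , proj₁ (proj₂ (h s s∈))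
      top : ∀ t → t ∈ T → proj₁ t + + 1 * proj₂ t ≤ d
      top = all-map φ {S} {λ t → proj₁ t + + 1 * proj₂ t ≤ d} λ s s∈ → subst (λ z → proj₁ (act φ s) + z ≤ d) (sym (ℤₚ.*-identityˡ (proj₂ (act φ s)))) (proj₂ (proj₂ (h s s∈)))

  record Triangle (S : List Pt) : Set where
    constructor mkTriangle
    field
      s₁ s₂ s₃ : Pt
      m₁ : s₁ ∈ S
      m₂ : s₂ ∈ S
      m₃ : s₃ ∈ S
      independent : ¬ (det (s₂ ⊖ s₁) (s₃ ⊖ s₁) ≡ + 0)

  triangle⇒full : ∀ {S} → Triangle S → Full S
  triangle⇒full {S} (mkTriangle s₁ s₂ s₃ m₁ m₂ m₃ ne) u nz = compare (ℤₚ.<-cmp (u ∙ s₁) (u ∙ s₂)) (ℤₚ.<-cmp (u ∙ s₁) (u ∙ s₃))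
    where
      u₁ = proj₁ u
      u₂ = proj₂ u
      a = proj₁ (s₂ ⊖ s₁)
      b = proj₂ (s₂ ⊖ s₁)
      c = proj₁ (s₃ ⊖ s₁)
      d = proj₂ (s₃ ⊖ s₁)
      flat : u ∙ s₁ ≡ u ∙ s₂ → u ∙ s₁ ≡ u ∙ s₃ → ⊥
      flat e f = nz (cancel u₁ (lin 6 (λ u₁ u₂ a b c d → u₁ :* a :+ u₂ :* b :≡ κ 0 ⇒ u₁ :* c :+ u₂ :* d :≡ κ 0 ⇒ 1 ⊙ d ∷ 2 ⊙ b ∷ [] ⊩ u₁ :* (a :* d :- b :* c) :≡ κ 0) u₁ u₂ a b c d (diff s₂ e) (diff s₃ f))
                    , cancel u₂ (lin 6 (λ u₁ u₂ a b c d → u₁ :* a :+ u₂ :* b :≡ κ 0 ⇒ u₁ :* c :+ u₂ :* d :≡ κ 0 ⇒ 1 ⊙ c ∷ 2 ⊙ a ∷ [] ⊩ u₂ :* (a :* d :- b :* c) :≡ κ 0) u₁ u₂ a b c d (diff s₂ e) (diff s₃ f)))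
        where
          diff : ∀ s → u ∙ s₁ ≡ u ∙ s → u₁ * (proj₁ s - proj₁ s₁) + u₂ * (proj₂ s - proj₂ s₁) ≡ + 0
          diff s = lin 6 (λ u₁ u₂ x y x′ y′ → u₁ :* x :+ u₂ :* y :≡ u₁ :* x′ :+ u₂ :* y′ ⇒ ⊢ u₁ :* (x′ :- x) :+ u₂ :* (y′ :- y) :≡ κ 0) u₁ u₂ (proj₁ s₁) (proj₂ s₁) (proj₁ s) (proj₂ s)
          cancel : ∀ z → z * (a * d - b * c) ≡ + 0 → z ≡ + 0
          cancel z e with ℤₚ.i*j≡0⇒i≡0∨j≡0 z e
          ... | inj₁ k = k
          ... | inj₂ k = ⊥-elim (ne k)
      compare : Tri (u ∙ s₁ < u ∙ s₂) (u ∙ s₁ ≡ u ∙ s₂) (u ∙ s₂ < u ∙ s₁) → Tri (u ∙ s₁ < u ∙ s₃) (u ∙ s₁ ≡ u ∙ s₃) (u ∙ s₃ < u ∙ s₁) → Σ Pt λ s → Σ Pt λ t → s ∈ S × t ∈ S × u ∙ s < u ∙ t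
      compare (tri< h _ _) _ = s₁ , s₂ , m₁ , m₂ , h
      compare (tri> _ _ h) _ = s₂ , s₁ , m₂ , m₁ , h
      compare _ (tri< h _ _) = s₁ , s₃ , m₁ , m₃ , h
      compare _ (tri> _ _ h) = s₃ , s₁ , m₃ , m₁ , h
      compare (tri≈ _ e _) (tri≈ _ f _) = ⊥-elim (flat e f)

  -- Fit is decidable: the images of a triangle bound the entries of the frame.

  inΔ? : ∀ d p → Dec (InΔ d p)
  inΔ? d (x , y) = (+ 0 ℤₚ.≤? x) ×-dec ((+ 0 ℤₚ.≤? y) ×-dec (x + y ℤₚ.≤? d))

  ∣Da∣≥ : ∀ D a → ¬ (D ≡ + 0) → ∣ a ∣ ℕ.≤ ∣ D * a ∣
  ∣Da∣≥ D a ne = subst (∣ a ∣ ℕ.≤_) (sym (ℤₚ.abs-* D a)) (grow ∣ D ∣ λ e → ne (ℤₚ.∣i∣≡0⇒i≡0 e))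
    where
      grow : ∀ n → ¬ (n ≡ 0) → ∣ a ∣ ℕ.≤ n ℕ.* ∣ a ∣
      grow zero    ne = ⊥-elim (ne refl)
      grow (suc n) _  = ℕₚ.m≤m+n ∣ a ∣ (n ℕ.* ∣ a ∣)

  ∣∣-mul : ∀ {k} x y → ∣ x ∣ ℕ.≤ k → ∣ x * y ∣ ℕ.≤ k ℕ.* ∣ y ∣
  ∣∣-mul x y h = subst (ℕ._≤ _) (sym (ℤₚ.abs-* x y)) (ℕₚ.*-monoˡ-≤ ∣ y ∣ h)

  module _ {S : List Pt} (Δ : Triangle S) (n : ℕ) where
    open Triangle Δ
    private
      w = s₂ ⊖ s₁
      v = s₃ ⊖ s₁
      D = det w v
      -- By Cramer's rule `D` times a matrix entry is a combination of differences of image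
      -- coordinates, each at most `n` in absolute value, and `D` is a nonzero integer; so `K`
      -- bounds the matrix. `M` bounds the translation, read off at `s₁`.
      K M B : ℕ
      K = n ℕ.* ∣ proj₁ w ∣ ℕ.+ n ℕ.* ∣ proj₂ w ∣ ℕ.+ (n ℕ.* ∣ proj₁ v ∣ ℕ.+ n ℕ.* ∣ proj₂ v ∣)
      M = n ℕ.+ (K ℕ.* ∣ proj₁ s₁ ∣ ℕ.+ K ℕ.* ∣ proj₂ s₁ ∣)
      B = K ℕ.+ M

      Entries : Set
      Entries = ℤ × ℤ × ℤ × ℤ × ℤ × ℤ

      candidates : List Entries
      candidates = cartesianProduct I (cartesianProduct I (cartesianProduct I (cartesianProduct I (cartesianProduct I I))))
        where I = ints B

      image : Entries → Pt → Pt
      image (a , b , c , d , z₁ , z₂) (x , y) = (a * x + b * y + z₁ , c * x + d * y + z₂)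

      Good : Entries → Set
      Good e@(a , b , c , d , _) = ((a * d - b * c ≡ + 1) ⊎ (a * d - b * c ≡ - + 1)) × All (λ s → InΔ (+ n) (image e s)) S

      good? : ∀ e → Dec (Good e)
      good? e@(a , b , c , d , _) = ((a * d - b * c ℤₚ.≟ + 1) ⊎-dec (a * d - b * c ℤₚ.≟ - + 1)) ×-dec all? (λ s → inΔ? (+ n) (image e s)) S

      diff≤ : ∀ x y → + 0 ≤ x → x ≤ + n → + 0 ≤ y → y ≤ + n → ∣ x - y ∣ ℕ.≤ n
      diff≤ x y a b c d with ℤₚ.+∣i∣≡i⊎+∣i∣≡-i (x - y)
      ... | inj₁ e = ℤₚ.drop‿+≤+ (lin 4 (λ z x y n → z :≡ x :- y ⇒ x :≤ n ⇒ κ 0 :≤ y ⇒ ⊢ z :≤ n) (+ ∣ x - y ∣) x y (+ n) e b c)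
      ... | inj₂ e = ℤₚ.drop‿+≤+ (lin 4 (λ z x y n → z :≡ :- (x :- y) ⇒ y :≤ n ⇒ κ 0 :≤ x ⇒ ⊢ z :≤ n) (+ ∣ x - y ∣) x y (+ n) e d a)

      module _ (α β γ : ℤ) (f : Pt → ℤ) (f≡ : ∀ p → f p ≡ α * proj₁ p + β * proj₂ p + γ)
               (r₁ : + 0 ≤ f s₁ × f s₁ ≤ + n) (r₂ : + 0 ≤ f s₂ × f s₂ ≤ + n) (r₃ : + 0 ≤ f s₃ × f s₃ ≤ + n) where
        δ₂ = f s₂ - f s₁
        δ₃ = f s₃ - f s₁
        δ₂≤ : ∣ δ₂ ∣ ℕ.≤ n
        δ₂≤ = diff≤ (f s₂) (f s₁) (proj₁ r₂) (proj₂ r₂) (proj₁ r₁) (proj₂ r₁)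
        δ₃≤ : ∣ δ₃ ∣ ℕ.≤ n
        δ₃≤ = diff≤ (f s₃) (f s₁) (proj₁ r₃) (proj₂ r₃) (proj₁ r₁) (proj₂ r₁)
        δ≡ : ∀ s → f s - f s₁ ≡ α * proj₁ (s ⊖ s₁) + β * proj₂ (s ⊖ s₁)
        δ≡ s = lin 9 (λ f g α β γ x y x₁ y₁ → f :≡ α :* x :+ β :* y :+ γ ⇒ g :≡ α :* x₁ :+ β :* y₁ :+ γ ⇒ ⊢ f :- g :≡ α :* (x :- x₁) :+ β :* (y :- y₁))
          (f s) (f s₁) α β γ (proj₁ s) (proj₂ s) (proj₁ s₁) (proj₂ s₁) (f≡ s) (f≡ s₁)
        Dα : D * α ≡ δ₂ * proj₂ v - δ₃ * proj₂ w
        Dα = lin 8 (λ α β a b c d p q → p :≡ α :* a :+ β :* b ⇒ q :≡ α :* c :+ β :* d ⇒ 1 ⊙ d ∷ 2 ⊙ b ∷ [] ⊩ (a :* d :- b :* c) :* α :≡ p :* d :- q :* b) α β (proj₁ w) (proj₂ w) (proj₁ v) (proj₂ v) δ₂ δ₃ (δ≡ s₂) (δ≡ s₃)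
        Dβ : D * β ≡ δ₃ * proj₁ w - δ₂ * proj₁ v
        Dβ = lin 8 (λ α β a b c d p q → p :≡ α :* a :+ β :* b ⇒ q :≡ α :* c :+ β :* d ⇒ 1 ⊙ c ∷ 2 ⊙ a ∷ [] ⊩ (a :* d :- b :* c) :* β :≡ q :* a :- p :* c) α β (proj₁ w) (proj₂ w) (proj₁ v) (proj₂ v) δ₂ δ₃ (δ≡ s₂) (δ≡ s₃)
        two-terms : ∀ x y a b → ∣ x ∣ ℕ.≤ n → ∣ y ∣ ℕ.≤ n → ∣ x * a - y * b ∣ ℕ.≤ n ℕ.* ∣ a ∣ ℕ.+ n ℕ.* ∣ b ∣
        two-terms x y a b hx hy = ℕₚ.≤-trans (ℤₚ.∣i-j∣≤∣i∣+∣j∣ (x * a) (y * b)) (ℕₚ.+-mono-≤ (∣∣-mul x a hx) (∣∣-mul y b hy))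
        α≤K : ∣ α ∣ ℕ.≤ K
        α≤K = ℕₚ.≤-trans (∣Da∣≥ D α independent) (subst (λ z → ∣ z ∣ ℕ.≤ K) (sym Dα) (ℕₚ.≤-trans (two-terms δ₂ δ₃ (proj₂ v) (proj₂ w) δ₂≤ δ₃≤)
          (subst (ℕ._≤ K) (ℕₚ.+-comm (n ℕ.* ∣ proj₂ w ∣) (n ℕ.* ∣ proj₂ v ∣)) (ℕₚ.+-mono-≤ (ℕₚ.m≤n+m (n ℕ.* ∣ proj₂ w ∣) (n ℕ.* ∣ proj₁ w ∣)) (ℕₚ.m≤n+m (n ℕ.* ∣ proj₂ v ∣) (n ℕ.* ∣ proj₁ v ∣))))))
        β≤K : ∣ β ∣ ℕ.≤ K
        β≤K = ℕₚ.≤-trans (∣Da∣≥ D β independent) (subst (λ z → ∣ z ∣ ℕ.≤ K) (sym Dβ) (ℕₚ.≤-trans (two-terms δ₃ δ₂ (proj₁ w) (proj₁ v) δ₃≤ δ₂≤)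
          (ℕₚ.+-mono-≤ (ℕₚ.m≤m+n (n ℕ.* ∣ proj₁ w ∣) (n ℕ.* ∣ proj₂ w ∣)) (ℕₚ.m≤m+n (n ℕ.* ∣ proj₁ v ∣) (n ℕ.* ∣ proj₂ v ∣)))))
        γ≤M : ∣ γ ∣ ℕ.≤ M
        γ≤M = subst (λ z → ∣ z ∣ ℕ.≤ M) γ≡ (ℕₚ.≤-trans (ℤₚ.∣i-j∣≤∣i∣+∣j∣ (f s₁) (α * proj₁ s₁ + β * proj₂ s₁))
          (ℕₚ.+-mono-≤ (∣f∣≤ (f s₁) r₁) (ℕₚ.≤-trans (ℤₚ.∣i+j∣≤∣i∣+∣j∣ (α * proj₁ s₁) (β * proj₂ s₁)) (ℕₚ.+-mono-≤ (∣∣-mul α (proj₁ s₁) α≤K) (∣∣-mul β (proj₂ s₁) β≤K)))))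
          where
            ∣f∣≤ : ∀ z → + 0 ≤ z × z ≤ + n → ∣ z ∣ ℕ.≤ n
            ∣f∣≤ (+ k) (_ , ℤ.+≤+ h) = h
            γ≡ : f s₁ - (α * proj₁ s₁ + β * proj₂ s₁) ≡ γ
            γ≡ = lin 6 (λ f α β γ x y → f :≡ α :* x :+ β :* y :+ γ ⇒ ⊢ f :- (α :* x :+ β :* y) :≡ γ) (f s₁) α β γ (proj₁ s₁) (proj₂ s₁) (f≡ s₁)

        entries : α ∈ ints B × β ∈ ints B × γ ∈ ints B
        entries = member α (ℕₚ.≤-trans α≤K (ℕₚ.m≤m+n K M)) , member β (ℕₚ.≤-trans β≤K (ℕₚ.m≤m+n K M)) , member γ (ℕₚ.≤-trans γ≤M (ℕₚ.m≤n+m M K))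
          where
            member : ∀ z → ∣ z ∣ ℕ.≤ B → z ∈ ints B
            member z h = ∈-ints B z (proj₁ (∣∣≤ z B h)) (proj₂ (∣∣≤ z B h))

    fit? : Dec (Fit (_∈ S) (+ n))
    fit? with any? good? candidates
    ... | yes found = yes (from (find found))
      where
        from : (Σ Entries λ e → e ∈ candidates × Good e) → Fit (_∈ S) (+ n)
        from ((a , b , c , d , z₁ , z₂) , _ , u , h) = unimod a b c d z₁ z₂ u , λ s s∈ → All.lookup h s∈
    ... | no none = no λ (unimod a b c d z₁ z₂ u , h) →
      let φ = unimod a b c d z₁ z₂ u
          xr : ∀ {s} → s ∈ S → + 0 ≤ proj₁ (act φ s) × proj₁ (act φ s) ≤ + n
          xr {s} s∈ = let (p , q , r) = h s s∈ in p , lin 3 (λ x y n → κ 0 :≤ y ⇒ x :+ y :≤ n ⇒ ⊢ x :≤ n) (proj₁ (act φ s)) (proj₂ (act φ s)) (+ n) q r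
          yr : ∀ {s} → s ∈ S → + 0 ≤ proj₂ (act φ s) × proj₂ (act φ s) ≤ + n
          yr {s} s∈ = let (p , q , r) = h s s∈ in q , lin 3 (λ x y n → κ 0 :≤ x ⇒ x :+ y :≤ n ⇒ ⊢ y :≤ n) (proj₁ (act φ s)) (proj₂ (act φ s)) (+ n) p r
          (a∈ , b∈ , z₁∈) = entries a b z₁ (λ s → proj₁ (act φ s)) (λ _ → refl) (xr m₁) (xr m₂) (xr m₃)
          (c∈ , d∈ , z₂∈) = entries c d z₂ (λ s → proj₂ (act φ s)) (λ _ → refl) (yr m₁) (yr m₂) (yr m₃)
      in none (lose (∈-cartesianProduct⁺ a∈ (∈-cartesianProduct⁺ b∈ (∈-cartesianProduct⁺ c∈ (∈-cartesianProduct⁺ d∈ (∈-cartesianProduct⁺ z₁∈ z₂∈)))))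
                (u , All.tabulate λ {s} s∈ → h s s∈))

  least : ∀ {P : ℕ → Set} → (∀ n → Dec (P n)) → ∀ n → P n → Σ ℕ λ m → P m × (∀ k → P k → m ℕ.≤ k)
  least P? zero    p = 0 , p , λ _ _ → z≤n
  least {P} P? (suc n) p with P? 0
  ... | yes p₀ = 0 , p₀ , λ _ _ → z≤n
  ... | no ¬p₀ with least {λ k → P (suc k)} (λ k → P? (suc k)) n p
  ...   | m , pm , min = suc m , pm , λ { zero q → ⊥-elim (¬p₀ q) ; (suc k) q → s≤s (min k q) }

  some-fit : ∀ S → Σ ℕ λ n → Fit (_∈ S) (+ n)
  some-fit S = 4 ℕ.* b , translate (+ b) (+ b) , λ s s∈ → subst (InΔ (+ (4 ℕ.* b))) (sym (act-translate (+ b) (+ b) s)) (inside s s∈)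
    where
      b = bound S
      inside : ∀ s → s ∈ S → InΔ (+ (4 ℕ.* b)) (proj₁ s + + b , proj₂ s + + b)
      inside (x , y) s∈ = let (hx , hy) = bound-∈ S s∈ ; (lx , ux) = ∣∣≤ x b hx ; (ly , uy) = ∣∣≤ y b hy in
        lin 2 (λ x b → :- b :≤ x ⇒ ⊢ κ 0 :≤ x :+ b) x (+ b) lx , lin 2 (λ x b → :- b :≤ x ⇒ ⊢ κ 0 :≤ x :+ b) y (+ b) ly ,
        subst (x + + b + (y + + b) ≤_) (sym (ℤₚ.pos-* 4 b)) (lin 3 (λ x y b → x :≤ b ⇒ y :≤ b ⇒ ⊢ x :+ b :+ (y :+ b) :≤ κ 4 :* b) x y (+ b) ux uy)

  leastFit : ∀ {S} → Triangle S → Σ ℕ λ m → Fit (_∈ S) (+ m) × (∀ k → Fit (_∈ S) (+ k) → m ℕ.≤ k)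
  leastFit {S} Δ = least (fit? Δ) (proj₁ (some-fit S)) (proj₂ (some-fit S))

-- Rational convex hulls and their lattice points

module ConvexHulls where
  open import Data.List using (_++_)
  open import Data.List.Relation.Unary.All as All using (All; []; _∷_)
  open import Data.Rational using (0ℚ; 1ℚ; ½; _+_; _*_; _-_; -_; _≤_; _<_)
  open Lattice
  open Frames
  open LinearArithmetic using (module Linear)
  open OrderedRings

  open Linear ℚ-ring public using () renaming (lin to linℚ)

  Weighted : (Pt → Set) → List (ℚ × Pt) → Set
  Weighted P = All (λ wp → (0ℚ ≤ proj₁ wp) × P (proj₂ wp))

  -- Stated homogeneously in the total weight, because the tail of a convex combination no longer
  -- has weight one.
  wcomb-≤ : ∀ {P} α β γ → (∀ p → P p → α * ι (proj₁ p) + β * ι (proj₂ p) ≤ γ) → ∀ l → Weighted P l →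
            α * proj₁ (wcomb l) + β * proj₂ (wcomb l) ≤ γ * wsum l
  wcomb-≤ α β γ h [] [] = linℚ 3 (λ α β γ → ⊢ α :* κ 0 :+ β :* κ 0 :≤ γ :* κ 0) α β γ
  wcomb-≤ α β γ h ((w , (x , y)) ∷ l) ((w≥0 , p) ∷ ps) =
    linℚ 9 (λ α β γ w x y X Y W → κ 0 :≤ w ⇒ α :* x :+ β :* y :≤ γ ⇒ α :* X :+ β :* Y :≤ γ :* W ⇒ 1 ⊛ 2 ∷ [] ⊩ α :* (w :* x :+ X) :+ β :* (w :* y :+ Y) :≤ γ :* (w :+ W))
      α β γ w (ι x) (ι y) (proj₁ (wcomb l)) (proj₂ (wcomb l)) (wsum l) w≥0 (h _ p) (wcomb-≤ α β γ h l ps)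

  conv-≤ : ∀ {P q} α β γ → (∀ p → P p → α * ι (proj₁ p) + β * ι (proj₂ p) ≤ γ) → Conv P q → α * proj₁ q + β * proj₂ q ≤ γ
  conv-≤ α β γ h (l , ps , s , refl) = subst (α * proj₁ (wcomb l) + β * proj₂ (wcomb l) ≤_) (trans (cong (γ *_) s) (ℚₚ.*-identityʳ γ)) (wcomb-≤ α β γ h l ps)

  conv-point : ∀ {P} p → P p → Conv P (emb p)
  conv-point (x , y) p = (1ℚ , (x , y)) ∷ [] , (ℚₚ.nonNegative⁻¹ 1ℚ , p) ∷ [] , refl ,
    cong₂ _,_ (linℚ 1 (λ x → ⊢ κ 1 :* x :+ κ 0 :≡ x) (ι x)) (linℚ 1 (λ x → ⊢ κ 1 :* x :+ κ 0 :≡ x) (ι y))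

  scale : ℚ → List (ℚ × Pt) → List (ℚ × Pt)
  scale t []            = []
  scale t ((w , p) ∷ l) = (t * w , p) ∷ scale t l

  wsum-scale : ∀ t l → wsum (scale t l) ≡ t * wsum l
  wsum-scale t []            = sym (ℚₚ.*-zeroʳ t)
  wsum-scale t ((w , p) ∷ l) = trans (cong (λ z → t * w + z) (wsum-scale t l)) (sym (ℚₚ.*-distribˡ-+ t w (wsum l)))

  wcomb-scale : ∀ t l → wcomb (scale t l) ≡ (t * proj₁ (wcomb l) , t * proj₂ (wcomb l))
  wcomb-scale t []            = cong₂ _,_ (sym (ℚₚ.*-zeroʳ t)) (sym (ℚₚ.*-zeroʳ t))
  wcomb-scale t ((w , (x , y)) ∷ l) = cong₂ _,_
    (trans (cong (λ z → t * w * ι x + proj₁ z) (wcomb-scale t l)) (linℚ 4 (λ t w x X → ⊢ t :* w :* x :+ t :* X :≡ t :* (w :* x :+ X)) t w (ι x) (proj₁ (wcomb l))))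
    (trans (cong (λ z → t * w * ι y + proj₂ z) (wcomb-scale t l)) (linℚ 4 (λ t w x X → ⊢ t :* w :* x :+ t :* X :≡ t :* (w :* x :+ X)) t w (ι y) (proj₂ (wcomb l))))

  weighted-scale : ∀ {P} t l → 0ℚ ≤ t → Weighted P l → Weighted P (scale t l)
  weighted-scale t [] t≥0 [] = []
  weighted-scale t ((w , p) ∷ l) t≥0 ((w≥0 , h) ∷ hs) =
    (linℚ 2 (λ t w → κ 0 :≤ t ⇒ κ 0 :≤ w ⇒ 1 ⊛ 2 ∷ [] ⊩ κ 0 :≤ t :* w) t w t≥0 w≥0 , h) ∷ weighted-scale t l t≥0 hs

  wsum-++ : ∀ l m → wsum (l ++ m) ≡ wsum l + wsum m
  wsum-++ []            m = sym (ℚₚ.+-identityˡ _)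
  wsum-++ ((w , p) ∷ l) m = trans (cong (λ z → w + z) (wsum-++ l m)) (sym (ℚₚ.+-assoc w (wsum l) (wsum m)))

  wcomb-++ : ∀ l m → wcomb (l ++ m) ≡ (proj₁ (wcomb l) + proj₁ (wcomb m) , proj₂ (wcomb l) + proj₂ (wcomb m))
  wcomb-++ []                  m = cong₂ _,_ (sym (ℚₚ.+-identityˡ _)) (sym (ℚₚ.+-identityˡ _))
  wcomb-++ ((w , (x , y)) ∷ l) m = cong₂ _,_
    (trans (cong (λ z → w * ι x + proj₁ z) (wcomb-++ l m)) (sym (ℚₚ.+-assoc (w * ι x) _ _)))
    (trans (cong (λ z → w * ι y + proj₂ z) (wcomb-++ l m)) (sym (ℚₚ.+-assoc (w * ι y) _ _)))

  weighted-++ : ∀ {P} l m → Weighted P l → Weighted P m → Weighted P (l ++ m)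
  weighted-++ []      m []       k = k
  weighted-++ (_ ∷ l) m (h ∷ hs) k = h ∷ weighted-++ l m hs k

  conv-mix : ∀ {P q r} s t → 0ℚ ≤ s → 0ℚ ≤ t → s + t ≡ 1ℚ → Conv P q → Conv P r → Conv P (s * proj₁ q + t * proj₁ r , s * proj₂ q + t * proj₂ r)
  conv-mix s t s≥0 t≥0 st (l , hl , sl , refl) (m , hm , sm , refl) = scale s l ++ scale t m ,
    weighted-++ (scale s l) (scale t m) (weighted-scale s l s≥0 hl) (weighted-scale t m t≥0 hm) ,
    trans (wsum-++ (scale s l) (scale t m)) (trans (cong₂ _+_ (trans (wsum-scale s l) (trans (cong (s *_) sl) (ℚₚ.*-identityʳ s))) (trans (wsum-scale t m) (trans (cong (t *_) sm) (ℚₚ.*-identityʳ t)))) st) ,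
    trans (wcomb-++ (scale s l) (scale t m)) (cong₂ (λ a b → (proj₁ a + proj₁ b , proj₂ a + proj₂ b)) (wcomb-scale s l) (wcomb-scale t m))

  conv-bind : ∀ {P Q q} → (∀ p → P p → Conv Q (emb p)) → Conv P q → Conv Q q
  conv-bind {P} {Q} f (l , ps , s , refl) = let (m , hm , sm , cm) = go l ps in m , hm , trans sm s , cm
    where
      go : ∀ l → Weighted P l → Σ (List (ℚ × Pt)) λ m → Weighted Q m × wsum m ≡ wsum l × wcomb m ≡ wcomb l
      go [] [] = [] , [] , refl , refl
      go ((w , p@(x , y)) ∷ l) ((w≥0 , h) ∷ hs) = add (f p h) (go l hs)
        where
          add : Conv Q (emb p) → (Σ (List (ℚ × Pt)) λ m → Weighted Q m × wsum m ≡ wsum l × wcomb m ≡ wcomb l) →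
                Σ (List (ℚ × Pt)) λ m → Weighted Q m × wsum m ≡ w + wsum l × wcomb m ≡ (w * ι x + proj₁ (wcomb l) , w * ι y + proj₂ (wcomb l))
          add (k , hk , sk , ck) (m , hm , sm , cm) = scale w k ++ m , weighted-++ (scale w k) m (weighted-scale w k w≥0 hk) hm ,
            trans (wsum-++ (scale w k) m) (cong₂ _+_ (trans (wsum-scale w k) (trans (cong (w *_) sk) (ℚₚ.*-identityʳ w))) sm) ,
            trans (wcomb-++ (scale w k) m) (cong₂ (λ a b → (proj₁ a + proj₁ b , proj₂ a + proj₂ b))
              (trans (wcomb-scale w k) (cong (λ z → (w * proj₁ z , w * proj₂ z)) ck)) cm)

  ι-neg : ∀ a → ι (ℤ.- a) ≡ - ι a
  ι-neg a = linℚ 2 (λ b a → κ 0 :≡ b :+ a ⇒ ⊢ b :≡ :- a) (ι (ℤ.- a)) (ι a) (trans (cong ι (sym (ℤₚ.+-inverseˡ a))) (ι-+ (ℤ.- a) a))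

  ι-lin : ∀ a b x y → ι (a ℤ.* x ℤ.+ b ℤ.* y) ≡ ι a * ι x + ι b * ι y
  ι-lin a b x y = trans (ι-+ (a ℤ.* x) (b ℤ.* y)) (cong₂ _+_ (ι-* a x) (ι-* b y))

  ι-∙ : ∀ u p → ι (u ∙ p) ≡ ι (proj₁ u) * ι (proj₁ p) + ι (proj₂ u) * ι (proj₂ p)
  ι-∙ (a , b) (x , y) = ι-lin a b x y

  ι-aff : ∀ a b w x y → ι (a ℤ.* x ℤ.+ b ℤ.* y ℤ.+ w) ≡ ι a * ι x + ι b * ι y + ι w
  ι-aff a b w x y = trans (ι-+ (a ℤ.* x ℤ.+ b ℤ.* y) w) (cong (_+ ι w) (ι-lin a b x y))

  apply-emb : ∀ φ p → apply φ (emb p) ≡ emb (act φ p)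
  apply-emb (unimod a b c d w₁ w₂ _) (x , y) = sym (cong₂ _,_ (ι-aff a b w₁ x y) (ι-aff c d w₂ x y))

  private
    affine-zero : ∀ a b w → 0ℚ ≡ a * 0ℚ + b * 0ℚ + w * 0ℚ
    affine-zero = linℚ 3 λ a b w → ⊢ κ 0 :≡ a :* κ 0 :+ b :* κ 0 :+ w :* κ 0

    affine-step : ∀ {z Z} a b c w x y X Y W → z ≡ a * x + b * y + c → Z ≡ a * X + b * Y + c * W → w * z + Z ≡ a * (w * x + X) + b * (w * y + Y) + c * (w + W)
    affine-step {z} {Z} a b c w x y X Y W = linℚ 11 (λ z Z a b c w x y X Y W → z :≡ a :* x :+ b :* y :+ c ⇒ Z :≡ a :* X :+ b :* Y :+ c :* W ⇒ 1 ⊙ w ∷ [] ⊩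
      w :* z :+ Z :≡ a :* (w :* x :+ X) :+ b :* (w :* y :+ Y) :+ c :* (w :+ W)) z Z a b c w x y X Y W

    affine-one : ∀ w z {W} → W ≡ 1ℚ → z + w * W ≡ z + w
    affine-one w z refl = cong (λ v → z + v) (ℚₚ.*-identityʳ w)

  mapʷ : (Pt → Pt) → List (ℚ × Pt) → List (ℚ × Pt)
  mapʷ f []            = []
  mapʷ f ((w , p) ∷ l) = (w , f p) ∷ mapʷ f l

  wsum-mapʷ : ∀ f l → wsum (mapʷ f l) ≡ wsum l
  wsum-mapʷ f []            = refl
  wsum-mapʷ f ((w , p) ∷ l) = cong (λ z → w + z) (wsum-mapʷ f l)

  weighted-mapʷ : ∀ {P Q : Pt → Set} f → (∀ p → P p → Q (f p)) → ∀ l → Weighted P l → Weighted Q (mapʷ f l)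
  weighted-mapʷ f h []      []            = []
  weighted-mapʷ f h (_ ∷ l) ((w , p) ∷ ps) = (w , h _ p) ∷ weighted-mapʷ f h l ps

  module _ (φ : Unimod) where
    open Unimod φ

    wcomb-mapʷ : ∀ l → proj₁ (wcomb (mapʷ (act φ) l)) ≡ ι a₁₁ * proj₁ (wcomb l) + ι a₁₂ * proj₂ (wcomb l) + ι w₁ * wsum l
                     × proj₂ (wcomb (mapʷ (act φ) l)) ≡ ι a₂₁ * proj₁ (wcomb l) + ι a₂₂ * proj₂ (wcomb l) + ι w₂ * wsum l
    wcomb-mapʷ [] = affine-zero (ι a₁₁) (ι a₁₂) (ι w₁) , affine-zero (ι a₂₁) (ι a₂₂) (ι w₂)
    wcomb-mapʷ ((w , (x , y)) ∷ l) =
      affine-step (ι a₁₁) (ι a₁₂) (ι w₁) w (ι x) (ι y) (proj₁ (wcomb l)) (proj₂ (wcomb l)) (wsum l) (ι-aff a₁₁ a₁₂ w₁ x y) (proj₁ (wcomb-mapʷ l)) ,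
      affine-step (ι a₂₁) (ι a₂₂) (ι w₂) w (ι x) (ι y) (proj₁ (wcomb l)) (proj₂ (wcomb l)) (wsum l) (ι-aff a₂₁ a₂₂ w₂ x y) (proj₂ (wcomb-mapʷ l))

    apply-wcomb : ∀ l → wsum l ≡ 1ℚ → wcomb (mapʷ (act φ) l) ≡ apply φ (wcomb l)
    apply-wcomb l s = cong₂ _,_ (trans (proj₁ (wcomb-mapʷ l)) (affine-one (ι w₁) (ι a₁₁ * proj₁ (wcomb l) + ι a₁₂ * proj₂ (wcomb l)) s)) (trans (proj₂ (wcomb-mapʷ l)) (affine-one (ι w₂) (ι a₂₁ * proj₁ (wcomb l) + ι a₂₂ * proj₂ (wcomb l)) s))

  conv-apply : ∀ φ {P Q : Pt → Set} {q} → (∀ p → P p → Q (act φ p)) → Conv P q → Conv Q (apply φ q)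
  conv-apply φ h (l , ps , s , refl) = mapʷ (act φ) l , weighted-mapʷ (act φ) h l ps , trans (wsum-mapʷ (act φ) l) s , apply-wcomb φ l s

  mapʷ-∘ : ∀ f g → (∀ p → f (g p) ≡ p) → ∀ l → mapʷ f (mapʷ g l) ≡ l
  mapʷ-∘ f g h []            = refl
  mapʷ-∘ f g h ((w , p) ∷ l) = cong₂ _∷_ (cong (w ,_) (h p)) (mapʷ-∘ f g h l)

  conv-image : ∀ φ {P Q : Pt → Set} {q} → (∀ p → P p → Q (act (inv φ) p)) → Conv P q → Image φ (Conv Q) q
  conv-image φ h (l , ps , s , refl) = wcomb m , (m , weighted-mapʷ (act (inv φ)) h l ps , sm , refl) ,
      trans (sym (apply-wcomb φ m sm)) (cong wcomb (mapʷ-∘ (act φ) (act (inv φ)) (act-inv φ) l))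
    where
      m = mapʷ (act (inv φ)) l
      sm = trans (wsum-mapʷ (act (inv φ)) l) s

  poly-halfplane : ∀ {P : Pt → Set} u c → (∀ s → P s → u ∙ s ℤ.≤ c) → ∀ {q} → Conv P q → ι (proj₁ u) * proj₁ q + ι (proj₂ u) * proj₂ q ≤ ι c
  poly-halfplane u c h = conv-≤ (ι (proj₁ u)) (ι (proj₂ u)) (ι c) λ p p∈ → subst (_≤ ι c) (ι-∙ u p) (ι-mono-≤ (u ∙ p) c (h p p∈))

  poly-halfplane-emb : ∀ {P : Pt → Set} u c → (∀ s → P s → u ∙ s ℤ.≤ c) → ∀ p → Conv P (emb p) → u ∙ p ℤ.≤ c
  poly-halfplane-emb u c h p q = ι-cancel-≤ (u ∙ p) c (subst (_≤ ι c) (sym (ι-∙ u p)) (poly-halfplane u c h q))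

  -- If no point of `S` is above `p` for the form `u`, then moving `p` by `ε` in either direction
  -- along either axis cannot increase `u`, which forces `u = 0`.
  interior⇒int : ∀ S p → Interior (Poly S) (emb p) → Int S p
  interior⇒int S p@(p₁ , p₂) (ε , ε>0 , ball) u@(u₁ , u₂) nz with search (λ s → u ∙ p ℤₚ.<? u ∙ s) S
  ... | inj₁ found = found
  ... | inj₂ none = ⊥-elim (nz (zero₁ , zero₂))
    where
      bounded : ∀ {q} → Poly S q → ι u₁ * proj₁ q + ι u₂ * proj₂ q ≤ ι u₁ * ι p₁ + ι u₂ * ι p₂
      bounded {q} c = subst (ι u₁ * proj₁ q + ι u₂ * proj₂ q ≤_) (ι-∙ u p) (poly-halfplane u (u ∙ p) (λ s s∈ → ℤₚ.≮⇒≥ (none s s∈)) c)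
      abs-ε : ∀ z δ → (δ ≡ ε ⊎ δ ≡ - ε ⊎ δ ≡ 0ℚ) → ℚ.∣ z + δ - z ∣ ≤ ε
      abs-ε z δ k = subst (λ w → ℚ.∣ w ∣ ≤ ε) (linℚ 2 (λ z δ → ⊢ δ :≡ z :+ δ :- z) z δ) (abs k)
        where
          abs : (δ ≡ ε ⊎ δ ≡ - ε ⊎ δ ≡ 0ℚ) → ℚ.∣ δ ∣ ≤ ε
          abs (inj₁ refl) = ℚₚ.≤-reflexive (ℚₚ.0≤p⇒∣p∣≡p (ℚₚ.<⇒≤ ε>0))
          abs (inj₂ (inj₁ refl)) = ℚₚ.≤-reflexive (trans (ℚₚ.∣-p∣≡∣p∣ ε) (ℚₚ.0≤p⇒∣p∣≡p (ℚₚ.<⇒≤ ε>0)))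
          abs (inj₂ (inj₂ refl)) = ℚₚ.<⇒≤ ε>0
      probe : ∀ δ₁ δ₂ → (δ₁ ≡ ε ⊎ δ₁ ≡ - ε ⊎ δ₁ ≡ 0ℚ) → (δ₂ ≡ ε ⊎ δ₂ ≡ - ε ⊎ δ₂ ≡ 0ℚ) → ι u₁ * δ₁ + ι u₂ * δ₂ ≤ 0ℚ
      probe δ₁ δ₂ k₁ k₂ = linℚ 6 (λ u v p q δ δ′ → u :* (p :+ δ) :+ v :* (q :+ δ′) :≤ u :* p :+ v :* q ⇒ ⊢ u :* δ :+ v :* δ′ :≤ κ 0) (ι u₁) (ι u₂) (ι p₁) (ι p₂) δ₁ δ₂
        (bounded (ball (ι p₁ + δ₁ , ι p₂ + δ₂) (abs-ε (ι p₁) δ₁ k₁) (abs-ε (ι p₂) δ₂ k₂)))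
      vanish : ∀ z → ι z * ε ≤ 0ℚ → ι z * - ε ≤ 0ℚ → z ≡ + 0
      vanish z a b = ι-injective z (+ 0) (ℚₚ.≤-antisym
        (linℚ 2 (λ z ε → κ 0 :< ε ⇒ z :* ε :≤ κ 0 ⇒ 0 ⊛ 1 ∷ [] ⊩ z :≤ κ 0) (ι z) ε ε>0 a)
        (linℚ 2 (λ z ε → κ 0 :< ε ⇒ z :* (:- ε) :≤ κ 0 ⇒ 0 ⊛ 1 ∷ [] ⊩ κ 0 :≤ z) (ι z) ε ε>0 b))
      first : ∀ a b δ → a * δ + b * 0ℚ ≤ 0ℚ → a * δ ≤ 0ℚ
      first = linℚ 3 λ a b δ → a :* δ :+ b :* κ 0 :≤ κ 0 ⇒ ⊢ a :* δ :≤ κ 0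
      other : ∀ a b δ → a * 0ℚ + b * δ ≤ 0ℚ → b * δ ≤ 0ℚ
      other = linℚ 3 λ a b δ → a :* κ 0 :+ b :* δ :≤ κ 0 ⇒ ⊢ b :* δ :≤ κ 0
      zero₁ : u₁ ≡ + 0
      zero₁ = vanish u₁ (first (ι u₁) (ι u₂) ε (probe ε 0ℚ (inj₁ refl) (inj₂ (inj₂ refl)))) (first (ι u₁) (ι u₂) (- ε) (probe (- ε) 0ℚ (inj₂ (inj₁ refl)) (inj₂ (inj₂ refl))))
      zero₂ : u₂ ≡ + 0
      zero₂ = vanish u₂ (other (ι u₁) (ι u₂) ε (probe 0ℚ ε (inj₂ (inj₂ refl)) (inj₁ refl))) (other (ι u₁) (ι u₂) (- ε) (probe 0ℚ (- ε) (inj₂ (inj₂ refl)) (inj₂ (inj₁ refl))))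

  p≤∣p∣ : ∀ p → p ≤ ℚ.∣ p ∣
  p≤∣p∣ p with ℚₚ.∣p∣≡p∨∣p∣≡-p p
  ... | inj₁ e = ℚₚ.≤-reflexive (sym e)
  ... | inj₂ e = linℚ 2 (λ p a → a :≡ :- p ⇒ κ 0 :≤ a ⇒ ⊢ p :≤ a) p ℚ.∣ p ∣ e (ℚₚ.0≤∣p∣ p)

  recip : ∀ δ → 0ℚ < δ → Σ ℚ λ ρ → ρ * δ ≡ 1ℚ × 0ℚ < ρ
  recip δ δ>0 = ρ , inverse , ρ>0
    where
      instance
        nz : ℚ.NonZero δ
        nz = ℚ.≢-nonZero λ e → ℚₚ.<-irrefl (sym e) δ>0
      ρ = ℚ.1/ δ
      inverse = ℚₚ.*-inverseˡ δ
      ρ>0 : 0ℚ < ρ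
      ρ>0 = linℚ 2 (λ ρ δ → κ 0 :< δ ⇒ ρ :* δ :≡ κ 1 ⇒ 0 ⊛ 1 ∷ [] ⊩ κ 0 :< ρ) ρ δ δ>0 inverse

  -- The weights are the fractions `k - j` and `j` over `k`, given by integers, so that concrete
  -- instances hold by computation.
  onSegment : ∀ {P} k j a b p → + 0 ℤ.≤ j → j ℤ.≤ k → + 0 ℤ.< k →
              k ℤ.* proj₁ p ≡ (k ℤ.- j) ℤ.* proj₁ a ℤ.+ j ℤ.* proj₁ b → k ℤ.* proj₂ p ≡ (k ℤ.- j) ℤ.* proj₂ a ℤ.+ j ℤ.* proj₂ b →
              Conv P (emb a) → Conv P (emb b) → Conv P (emb p)
  onSegment {P} k j (a₁ , a₂) (b₁ , b₂) (p₁ , p₂) j≥0 j≤k k>0 e₁ e₂ ca cb = subst (Conv P) (cong₂ _,_ (eq a₁ b₁ p₁ e₁) (eq a₂ b₂ p₂ e₂))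
      (conv-mix s t s≥0 t≥0 st ca cb)
    where
      κ>0 : 0ℚ < ι k
      κ>0 = ι-mono-< (+ 0) k k>0
      ρ = proj₁ (recip (ι k) κ>0)
      ρk : ρ * ι k ≡ 1ℚ
      ρk = proj₁ (proj₂ (recip (ι k) κ>0))
      ρ>0 = proj₂ (proj₂ (recip (ι k) κ>0))
      s = ρ * (ι k - ι j)
      t = ρ * ι j
      s≥0 : 0ℚ ≤ s
      s≥0 = linℚ 3 (λ ρ k j → κ 0 :< ρ ⇒ j :≤ k ⇒ 1 ⊛ 2 ∷ [] ⊩ κ 0 :≤ ρ :* (k :- j)) ρ (ι k) (ι j) ρ>0 (ι-mono-≤ j k j≤k)
      t≥0 : 0ℚ ≤ t
      t≥0 = linℚ 2 (λ ρ j → κ 0 :< ρ ⇒ κ 0 :≤ j ⇒ 1 ⊛ 2 ∷ [] ⊩ κ 0 :≤ ρ :* j) ρ (ι j) ρ>0 (ι-mono-≤ (+ 0) j j≥0)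
      st : s + t ≡ 1ℚ
      st = linℚ 3 (λ ρ k j → ρ :* k :≡ κ 1 ⇒ ⊢ ρ :* (k :- j) :+ ρ :* j :≡ κ 1) ρ (ι k) (ι j) ρk
      ι-minus : ∀ a b → ι (a ℤ.- b) ≡ ι a - ι b
      ι-minus a b = trans (ι-+ a (ℤ.- b)) (cong (λ z → ι a + z) (ι-neg b))
      eq : ∀ a b p → k ℤ.* p ≡ (k ℤ.- j) ℤ.* a ℤ.+ j ℤ.* b → s * ι a + t * ι b ≡ ι p
      eq a b p e = linℚ 6 (λ ρ k j a b p → ρ :* k :≡ κ 1 ⇒ k :* p :≡ (k :- j) :* a :+ j :* b ⇒ 1 ⊙ p ∷ 2 ⊙ ρ ∷ [] ⊩ ρ :* (k :- j) :* a :+ ρ :* j :* b :≡ p) ρ (ι k) (ι j) (ι a) (ι b) (ι p) ρk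
        (trans (sym (ι-* k p)) (trans (cong ι e) (trans (ι-lin (k ℤ.- j) j a b) (cong (λ z → z * ι a + ι j * ι b) (ι-minus k j)))))

  module _ {S : List Pt} (p : Pt) where
    private
      P₁ = ι (proj₁ p)
      P₂ = ι (proj₂ p)

    Ray : ℚ → ℚ → Set
    Ray e₁ e₂ = Σ ℚ λ δ → 0ℚ < δ × Poly S (P₁ + δ * e₁ , P₂ + δ * e₂)

    inCone⇒ray : ∀ {e} → InCone S p e → Ray (ι (proj₁ e)) (ι (proj₂ e))
    inCone⇒ray {e} c = δ , δ>0 , subst (Poly S) (cong₂ _,_ (eq (proj₁ e) (proj₁ r) (proj₁ t) (proj₁ p) eq₁) (eq (proj₂ e) (proj₂ r) (proj₂ t) (proj₂ p) eq₂))
        (conv-mix σ τ σ≥0 τ≥0 στ (conv-point r r∈) (conv-point t t∈))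
      where
        open InCone c
        n = ι x + ι y
        n>0 : 0ℚ < n
        n>0 = linℚ 2 (λ x y → κ 0 :< x ⇒ κ 0 :≤ y ⇒ ⊢ κ 0 :< x :+ y) (ι x) (ι y) (ι-mono-< (+ 0) x x>0) (ι-mono-≤ (+ 0) y y≥0)
        ρ = proj₁ (recip n n>0)
        ρn : ρ * (ι x + ι y) ≡ 1ℚ
        ρn = proj₁ (proj₂ (recip n n>0))
        ρ>0 = proj₂ (proj₂ (recip n n>0))
        δ = ρ * ι z
        δ>0 : 0ℚ < δ
        δ>0 = linℚ 2 (λ ρ z → κ 0 :< ρ ⇒ κ 0 :< z ⇒ 1 ⊛ 2 ∷ [] ⊩ κ 0 :< ρ :* z) ρ (ι z) ρ>0 (ι-mono-< (+ 0) z z>0)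
        σ = ρ * ι x
        τ = ρ * ι y
        σ≥0 : 0ℚ ≤ σ
        σ≥0 = linℚ 2 (λ ρ z → κ 0 :< ρ ⇒ κ 0 :< z ⇒ 1 ⊛ 2 ∷ [] ⊩ κ 0 :≤ ρ :* z) ρ (ι x) ρ>0 (ι-mono-< (+ 0) x x>0)
        τ≥0 : 0ℚ ≤ τ
        τ≥0 = linℚ 2 (λ ρ z → κ 0 :< ρ ⇒ κ 0 :≤ z ⇒ 1 ⊛ 2 ∷ [] ⊩ κ 0 :≤ ρ :* z) ρ (ι y) ρ>0 (ι-mono-≤ (+ 0) y y≥0)
        στ : σ + τ ≡ 1ℚ
        στ = linℚ 3 (λ ρ x y → ρ :* (x :+ y) :≡ κ 1 ⇒ ⊢ ρ :* x :+ ρ :* y :≡ κ 1) ρ (ι x) (ι y) ρn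
        ι-minus : ∀ a b → ι (a ℤ.- b) ≡ ι a - ι b
        ι-minus a b = trans (ι-+ a (ℤ.- b)) (cong (λ z → ι a + z) (ι-neg b))
        eq : ∀ e r t p → z ℤ.* e ≡ x ℤ.* (r ℤ.- p) ℤ.+ y ℤ.* (t ℤ.- p) → σ * ι r + τ * ι t ≡ ι p + δ * ι e
        eq e r t p h = linℚ 8 (λ ρ x y z e r t p → ρ :* (x :+ y) :≡ κ 1 ⇒ z :* e :≡ x :* (r :- p) :+ y :* (t :- p) ⇒ 1 ⊙ p ∷ 2 ⊙ ρ ∷ [] ⊩ ρ :* x :* r :+ ρ :* y :* t :≡ p :+ ρ :* z :* e) ρ (ι x) (ι y) (ι z) (ι e) (ι r) (ι t) (ι p) ρn
          (trans (sym (ι-* z e)) (trans (cong ι h) (trans (ι-lin x y (r ℤ.- p) (t ℤ.- p)) (cong₂ (λ a b → ι x * a + ι y * b) (ι-minus r p) (ι-minus t p)))))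

    -- The four rays put points of the hull on both sides of `p` along each axis; by convexity they
    -- contain a cross, and midpoints between its two arms fill a box.
    cones⇒interior : Cones S p → Interior (Poly S) (emb p)
    cones⇒interior (c₁ , c₂ , c₃ , c₄) = build (inCone⇒ray c₁) (inCone⇒ray c₂) (inCone⇒ray c₃) (inCone⇒ray c₄)
      where
        build : Ray 1ℚ 0ℚ → Ray (- 1ℚ) 0ℚ → Ray 0ℚ 1ℚ → Ray 0ℚ (- 1ℚ) → Interior (Poly S) (emb p)
        build (δ₁ , δ₁>0 , r₁) (δ₂ , δ₂>0 , r₂) (δ₃ , δ₃>0 , r₃) (δ₄ , δ₄>0 , r₄) = ε , ε>0 , ball
          where
            Δ = (δ₁ ℚ.⊓ δ₂) ℚ.⊓ (δ₃ ℚ.⊓ δ₄)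
            -- With `a` and `b` the displacements of `q`, the point `q` is the midpoint of
            -- `p + (2a , 0)` and `p + (0 , 2b)`, so the arms must reach twice as far as the box.
            ε = ½ * Δ
            Δ>0 : 0ℚ < Δ
            Δ>0 = ⊓>0 (⊓>0 δ₁>0 δ₂>0) (⊓>0 δ₃>0 δ₄>0)
              where
                ⊓>0 : ∀ {a b} → 0ℚ < a → 0ℚ < b → 0ℚ < a ℚ.⊓ b
                ⊓>0 {a} {b} ha hb with ℚₚ.⊓-sel a b
                ... | inj₁ e = subst (0ℚ <_) (sym e) ha
                ... | inj₂ e = subst (0ℚ <_) (sym e) hb
            2ε : ε + ε ≡ Δ
            2ε = trans (linℚ 2 (λ h d → ⊢ h :* d :+ h :* d :≡ (h :+ h) :* d) ½ Δ) (ℚₚ.*-identityˡ Δ)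
            ε>0 : 0ℚ < ε
            ε>0 = linℚ 2 (λ e d → e :+ e :≡ d ⇒ κ 0 :< d ⇒ ⊢ κ 0 :< e) ε Δ 2ε Δ>0
            Δ≤₁ : Δ ≤ δ₁
            Δ≤₁ = ℚₚ.≤-trans (ℚₚ.p⊓q≤p (δ₁ ℚ.⊓ δ₂) (δ₃ ℚ.⊓ δ₄)) (ℚₚ.p⊓q≤p δ₁ δ₂)
            Δ≤₂ : Δ ≤ δ₂
            Δ≤₂ = ℚₚ.≤-trans (ℚₚ.p⊓q≤p (δ₁ ℚ.⊓ δ₂) (δ₃ ℚ.⊓ δ₄)) (ℚₚ.p⊓q≤q δ₁ δ₂)
            Δ≤₃ : Δ ≤ δ₃
            Δ≤₃ = ℚₚ.≤-trans (ℚₚ.p⊓q≤q (δ₁ ℚ.⊓ δ₂) (δ₃ ℚ.⊓ δ₄)) (ℚₚ.p⊓q≤p δ₃ δ₄)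
            Δ≤₄ : Δ ≤ δ₄
            Δ≤₄ = ℚₚ.≤-trans (ℚₚ.p⊓q≤q (δ₁ ℚ.⊓ δ₂) (δ₃ ℚ.⊓ δ₄)) (ℚₚ.p⊓q≤q δ₃ δ₄)
            between : ∀ e₁ e₂ α β → 0ℚ < α → 0ℚ < β → Poly S (P₁ + α * e₁ , P₂ + α * e₂) → Poly S (P₁ + β * (- e₁) , P₂ + β * (- e₂)) →
                      ∀ a → - β ≤ a → a ≤ α → Poly S (P₁ + a * e₁ , P₂ + a * e₂)
            between e₁ e₂ α β α>0 β>0 A B a lo hi = subst (Poly S) (cong₂ _,_ (eq P₁ e₁) (eq P₂ e₂))
                (conv-mix (ρ * (a + β)) (ρ * (α - a))
                  (linℚ 3 (λ ρ a b → κ 0 :< ρ ⇒ :- b :≤ a ⇒ 1 ⊛ 2 ∷ [] ⊩ κ 0 :≤ ρ :* (a :+ b)) ρ a β ρ>0 lo)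
                  (linℚ 3 (λ ρ a b → κ 0 :< ρ ⇒ a :≤ b ⇒ 1 ⊛ 2 ∷ [] ⊩ κ 0 :≤ ρ :* (b :- a)) ρ a α ρ>0 hi)
                  (linℚ 4 (λ ρ a α β → ρ :* (α :+ β) :≡ κ 1 ⇒ ⊢ ρ :* (a :+ β) :+ ρ :* (α :- a) :≡ κ 1) ρ a α β ρn) A B)
              where
                n>0 : 0ℚ < α + β
                n>0 = linℚ 2 (λ a b → κ 0 :< a ⇒ κ 0 :< b ⇒ ⊢ κ 0 :< a :+ b) α β α>0 β>0
                ρ = proj₁ (recip (α + β) n>0)
                ρn : ρ * (α + β) ≡ 1ℚ
                ρn = proj₁ (proj₂ (recip (α + β) n>0))
                ρ>0 = proj₂ (proj₂ (recip (α + β) n>0))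
                eq : ∀ P e → ρ * (a + β) * (P + α * e) + ρ * (α - a) * (P + β * (- e)) ≡ P + a * e
                eq P e = linℚ 6 (λ ρ a α β P e → ρ :* (α :+ β) :≡ κ 1 ⇒ 1 ⊙ P ∷ 1 ⊙ (a :* e) ∷ [] ⊩ ρ :* (a :+ β) :* (P :+ α :* e) :+ ρ :* (α :- a) :* (P :+ β :* (:- e)) :≡ P :+ a :* e) ρ a α β P e ρn
            ball : ∀ q → ℚ.∣ proj₁ q - P₁ ∣ ≤ ε → ℚ.∣ proj₂ q - P₂ ∣ ≤ ε → Poly S q
            ball (q₁ , q₂) h₁ h₂ = subst (Poly S) (cong₂ _,_ mid₁ mid₂) (conv-mix ½ ½ (ℚₚ.nonNegative⁻¹ ½) (ℚₚ.nonNegative⁻¹ ½) refl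
                (between 1ℚ 0ℚ δ₁ δ₂ δ₁>0 δ₂>0 r₁ r₂ (a + a) (lower a δ₂ Δ≤₂ h₁) (upper a δ₁ Δ≤₁ h₁))
                (between 0ℚ 1ℚ δ₃ δ₄ δ₃>0 δ₄>0 r₃ r₄ (b + b) (lower b δ₄ Δ≤₄ h₂) (upper b δ₃ Δ≤₃ h₂)))
              where
                a = q₁ - P₁
                b = q₂ - P₂
                upper : ∀ a δ → Δ ≤ δ → ℚ.∣ a ∣ ≤ ε → a + a ≤ δ
                upper a δ Δ≤ h = linℚ 4 (λ a e d δ → a :≤ e ⇒ e :+ e :≡ d ⇒ d :≤ δ ⇒ ⊢ a :+ a :≤ δ) a ε Δ δ (ℚₚ.≤-trans (p≤∣p∣ a) h) 2ε Δ≤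
                lower : ∀ a δ → Δ ≤ δ → ℚ.∣ a ∣ ≤ ε → - δ ≤ a + a
                lower a δ Δ≤ h = linℚ 4 (λ a e d δ → :- a :≤ e ⇒ e :+ e :≡ d ⇒ d :≤ δ ⇒ ⊢ :- δ :≤ a :+ a) a ε Δ δ (ℚₚ.≤-trans (p≤∣p∣ (- a)) (subst (_≤ ε) (sym (ℚₚ.∣-p∣≡∣p∣ a)) h)) 2ε Δ≤
                halves : ½ + ½ ≡ 1ℚ
                halves = refl
                mid₁ : ½ * (P₁ + (a + a) * 1ℚ) + ½ * (P₁ + (b + b) * 0ℚ) ≡ q₁
                mid₁ = linℚ 4 (λ h P q b → h :+ h :≡ κ 1 ⇒ 1 ⊙ q ∷ [] ⊩ h :* (P :+ (q :- P :+ (q :- P)) :* κ 1) :+ h :* (P :+ b :* κ 0) :≡ q) ½ P₁ q₁ (b + b) halves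
                mid₂ : ½ * (P₂ + (a + a) * 0ℚ) + ½ * (P₂ + (b + b) * 1ℚ) ≡ q₂
                mid₂ = linℚ 4 (λ h P q b → h :+ h :≡ κ 1 ⇒ 1 ⊙ q ∷ [] ⊩ h :* (P :+ b :* κ 0) :+ h :* (P :+ (q :- P :+ (q :- P)) :* κ 1) :≡ q) ½ P₂ q₂ (a + a) halves

  int⇒interior : ∀ S p → Int S p → Interior (Poly S) (emb p)
  int⇒interior S p i with cones? S p
  ... | inj₁ s = ⊥-elim (int-¬sep i s)
  ... | inj₂ c = cones⇒interior p c

-- Transport of lattice sizes along unimodular equivalence

module Equivalence where
  open import Data.Integer using (_+_; _*_; _-_; -_; _≤_)
  open import Data.List.Relation.Unary.All using ([]; _∷_)
  open import Data.List.Relation.Unary.Any using (here; there)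
  open import Data.Nat using (suc; z≤n; s≤s)
  open Lattice
  open Frames
  open Configurations
  open Reflexive using (≤⊎>; split012)
  open LatticeSize
  open ConvexHulls
  open OrderedRings

  fit⇒fits : ∀ {P : Pt → Set} {n} → Fit P (+ n) → Fits (Conv P) n
  fit⇒fits {P} {n} (φ , h) = φ , λ q c → inside (conv-apply φ {P} {InΔ (+ n)} h c)
    where
      inside : ∀ {q} → Conv (InΔ (+ n)) q → InDSigma n q
      inside {x , y} c =
        linℚ 2 (λ x y → :- κ 1 :* x :+ κ 0 :* y :≤ κ 0 ⇒ ⊢ κ 0 :≤ x) x y
          (poly-halfplane (- + 1 , + 0) (+ 0) (λ (a , b) (p , q , r) → lin 2 (λ a b → κ 0 :≤ a ⇒ ⊢ :- κ 1 :* a :+ κ 0 :* b :≤ κ 0) a b p) c) ,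
        linℚ 2 (λ x y → κ 0 :* x :+ :- κ 1 :* y :≤ κ 0 ⇒ ⊢ κ 0 :≤ y) x y
          (poly-halfplane (+ 0 , - + 1) (+ 0) (λ (a , b) (p , q , r) → lin 2 (λ a b → κ 0 :≤ b ⇒ ⊢ κ 0 :* a :+ :- κ 1 :* b :≤ κ 0) a b q) c) ,
        linℚ 3 (λ x y n → κ 1 :* x :+ κ 1 :* y :≤ n ⇒ ⊢ x :+ y :≤ n) x y (ι (+ n))
          (poly-halfplane (+ 1 , + 1) (+ n) (λ (a , b) (p , q , r) → lin 3 (λ a b n → a :+ b :≤ n ⇒ ⊢ κ 1 :* a :+ κ 1 :* b :≤ n) a b (+ n) r) c)

  fits⇒fit : ∀ {P : Pt → Set} {n} → Fits (Conv P) n → Fit P (+ n)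
  fits⇒fit {P} {n} (φ , h) = φ , λ p pp → inside (act φ p) (subst (InDSigma n) (apply-emb φ p) (h (emb p) (conv-point p pp)))
    where
      inside : ∀ p → InDSigma n (emb p) → InΔ (+ n) p
      inside (x , y) (a , b , c) = ι-cancel-≤ (+ 0) x a , ι-cancel-≤ (+ 0) y b , ι-cancel-≤ (x + y) (+ n) (subst (ℚ._≤ ι (+ n)) (sym (ι-+ x y)) c)

  record IsSize (P : Pt → Set) (m : ℕ) : Set where
    constructor isSize
    field
      inhabited : Σ Pt P
      fits      : Fit P (+ m)
      minimal   : ∀ k → Fit P (+ k) → m ℕ.≤ k

  fit-mono : ∀ {P Q : Pt → Set} {d} → (∀ p → Q p → P p) → Fit P d → Fit Q d
  fit-mono f (φ , h) = φ , λ p q → h p (f p q)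

  size⇒LS : ∀ {P m} → IsSize P m → LS (Conv P) (+ m)
  size⇒LS {P} {m} (isSize (p , pp) f min) = inj₂ ((emb p , conv-point p pp) , m , refl , fit⇒fits f , λ k g → min k (fits⇒fit g))

  empty⇒LS : ∀ {P : Pt → Set} → (∀ p → ¬ P p) → LS (Conv P) (- + 2)
  empty⇒LS {P} none = inj₁ ((λ (q , c) → absurd c) , refl)
    where
      absurd : ∀ {q} → Conv P q → ⊥
      absurd ([] , [] , () , _)
      absurd (_ , (_ , p) ∷ _ , _) = none _ p

  innerSize⇒LS : ∀ {S m} → IsSize (Int S) m → LS (Inner (Poly S)) (+ m)
  innerSize⇒LS {S} (isSize (p , i) f min) = size⇒LS (isSize (p , int⇒interior S p i) (fit-mono (λ q → interior⇒int S q) f) λ k g → min k (fit-mono (λ q → int⇒interior S q) g))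

  innerEmpty⇒LS : ∀ {S} → (∀ p → ¬ Int S p) → LS (Inner (Poly S)) (- + 2)
  innerEmpty⇒LS {S} none = empty⇒LS λ p i → none p (interior⇒int S p i)

  -- conv U ⊆ conv T, in terms of half-planes.
  _⊴_ : List Pt → List Pt → Set
  U ⊴ T = ∀ u c → (∀ t → t ∈ T → u ∙ t ≤ c) → ∀ s → s ∈ U → u ∙ s ≤ c

  ⊴-fit : ∀ {U T d} → U ⊴ T → Fit (_∈ T) d → Fit (_∈ U) d
  ⊴-fit {U} {T} {d} H (φ@(unimod a b c e z₁ z₂ h) , f) = φ , λ s@(x , y) s∈ →
    lin 5 (λ a b z x y → :- a :* x :+ :- b :* y :≤ z ⇒ ⊢ κ 0 :≤ a :* x :+ b :* y :+ z) a b z₁ x y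
      (H (- a , - b) z₁ (λ t@(x , y) t∈ → lin 5 (λ a b z x y → κ 0 :≤ a :* x :+ b :* y :+ z ⇒ ⊢ :- a :* x :+ :- b :* y :≤ z) a b z₁ x y (proj₁ (f t t∈))) s s∈) ,
    lin 5 (λ a b z x y → :- a :* x :+ :- b :* y :≤ z ⇒ ⊢ κ 0 :≤ a :* x :+ b :* y :+ z) c e z₂ x y
      (H (- c , - e) z₂ (λ t@(x , y) t∈ → lin 5 (λ a b z x y → κ 0 :≤ a :* x :+ b :* y :+ z ⇒ ⊢ :- a :* x :+ :- b :* y :≤ z) c e z₂ x y (proj₁ (proj₂ (f t t∈)))) s s∈) ,
    lin 9 (λ a b c e z₁ z₂ x y d → (a :+ c) :* x :+ (b :+ e) :* y :≤ d :- z₁ :- z₂ ⇒ ⊢ a :* x :+ b :* y :+ z₁ :+ (c :* x :+ e :* y :+ z₂) :≤ d) a b c e z₁ z₂ x y d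
      (H (a + c , b + e) (d - z₁ - z₂) (λ t@(x , y) t∈ → lin 9 (λ a b c e z₁ z₂ x y d → a :* x :+ b :* y :+ z₁ :+ (c :* x :+ e :* y :+ z₂) :≤ d ⇒ ⊢ (a :+ c) :* x :+ (b :+ e) :* y :≤ d :- z₁ :- z₂) a b c e z₁ z₂ x y d (proj₂ (proj₂ (f t t∈)))) s s∈)

  ⊴-int : ∀ {U T p} → U ⊴ T → Int U p → Int T p
  ⊴-int {U} {T} {p} H i with int⊎sep T p
  ... | inj₁ j = j
  ... | inj₂ (u , nz , h) = ⊥-elim (int-¬sep i (u , nz , H u (u ∙ p) h))

  -- The equivalence compares hulls, so the image list `U` and `T` need not have the same entries.
  -- Mutual `⊴` is enough, since fits and interior points depend on half-planes only.
  module Transport {S T : List Pt} (φ : Unimod) (eq : ∀ q → (Poly T q → Image φ (Poly S) q) × (Image φ (Poly S) q → Poly T q)) where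
    private
      U = map (act φ) S

    U⊴T : U ⊴ T
    U⊴T u c h = all-map φ {S} {λ s → u ∙ s ≤ c} λ s s∈ → poly-halfplane-emb u c h (act φ s)
      (proj₂ (eq (emb (act φ s))) (emb s , conv-point s s∈ , apply-emb φ s))

    T⊴U : T ⊴ U
    T⊴U u c h t t∈ = poly-halfplane-emb u c h t (from (proj₁ (eq (emb t)) (conv-point t t∈)))
      where
        from : Image φ (Poly S) (emb t) → Poly U (emb t)
        from (q , c , e) = subst (Poly U) e (conv-apply φ (λ s s∈ → ∈-map⁺ (act φ) s∈) c)

    fit-S : ∀ {d} → Fit (_∈ T) d → Fit (_∈ S) d
    fit-S f = fit-map φ {S} (⊴-fit U⊴T f)

    fit-T : ∀ {d} → Fit (_∈ S) d → Fit (_∈ T) d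
    fit-T {d} f = ⊴-fit T⊴U (fit-map (inv φ) {U} (subst (λ L → Fit (_∈ L) d) (sym (map-inv-act φ S)) f))

    int-S : ∀ {p} → Int T p → Int S (act (inv φ) p)
    int-S i = int-map⁻ φ {S} (⊴-int T⊴U i)

    int-T : ∀ {p} → Int S p → Int T (act φ p)
    int-T i = ⊴-int U⊴T (int-map⁺ φ {S} i)

    fitInt-S : ∀ {d} → Fit (Int T) d → Fit (Int S) d
    fitInt-S {d} f = fitInt-map φ {S} (fit-mono (λ p → ⊴-int U⊴T) f)

    fitInt-T : ∀ {d} → Fit (Int S) d → Fit (Int T) d
    fitInt-T {d} f = fit-mono (λ p → ⊴-int T⊴U) (fitInt-map (inv φ) {U} (subst (λ L → Fit (Int L) d) (sym (map-inv-act φ S)) f))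

    size-S : ∀ {m} → IsSize (_∈ T) m → IsSize (_∈ S) m
    size-S (isSize (t , t∈) f min) = isSize (some (proj₁ (eq (emb t)) (conv-point t t∈))) (fit-S f) (λ k g → min k (fit-T g))
      where
        some : Image φ (Poly S) (emb t) → Σ Pt (_∈ S)
        some (q , ((_ , p) ∷ _ , (_ , h) ∷ _ , _) , _) = p , h
        some (q , ([] , [] , () , _) , _)

    sizeInt-S : ∀ {m} → IsSize (Int T) m → IsSize (Int S) m
    sizeInt-S (isSize (t , i) f min) = isSize (act (inv φ) t , int-S i) (fitInt-S f) (λ k g → min k (fitInt-T g))

    noInt-S : (∀ p → ¬ Int T p) → ∀ p → ¬ Int S p
    noInt-S h p i = h (act φ p) (int-T i)

  mk≃ : ∀ φ S T → (∀ s → s ∈ map (act φ) S → Poly T (emb s)) → (∀ t → t ∈ T → t ∈ map (act φ) S) → Poly S ≃ Poly T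
  mk≃ φ S T inside corners = φ , λ q → (λ c → conv-image φ back c) , λ (p , c , e) → subst (Poly T) e (conv-bind inside (conv-apply φ (λ s s∈ → ∈-map⁺ (act φ) s∈) c))
    where
      back : ∀ p → p ∈ T → act (inv φ) p ∈ S
      back p p∈ with ∈-map⁻ (act φ) (corners p p∈)
      ... | s , s∈ , refl = subst (_∈ S) (sym (inv-act φ s)) s∈

  onRow : ∀ {P} l r x y → l ≤ x → x ≤ r → Conv P (emb (l , y)) → Conv P (emb (r , y)) → Conv P (emb (x , y))
  onRow {P} l r x y lo hi cl cr with ≤⊎> r l
  ... | inj₁ r≤l = subst (λ z → Conv P (emb (z , y))) (ℤₚ.≤-antisym lo (ℤₚ.≤-trans hi r≤l)) cl
  ... | inj₂ l<r = onSegment (r - l) (x - l) (l , y) (r , y) (x , y) (ℤₚ.i≤j⇒0≤j-i lo) (ℤₚ.+-monoˡ-≤ (- l) hi)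
      (lin 2 (λ l r → l :< r ⇒ ⊢ κ 0 :< r :- l) l r l<r)
      (lin 3 (λ l r x → ⊢ (r :- l) :* x :≡ (r :- l :- (x :- l)) :* l :+ (x :- l) :* r) l r x)
      (lin 4 (λ l r x y → ⊢ (r :- l) :* y :≡ (r :- l :- (x :- l)) :* y :+ (x :- l) :* y) l r x y) cl cr

  onColumn : ∀ {P} x l r y → l ≤ y → y ≤ r → Conv P (emb (x , l)) → Conv P (emb (x , r)) → Conv P (emb (x , y))
  onColumn {P} x l r y lo hi cl cr with ≤⊎> r l
  ... | inj₁ r≤l = subst (λ z → Conv P (emb (x , z))) (ℤₚ.≤-antisym lo (ℤₚ.≤-trans hi r≤l)) cl
  ... | inj₂ l<r = onSegment (r - l) (y - l) (x , l) (x , r) (x , y) (ℤₚ.i≤j⇒0≤j-i lo) (ℤₚ.+-monoˡ-≤ (- l) hi)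
      (lin 2 (λ l r → l :< r ⇒ ⊢ κ 0 :< r :- l) l r l<r)
      (lin 4 (λ l r x y → ⊢ (r :- l) :* y :≡ (r :- l :- (x :- l)) :* y :+ (x :- l) :* y) l r y x)
      (lin 3 (λ l r x → ⊢ (r :- l) :* x :≡ (r :- l :- (x :- l)) :* l :+ (x :- l) :* r) l r y) cl cr

  corner : ∀ {T : List Pt} {p} → p ∈ T → Poly T (emb p)
  corner {p = p} m = conv-point p m

  trap-≃ : ∀ φ S a b → IsTrap a b (map (act φ) S) → Poly S ≃ Trap a b
  trap-≃ φ S a b I = mk≃ φ S _ inside λ { t (here refl) → c₀₀ ; t (there (here refl)) → c₁₀ ; t (there (there (here refl))) → c₀₁ ; t (there (there (there (here refl)))) → c₁₁ }
    where
      open IsTrap I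
      row : ∀ x y → + 0 ≤ x → + 0 ≤ y → y ≤ + 1 → x + (+ a - + b) * y ≤ + a → Trap a b (emb (x , y))
      row x (+ 0) lo _ _ hi = onRow (+ 0) (+ a) x (+ 0) lo (lin 3 (λ x a b → x :+ (a :- b) :* κ 0 :≤ a ⇒ ⊢ x :≤ a) x (+ a) (+ b) hi) (corner (here refl)) (corner (there (here refl)))
      row x (+ 1) lo _ _ hi = onRow (+ 0) (+ b) x (+ 1) lo (lin 3 (λ x a b → x :+ (a :- b) :* κ 1 :≤ a ⇒ ⊢ x :≤ b) x (+ a) (+ b) hi) (corner (there (there (here refl)))) (corner (there (there (there (here refl)))))
      row x (+ suc (suc _)) _ _ (ℤ.+≤+ (s≤s ())) _
      inside : ∀ s → s ∈ map (act φ) S → Trap a b (emb s)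
      inside (x , y) s∈ = let (p , q , r , h) = all _ s∈ in row x y p q r h

  tri2-≃ : ∀ φ S → IsTri2 (map (act φ) S) → Poly S ≃ Tri2
  tri2-≃ φ S I = mk≃ φ S _ inside λ { t (here refl) → c₀ ; t (there (here refl)) → c₁ ; t (there (there (here refl))) → c₂ }
    where
      open IsTri2 I
      o : Tri2 (emb (+ 0 , + 0))
      o = corner (here refl)
      a : Tri2 (emb (+ 2 , + 0))
      a = corner (there (here refl))
      b : Tri2 (emb (+ 0 , + 2))
      b = corner (there (there (here refl)))
      row : ∀ x y → + 0 ≤ x → y ≡ + 0 ⊎ y ≡ + 1 ⊎ y ≡ + 2 → x + y ≤ + 2 → Tri2 (emb (x , y))
      row x y lo (inj₁ refl) hi = onRow (+ 0) (+ 2) x (+ 0) lo (lin 1 (λ x → x :+ κ 0 :≤ κ 2 ⇒ ⊢ x :≤ κ 2) x hi) o a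
      row x y lo (inj₂ (inj₁ refl)) hi = onRow (+ 0) (+ 1) x (+ 1) lo (lin 1 (λ x → x :+ κ 1 :≤ κ 2 ⇒ ⊢ x :≤ κ 1) x hi)
        (onSegment (+ 2) (+ 1) (+ 0 , + 0) (+ 0 , + 2) (+ 0 , + 1) (ℤ.+≤+ z≤n) (ℤ.+≤+ (s≤s z≤n)) (ℤ.+<+ (s≤s z≤n)) refl refl o b)
        (onSegment (+ 2) (+ 1) (+ 2 , + 0) (+ 0 , + 2) (+ 1 , + 1) (ℤ.+≤+ z≤n) (ℤ.+≤+ (s≤s z≤n)) (ℤ.+<+ (s≤s z≤n)) refl refl a b)
      row x y lo (inj₂ (inj₂ refl)) hi = onRow (+ 0) (+ 0) x (+ 2) lo (lin 1 (λ x → x :+ κ 2 :≤ κ 2 ⇒ ⊢ x :≤ κ 0) x hi) b b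
      inside : ∀ s → s ∈ map (act φ) S → Tri2 (emb s)
      inside (x , y) s∈ = let (p , q , h) = all _ s∈ in row x y p (split012 y q (lin 2 (λ x y → κ 0 :≤ x ⇒ x :+ y :≤ κ 2 ⇒ ⊢ y :≤ κ 2) x y p h)) h

  tri42-≃ : ∀ φ S → IsTri42 (map (act φ) S) → Poly S ≃ Tri42
  tri42-≃ φ S I = mk≃ φ S _ inside λ { t (here refl) → c₀ ; t (there (here refl)) → c₁ ; t (there (there (here refl))) → c₂ }
    where
      open IsTri42 I
      o : Tri42 (emb (+ 0 , + 0))
      o = corner (here refl)
      a : Tri42 (emb (+ 4 , + 0))
      a = corner (there (here refl))
      b : Tri42 (emb (+ 0 , + 2))
      b = corner (there (there (here refl)))
      row : ∀ x y → + 0 ≤ x → y ≡ + 0 ⊎ y ≡ + 1 ⊎ y ≡ + 2 → x + + 2 * y ≤ + 4 → Tri42 (emb (x , y))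
      row x y lo (inj₁ refl) hi = onRow (+ 0) (+ 4) x (+ 0) lo (lin 1 (λ x → x :+ κ 0 :≤ κ 4 ⇒ ⊢ x :≤ κ 4) x hi) o a
      row x y lo (inj₂ (inj₁ refl)) hi = onRow (+ 0) (+ 2) x (+ 1) lo (lin 1 (λ x → x :+ κ 2 :≤ κ 4 ⇒ ⊢ x :≤ κ 2) x hi)
        (onSegment (+ 2) (+ 1) (+ 0 , + 0) (+ 0 , + 2) (+ 0 , + 1) (ℤ.+≤+ z≤n) (ℤ.+≤+ (s≤s z≤n)) (ℤ.+<+ (s≤s z≤n)) refl refl o b)
        (onSegment (+ 2) (+ 1) (+ 4 , + 0) (+ 0 , + 2) (+ 2 , + 1) (ℤ.+≤+ z≤n) (ℤ.+≤+ (s≤s z≤n)) (ℤ.+<+ (s≤s z≤n)) refl refl a b)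
      row x y lo (inj₂ (inj₂ refl)) hi = onRow (+ 0) (+ 0) x (+ 2) lo (lin 1 (λ x → x :+ κ 4 :≤ κ 4 ⇒ ⊢ x :≤ κ 0) x hi) b b
      inside : ∀ s → s ∈ map (act φ) S → Tri42 (emb s)
      inside (x , y) s∈ = let (p , q , h) = all _ s∈ in row x y p (split012 y q (lin 2 (λ x y → κ 0 :≤ x ⇒ x :+ κ 2 :* y :≤ κ 4 ⇒ ⊢ y :≤ κ 2) x y p h)) h

  rect-≃ : ∀ φ S a b → IsRect a b (map (act φ) S) → Poly S ≃ Rect a b
  rect-≃ φ S a b I = mk≃ φ S _ inside λ { t (here refl) → c₀₀ ; t (there (here refl)) → c₁₀ ; t (there (there (here refl))) → c₀₁ ; t (there (there (there (here refl)))) → c₁₁ }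
    where
      open IsRect I
      inside : ∀ s → s ∈ map (act φ) S → Rect a b (emb s)
      inside (x , y) s∈ = let (p , q , r , h) = all _ s∈ in onRow (+ 0) (+ a) x y p q
        (onColumn (+ 0) (+ 0) (+ b) y r h (corner (here refl)) (corner (there (there (here refl)))))
        (onColumn (+ a) (+ 0) (+ b) y r h (corner (there (here refl))) (corner (there (there (there (here refl))))))

-- Lattice sizes of the trapezoids, triangles and rectangles

module StandardPolygons where
  open import Data.Integer using (_+_; _*_; _-_; -_; _≤_; _<_)
  open import Data.List.Relation.Unary.All using ([]; _∷_)
  open import Data.List.Relation.Unary.Any using (here; there)
  open import Data.Nat using (suc; z≤n; s≤s)
  open Lattice
  open Frames
  open Configurations
  open LatticeSize
  open ConvexHulls
  open Equivalence

  trapL : ℕ → ℕ → List Pt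
  trapL a b = pt 0 0 ∷ pt a 0 ∷ pt 0 1 ∷ pt b 1 ∷ []

  rectL : ℕ → ℕ → List Pt
  rectL a b = pt 0 0 ∷ pt a 0 ∷ pt 0 b ∷ pt a b ∷ []

  tri2L tri42L : List Pt
  tri2L  = pt 0 0 ∷ pt 2 0 ∷ pt 0 2 ∷ []
  tri42L = pt 0 0 ∷ pt 4 0 ∷ pt 0 2 ∷ []

  box-bound : ∀ φ d x y a b → + 0 ≤ a → + 0 ≤ b → InΔ d (act φ (x , y)) → InΔ d (act φ (x + a , y)) → InΔ d (act φ (x , y + b)) → InΔ d (act φ (x + a , y + b)) → a + b ≤ d
  box-bound φ d x y a b a≥0 b≥0 h₀₀ h₁₀ h₀₁ h₁₁ = parallelogram-bound φ d (x , y) a (+ 1 , + 0) b (+ 0 , + 1) a≥0 b≥0 (λ ()) (λ ()) corners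
    where
      e : ∀ x a i b j → x + i * (a * + 1) + j * (b * + 0) ≡ x + i * a
      e = lin 5 λ x a i b j → ⊢ x :+ i :* (a :* κ 1) :+ j :* (b :* κ 0) :≡ x :+ i :* a
      f : ∀ x a i b j → x + i * (a * + 0) + j * (b * + 1) ≡ x + j * b
      f = lin 5 λ x a i b j → ⊢ x :+ i :* (a :* κ 0) :+ j :* (b :* κ 1) :≡ x :+ j :* b
      off : ∀ i j → offset (x , y) a (+ 1 , + 0) b (+ 0 , + 1) i j ≡ (x + i * a , y + j * b)
      off i j = cong₂ _,_ (e x a i b j) (f y a i b j)
      zero′ : ∀ x a → x + + 0 * a ≡ x
      zero′ = lin 2 λ x a → ⊢ x :+ κ 0 :* a :≡ x
      one′ : ∀ x a → x + + 1 * a ≡ x + a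
      one′ = lin 2 λ x a → ⊢ x :+ κ 1 :* a :≡ x :+ a
      corners : ∀ i j → Bit i → Bit j → InΔ d (act φ (offset (x , y) a (+ 1 , + 0) b (+ 0 , + 1) i j))
      corners i j (inj₁ refl) (inj₁ refl) = subst (λ p → InΔ d (act φ p)) (sym (trans (off i j) (cong₂ _,_ (zero′ x a) (zero′ y b)))) h₀₀
      corners i j (inj₂ refl) (inj₁ refl) = subst (λ p → InΔ d (act φ p)) (sym (trans (off i j) (cong₂ _,_ (one′ x a) (zero′ y b)))) h₁₀
      corners i j (inj₁ refl) (inj₂ refl) = subst (λ p → InΔ d (act φ p)) (sym (trans (off i j) (cong₂ _,_ (zero′ x a) (one′ y b)))) h₀₁
      corners i j (inj₂ refl) (inj₂ refl) = subst (λ p → InΔ d (act φ p)) (sym (trans (off i j) (cong₂ _,_ (one′ x a) (one′ y b)))) h₁₁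

  0≤ : ∀ {n} → + 0 ≤ + n
  0≤ = ℤ.+≤+ z≤n

  edge-bound : ∀ {P : Pt → Set} a y k → P (+ 0 , y) → P (+ a , y) → Fit P (+ k) → a ℕ.≤ k
  edge-bound a y k p q (φ , h) = ℤₚ.drop‿+≤+ (subst (_≤ + k) (ℤₚ.+-identityʳ (+ a)) (segment-bound φ (+ k) (+ 0) (+ a) y 0≤ (h _ p) (h _ q)))

  trap-noInt : ∀ a b p → ¬ Int (trapL a b) p
  trap-noInt a b p i = ℤₚ.<⇒≱ (int-y< {c = + 1} top i) (int-y≥1 bottom i)
    where
      top : ∀ s → s ∈ trapL a b → proj₂ s ≤ + 1
      top s (here refl) = ℤ.+≤+ z≤n
      top s (there (here refl)) = ℤ.+≤+ z≤n
      top s (there (there (here refl))) = ℤ.+≤+ (s≤s z≤n)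
      top s (there (there (there (here refl)))) = ℤ.+≤+ (s≤s z≤n)
      bottom : ∀ s → s ∈ trapL a b → + 0 ≤ proj₂ s
      bottom s (here refl) = 0≤
      bottom s (there (here refl)) = 0≤
      bottom s (there (there (here refl))) = 0≤
      bottom s (there (there (there (here refl)))) = 0≤

  trap-size₁ : ∀ a → IsSize (_∈ trapL a a) (suc a)
  trap-size₁ a = isSize (_ , here refl) (fitHere inside) λ k (φ , h) → ℤₚ.drop‿+≤+ (subst (_≤ + k) (cong +_ (ℕₚ.+-comm a 1))
      (box-bound φ (+ k) (+ 0) (+ 0) (+ a) (+ 1) 0≤ 0≤ (h _ (here refl)) (h _ (there (here refl))) (h _ (there (there (here refl)))) (h _ (there (there (there (here refl)))))))
    where
      inside : ∀ s → s ∈ trapL a a → InΔ (+ suc a) s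
      inside s (here refl) = 0≤ , 0≤ , ℤ.+≤+ z≤n
      inside s (there (here refl)) = 0≤ , 0≤ , ℤ.+≤+ (ℕₚ.≤-trans (ℕₚ.≤-reflexive (ℕₚ.+-identityʳ a)) (ℕₚ.n≤1+n a))
      inside s (there (there (here refl))) = 0≤ , 0≤ , ℤ.+≤+ (s≤s z≤n)
      inside s (there (there (there (here refl)))) = 0≤ , 0≤ , ℤ.+≤+ (ℕₚ.≤-reflexive (ℕₚ.+-comm a 1))

  -- For `b < a` the upper row ends at coordinate sum `b + 1 ≤ a`, so the height costs nothing and
  -- the bottom edge alone determines the size.
  trap-size₂ : ∀ a b → b ℕ.< a → IsSize (_∈ trapL a b) a
  trap-size₂ a b b<a = isSize (_ , here refl) (fitHere inside) λ k → edge-bound a (+ 0) k (here refl) (there (here refl))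
    where
      inside : ∀ s → s ∈ trapL a b → InΔ (+ a) s
      inside s (here refl) = 0≤ , 0≤ , ℤ.+≤+ z≤n
      inside s (there (here refl)) = 0≤ , 0≤ , ℤ.+≤+ (ℕₚ.≤-reflexive (ℕₚ.+-identityʳ a))
      inside s (there (there (here refl))) = 0≤ , 0≤ , ℤ.+≤+ (ℕₚ.≤-trans (s≤s z≤n) b<a)
      inside s (there (there (there (here refl)))) = 0≤ , 0≤ , ℤ.+≤+ (ℕₚ.≤-trans (ℕₚ.≤-reflexive (ℕₚ.+-comm b 1)) b<a)

  tri2-inside : ∀ s → s ∈ tri2L → InΔ (+ 2) s
  tri2-inside s (here refl) = 0≤ , 0≤ , ℤ.+≤+ z≤n
  tri2-inside s (there (here refl)) = 0≤ , 0≤ , ℤₚ.≤-refl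
  tri2-inside s (there (there (here refl))) = 0≤ , 0≤ , ℤₚ.≤-refl

  tri2-noInt : ∀ p → ¬ Int tri2L p
  tri2-noInt p@(x , y) i = let (x≥1 , y≥1) = int-≥1 (λ s s∈ → let (a , b , _) = tri2-inside s s∈ in a , b) i in
    lin 2 (λ x y → κ 1 :≤ x ⇒ κ 1 :≤ y ⇒ x :+ κ 1 :* y :< κ 2 ⇒ ⊢ :⊥) x y x≥1 y≥1
      (int-slope< (+ 1) (+ 2) (λ s s∈ → subst (λ z → proj₁ s + z ≤ + 2) (sym (ℤₚ.*-identityˡ (proj₂ s))) (proj₂ (proj₂ (tri2-inside s s∈)))) i)

  tri2-size : IsSize (_∈ tri2L) 2
  tri2-size = isSize (_ , here refl) (fitHere tri2-inside) λ k → edge-bound 2 (+ 0) k (here refl) (there (here refl))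

  tri42-size : IsSize (_∈ tri42L) 4
  tri42-size = isSize (_ , here refl) (fitHere inside) λ k → edge-bound 4 (+ 0) k (here refl) (there (here refl))
    where
      inside : ∀ s → s ∈ tri42L → InΔ (+ 4) s
      inside s (here refl) = 0≤ , 0≤ , ℤ.+≤+ z≤n
      inside s (there (here refl)) = 0≤ , 0≤ , ℤₚ.≤-refl
      inside s (there (there (here refl))) = 0≤ , 0≤ , ℤ.+≤+ (s≤s (s≤s z≤n))

  tri42-innerSize : IsSize (Int tri42L) 0
  tri42-innerSize = isSize ((+ 1 , + 1) , center) (translate (- + 1) (- + 1) , λ p@(x , y) i →
      let (x≥1 , y≥1) = int-≥1 quad i ; top = int-slope< (+ 2) (+ 4) slope i in
      subst (InΔ (+ 0)) (sym (act-translate (- + 1) (- + 1) p))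
        ( lin 1 (λ x → κ 1 :≤ x ⇒ ⊢ κ 0 :≤ x :+ :- κ 1) x x≥1 , lin 1 (λ x → κ 1 :≤ x ⇒ ⊢ κ 0 :≤ x :+ :- κ 1) y y≥1
        , lin 2 (λ x y → κ 1 :≤ x ⇒ κ 1 :≤ y ⇒ x :+ κ 2 :* y :< κ 4 ⇒ ⊢ x :+ :- κ 1 :+ (y :+ :- κ 1) :≤ κ 0) x y x≥1 y≥1 top)) λ _ _ → z≤n
    where
      quad : Quadrant tri42L
      quad s (here refl) = 0≤ , 0≤
      quad s (there (here refl)) = 0≤ , 0≤
      quad s (there (there (here refl))) = 0≤ , 0≤
      slope : ∀ s → s ∈ tri42L → proj₁ s + + 2 * proj₂ s ≤ + 4
      slope s (here refl) = 0≤
      slope s (there (here refl)) = ℤₚ.≤-refl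
      slope s (there (there (here refl))) = ℤₚ.≤-refl
      center : Int tri42L (+ 1 , + 1)
      center with int⊎sep tri42L (+ 1 , + 1)
      ... | inj₁ i = i
      ... | inj₂ ((a , b) , nz , h) = ⊥-elim (nz
        ( lin 2 (λ a b → a :* κ 0 :+ b :* κ 0 :≤ a :* κ 1 :+ b :* κ 1 ⇒ a :* κ 4 :+ b :* κ 0 :≤ a :* κ 1 :+ b :* κ 1 ⇒ a :* κ 0 :+ b :* κ 2 :≤ a :* κ 1 :+ b :* κ 1 ⇒ ⊢ a :≡ κ 0) a b (h _ (here refl)) (h _ (there (here refl))) (h _ (there (there (here refl))))
        , lin 2 (λ a b → a :* κ 0 :+ b :* κ 0 :≤ a :* κ 1 :+ b :* κ 1 ⇒ a :* κ 4 :+ b :* κ 0 :≤ a :* κ 1 :+ b :* κ 1 ⇒ a :* κ 0 :+ b :* κ 2 :≤ a :* κ 1 :+ b :* κ 1 ⇒ ⊢ b :≡ κ 0) a b (h _ (here refl)) (h _ (there (here refl))) (h _ (there (there (here refl)))) ))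

  rect-size : ∀ a b → IsSize (_∈ rectL a b) (a ℕ.+ b)
  rect-size a b = isSize (_ , here refl) (fitHere inside) λ k (φ , h) → ℤₚ.drop‿+≤+
      (box-bound φ (+ k) (+ 0) (+ 0) (+ a) (+ b) 0≤ 0≤ (h _ (here refl)) (h _ (there (here refl))) (h _ (there (there (here refl)))) (h _ (there (there (there (here refl))))))
    where
      inside : ∀ s → s ∈ rectL a b → InΔ (+ (a ℕ.+ b)) s
      inside s (here refl) = 0≤ , 0≤ , ℤ.+≤+ z≤n
      inside s (there (here refl)) = 0≤ , 0≤ , ℤ.+≤+ (ℕₚ.≤-trans (ℕₚ.≤-reflexive (ℕₚ.+-identityʳ a)) (ℕₚ.m≤m+n a b))
      inside s (there (there (here refl))) = 0≤ , 0≤ , ℤ.+≤+ (ℕₚ.m≤n+m b a)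
      inside s (there (there (there (here refl)))) = 0≤ , 0≤ , ℤₚ.≤-refl

  rect-int : ∀ a b x y → + 0 < x → x < + a → + 0 < y → y < + b → Int (rectL a b) (x , y)
  rect-int a b x y x>0 x<a y>0 y<b with int⊎sep (rectL a b) (x , y)
  ... | inj₁ i = i
  ... | inj₂ ((u , v) , nz , h) = ⊥-elim (nz (ℤₚ.≤-antisym u≤0 u≥0 , ℤₚ.≤-antisym v≤0 v≥0))
    where
      A B P : ℤ
      A = + a
      B = + b
      P = u * x + v * y
      h₀₀ : + 0 ≤ P
      h₀₀ = lin 3 (λ u v P → u :* κ 0 :+ v :* κ 0 :≤ P ⇒ ⊢ κ 0 :≤ P) u v P (h _ (here refl))
      h₁₀ : u * A ≤ P
      h₁₀ = lin 4 (λ u v A P → u :* A :+ v :* κ 0 :≤ P ⇒ ⊢ u :* A :≤ P) u v A P (h _ (there (here refl)))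
      h₀₁ : v * B ≤ P
      h₀₁ = lin 4 (λ u v A P → u :* κ 0 :+ v :* A :≤ P ⇒ ⊢ v :* A :≤ P) u v B P (h _ (there (there (here refl))))
      h₁₁ : u * A + v * B ≤ P
      h₁₁ = h _ (there (there (there (here refl))))
      A>0 : + 0 < A
      A>0 = ℤₚ.<-trans x>0 x<a
      B>0 : + 0 < B
      B>0 = ℤₚ.<-trans y>0 y<b
      drop : ∀ c z → + 0 < c → c * z ≤ + 0 → z ≤ + 0
      drop = lin 2 λ c z → κ 0 :< c ⇒ c :* z :≤ κ 0 ⇒ 0 ⊛ 1 ∷ [] ⊩ z :≤ κ 0
      drop′ : ∀ c z → + 0 < c → + 0 ≤ c * z → + 0 ≤ z
      drop′ = lin 2 λ c z → κ 0 :< c ⇒ κ 0 :≤ c :* z ⇒ 0 ⊛ 1 ∷ [] ⊩ κ 0 :≤ z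
      -- (B − y) (corner below) + y (corner above) on each vertical side, and likewise on the horizontal ones
      right : ∀ u v x y A B → y < B → + 0 < y → u * A ≤ u * x + v * y → u * A + v * B ≤ u * x + v * y → B * ((A - x) * u) ≤ + 0
      right = lin 6 λ u v x y A B → y :< B ⇒ κ 0 :< y ⇒ u :* A :≤ u :* x :+ v :* y ⇒ u :* A :+ v :* B :≤ u :* x :+ v :* y ⇒ 1 ⊛ 3 ∷ 2 ⊛ 4 ∷ [] ⊩ B :* ((A :- x) :* u) :≤ κ 0
      left : ∀ u v x y B → y < B → + 0 < y → + 0 ≤ u * x + v * y → v * B ≤ u * x + v * y → + 0 ≤ B * (x * u)
      left = lin 5 λ u v x y B → y :< B ⇒ κ 0 :< y ⇒ κ 0 :≤ u :* x :+ v :* y ⇒ v :* B :≤ u :* x :+ v :* y ⇒ 1 ⊛ 3 ∷ 2 ⊛ 4 ∷ [] ⊩ κ 0 :≤ B :* (x :* u)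
      flip : ∀ x y → u * x + v * y ≡ v * y + u * x
      flip x y = ℤₚ.+-comm (u * x) (v * y)
      u≤0 : u ≤ + 0
      u≤0 = drop (A - x) u (lin 2 (λ x A → x :< A ⇒ ⊢ κ 0 :< A :- x) x A x<a) (drop B ((A - x) * u) B>0 (right u v x y A B y<b y>0 h₁₀ h₁₁))
      u≥0 : + 0 ≤ u
      u≥0 = drop′ x u x>0 (drop′ B (x * u) B>0 (left u v x y B y<b y>0 h₀₀ h₀₁))
      v≤0 : v ≤ + 0
      v≤0 = drop (B - y) v (lin 2 (λ x A → x :< A ⇒ ⊢ κ 0 :< A :- x) y B y<b) (drop A ((B - y) * v) A>0
        (right v u y x B A x<a x>0 (subst (v * B ≤_) (flip x y) h₀₁) (subst₂ _≤_ (flip A B) (flip x y) h₁₁)))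
      v≥0 : + 0 ≤ v
      v≥0 = drop′ y v y>0 (drop′ A (y * v) A>0 (left v u y x A x<a x>0 (subst (+ 0 ≤_) (flip x y) h₀₀) (subst (u * A ≤_) (flip x y) h₁₀)))

  rect-innerSize : ∀ a b → IsSize (Int (rectL (2 ℕ.+ a) (2 ℕ.+ b))) (a ℕ.+ b)
  rect-innerSize a b = isSize (_ , i₀₀) (translate (- + 1) (- + 1) , λ p@(x , y) i →
      let (x≥1 , y≥1) = int-≥1 (λ s s∈ → let (p , q , _) = box s s∈ in p , q) i in
      subst (InΔ (+ (a ℕ.+ b))) (sym (act-translate (- + 1) (- + 1) p))
        ( lin 1 (λ x → κ 1 :≤ x ⇒ ⊢ κ 0 :≤ x :+ :- κ 1) x x≥1 , lin 1 (λ x → κ 1 :≤ x ⇒ ⊢ κ 0 :≤ x :+ :- κ 1) y y≥1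
        , lin 4 (λ x y a b → x :< κ 2 :+ a ⇒ y :< κ 2 :+ b ⇒ ⊢ x :+ :- κ 1 :+ (y :+ :- κ 1) :≤ a :+ b) x y (+ a) (+ b)
            (int-x< {c = + (2 ℕ.+ a)} (λ s s∈ → proj₁ (proj₂ (proj₂ (box s s∈)))) i) (int-y< {c = + (2 ℕ.+ b)} (λ s s∈ → proj₂ (proj₂ (proj₂ (box s s∈)))) i)))
      λ k (φ , h) → ℤₚ.drop‿+≤+ (box-bound φ (+ k) (+ 1) (+ 1) (+ a) (+ b) 0≤ 0≤ (h _ i₀₀) (h _ i₁₀) (h _ i₀₁) (h _ i₁₁))
    where
      T = rectL (2 ℕ.+ a) (2 ℕ.+ b)
      one< : ∀ {n} → + 1 < + (2 ℕ.+ n)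
      one< = ℤ.+<+ (s≤s (s≤s z≤n))
      suc< : ∀ {n} → + suc n < + (2 ℕ.+ n)
      suc< = ℤ.+<+ ℕₚ.≤-refl
      pos : ∀ {n} → + 0 < + suc n
      pos = ℤ.+<+ (s≤s z≤n)
      i₀₀ : Int T (+ 1 , + 1)
      i₀₀ = rect-int (2 ℕ.+ a) (2 ℕ.+ b) (+ 1) (+ 1) pos one< pos one<
      i₁₀ : Int T (+ suc a , + 1)
      i₁₀ = rect-int (2 ℕ.+ a) (2 ℕ.+ b) (+ suc a) (+ 1) pos suc< pos one<
      i₀₁ : Int T (+ 1 , + suc b)
      i₀₁ = rect-int (2 ℕ.+ a) (2 ℕ.+ b) (+ 1) (+ suc b) pos one< pos suc<
      i₁₁ : Int T (+ suc a , + suc b)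
      i₁₁ = rect-int (2 ℕ.+ a) (2 ℕ.+ b) (+ suc a) (+ suc b) pos suc< pos suc<
      box : ∀ s → s ∈ T → + 0 ≤ proj₁ s × + 0 ≤ proj₂ s × proj₁ s ≤ + (2 ℕ.+ a) × proj₂ s ≤ + (2 ℕ.+ b)
      box s (here refl) = 0≤ , 0≤ , 0≤ , 0≤
      box s (there (here refl)) = 0≤ , 0≤ , ℤₚ.≤-refl , 0≤
      box s (there (there (here refl))) = 0≤ , 0≤ , 0≤ , ℤₚ.≤-refl
      box s (there (there (there (here refl)))) = 0≤ , 0≤ , ℤₚ.≤-refl , ℤₚ.≤-refl

  case₁ : ∀ S a b → Poly S ≃ Trap a b → LS (Inner (Poly S)) (- + 2) × (a ≡ b → LS (Poly S) (+ suc a)) × (b ℕ.< a → LS (Poly S) (+ a))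
  case₁ S a b (φ , eq) = innerEmpty⇒LS {S} (noInt-S (trap-noInt a b)) , (λ { refl → size⇒LS (size-S (trap-size₁ a)) }) , λ b<a → size⇒LS (size-S (trap-size₂ a b b<a))
    where open Transport {S} {trapL a b} φ eq

  case₂ : ∀ S → Poly S ≃ Tri2 → LS (Inner (Poly S)) (- + 2) × LS (Poly S) (+ 2)
  case₂ S (φ , eq) = innerEmpty⇒LS {S} (noInt-S tri2-noInt) , size⇒LS (size-S tri2-size)
    where open Transport {S} {tri2L} φ eq

  case₃ : ∀ S → Poly S ≃ Tri42 → LS (Inner (Poly S)) (+ 0) × LS (Poly S) (+ 4)
  case₃ S (φ , eq) = innerSize⇒LS {S} (sizeInt-S tri42-innerSize) , size⇒LS (size-S tri42-size)
    where open Transport {S} {tri42L} φ eq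

  case₄ : ∀ S a b → 2 ℕ.≤ a → 2 ℕ.≤ b → Poly S ≃ Rect a b → LS (Inner (Poly S)) (+ (a ℕ.+ b) - + 4) × LS (Poly S) (+ (a ℕ.+ b))
  case₄ S (suc (suc a)) (suc (suc b)) (s≤s (s≤s z≤n)) (s≤s (s≤s z≤n)) (φ , eq) =
      subst (LS (Inner (Poly S))) (lin 2 (λ a b → ⊢ a :+ b :≡ (κ 2 :+ a) :+ (κ 2 :+ b) :- κ 4) (+ a) (+ b)) (innerSize⇒LS {S} (sizeInt-S (rect-innerSize a b))) ,
      size⇒LS (size-S (rect-size (2 ℕ.+ a) (2 ℕ.+ b)))
    where open Transport {S} {rectL (2 ℕ.+ a) (2 ℕ.+ b)} φ eq

-- A long edge above which a parallel inner edge runs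

module EdgePairs where
  open import Data.Integer using (_+_; _*_; _-_; -_; _≤_; _<_)
  open import Data.List using (_++_; length; upTo)
  open import Data.List.Membership.Propositional.Properties using (∈-++⁺ˡ; ∈-++⁺ʳ; ∈-++⁻; ∈-∃++; ∈-upTo⁺; ∈-upTo⁻)
  open import Data.List.Relation.Unary.All using (All; []; _∷_)
  open import Data.List.Relation.Unary.Any using (here; there)
  open import Data.Nat using (suc; z≤n; s≤s)
  import Data.Nat.Divisibility as ℕ∣
  open import Data.Integer.GCD using (gcd)
  import Data.Integer.GCD as ℤgcd
  import Data.Integer.Divisibility.Signed as ℤ∣
  open import Data.List.Relation.Unary.Unique.Propositional using (Unique)
  import Data.List.Relation.Unary.Unique.Propositional.Properties as Uniqueₚ
  import Data.List.Relation.Unary.AllPairs as AllPairs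
  import Data.List.Relation.Unary.All as All
  open Lattice
  open Frames
  open Configurations
  open Reflexive using (≤⊎>)
  open LatticeSize
  open ConvexHulls
  open Equivalence
  open StandardPolygons using (0≤)
  open Cones using (reduce; reduced; Reduced)

  -- Normal position of a long edge and its inner edge, of lengths `R` and `J`: a shear has placed
  -- the left end of the inner row at `(1 , 1)`.
  record EdgePair (T : List Pt) (R J : ℕ) : Set where
    field
      o∈    : (+ 0 , + 0) ∈ T
      R∈    : (+ R , + 0) ∈ T
      above : ∀ t → t ∈ T → + 0 ≤ proj₂ t
      edge  : ∀ t → t ∈ T → proj₂ t ≡ + 0 → + 0 ≤ proj₁ t × proj₁ t ≤ + R
      i₁    : Int T (+ 1 , + 1)
      iⱼ    : Int T (+ suc J , + 1)
      iedge : ∀ q → Int T q → proj₂ q ≡ + 1 → + 1 ≤ proj₁ q × proj₁ q ≤ + suc J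
      long  : J ℕ.+ 4 ℕ.≤ R

  module _ {T : List Pt} {R J : ℕ} (E : EdgePair T R J) where
    open EdgePair E
    private
      outside : ∀ x → ¬ (+ 1 ≤ x × x ≤ + suc J) → Sep T (x , + 1)
      outside x h with int⊎sep T (x , + 1)
      ... | inj₁ i = ⊥-elim (h (iedge _ i refl))
      ... | inj₂ s = s

      long′ : + suc J + + 3 ≤ + R
      long′ = subst (_≤ + R) (lin 1 (λ j → ⊢ j :+ κ 4 :≡ κ 1 :+ j :+ κ 3) (+ J)) (ℤ.+≤+ long)

      -- `(1 , 1)` is interior and `(0 , 1)` is not, so a separating line at `(0 , 1)` has `u₁ < 0`,
      -- and the origin gives `u₂ ≥ 0`. This keeps the rows above the bottom in `x ≥ 0`.
      x≥0 : ∀ t → t ∈ T → + 0 ≤ proj₁ t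
      x≥0 t@(x , y) t∈ = go (outside (+ 0) λ { (ℤ.+≤+ () , _) }) (≤⊎> y (+ 0))
        where
          go : Sep T (+ 0 , + 1) → y ≤ + 0 ⊎ + 0 < y → + 0 ≤ x
          go _ (inj₁ y≤0) = proj₁ (edge t t∈ (ℤₚ.≤-antisym y≤0 (above t t∈)))
          go (u@(u₁ , u₂) , nz , h) (inj₂ y>0) = lin 4 (λ u₁ u₂ x y → u₁ :< κ 0 ⇒ κ 0 :≤ u₂ ⇒ κ 0 :< y ⇒ u₁ :* x :+ u₂ :* y :≤ u₁ :* κ 0 :+ u₂ :* κ 1 ⇒ 0 ⊛ 1 ∷ 2 ⊛ 3 ∷ [] ⊩ κ 0 :≤ x) u₁ u₂ x y
              (lin 2 (λ u₁ u₂ → u₁ :* κ 1 :+ u₂ :* κ 1 :< u₁ :* κ 0 :+ u₂ :* κ 1 ⇒ ⊢ u₁ :< κ 0) u₁ u₂ (int-strict i₁ u nz _ h))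
              (lin 2 (λ u₁ u₂ → u₁ :* κ 0 :+ u₂ :* κ 0 :≤ u₁ :* κ 0 :+ u₂ :* κ 1 ⇒ ⊢ κ 0 :≤ u₂) u₁ u₂ (h _ o∈)) y>0 (h _ t∈)

      -- The right boundary moves left by at least two per row.
      record Slope : Set where
        field
          u₁ u₂ : ℤ
          u₁>0  : + 0 < u₁
          u₂≥   : + 2 * u₁ ≤ u₂
          bound′ : ∀ t → t ∈ T → u₁ * proj₁ t + u₂ * proj₂ t ≤ u₁ * (+ suc J + + 1) + u₂

      slope : Slope
      slope = go (outside (+ suc J + + 1) λ (_ , h) → ℤₚ.<⇒≱ (lin 1 (λ j → ⊢ j :< j :+ κ 1) (+ suc J)) h)
        where
          go : Sep T (+ suc J + + 1 , + 1) → Slope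
          go (u@(u₁ , u₂) , nz , h) = record
            { u₁ = u₁ ; u₂ = u₂
            ; u₁>0 = u₁>0
            -- The difference of 4 enters here: `(R , 0)` is at least two to the right of the
            -- non-interior point `(J + 2 , 1)`.
            ; u₂≥ = lin 4 (λ u₁ u₂ R j → κ 0 :< u₁ ⇒ u₁ :* R :+ u₂ :* κ 0 :≤ u₁ :* (j :+ κ 1) :+ u₂ :* κ 1 ⇒ j :+ κ 3 :≤ R ⇒ 1 ⊛ 3 ∷ [] ⊩ κ 2 :* u₁ :≤ u₂) u₁ u₂ (+ R) (+ suc J) u₁>0 (h _ R∈) long′
            ; bound′ = λ t t∈ → subst (u ∙ t ≤_) (cong (λ z → u₁ * (+ suc J + + 1) + z) (ℤₚ.*-identityʳ u₂)) (h t t∈) }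
            where
              u₁>0 : + 0 < u₁
              u₁>0 = lin 3 (λ u₁ u₂ j → u₁ :* j :+ u₂ :* κ 1 :< u₁ :* (j :+ κ 1) :+ u₂ :* κ 1 ⇒ ⊢ κ 0 :< u₁) u₁ u₂ (+ suc J) (int-strict iⱼ u nz _ h)

      open Slope slope

      -- In the rows `y ≥ 1` the slope gives `x + 2 (y - 1) ≤ J + 2`, hence `x + y ≤ J + 3 < R`; so
      -- the edge alone determines the size.
      top : ∀ t → t ∈ T → proj₁ t + proj₂ t ≤ + R
      top t@(x , y) t∈ with ≤⊎> y (+ 0)
      ... | inj₁ y≤0 = lin 3 (λ x y R → x :≤ R ⇒ y :≤ κ 0 ⇒ ⊢ x :+ y :≤ R) x y (+ R) (proj₂ (edge t t∈ (ℤₚ.≤-antisym y≤0 (above t t∈)))) y≤0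
      ... | inj₂ y>0 = lin 6 (λ u₁ u₂ x y j R → κ 0 :< u₁ ⇒ κ 2 :* u₁ :≤ u₂ ⇒ κ 0 :< y ⇒ u₁ :* x :+ u₂ :* y :≤ u₁ :* (j :+ κ 1) :+ u₂ ⇒ j :+ κ 3 :≤ R ⇒
            0 ⊛ 1 ∷ 2 ⊛ 3 ∷ 1 ⊛ 3 ∷ 1 ⊛ 5 ∷ [] ⊩ x :+ y :≤ R) u₁ u₂ x y (+ suc J) (+ R) u₁>0 u₂≥ y>0 (bound′ t t∈) long′

      topInt : ∀ q → Int T q → proj₁ q + proj₂ q ≤ + suc J + + 1
      topInt q@(x , y) i = lin 5 (λ u₁ u₂ x y j → κ 0 :< u₁ ⇒ κ 2 :* u₁ :≤ u₂ ⇒ κ 1 :≤ y ⇒ u₁ :* x :+ u₂ :* y :< u₁ :* (j :+ κ 1) :+ u₂ ⇒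
          0 ⊛ 1 ∷ 2 ⊛ 3 ∷ 1 ⊛ 3 ∷ [] ⊩ x :+ y :≤ j :+ κ 1) u₁ u₂ x y (+ suc J) u₁>0 u₂≥ (int-y≥1 above i)
          (int-strict i (u₁ , u₂) (λ (e , _) → ℤₚ.<-irrefl (sym e) u₁>0) _ bound′)

    edgePair-size : IsSize (_∈ T) R
    edgePair-size = isSize (_ , o∈) (fitHere λ t t∈ → x≥0 t t∈ , above t t∈ , top t t∈) λ k (φ , h) →
      ℤₚ.drop‿+≤+ (subst (_≤ + k) (ℤₚ.+-identityʳ (+ R)) (segment-bound φ (+ k) (+ 0) (+ R) (+ 0) 0≤ (h _ o∈) (h _ R∈)))

    edgePair-innerSize : IsSize (Int T) J
    edgePair-innerSize = isSize (_ , i₁) (translate (- + 1) (- + 1) , λ q@(x , y) i →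
        let x≥1 = int-x≥1 x≥0 i ; y≥1 = int-y≥1 above i in
        subst (InΔ (+ J)) (sym (act-translate (- + 1) (- + 1) q))
          ( lin 1 (λ x → κ 1 :≤ x ⇒ ⊢ κ 0 :≤ x :+ :- κ 1) x x≥1 , lin 1 (λ x → κ 1 :≤ x ⇒ ⊢ κ 0 :≤ x :+ :- κ 1) y y≥1
          , lin 3 (λ x y j → x :+ y :≤ κ 1 :+ j :+ κ 1 ⇒ ⊢ x :+ :- κ 1 :+ (y :+ :- κ 1) :≤ j) x y (+ J) (topInt q i))) λ k (φ , h) →
      ℤₚ.drop‿+≤+ (subst (_≤ + k) (lin 1 (λ j → ⊢ κ 1 :+ j :- κ 1 :≡ j) (+ J)) (segment-bound φ (+ k) (+ 1) (+ suc J) (+ 1) (ℤ.+≤+ (s≤s z≤n)) (h _ i₁) (h _ iⱼ)))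

  size-map : ∀ φ {S m} → IsSize (_∈ map (act φ) S) m → IsSize (_∈ S) m
  size-map φ {S} (isSize (t , t∈) f min) = isSize (preimage (∈-map⁻ (act φ) t∈)) (fit-map φ {S} f)
      λ k g → min k (fit-map (inv φ) {map (act φ) S} (subst (λ L → Fit (_∈ L) (+ k)) (sym (map-inv-act φ S)) g))
    where
      preimage : (Σ Pt λ s → s ∈ S × t ≡ act φ s) → Σ Pt (_∈ S)
      preimage (s , s∈ , _) = s , s∈

  sizeInt-map : ∀ φ {S m} → IsSize (Int (map (act φ) S)) m → IsSize (Int S) m
  sizeInt-map φ {S} (isSize (t , i) f min) = isSize (act (inv φ) t , int-map⁻ φ {S} i) (fitInt-map φ {S} f)
      λ k g → min k (fitInt-map (inv φ) {map (act φ) S} (subst (λ L → Fit (Int L) (+ k)) (sym (map-inv-act φ S)) g))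

  unique-length : ∀ {A : Set} (L M : List A) → Unique L → (∀ p → p ∈ L → p ∈ M) → length L ℕ.≤ length M
  unique-length [] M _ _ = z≤n
  unique-length (x ∷ L) M (x∉ AllPairs.∷ uL) sub = shrink (∈-∃++ (sub x (here refl)))
    where
      shrink : (Σ (List _) λ A → Σ (List _) λ B → M ≡ A ++ (x ∷ B)) → suc (length L) ℕ.≤ length M
      shrink (A , B , refl) = subst (suc (length L) ℕ.≤_) (sym (trans (Listₚ.length-++ A) (trans (ℕₚ.+-suc (length A) (length B)) (cong suc (sym (Listₚ.length-++ A))))))
          (s≤s (unique-length L (A ++ B) uL remaining))
        where
          remaining : ∀ p → p ∈ L → p ∈ A ++ B
          remaining p p∈ with ∈-++⁻ A (sub p (there p∈))
          ... | inj₁ p∈A = ∈-++⁺ˡ p∈A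
          ... | inj₂ (there p∈B) = ∈-++⁺ʳ A p∈B
          ... | inj₂ (here refl) = ⊥-elim (All.lookup x∉ p∈ refl)

  -- A large multiple of the height absorbs all points of L off the lowest row.
  row-bound : ∀ (L : List Pt) h c (σ : ℤ) → Bit σ ⊎ σ ≡ - + 1 → (∀ t → t ∈ L → h ≤ proj₂ t) → (∀ t → t ∈ L → proj₂ t ≡ h → σ * proj₁ t ≤ c) →
              ∀ x → Conv (_∈ L) (emb (x , h)) → σ * x ≤ c
  row-bound L h c σ s low row x cx = lin 5 (λ σ K x h c → σ :* x :+ :- K :* h :≤ c :- K :* h ⇒ ⊢ σ :* x :≤ c) σ K x h c
      (poly-halfplane-emb (σ , - K) (c - K * h) bounded (x , h) cx)
    where
      -- One row up lowers the form by `K`, which brings any value up to `bound L` down to at most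
      -- `c`.
      K = + (bound L) + + ℤ.∣ c ∣
      ∣σx∣ : ∀ σ x → Bit σ ⊎ σ ≡ - + 1 → ℤ.∣ x ∣ ℕ.≤ bound L → σ * x ≤ + bound L
      ∣σx∣ σ x (inj₁ (inj₁ refl)) k = ℤₚ.≤-trans (ℤₚ.≤-reflexive (ℤₚ.*-zeroˡ x)) 0≤
      ∣σx∣ σ x (inj₁ (inj₂ refl)) k = subst (_≤ + bound L) (sym (ℤₚ.*-identityˡ x)) (proj₂ (∣∣≤ x (bound L) k))
      ∣σx∣ σ x (inj₂ refl) k = lin 2 (λ x b → :- b :≤ x ⇒ ⊢ :- κ 1 :* x :≤ b) x (+ bound L) (proj₁ (∣∣≤ x (bound L) k))
      bounded : ∀ t → t ∈ L → (σ , - K) ∙ t ≤ c - K * h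
      bounded t@(x , y) t∈ with ≤⊎> y h
      ... | inj₁ y≤h = lin 6 (λ σ K x y h c → y :≡ h ⇒ σ :* x :≤ c ⇒ 1 ⊙ K ∷ [] ⊩ σ :* x :+ :- K :* y :≤ c :- K :* h) σ K x y h c y≡h (row t t∈ y≡h)
        where y≡h = ℤₚ.≤-antisym y≤h (low t t∈)
      ... | inj₂ y>h = lin 7 (λ σx b a y h c K → σx :≤ b ⇒ h :< y ⇒ :- a :≤ c ⇒ κ 0 :≤ K ⇒ K :≡ b :+ a ⇒ 2 ⊛ 4 ∷ [] ⊩ σx :+ :- K :* y :≤ c :- K :* h) (σ * x) (+ bound L) (+ ℤ.∣ c ∣) y h c K
            (∣σx∣ σ x s (proj₁ (bound-∈ L t∈))) y>h (proj₁ (∣∣≤ c ℤ.∣ c ∣ ℕₚ.≤-refl)) 0≤ refl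

  -- Lists the lattice points of the hull on its lowest row, pulled back along `φ`. There are
  -- `m + 1` of them, which links integral lengths with the counts of `LatCount`.
  module Row (φ : Unimod) (L : List Pt) (h l : ℤ) (m : ℕ)
             (low : ∀ t → t ∈ L → h ≤ proj₂ t) (row : ∀ t → t ∈ L → proj₂ t ≡ h → l ≤ proj₁ t × proj₁ t ≤ l + + m)
             (l∈ : (l , h) ∈ L) (r∈ : (l + + m , h) ∈ L) where

    OnRow : Pt → Set
    OnRow p = Conv (_∈ L) (emb (act φ p)) × proj₂ (act φ p) ≡ h

    points : List Pt
    points = map (λ k → act (inv φ) (l + + k , h)) (upTo (suc m))

    points-length : length points ≡ suc m
    points-length = trans (Listₚ.length-map (λ k → act (inv φ) (l + + k , h)) (upTo (suc m))) (Listₚ.length-applyUpTo (λ k → k) (suc m))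

    points-unique : Unique points
    points-unique = Uniqueₚ.map⁺ injective (Uniqueₚ.upTo⁺ (suc m))
      where
        injective : ∀ {x y} → act (inv φ) (l + + x , h) ≡ act (inv φ) (l + + y , h) → x ≡ y
        injective {x} {y} e = ℤₚ.+-injective (lin 3 (λ l x y → l :+ x :≡ l :+ y ⇒ ⊢ x :≡ y) l (+ x) (+ y) (cong proj₁ (act-injective (inv φ) e)))

    range : ∀ x → Conv (_∈ L) (emb (x , h)) → l ≤ x × x ≤ l + + m
    range x c =
      lin 2 (λ x l → :- κ 1 :* x :≤ :- l ⇒ ⊢ l :≤ x) x l (row-bound L h (- l) (- + 1) (inj₂ refl) low (λ t t∈ e → lin 2 (λ x l → l :≤ x ⇒ ⊢ :- κ 1 :* x :≤ :- l) (proj₁ t) l (proj₁ (row t t∈ e))) x c) ,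
      lin 2 (λ x r → κ 1 :* x :≤ r ⇒ ⊢ x :≤ r) x (l + + m) (row-bound L h (l + + m) (+ 1) (inj₁ (inj₂ refl)) low (λ t t∈ e → lin 2 (λ x r → x :≤ r ⇒ ⊢ κ 1 :* x :≤ r) (proj₁ t) (l + + m) (proj₂ (row t t∈ e))) x c)

    points⇒row : ∀ p → p ∈ points → OnRow p
    points⇒row p p∈ = go (∈-map⁻ (λ k → act (inv φ) (l + + k , h)) p∈)
      where
        go : (Σ ℕ λ k → k ∈ upTo (suc m) × p ≡ act (inv φ) (l + + k , h)) → OnRow p
        go (k , k∈ , refl) = subst (λ t → Conv (_∈ L) (emb t) × proj₂ t ≡ h) (sym (act-inv φ (l + + k , h)))
          (onRow l (l + + m) (l + + k) h (ℤₚ.i≤i+j l (+ k)) (ℤₚ.+-monoʳ-≤ l (ℤ.+≤+ (ℕ.s≤s⁻¹ (∈-upTo⁻ k∈)))) (conv-point (l , h) l∈) (conv-point (l + + m , h) r∈) , refl)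

    row⇒points : ∀ p → OnRow p → p ∈ points
    row⇒points p (c , e) = subst (_∈ points) (trans (cong (act (inv φ)) (cong₂ _,_ x≡ (sym e))) (inv-act φ p)) (∈-map⁺ (λ k → act (inv φ) (l + + k , h)) (∈-upTo⁺ (s≤s k≤m)))
      where
        x = proj₁ (act φ p)
        r = range x (subst (λ y → Conv (_∈ L) (emb (x , y))) e c)
        k = ℤ.∣ x - l ∣
        +k : + k ≡ x - l
        +k = ℤₚ.0≤i⇒+∣i∣≡i (ℤₚ.i≤j⇒0≤j-i (proj₁ r))
        x≡ : l + + k ≡ x
        x≡ = lin 3 (λ k x l → k :≡ x :- l ⇒ ⊢ l :+ k :≡ x) (+ k) x l +k
        k≤m : k ℕ.≤ m
        k≤m = ℤₚ.drop‿+≤+ (lin 4 (λ k x l m → k :≡ x :- l ⇒ x :≤ l :+ m ⇒ ⊢ k :≤ m) (+ k) x l (+ m) +k (proj₂ r))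

    module _ {F : QSet} (F⇒ : ∀ p → F (emb p) → OnRow p) (⇒F : ∀ p → OnRow p → F (emb p)) where

      latCount : LatCount F (suc m)
      latCount = points , points-unique , points-length , λ p → (λ p∈ → ⇒F p (points⇒row p p∈)) , λ f → row⇒points p (F⇒ p f)

      latCount-≡ : ∀ {k} → LatCount F k → k ≡ suc m
      latCount-≡ {k} (M , uM , lM , iff) = trans (sym lM) (trans (ℕₚ.≤-antisym
        (unique-length M points uM λ p p∈ → row⇒points p (F⇒ p (proj₁ (iff p) p∈)))
        (unique-length points M points-unique λ p p∈ → proj₂ (iff p) (⇒F p (points⇒row p p∈)))) points-length)

  poly-frame⁺ : ∀ φ S p → Poly S (emb p) → Poly (map (act φ) S) (emb (act φ p))
  poly-frame⁺ φ S p c = subst (Poly (map (act φ) S)) (apply-emb φ p) (conv-apply φ (λ s s∈ → ∈-map⁺ (act φ) s∈) c)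

  poly-frame⁻ : ∀ φ S p → Poly (map (act φ) S) (emb (act φ p)) → Poly S (emb p)
  poly-frame⁻ φ S p c = subst (λ q → Poly S (emb q)) (inv-act φ p) (subst (Poly S) (apply-emb (inv φ) (act φ p)) (conv-apply (inv φ) back c))
    where
      back : ∀ t → t ∈ map (act φ) S → act (inv φ) t ∈ S
      back = all-map φ {S} {λ t → act (inv φ) t ∈ S} λ s s∈ → subst (_∈ S) (sym (inv-act φ s)) s∈

  inner-frame⁺ : ∀ φ S p → Inner (Poly S) (emb p) → Conv (_∈ interiorPoints (map (act φ) S)) (emb (act φ p))
  inner-frame⁺ φ S p c = subst (Conv (_∈ interiorPoints (map (act φ) S))) (apply-emb φ p)
    (conv-apply φ (λ q i → ∈-interiorPoints⁺ (map (act φ) S) (int-map⁺ φ {S} (interior⇒int S q i))) c)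

  inner-frame⁻ : ∀ φ S p → Conv (_∈ interiorPoints (map (act φ) S)) (emb (act φ p)) → Inner (Poly S) (emb p)
  inner-frame⁻ φ S p c = subst (λ q → Inner (Poly S) (emb q)) (inv-act φ p) (subst (Inner (Poly S)) (apply-emb (inv φ) (act φ p))
    (conv-apply (inv φ) (λ q q∈ → int⇒interior S _ (int-map⁻ φ {S} (∈-interiorPoints⁻ (map (act φ) S) q∈))) c))

  inner⊆ : ∀ {S} u c → (∀ p → Int S p → u ∙ p ≤ c) → ∀ {q} → Inner (Poly S) q → ι (proj₁ u) ℚ.* proj₁ q ℚ.+ ι (proj₂ u) ℚ.* proj₂ q ℚ.≤ ι c
  inner⊆ {S} u c h = poly-halfplane u c λ p i → h p (interior⇒int S p i)

  -- The factor `g` found by `reduce` divides both entries, hence their gcd 1; so the vector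
  -- completing the reduced pair also completes `(a , b)`.
  coprime⇒unit : ∀ a b → gcd a b ≡ + 1 → Σ Pt λ e → det e (a , b) ≡ + 1
  coprime⇒unit a b co = go (reduce (a , b))
    where
      go : Reduced (a , b) → Σ Pt λ e → det e (a , b) ≡ + 1
      go (reduced g (a′ , b′) e g≥0 a≡ b≡ one) = e ,
          lin 7 (λ g a b a′ b′ e₁ e₂ → g :≡ κ 1 ⇒ a :≡ g :* a′ ⇒ b :≡ g :* b′ ⇒ e₁ :* b′ :- e₂ :* a′ :≡ κ 1 ⇒ 1 ⊙ (e₁ :* b′) ∷ 1 ⊙ (e₂ :* a′) ∷ 2 ⊙ e₂ ∷ 3 ⊙ e₁ ∷ [] ⊩ e₁ :* b :- e₂ :* a :≡ κ 1)
            g a b a′ b′ (proj₁ e) (proj₂ e) g≡1 a≡ b≡ one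
        where
          divs : ∀ z z′ → z ≡ g * z′ → ℤ.∣ g ∣ ℕ∣.∣ ℤ.∣ z ∣
          divs z z′ eq = ℕ∣.divides ℤ.∣ z′ ∣ (trans (cong ℤ.∣_∣ eq) (trans (ℤₚ.abs-* g z′) (ℕₚ.*-comm ℤ.∣ g ∣ ℤ.∣ z′ ∣)))
          ∣g∣≡1 : ℤ.∣ g ∣ ≡ 1
          ∣g∣≡1 = ℕ∣.∣1⇒≡1 (subst (ℤ.∣ g ∣ ℕ∣.∣_) (cong ℤ.∣_∣ co) (ℤgcd.gcd-greatest {a} {b} {g} (divs a a′ a≡) (divs b b′ b≡)))
          g≡1 : g ≡ + 1
          g≡1 = trans (sym (ℤₚ.0≤i⇒+∣i∣≡i g≥0)) (cong +_ ∣g∣≡1)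

  -- The gcd of a row of the matrix divides its determinant.
  unit⇒coprime : ∀ a b c d → (a * d - b * c ≡ + 1) ⊎ (a * d - b * c ≡ - + 1) → gcd c d ≡ + 1
  unit⇒coprime a b c d h = cong +_ (ℕₚ.m*n≡1⇒m≡1 ℤ.∣ g ∣ ℤ.∣ k ∣ (trans (sym (ℤₚ.abs-* g k)) (trans (cong ℤ.∣_∣ (sym det≡)) one)))
    where
      g = gcd c d
      qc = ℤ∣.∣ᵤ⇒∣ {g} {c} (ℤgcd.gcd[i,j]∣i c d)
      qd = ℤ∣.∣ᵤ⇒∣ {g} {d} (ℤgcd.gcd[i,j]∣j c d)
      c′ = ℤ∣.quotient qc
      d′ = ℤ∣.quotient qd
      k = a * d′ - b * c′
      det≡ : a * d - b * c ≡ g * k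
      det≡ = lin 7 (λ a b c d g c′ d′ → c :≡ c′ :* g ⇒ d :≡ d′ :* g ⇒ 1 ⊙ b ∷ 2 ⊙ a ∷ [] ⊩ a :* d :- b :* c :≡ g :* (a :* d′ :- b :* c′)) a b c d g c′ d′ (ℤ∣._∣_.equality qc) (ℤ∣._∣_.equality qd)
      one : ℤ.∣ a * d - b * c ∣ ≡ 1
      one = [ cong ℤ.∣_∣ , cong ℤ.∣_∣ ]′ h

-- Lattice sizes in the presence of a long edge

module LongEdgeSizes where
  open import Data.Integer using (_+_; _*_; _-_; -_; _≤_; _<_)
  open import Data.List.Relation.Unary.All using ([]; _∷_)
  open import Data.Nat using (suc)
  open import Data.Rational using (0ℚ)
  open Lattice
  open Frames
  open Configurations
  open Reflexive using (≤⊎>)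
  open LatticeSize
  open ConvexHulls
  open Equivalence
  open EdgePairs
  open OrderedRings

  ℚ-cancel : ∀ z d → z ℚ.* d ≡ 0ℚ → ¬ (d ≡ 0ℚ) → z ≡ 0ℚ
  ℚ-cancel z d e ne with ℚₚ.<-cmp d 0ℚ
  ... | tri< d<0 _ _ = ℚₚ.≤-antisym
    (linℚ 2 (λ z d → z :* d :≡ κ 0 ⇒ d :< κ 0 ⇒ 0 ⊛ 2 ∷ [] ⊩ z :≤ κ 0) z d e d<0)
    (linℚ 2 (λ z d → z :* d :≡ κ 0 ⇒ d :< κ 0 ⇒ 0 ⊛ 2 ∷ [] ⊩ κ 0 :≤ z) z d e d<0)
  ... | tri≈ _ k _ = ⊥-elim (ne k)
  ... | tri> _ _ d>0 = ℚₚ.≤-antisym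
    (linℚ 2 (λ z d → z :* d :≡ κ 0 ⇒ κ 0 :< d ⇒ 0 ⊛ 2 ∷ [] ⊩ z :≤ κ 0) z d e d>0)
    (linℚ 2 (λ z d → z :* d :≡ κ 0 ⇒ κ 0 :< d ⇒ 0 ⊛ 2 ∷ [] ⊩ κ 0 :≤ z) z d e d>0)

  -- A face with two points on the line A x + B y = C has a normal vector proportional to (A , B).
  module Proportional {C : QSet} {α β γ A B D : ℚ} (N>0 : 0ℚ ℚ.< A ℚ.* A ℚ.+ B ℚ.* B) (edge : IsEdge C α β γ)
                      (line : ∀ q → Face C α β γ q → A ℚ.* proj₁ q ℚ.+ B ℚ.* proj₂ q ≡ D) where
    -- Orthogonal projection shows that `(α , β)` is `m / N` times `(A , B)`; the relation is used
    -- with denominators cleared, as `N α = m A` and `N β = m B`.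
    N m : ℚ
    N = A ℚ.* A ℚ.+ B ℚ.* B
    m = α ℚ.* A ℚ.+ β ℚ.* B

    private
      P = proj₁ (proj₂ (proj₂ edge))
      Q = proj₁ (proj₂ (proj₂ (proj₂ edge)))
      fP : Face C α β γ P
      fP = proj₁ (proj₂ (proj₂ (proj₂ (proj₂ edge))))
      fQ : Face C α β γ Q
      fQ = proj₁ (proj₂ (proj₂ (proj₂ (proj₂ (proj₂ edge)))))
      P≢Q : ¬ (P ≡ Q)
      P≢Q = proj₂ (proj₂ (proj₂ (proj₂ (proj₂ (proj₂ edge)))))
      dx = proj₁ P ℚ.- proj₁ Q
      dy = proj₂ P ℚ.- proj₂ Q
      diff : ∀ u v w → u ℚ.* proj₁ P ℚ.+ v ℚ.* proj₂ P ≡ w → u ℚ.* proj₁ Q ℚ.+ v ℚ.* proj₂ Q ≡ w → u ℚ.* dx ℚ.+ v ℚ.* dy ≡ 0ℚ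
      diff u v w = linℚ 7 (λ u v w p q r s → u :* p :+ v :* q :≡ w ⇒ u :* r :+ v :* s :≡ w ⇒ ⊢ u :* (p :- r) :+ v :* (q :- s) :≡ κ 0) u v w (proj₁ P) (proj₂ P) (proj₁ Q) (proj₂ Q)
      d₁ : α ℚ.* dx ℚ.+ β ℚ.* dy ≡ 0ℚ
      d₁ = diff α β γ (proj₂ fP) (proj₂ fQ)
      d₂ : A ℚ.* dx ℚ.+ B ℚ.* dy ≡ 0ℚ
      d₂ = diff A B D (line P fP) (line Q fQ)
      parallel : α ℚ.* B ℚ.- β ℚ.* A ≡ 0ℚ
      parallel with dx ℚₚ.≟ 0ℚ | dy ℚₚ.≟ 0ℚ
      ... | no ne | _ = ℚ-cancel _ dx (linℚ 6 (λ α β A B x y → α :* x :+ β :* y :≡ κ 0 ⇒ A :* x :+ B :* y :≡ κ 0 ⇒ 1 ⊙ B ∷ 2 ⊙ β ∷ [] ⊩ (α :* B :- β :* A) :* x :≡ κ 0) α β A B dx dy d₁ d₂) ne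
      ... | yes _ | no ne = ℚ-cancel _ dy (linℚ 6 (λ α β A B x y → α :* x :+ β :* y :≡ κ 0 ⇒ A :* x :+ B :* y :≡ κ 0 ⇒ 1 ⊙ A ∷ 2 ⊙ α ∷ [] ⊩ (α :* B :- β :* A) :* y :≡ κ 0) α β A B dx dy d₁ d₂) ne
      ... | yes e | yes f = ⊥-elim (P≢Q (cong₂ _,_ (linℚ 2 (λ p q → p :- q :≡ κ 0 ⇒ ⊢ p :≡ q) (proj₁ P) (proj₁ Q) e) (linℚ 2 (λ p q → p :- q :≡ κ 0 ⇒ ⊢ p :≡ q) (proj₂ P) (proj₂ Q) f)))
      Nα : N ℚ.* α ≡ m ℚ.* A
      Nα = linℚ 4 (λ α β A B → α :* B :- β :* A :≡ κ 0 ⇒ 1 ⊙ B ∷ [] ⊩ (A :* A :+ B :* B) :* α :≡ (α :* A :+ β :* B) :* A) α β A B parallel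
      Nβ : N ℚ.* β ≡ m ℚ.* B
      Nβ = linℚ 4 (λ α β A B → α :* B :- β :* A :≡ κ 0 ⇒ 1 ⊙ A ∷ [] ⊩ (A :* A :+ B :* B) :* β :≡ (α :* A :+ β :* B) :* B) α β A B parallel

    scaled : ∀ x y → N ℚ.* (α ℚ.* x ℚ.+ β ℚ.* y) ≡ m ℚ.* (A ℚ.* x ℚ.+ B ℚ.* y)
    scaled x y = linℚ 8 (λ N m α β A B x y → N :* α :≡ m :* A ⇒ N :* β :≡ m :* B ⇒ 1 ⊙ x ∷ 2 ⊙ y ∷ [] ⊩ N :* (α :* x :+ β :* y) :≡ m :* (A :* x :+ B :* y)) N m α β A B x y Nα Nβ

    scaledγ : N ℚ.* γ ≡ m ℚ.* D
    scaledγ = trans (cong (N ℚ.*_) (sym (proj₂ fP))) (trans (scaled (proj₁ P) (proj₂ P)) (cong (m ℚ.*_) (line P fP)))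

    m≢0 : ¬ (m ≡ 0ℚ)
    m≢0 e = proj₁ edge (vanish α A Nα , vanish β B Nβ)
      where
        N≢0 : ¬ (N ≡ 0ℚ)
        N≢0 k = ℚₚ.<-irrefl (sym k) N>0
        vanish : ∀ z w → N ℚ.* z ≡ m ℚ.* w → z ≡ 0ℚ
        vanish z w h = ℚ-cancel z N (linℚ 4 (λ N z m w → N :* z :≡ m :* w ⇒ m :≡ κ 0 ⇒ 2 ⊙ w ∷ [] ⊩ z :* N :≡ κ 0) N z m w h e) N≢0

    onLine⇒face : ∀ x y → A ℚ.* x ℚ.+ B ℚ.* y ≡ D → α ℚ.* x ℚ.+ β ℚ.* y ≡ γ
    onLine⇒face x y e = linℚ 2 (λ a b → a :- b :≡ κ 0 ⇒ ⊢ a :≡ b) (α ℚ.* x ℚ.+ β ℚ.* y) γ (ℚ-cancel _ N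
      (linℚ 6 (λ N V γ m L D → N :* V :≡ m :* L ⇒ N :* γ :≡ m :* D ⇒ L :≡ D ⇒ 3 ⊙ m ∷ [] ⊩ (V :- γ) :* N :≡ κ 0) N (α ℚ.* x ℚ.+ β ℚ.* y) γ m (A ℚ.* x ℚ.+ B ℚ.* y) D (scaled x y) scaledγ e)
      (λ k → ℚₚ.<-irrefl (sym k) N>0))

    below : 0ℚ ℚ.< m → ∀ q → C q → A ℚ.* proj₁ q ℚ.+ B ℚ.* proj₂ q ℚ.≤ D
    below m>0 q c = linℚ 6 (λ N V γ m L D → κ 0 :< m ⇒ κ 0 :< N ⇒ N :* V :≡ m :* L ⇒ N :* γ :≡ m :* D ⇒ V :≤ γ ⇒ 0 ⊛ 1 ∷ 2 ⊛ 5 ∷ [] ⊩ L :≤ D)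
      N (α ℚ.* proj₁ q ℚ.+ β ℚ.* proj₂ q) γ m (A ℚ.* proj₁ q ℚ.+ B ℚ.* proj₂ q) D m>0 N>0 (scaled (proj₁ q) (proj₂ q)) scaledγ (proj₁ (proj₂ edge) q c)

    facePoint : Σ QPt λ q → C q × A ℚ.* proj₁ q ℚ.+ B ℚ.* proj₂ q ≡ D
    facePoint = P , proj₁ fP , line P fP

  norm>0 : ∀ a b e → det e (a , b) ≡ + 1 → 0ℚ ℚ.< ι a ℚ.* ι a ℚ.+ ι b ℚ.* ι b
  norm>0 a b (e₁ , e₂) one = subst (0ℚ ℚ.<_) (ι-lin a b a b) (ι-mono-< (+ 0) (a * a + b * b) positive)
    where
      square : ∀ z → + 0 ≤ z * z
      square z with ≤⊎> (+ 0) z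
      ... | inj₁ h = lin 1 (λ z → κ 0 :≤ z ⇒ 1 ⊛ 1 ∷ [] ⊩ κ 0 :≤ z :* z) z h
      ... | inj₂ h = lin 1 (λ z → z :< κ 0 ⇒ 1 ⊛ 1 ∷ [] ⊩ κ 0 :≤ z :* z) z h
      nonzero : ∀ z → ¬ (z ≡ + 0) → + 0 < z * z
      nonzero z ne with ℤₚ.<-cmp z (+ 0)
      ... | tri< h _ _ = lin 1 (λ z → z :< κ 0 ⇒ 1 ⊛ 1 ∷ [] ⊩ κ 0 :< z :* z) z h
      ... | tri≈ _ k _ = ⊥-elim (ne k)
      ... | tri> _ _ h = lin 1 (λ z → κ 0 :< z ⇒ 1 ⊛ 1 ∷ [] ⊩ κ 0 :< z :* z) z h
      positive : + 0 < a * a + b * b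
      positive with a ℤₚ.≟ + 0 | b ℤₚ.≟ + 0
      ... | no ne | _ = lin 2 (λ x y → κ 0 :< x ⇒ κ 0 :≤ y ⇒ ⊢ κ 0 :< x :+ y) (a * a) (b * b) (nonzero a ne) (square b)
      ... | yes _ | no ne = lin 2 (λ x y → κ 0 :≤ x ⇒ κ 0 :< y ⇒ ⊢ κ 0 :< x :+ y) (a * a) (b * b) (square a) (nonzero b ne)
      ... | yes ea | yes eb = ⊥-elim (lin 4 (λ a b e₁ e₂ → e₁ :* b :- e₂ :* a :≡ κ 1 ⇒ a :≡ κ 0 ⇒ b :≡ κ 0 ⇒ 2 ⊙ e₂ ∷ 3 ⊙ e₁ ∷ [] ⊩ :⊥) a b e₁ e₂ one ea eb)

  Sizes : List Pt → ℕ → ℕ → Set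
  Sizes S k k′ = LS (Inner (Poly S)) (+ k′ - + 1) × LS (Poly S) (+ k - + 1)

  module Case₅ (S : List Pt) {α β γ α′ β′ γ′ : ℚ} {k k′ : ℕ} (E : IsEdge (Poly S) α β γ) (E′ : IsEdge (Inner (Poly S)) α′ β′ γ′)
               (count : LatCount (Face (Poly S) α β γ) k) (count′ : LatCount (Face (Inner (Poly S)) α′ β′ γ′) k′) (gap : k′ ℕ.+ 4 ℕ.≤ k) where

    -- `m>0` makes `(a , b)` an outer normal of the edge. The polygon then lies in
    -- `(a , b) ∙ p ≤ c`, and `φ` takes the distance to this line as height, so that the edge
    -- becomes the bottom row.
    module Oriented (a b c c′ : ℤ) (e : Pt) (one : det e (a , b) ≡ + 1) (on : OnLine (Face (Poly S) α β γ) a b c) (on′ : OnLine (Face (Inner (Poly S)) α′ β′ γ′) a b c′)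
                    (dist : ℤ.∣ c - c′ ∣ ≡ 1) (m>0 : 0ℚ ℚ.< α ℚ.* ι a ℚ.+ β ℚ.* ι b) where
      module F  = Proportional {Poly S} {α} {β} {γ} {ι a} {ι b} {ι c} (norm>0 a b e one) E on
      module F′ = Proportional {Inner (Poly S)} {α′} {β′} {γ′} {ι a} {ι b} {ι c′} (norm>0 a b e one) E′ on′

      φ : Unimod
      φ = unimod (proj₁ e) (proj₂ e) (- a) (- b) (+ 0) c
        (inj₂ (lin 4 (λ a b e₁ e₂ → e₁ :* b :- e₂ :* a :≡ κ 1 ⇒ ⊢ e₁ :* (:- b) :- e₂ :* (:- a) :≡ :- κ 1) a b (proj₁ e) (proj₂ e) one))

      T : List Pt
      T = map (act φ) S

      height : ∀ p → proj₂ (act φ p) ≡ c - (a , b) ∙ p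
      height (x , y) = lin 5 (λ a b c x y → ⊢ :- a :* x :+ :- b :* y :+ c :≡ c :- (a :* x :+ b :* y)) a b c x y

      above : ∀ t → t ∈ T → + 0 ≤ proj₂ t
      above = all-map φ {S} {λ t → + 0 ≤ proj₂ t} λ s s∈ → subst (+ 0 ≤_) (sym (height s)) (ℤₚ.i≤j⇒0≤j-i
        (ι-cancel-≤ ((a , b) ∙ s) c (subst (ℚ._≤ ι c) (sym (ι-∙ (a , b) s)) (F.below m>0 (emb s) (conv-point s s∈)))))

      intHeight : ∀ p → Int S p → + 1 ≤ proj₂ (act φ p)
      intHeight p i = int-y≥1 {T} above (int-map⁺ φ {S} i)

      -- If no listed point had height 0, the whole hull would satisfy `(a , b) ∙ p ≤ c - 1`,
      -- against the point of the face on the line with value `c`.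
      bottom : Σ Pt λ t → t ∈ T × proj₂ t ≡ + 0
      bottom = pick (search (λ t → proj₂ t ℤₚ.≟ + 0) T)
        where
          low : (∀ t → t ∈ T → ¬ (proj₂ t ≡ + 0)) → ∀ s → s ∈ S → (a , b) ∙ s ≤ c - + 1
          low none s s∈ = lin 3 (λ y c v → y :≡ c :- v ⇒ κ 0 :< y ⇒ ⊢ v :≤ c :- κ 1) (proj₂ (act φ s)) c ((a , b) ∙ s) (height s)
            (ℤₚ.≤∧≢⇒< (above (act φ s) (∈-map⁺ (act φ) s∈)) λ k → none (act φ s) (∈-map⁺ (act φ) s∈) (sym k))
          contra : (∀ t → t ∈ T → ¬ (proj₂ t ≡ + 0)) → (Σ QPt λ q → Poly S q × ι a ℚ.* proj₁ q ℚ.+ ι b ℚ.* proj₂ q ≡ ι c) → ⊥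
          contra none (q , cq , eq) = ℤₚ.<⇒≱ (lin 1 (λ c → ⊢ c :- κ 1 :< c) c) (ι-cancel-≤ c (c - + 1) (subst (ℚ._≤ ι (c - + 1)) eq (poly-halfplane (a , b) (c - + 1) (low none) {q} cq)))
          pick : (Σ Pt λ t → t ∈ T × proj₂ t ≡ + 0) ⊎ (∀ t → t ∈ T → ¬ (proj₂ t ≡ + 0)) → Σ Pt λ t → t ∈ T × proj₂ t ≡ + 0
          pick (inj₁ found) = found
          pick (inj₂ none)  = ⊥-elim (contra none F.facePoint)

      -- Interior points have height at least 1, so `c′ ≤ c - 1`; of the two values at integral
      -- distance 1 only one is left.
      c′≡ : c′ ≡ c - + 1
      c′≡ = go F′.facePoint
        where
          below : ∀ p → Int S p → (a , b) ∙ p ≤ c - + 1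
          below p i = lin 3 (λ y c v → y :≡ c :- v ⇒ κ 1 :≤ y ⇒ ⊢ v :≤ c :- κ 1) (proj₂ (act φ p)) c ((a , b) ∙ p) (height p) (intHeight p i)
          go : (Σ QPt λ q → Inner (Poly S) q × ι a ℚ.* proj₁ q ℚ.+ ι b ℚ.* proj₂ q ≡ ι c′) → c′ ≡ c - + 1
          go (q , cq , eq) = lin 3 (λ c c′ d → d :≡ c :- c′ ⇒ d :≡ κ 1 ⇒ ⊢ c′ :≡ c :- κ 1) c c′ (+ ℤ.∣ c - c′ ∣) (ℤₚ.0≤i⇒+∣i∣≡i c-c′≥0) (cong +_ dist)
            where
              c-c′≥0 : + 0 ≤ c - c′
              c-c′≥0 = lin 2 (λ c c′ → c′ :≤ c :- κ 1 ⇒ ⊢ κ 0 :≤ c :- c′) c c′ (ι-cancel-≤ c′ (c - + 1) (subst (ℚ._≤ ι (c - + 1)) eq (inner⊆ {S} (a , b) (c - + 1) below {q} cq)))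

      L′ : List Pt
      L′ = interiorPoints T

      above′ : ∀ t → t ∈ L′ → + 1 ≤ proj₂ t
      above′ t t∈ = int-y≥1 {T} above (∈-interiorPoints⁻ T t∈)

      bottom′ : Σ Pt λ t → t ∈ L′ × proj₂ t ≡ + 1
      bottom′ = pick (search (λ t → proj₂ t ℤₚ.≟ + 1) L′)
        where
          low : (∀ t → t ∈ L′ → ¬ (proj₂ t ≡ + 1)) → ∀ p → Int S p → (a , b) ∙ p ≤ c - + 2
          low none p i = lin 3 (λ y c v → y :≡ c :- v ⇒ κ 1 :< y ⇒ ⊢ v :≤ c :- κ 2) (proj₂ (act φ p)) c ((a , b) ∙ p) (height p)
            (ℤₚ.≤∧≢⇒< (intHeight p i) λ k → none (act φ p) (∈-interiorPoints⁺ T (int-map⁺ φ {S} i)) (sym k))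
          contra : (∀ t → t ∈ L′ → ¬ (proj₂ t ≡ + 1)) → (Σ QPt λ q → Inner (Poly S) q × ι a ℚ.* proj₁ q ℚ.+ ι b ℚ.* proj₂ q ≡ ι c′) → ⊥
          contra none (q , cq , eq) = ℤₚ.<⇒≱ (lin 2 (λ c c′ → c′ :≡ c :- κ 1 ⇒ ⊢ c :- κ 2 :< c′) c c′ c′≡) (ι-cancel-≤ c′ (c - + 2) (subst (ℚ._≤ ι (c - + 2)) eq (inner⊆ {S} (a , b) (c - + 2) (low none) {q} cq)))
          pick : (Σ Pt λ t → t ∈ L′ × proj₂ t ≡ + 1) ⊎ (∀ t → t ∈ L′ → ¬ (proj₂ t ≡ + 1)) → Σ Pt λ t → t ∈ L′ × proj₂ t ≡ + 1
          pick (inj₁ found) = found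
          pick (inj₂ none)  = ⊥-elim (contra none F′.facePoint)

      value : ∀ p z → ι a ℚ.* ι (proj₁ p) ℚ.+ ι b ℚ.* ι (proj₂ p) ≡ ι z → (a , b) ∙ p ≡ z
      value p z h = ι-injective ((a , b) ∙ p) z (trans (ι-∙ (a , b) p) h)

      value⁻ : ∀ p z → (a , b) ∙ p ≡ z → ι a ℚ.* ι (proj₁ p) ℚ.+ ι b ℚ.* ι (proj₂ p) ≡ ι z
      value⁻ p z h = trans (sym (ι-∙ (a , b) p)) (cong ι h)

      Least : List Pt → ℤ → Set
      Least L h = Σ Pt λ s → s ∈ L × proj₂ s ≡ h × (∀ t → t ∈ L → proj₂ t ≡ h → proj₁ s ≤ proj₁ t)

      Greatest : List Pt → ℤ → Set
      Greatest L h = Σ Pt λ s → s ∈ L × proj₂ s ≡ h × (∀ t → t ∈ L → proj₂ t ≡ h → proj₁ t ≤ proj₁ s)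

      finish : Least T (+ 0) → Greatest T (+ 0) → Least L′ (+ 1) → Greatest L′ (+ 1) → Sizes S k k′
      finish ((l , _) , l∈ , refl , ml) ((r , _) , r∈ , refl , mr) ((i , _) , i∈ , refl , mi) ((j , _) , j∈ , refl , mj) =
          lengths (toℕ 0 (ℤₚ.i≤j⇒0≤j-i (ml _ r∈ refl))) (toℕ 0 (ℤₚ.i≤j⇒0≤j-i (mi _ j∈ refl)))
        where
          lengths : (Σ ℕ λ n → r - l ≡ + n × 0 ℕ.≤ n) → (Σ ℕ λ n → j - i ≡ + n × 0 ℕ.≤ n) → Sizes S k k′
          lengths (M , M≡ , _) (J , J≡ , _) = subst₂ (Sizes S) (sym k≡) (sym k′≡)
              ( innerSize⇒LS {S} (sizeInt-map φ {S} (sizeInt-map ψ {T} (edgePair-innerSize pair)))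
              , size⇒LS (size-map φ {S} (size-map ψ {T} (edgePair-size pair))) )
            where
              r≡ : r ≡ l + + M
              r≡ = lin 3 (λ r l m → r :- l :≡ m ⇒ ⊢ r :≡ l :+ m) r l (+ M) M≡
              j≡ : j ≡ i + + J
              j≡ = lin 3 (λ r l m → r :- l :≡ m ⇒ ⊢ r :≡ l :+ m) j i (+ J) J≡
              module R = Row φ T (+ 0) l M above (λ t t∈ h → ml t t∈ h , subst (proj₁ t ≤_) r≡ (mr t t∈ h)) l∈ (pt≡ r≡ refl r∈)
              module R′ = Row φ L′ (+ 1) i J above′ (λ t t∈ h → mi t t∈ h , subst (proj₁ t ≤_) j≡ (mj t t∈ h)) i∈ (pt≡ j≡ refl j∈)
              k≡ : k ≡ suc M
              k≡ = R.latCount-≡ {Face (Poly S) α β γ}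
                (λ p f → poly-frame⁺ φ S p (proj₁ f) , trans (height p) (ℤₚ.i≡j⇒i-j≡0 (sym (value p c (on (emb p) f)))))
                (λ p (cp , h) → poly-frame⁻ φ S p cp , F.onLine⇒face (ι (proj₁ p)) (ι (proj₂ p)) (value⁻ p c (lin 3 (λ y c v → y :≡ c :- v ⇒ y :≡ κ 0 ⇒ ⊢ v :≡ c) (proj₂ (act φ p)) c ((a , b) ∙ p) (height p) h)))
                count
              k′≡ : k′ ≡ suc J
              k′≡ = R′.latCount-≡ {Face (Inner (Poly S)) α′ β′ γ′}
                (λ p f → inner-frame⁺ φ S p (proj₁ f) , lin 4 (λ y c c′ v → y :≡ c :- v ⇒ v :≡ c′ ⇒ c′ :≡ c :- κ 1 ⇒ ⊢ y :≡ κ 1) (proj₂ (act φ p)) c c′ ((a , b) ∙ p) (height p) (value p c′ (on′ (emb p) f)) c′≡)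
                (λ p (cp , h) → inner-frame⁻ φ S p cp , F′.onLine⇒face (ι (proj₁ p)) (ι (proj₂ p)) (value⁻ p c′ (lin 4 (λ y c c′ v → y :≡ c :- v ⇒ y :≡ κ 1 ⇒ c′ :≡ c :- κ 1 ⇒ ⊢ v :≡ c′) (proj₂ (act φ p)) c c′ ((a , b) ∙ p) (height p) h c′≡)))
                count′
              long : J ℕ.+ 4 ℕ.≤ M
              long = ℕ.s≤s⁻¹ (subst₂ (λ x y → x ℕ.+ 4 ℕ.≤ y) k′≡ k≡ gap)
              -- Once `(l , 0)` is moved to the origin, the shear by `g` takes `(i , 1)` to
              -- `(1 , 1)`.
              g = i - + 1 - l
              ψ = unimod (+ 1) (- g) (+ 0) (+ 1) (- l) (+ 0) (inj₁ (lin 1 (λ g → ⊢ κ 1 :* κ 1 :- :- g :* κ 0 :≡ κ 1) g))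
              act-ψ : ∀ p → act ψ p ≡ (proj₁ p - g * proj₂ p - l , proj₂ p)
              act-ψ (x , y) = cong₂ _,_ (lin 4 (λ x y g l → ⊢ κ 1 :* x :+ :- g :* y :+ :- l :≡ x :- g :* y :- l) x y g l) (lin 2 (λ x y → ⊢ κ 0 :* x :+ κ 1 :* y :+ κ 0 :≡ y) x y)
              U = map (act ψ) T
              to : ∀ p → p ∈ T → (proj₁ p - g * proj₂ p - l , proj₂ p) ∈ U
              to p p∈ = subst (_∈ U) (act-ψ p) (∈-map⁺ (act ψ) p∈)
              toInt : ∀ p → p ∈ L′ → Int U (proj₁ p - g * proj₂ p - l , proj₂ p)
              toInt p p∈ = subst (Int U) (act-ψ p) (int-map⁺ ψ {T} (∈-interiorPoints⁻ T p∈))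
              edgeRow : ∀ s → s ∈ T → proj₂ s ≡ + 0 → + 0 ≤ proj₁ s - g * proj₂ s - l × proj₁ s - g * proj₂ s - l ≤ + M
              edgeRow s@(x , y) s∈ h =
                lin 4 (λ x y g l → y :≡ κ 0 ⇒ l :≤ x ⇒ 1 ⊙ g ∷ [] ⊩ κ 0 :≤ x :- g :* y :- l) x y g l h (ml s s∈ h) ,
                lin 6 (λ x y g l r m → y :≡ κ 0 ⇒ x :≤ r ⇒ r :- l :≡ m ⇒ 1 ⊙ g ∷ [] ⊩ x :- g :* y :- l :≤ m) x y g l r (+ M) h (mr s s∈ h) M≡
              innerRow : ∀ s → Int T s → proj₂ s ≡ + 1 → + 1 ≤ proj₁ s - g * proj₂ s - l × proj₁ s - g * proj₂ s - l ≤ + suc J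
              innerRow s@(x , y) is h =
                lin 5 (λ x y i l g → y :≡ κ 1 ⇒ i :≤ x ⇒ g :≡ i :- κ 1 :- l ⇒ 1 ⊙ g ∷ [] ⊩ κ 1 :≤ x :- g :* y :- l) x y i l g h (mi s s∈ h) refl ,
                lin 7 (λ x y i l j m g → y :≡ κ 1 ⇒ x :≤ j ⇒ j :- i :≡ m ⇒ g :≡ i :- κ 1 :- l ⇒ 1 ⊙ g ∷ [] ⊩ x :- g :* y :- l :≤ κ 1 :+ m) x y i l j (+ J) g h (mj s s∈ h) J≡ refl
                where s∈ = ∈-interiorPoints⁺ T is
              Row₀ Row₁ : Pt → Set
              Row₀ t = proj₂ t ≡ + 0 → + 0 ≤ proj₁ t × proj₁ t ≤ + M
              Row₁ t = proj₂ t ≡ + 1 → + 1 ≤ proj₁ t × proj₁ t ≤ + suc J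
              pair : EdgePair U M J
              pair = record
                { o∈ = pt≡ (lin 2 (λ l g → ⊢ l :- g :* κ 0 :- l :≡ κ 0) l g) refl (to (l , + 0) l∈)
                ; R∈ = pt≡ (lin 4 (λ l g r m → r :- l :≡ m ⇒ ⊢ r :- g :* κ 0 :- l :≡ m) l g r (+ M) M≡) refl (to (r , + 0) r∈)
                ; above = all-map ψ {T} {λ t → + 0 ≤ proj₂ t} λ s s∈ → subst (λ t → + 0 ≤ proj₂ t) (sym (act-ψ s)) (above s s∈)
                ; edge = all-map ψ {T} {Row₀} λ s s∈ → subst Row₀ (sym (act-ψ s)) (edgeRow s s∈)
                ; i₁ = intPt≡ (lin 3 (λ i l g → g :≡ i :- κ 1 :- l ⇒ ⊢ i :- g :* κ 1 :- l :≡ κ 1) i l g refl) refl (toInt (i , + 1) i∈)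
                ; iⱼ = intPt≡ (lin 5 (λ i l j m g → j :- i :≡ m ⇒ g :≡ i :- κ 1 :- l ⇒ ⊢ j :- g :* κ 1 :- l :≡ κ 1 :+ m) i l j (+ J) g J≡ refl) refl (toInt (j , + 1) j∈)
                ; iedge = allInt-map ψ {T} {Row₁} λ s is → subst Row₁ (sym (act-ψ s)) (innerRow s is)
                ; long = long }

      sizes : Sizes S k k′
      sizes = let (t , t∈ , h) = bottom ; (t′ , t′∈ , h′) = bottom′ in
        finish (argminOn (λ s → proj₂ s ℤₚ.≟ + 0) proj₁ T t∈ h) (argmaxOn (λ s → proj₂ s ℤₚ.≟ + 0) proj₁ T t∈ h)
               (argminOn (λ s → proj₂ s ℤₚ.≟ + 1) proj₁ L′ t′∈ h′) (argmaxOn (λ s → proj₂ s ℤₚ.≟ + 1) proj₁ L′ t′∈ h′)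

    flipLine : ∀ {τ} a b c → OnLine τ a b c → OnLine τ (- a) (- b) (- c)
    flipLine a b c on q t = linℚ 8 (λ a b c a′ b′ c′ x y → a′ :≡ :- a ⇒ b′ :≡ :- b ⇒ c′ :≡ :- c ⇒ a :* x :+ b :* y :≡ c ⇒ 1 ⊙ x ∷ 2 ⊙ y ∷ [] ⊩ a′ :* x :+ b′ :* y :≡ c′)
      (ι a) (ι b) (ι c) (ι (- a)) (ι (- b)) (ι (- c)) (proj₁ q) (proj₂ q) (ι-neg a) (ι-neg b) (ι-neg c) (on q t)

    sizes₅ : ParallelDist1 (Face (Poly S) α β γ) (Face (Inner (Poly S)) α′ β′ γ′) → Sizes S k k′
    sizes₅ (a , b , c , c′ , co , on , on′ , dist) = withUnit (coprime⇒unit a b co)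
      where
        withUnit : (Σ Pt λ e → det e (a , b) ≡ + 1) → Sizes S k k′
        withUnit (e , one) = orient (ℚₚ.<-cmp 0ℚ (α ℚ.* ι a ℚ.+ β ℚ.* ι b))
          where
            orient : Tri (0ℚ ℚ.< α ℚ.* ι a ℚ.+ β ℚ.* ι b) (0ℚ ≡ α ℚ.* ι a ℚ.+ β ℚ.* ι b) (α ℚ.* ι a ℚ.+ β ℚ.* ι b ℚ.< 0ℚ) → Sizes S k k′
            orient (tri< m>0 _ _) = Oriented.sizes a b c c′ e one on on′ dist m>0
            orient (tri≈ _ m≡0 _) = ⊥-elim (Proportional.m≢0 {Poly S} {α} {β} {γ} {ι a} {ι b} {ι c} (norm>0 a b e one) E on (sym m≡0))
            -- The given normal points inwards; negating it together with `c`, `c′` and `e` keeps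
            -- the determinant and the distance.
            orient (tri> _ _ m<0) = Oriented.sizes (- a) (- b) (- c) (- c′) (- proj₁ e , - proj₂ e)
              (trans (lin 4 (λ a b e₁ e₂ → ⊢ :- e₁ :* (:- b) :- :- e₂ :* (:- a) :≡ e₁ :* b :- e₂ :* a) a b (proj₁ e) (proj₂ e)) one)
              (flipLine a b c on) (flipLine a b c′ on′)
              (trans (cong ℤ.∣_∣ (lin 2 (λ c c′ → ⊢ :- c :- :- c′ :≡ :- (c :- c′)) c c′)) (trans (ℤₚ.∣-i∣≡∣i∣ (c - c′)) dist))
              (linℚ 6 (λ α β a b a′ b′ → a′ :≡ :- a ⇒ b′ :≡ :- b ⇒ α :* a :+ β :* b :< κ 0 ⇒ 1 ⊙ α ∷ 2 ⊙ β ∷ [] ⊩ κ 0 :< α :* a′ :+ β :* b′) α β (ι a) (ι b) (ι (- a)) (ι (- b)) (ι-neg a) (ι-neg b) m<0)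

-- From configurations to the listed exceptions, and the generic case

module MainTheorem where
  open import Data.Integer using (_+_; _*_; _-_; -_; _≤_; _<_)
  open import Data.List.Relation.Unary.All using ([]; _∷_)
  open import Data.Nat using (zero; suc; z≤n; s≤s)
  open import Data.Integer.GCD using (gcd)
  open import Data.Rational using (0ℚ)
  open import Data.Unit using (⊤; tt)
  open import Relation.Nullary.Decidable using (_×-dec_; ¬?; decidable-stable)
  open Lattice
  open Frames
  open Configurations
  open LatticeSize
  open ConvexHulls
  open Equivalence
  open StandardPolygons
  open EdgePairs
  open LongEdgeSizes
  open HollowPolygons
  open InnerFits using (interior-fit⇒fit)
  open OrderedRings

  LongEdges : List Pt → Set
  LongEdges S = Σ ℚ λ α → Σ ℚ λ β → Σ ℚ λ γ → Σ ℚ λ α′ → Σ ℚ λ β′ → Σ ℚ λ γ′ → Σ ℕ λ k → Σ ℕ λ k′ →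
    IsEdge (Poly S) α β γ × IsEdge (Inner (Poly S)) α′ β′ γ′
    × ParallelDist1 (Face (Poly S) α β γ) (Face (Inner (Poly S)) α′ β′ γ′)
    × LatCount (Face (Poly S) α β γ) k × LatCount (Face (Inner (Poly S)) α′ β′ γ′) k′
    × k′ ℕ.+ 4 ℕ.≤ k

  -- The second coordinate of the frame is the height above the edge, so minus its second row is an
  -- outer normal of both edges, which lie at heights 0 and 1. This row is coprime because the
  -- determinant is a unit.
  module LongEdge⇒edges (S : List Pt) (φ : Unimod) {l r i j : ℤ} (E : LongEdge l r i j (map (act φ) S)) where
    open LongEdge E
    open Unimod φ
    private
      T = map (act φ) S
      L′ = interiorPoints T
      u : Pt
      u = (- a₂₁ , - a₂₂)
      α β : ℚ
      α = ι (- a₂₁)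
      β = ι (- a₂₂)

      height : ∀ p → proj₂ (act φ p) ≡ w₂ - u ∙ p
      height (x , y) = lin 5 (λ c d w x y → ⊢ c :* x :+ d :* y :+ w :≡ w :- (:- c :* x :+ :- d :* y)) a₂₁ a₂₂ w₂ x y

      value : ∀ p h → proj₂ (act φ p) ≡ h → α ℚ.* ι (proj₁ p) ℚ.+ β ℚ.* ι (proj₂ p) ≡ ι (w₂ - h)
      value p h e = trans (sym (ι-∙ u p)) (cong ι (lin 4 (λ y w v h → y :≡ w :- v ⇒ y :≡ h ⇒ ⊢ v :≡ w :- h) (proj₂ (act φ p)) w₂ (u ∙ p) h (height p) e))

      value⁻ : ∀ p h → α ℚ.* ι (proj₁ p) ℚ.+ β ℚ.* ι (proj₂ p) ≡ ι (w₂ - h) → proj₂ (act φ p) ≡ h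
      value⁻ p h e = lin 4 (λ y w v h → y :≡ w :- v ⇒ v :≡ w :- h ⇒ ⊢ y :≡ h) (proj₂ (act φ p)) w₂ (u ∙ p) h (height p) (ι-injective (u ∙ p) (w₂ - h) (trans (ι-∙ u p) e))

      nonzero : ¬ (α ≡ 0ℚ × β ≡ 0ℚ)
      nonzero (e , f) = contra det±
        where
          c≡0 = ι-injective (- a₂₁) (+ 0) e
          d≡0 = ι-injective (- a₂₂) (+ 0) f
          contra : (a₁₁ * a₂₂ - a₁₂ * a₂₁ ≡ + 1) ⊎ (a₁₁ * a₂₂ - a₁₂ * a₂₁ ≡ - + 1) → ⊥
          contra (inj₁ k) = lin 4 (λ a b c d → :- c :≡ κ 0 ⇒ :- d :≡ κ 0 ⇒ a :* d :- b :* c :≡ κ 1 ⇒ 1 ⊙ b ∷ 2 ⊙ a ∷ [] ⊩ :⊥) a₁₁ a₁₂ a₂₁ a₂₂ c≡0 d≡0 k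
          contra (inj₂ k) = lin 4 (λ a b c d → :- c :≡ κ 0 ⇒ :- d :≡ κ 0 ⇒ a :* d :- b :* c :≡ :- κ 1 ⇒ 1 ⊙ b ∷ 2 ⊙ a ∷ [] ⊩ :⊥) a₁₁ a₁₂ a₂₁ a₂₂ c≡0 d≡0 k

      l<r : l < r
      l<r = lin 4 (λ l r i j → i :< j ⇒ j :- i :+ κ 4 :≤ r :- l ⇒ ⊢ l :< r) l r i j i<j long

      emb-distinct : ∀ x x′ h → x < x′ → ¬ (emb (act (inv φ) (x , h)) ≡ emb (act (inv φ) (x′ , h)))
      emb-distinct x x′ h lt e = ℤₚ.<-irrefl (cong proj₁ (act-injective (inv φ) {x , h} {x′ , h} (cong₂ _,_ (ι-injective (proj₁ p) (proj₁ q) (cong proj₁ e)) (ι-injective (proj₂ p) (proj₂ q) (cong proj₂ e))))) lt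
        where
          p = act (inv φ) (x , h)
          q = act (inv φ) (x′ , h)

      -- `w₂ - + 0` is left unsimplified so that the heights 0 and 1 are instances of one formula.
      F F′ : QSet
      F  = Face (Poly S) α β (ι (w₂ - + 0))
      F′ = Face (Inner (Poly S)) α β (ι (w₂ - + 1))

      OnF OnF′ : Pt → Set
      OnF p  = Conv (_∈ T) (emb (act φ p)) × proj₂ (act φ p) ≡ + 0
      OnF′ p = Conv (_∈ L′) (emb (act φ p)) × proj₂ (act φ p) ≡ + 1

      F⇒ : ∀ p → F (emb p) → OnF p
      F⇒ p (c , e) = poly-frame⁺ φ S p c , value⁻ p (+ 0) e
      ⇒F : ∀ p → OnF p → F (emb p)
      ⇒F p (c , e) = poly-frame⁻ φ S p c , value p (+ 0) e
      F′⇒ : ∀ p → F′ (emb p) → OnF′ p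
      F′⇒ p (c , e) = inner-frame⁺ φ S p c , value⁻ p (+ 1) e
      ⇒F′ : ∀ p → OnF′ p → F′ (emb p)
      ⇒F′ p (c , e) = inner-frame⁻ φ S p c , value p (+ 1) e

      back : ∀ {L} t h → t ∈ L → proj₂ t ≡ h → Conv (_∈ L) (emb (act φ (act (inv φ) t))) × proj₂ (act φ (act (inv φ) t)) ≡ h
      back {L} t h t∈ e = subst (λ q → Conv (_∈ L) (emb q) × proj₂ q ≡ h) (sym (act-inv φ t)) (conv-point t t∈ , e)

      i∈ : (i , + 1) ∈ L′
      i∈ = ∈-interiorPoints⁺ T ileft
      j∈ : (j , + 1) ∈ L′
      j∈ = ∈-interiorPoints⁺ T iright

      isEdge : IsEdge (Poly S) α β (ι (w₂ - + 0))
      isEdge = nonzero ,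
        (λ q → poly-halfplane u (w₂ - + 0) (λ s s∈ → lin 3 (λ y w v → y :≡ w :- v ⇒ κ 0 :≤ y ⇒ ⊢ v :≤ w :- κ 0) (proj₂ (act φ s)) w₂ (u ∙ s) (height s) (above (act φ s) (∈-map⁺ (act φ) s∈))) {q}) ,
        emb (act (inv φ) (l , + 0)) , emb (act (inv φ) (r , + 0)) ,
        ⇒F (act (inv φ) (l , + 0)) (back {T} (l , + 0) (+ 0) left refl) , ⇒F (act (inv φ) (r , + 0)) (back {T} (r , + 0) (+ 0) right refl) , emb-distinct l r (+ 0) l<r

      isEdge′ : IsEdge (Inner (Poly S)) α β (ι (w₂ - + 1))
      isEdge′ = nonzero ,
        (λ q → inner⊆ {S} u (w₂ - + 1) (λ p ip → lin 3 (λ y w v → y :≡ w :- v ⇒ κ 1 :≤ y ⇒ ⊢ v :≤ w :- κ 1) (proj₂ (act φ p)) w₂ (u ∙ p) (height p) (int-y≥1 {T} above (int-map⁺ φ {S} ip))) {q}) ,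
        emb (act (inv φ) (i , + 1)) , emb (act (inv φ) (j , + 1)) ,
        ⇒F′ (act (inv φ) (i , + 1)) (back {L′} (i , + 1) (+ 1) i∈ refl) , ⇒F′ (act (inv φ) (j , + 1)) (back {L′} (j , + 1) (+ 1) j∈ refl) , emb-distinct i j (+ 1) i<j

      coprime : gcd (- a₂₁) (- a₂₂) ≡ + 1
      coprime = unit⇒coprime a₁₁ a₁₂ (- a₂₁) (- a₂₂) (signs det±)
        where
          neg : a₁₁ * - a₂₂ - a₁₂ * - a₂₁ ≡ - (a₁₁ * a₂₂ - a₁₂ * a₂₁)
          neg = lin 4 (λ a b c d → ⊢ a :* (:- d) :- b :* (:- c) :≡ :- (a :* d :- b :* c)) a₁₁ a₁₂ a₂₁ a₂₂
          signs : (a₁₁ * a₂₂ - a₁₂ * a₂₁ ≡ + 1) ⊎ (a₁₁ * a₂₂ - a₁₂ * a₂₁ ≡ - + 1) → (a₁₁ * - a₂₂ - a₁₂ * - a₂₁ ≡ + 1) ⊎ (a₁₁ * - a₂₂ - a₁₂ * - a₂₁ ≡ - + 1)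
          signs (inj₁ k) = inj₂ (trans neg (cong -_ k))
          signs (inj₂ k) = inj₁ (trans neg (cong -_ k))

      parallel : ParallelDist1 F F′
      parallel = - a₂₁ , - a₂₂ , w₂ - + 0 , w₂ - + 1 , coprime , (λ q f → proj₂ f) , (λ q f → proj₂ f) ,
        cong ℤ.∣_∣ (lin 1 (λ w → ⊢ w :- κ 0 :- (w :- κ 1) :≡ κ 1) w₂)

    edges : LongEdges S
    edges = build (toℕ 0 (ℤₚ.i≤j⇒0≤j-i (ℤₚ.<⇒≤ l<r))) (toℕ 0 (ℤₚ.i≤j⇒0≤j-i (ℤₚ.<⇒≤ i<j)))
      where
        build : (Σ ℕ λ n → r - l ≡ + n × 0 ℕ.≤ n) → (Σ ℕ λ n → j - i ≡ + n × 0 ℕ.≤ n) → LongEdges S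
        build (M , M≡ , _) (J , J≡ , _) = α , β , ι (w₂ - + 0) , α , β , ι (w₂ - + 1) , suc M , suc J , isEdge , isEdge′ , parallel ,
            R.latCount {F} F⇒ ⇒F , R′.latCount {F′} F′⇒ ⇒F′ , s≤s (ℤₚ.drop‿+≤+ (subst₂ (λ x y → x + + 4 ≤ y) J≡ M≡ long))
          where
            r≡ : r ≡ l + + M
            r≡ = lin 3 (λ r l m → r :- l :≡ m ⇒ ⊢ r :≡ l :+ m) r l (+ M) M≡
            j≡ : j ≡ i + + J
            j≡ = lin 3 (λ r l m → r :- l :≡ m ⇒ ⊢ r :≡ l :+ m) j i (+ J) J≡
            module R = Row φ T (+ 0) l M above (λ t t∈ h → proj₁ (edge t t∈ h) , subst (proj₁ t ≤_) r≡ (proj₂ (edge t t∈ h))) left (pt≡ r≡ refl right)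
            module R′ = Row φ L′ (+ 1) i J (λ t t∈ → int-y≥1 {T} above (∈-interiorPoints⁻ T t∈))
              (λ t t∈ h → proj₁ (iedge t (∈-interiorPoints⁻ T t∈) h) , subst (proj₁ t ≤_) j≡ (proj₂ (iedge t (∈-interiorPoints⁻ T t∈) h))) i∈ (pt≡ j≡ refl j∈)

  collinear : ∀ {S p q r} u c → NonZero u → (∀ s → s ∈ S → u ∙ s ≡ c) → Poly S p → Poly S q → Poly S r →
              (proj₁ q ℚ.- proj₁ p) ℚ.* (proj₂ r ℚ.- proj₂ p) ≡ (proj₂ q ℚ.- proj₂ p) ℚ.* (proj₁ r ℚ.- proj₁ p)
  collinear {S} {p} {q} {r} u@(u₁ , u₂) c nz h cp cq cr = linℚ 2 (λ a b → a :- b :≡ κ 0 ⇒ ⊢ a :≡ b) _ _ (vanish (u₁ ℤₚ.≟ + 0) (u₂ ℤₚ.≟ + 0))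
    where
      U V dx dy ex ey W : ℚ
      U = ι u₁
      V = ι u₂
      dx = proj₁ q ℚ.- proj₁ p
      dy = proj₂ q ℚ.- proj₂ p
      ex = proj₁ r ℚ.- proj₁ p
      ey = proj₂ r ℚ.- proj₂ p
      W = dx ℚ.* ey ℚ.- dy ℚ.* ex
      on : ∀ {z} → Poly S z → U ℚ.* proj₁ z ℚ.+ V ℚ.* proj₂ z ≡ ι c
      on {z} cz = ℚₚ.≤-antisym (poly-halfplane u c (λ s s∈ → ℤₚ.≤-reflexive (h s s∈)) {z} cz)
        (linℚ 7 (λ U V U′ V′ x y cs → U′ :≡ :- U ⇒ V′ :≡ :- V ⇒ U′ :* x :+ V′ :* y :≤ :- cs ⇒ 1 ⊙ x ∷ 2 ⊙ y ∷ [] ⊩ cs :≤ U :* x :+ V :* y) U V (ι (- u₁)) (ι (- u₂)) (proj₁ z) (proj₂ z) (ι c) (ι-neg u₁) (ι-neg u₂)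
          (subst (ι (- u₁) ℚ.* proj₁ z ℚ.+ ι (- u₂) ℚ.* proj₂ z ℚ.≤_) (ι-neg c) (poly-halfplane (- u₁ , - u₂) (- c)
            (λ s s∈ → lin 5 (λ a b c x y → a :* x :+ b :* y :≡ c ⇒ ⊢ :- a :* x :+ :- b :* y :≤ :- c) u₁ u₂ c (proj₁ s) (proj₂ s) (h s s∈)) {z} cz)))
      diff : ∀ z → Poly S z → U ℚ.* (proj₁ z ℚ.- proj₁ p) ℚ.+ V ℚ.* (proj₂ z ℚ.- proj₂ p) ≡ 0ℚ
      diff z cz = linℚ 7 (λ U V x y a b cs → U :* x :+ V :* y :≡ cs ⇒ U :* a :+ V :* b :≡ cs ⇒ ⊢ U :* (x :- a) :+ V :* (y :- b) :≡ κ 0) U V (proj₁ z) (proj₂ z) (proj₁ p) (proj₂ p) (ι c) (on cz) (on cp)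
      vanish : Dec (u₁ ≡ + 0) → Dec (u₂ ≡ + 0) → W ≡ 0ℚ
      vanish (no ne) _ = ℚ-cancel W U (linℚ 6 (λ U V a b c d → U :* a :+ V :* b :≡ κ 0 ⇒ U :* c :+ V :* d :≡ κ 0 ⇒ 1 ⊙ d ∷ 2 ⊙ b ∷ [] ⊩ (a :* d :- b :* c) :* U :≡ κ 0) U V dx dy ex ey (diff q cq) (diff r cr)) λ k → ne (ι-injective u₁ (+ 0) k)
      vanish (yes _) (no ne) = ℚ-cancel W V (linℚ 6 (λ U V a b c d → U :* a :+ V :* b :≡ κ 0 ⇒ U :* c :+ V :* d :≡ κ 0 ⇒ 1 ⊙ c ∷ 2 ⊙ a ∷ [] ⊩ (a :* d :- b :* c) :* V :≡ κ 0) U V dx dy ex ey (diff q cq) (diff r cr)) λ k → ne (ι-injective u₂ (+ 0) k)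
      vanish (yes e) (yes f) = ⊥-elim (nz (e , f))

  -- Either failed search exhibits a line containing all of `S`, and therefore its hull, against
  -- two-dimensionality.
  twoDim⇒triangle : ∀ S → TwoDim (Poly S) → Triangle S
  twoDim⇒triangle S (p , q , r , cp , cq , cr , ne) = from (someVertex cp)
    where
      someVertex : ∀ {z} → Poly S z → Σ Pt (_∈ S)
      someVertex ((_ , s) ∷ _ , (_ , s∈) ∷ _ , _) = s , s∈
      someVertex ([] , [] , () , _)
      from : Σ Pt (_∈ S) → Triangle S
      from (s₁ , m₁) = second (search (λ s → ¬? ((proj₁ s ℤₚ.≟ proj₁ s₁) ×-dec (proj₂ s ℤₚ.≟ proj₂ s₁))) S)
        where
          second : (Σ Pt λ s → s ∈ S × ¬ (proj₁ s ≡ proj₁ s₁ × proj₂ s ≡ proj₂ s₁)) ⊎ (∀ s → s ∈ S → ¬ ¬ (proj₁ s ≡ proj₁ s₁ × proj₂ s ≡ proj₂ s₁)) → Triangle S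
          second (inj₂ same) = ⊥-elim (ne (collinear {S} (+ 1 , + 0) (proj₁ s₁) (λ ()) (λ s s∈ →
            lin 3 (λ x y z → x :≡ z ⇒ ⊢ κ 1 :* x :+ κ 0 :* y :≡ z) (proj₁ s) (proj₂ s) (proj₁ s₁) (proj₁ (decidable-stable ((proj₁ s ℤₚ.≟ proj₁ s₁) ×-dec (proj₂ s ℤₚ.≟ proj₂ s₁)) (same s s∈)))) cp cq cr))
          second (inj₁ (s₂ , m₂ , distinct)) = third (search (λ s → ¬? (det (s₂ ⊖ s₁) (s ⊖ s₁) ℤₚ.≟ + 0)) S)
            where
              w₁ = proj₁ (s₂ ⊖ s₁)
              w₂ = proj₂ (s₂ ⊖ s₁)
              third : (Σ Pt λ s → s ∈ S × ¬ (det (s₂ ⊖ s₁) (s ⊖ s₁) ≡ + 0)) ⊎ (∀ s → s ∈ S → ¬ ¬ (det (s₂ ⊖ s₁) (s ⊖ s₁) ≡ + 0)) → Triangle S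
              third (inj₁ (s₃ , m₃ , ind)) = mkTriangle s₁ s₂ s₃ m₁ m₂ m₃ ind
              third (inj₂ flat) = ⊥-elim (ne (collinear {S} (- w₂ , w₁) (w₁ * proj₂ s₁ - w₂ * proj₁ s₁) nz (λ s s∈ →
                  lin 6 (λ a b x y x₁ y₁ → a :* (y :- y₁) :- b :* (x :- x₁) :≡ κ 0 ⇒ ⊢ :- b :* x :+ a :* y :≡ a :* y₁ :- b :* x₁) w₁ w₂ (proj₁ s) (proj₂ s) (proj₁ s₁) (proj₂ s₁)
                    (decidable-stable (det (s₂ ⊖ s₁) (s ⊖ s₁) ℤₚ.≟ + 0) (flat s s∈))) cp cq cr))
                where
                  nz : NonZero (- w₂ , w₁)
                  nz (e , f) = distinct (lin 2 (λ x y → x :- y :≡ κ 0 ⇒ ⊢ x :≡ y) (proj₁ s₂) (proj₁ s₁) f , lin 2 (λ x y → :- (x :- y) :≡ κ 0 ⇒ ⊢ x :≡ y) (proj₂ s₂) (proj₂ s₁) e)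

  Exception : List Pt → Set
  Exception S = (Σ ℕ λ a → Σ ℕ λ b → ((a ≡ 1 × b ≡ 1) ⊎ (2 ℕ.≤ a × b ℕ.≤ a)) × Poly S ≃ Trap a b)
    ⊎ Poly S ≃ Tri2
    ⊎ Poly S ≃ Tri42
    ⊎ (Σ ℕ λ a → Σ ℕ λ b → 2 ℕ.≤ a × 2 ℕ.≤ b × Poly S ≃ Rect a b)
    ⊎ LongEdges S

  exceptional⇒exception : ∀ S → Exceptional S → Exception S
  exceptional⇒exception S (φ , trap a b I)      = inj₁ (a , b , IsTrap.shape I , trap-≃ φ S a b I)
  exceptional⇒exception S (φ , tri2 I)          = inj₂ (inj₁ (tri2-≃ φ S I))
  exceptional⇒exception S (φ , tri42 I)         = inj₂ (inj₂ (inj₁ (tri42-≃ φ S I)))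
  exceptional⇒exception S (φ , rect a b I)      = inj₂ (inj₂ (inj₂ (inj₁ (a , b , IsRect.a≥2 I , IsRect.b≥2 I , rect-≃ φ S a b I))))
  exceptional⇒exception S (φ , edge5 l r i j E) = inj₂ (inj₂ (inj₂ (inj₂ (LongEdge⇒edges.edges S φ E))))

  module Generic (S : List Pt) (Δ : Triangle S) (regular : ¬ Exceptional S) where
    private
      full = triangle⇒full Δ
      Result = Σ ℤ λ n → LS (Inner (Poly S)) n × LS (Poly S) (n + + 3)

      positive : ∀ k → Fit (_∈ S) (+ k) → 1 ℕ.≤ k
      positive (suc k) _ = s≤s z≤n
      positive zero (φ , h) = ⊥-elim (contra (full-map φ {S} full (+ 1 , + 0) (λ ())))
        where
          T = map (act φ) S
          zeroX : ∀ t → t ∈ T → proj₁ t ≡ + 0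
          zeroX = all-map φ {S} {λ t → proj₁ t ≡ + 0} λ s s∈ → let (a , b , c) = h s s∈ in
            lin 2 (λ x y → κ 0 :≤ x ⇒ κ 0 :≤ y ⇒ x :+ y :≤ κ 0 ⇒ ⊢ x :≡ κ 0) (proj₁ (act φ s)) (proj₂ (act φ s)) a b c
          contra : (Σ Pt λ s → Σ Pt λ t → s ∈ T × t ∈ T × (+ 1 , + 0) ∙ s < (+ 1 , + 0) ∙ t) → ⊥
          contra (s , t , s∈ , t∈ , lt) = lin 4 (λ x y x′ y′ → κ 1 :* x :+ κ 0 :* y :< κ 1 :* x′ :+ κ 0 :* y′ ⇒ x :≡ κ 0 ⇒ x′ :≡ κ 0 ⇒ ⊢ :⊥) (proj₁ s) (proj₂ s) (proj₁ t) (proj₂ t) lt (zeroX s s∈) (zeroX t t∈)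

      hollow-case : (∀ p → ¬ Int S p) → HollowOutcome S → Result
      hollow-case none (inj₁ e) = ⊥-elim (regular e)
      -- The convention -2 for the empty polygon turns `n + 3` into 1, which is the size of Σ.
      hollow-case none (inj₂ f) = - + 2 , innerEmpty⇒LS {S} none , size⇒LS (isSize (Triangle.s₁ Δ , Triangle.m₁ Δ) f positive)

      -- Only the outer size `m` is found by search. The inner polygon fits `m - 3`, and an inner
      -- fit of size `k` yields an outer one of size at most `k + 3`, so `m - 3` is already minimal.
      solid-case : ∀ p → Int S p → (Σ ℕ λ m → Fit (_∈ S) (+ m) × (∀ k → Fit (_∈ S) (+ k) → m ℕ.≤ k)) → Result
      solid-case p ip (m , f , min) = go (fit⇒fitInt S (+ m) f)
        where
          go : Fit (Int S) (+ m - + 3) → Result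
          go g@(φ , h) = let (x≥0 , y≥0 , top) = h p ip in shift (toℕ 0 (lin 3 (λ x y d → κ 0 :≤ x ⇒ κ 0 :≤ y ⇒ x :+ y :≤ d ⇒ ⊢ κ 0 :≤ d) (proj₁ (act φ p)) (proj₂ (act φ p)) (+ m - + 3) x≥0 y≥0 top))
            where
              shift : (Σ ℕ λ n → + m - + 3 ≡ + n × 0 ℕ.≤ n) → Result
              shift (n , n≡ , _) = + n , innerSize⇒LS {S} (isSize (p , ip) (subst (Fit (Int S)) n≡ g) minimal) , subst (LS (Poly S)) m≡ (size⇒LS (isSize (Triangle.s₁ Δ , Triangle.m₁ Δ) f min))
                where
                  m≡ : + m ≡ + n + + 3
                  m≡ = lin 2 (λ m n → m :- κ 3 :≡ n ⇒ ⊢ m :≡ n :+ κ 3) (+ m) (+ n) n≡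
                  minimal : ∀ k → Fit (Int S) (+ k) → n ℕ.≤ k
                  minimal k (ψ , h′) = compare (interior-fit⇒fit k (map (act ψ) S) (int-map⁺ ψ {S} ip) (allInt-map ψ {S} {InΔ (+ k)} h′))
                    where
                      compare : Exceptional (map (act ψ) S) ⊎ (Σ ℕ λ m′ → m′ ℕ.≤ k × Fit (_∈ map (act ψ) S) (+ m′ + + 3)) → n ℕ.≤ k
                      compare (inj₁ e) = ⊥-elim (regular (exceptional-map ψ {S} e))
                      compare (inj₂ (m′ , m′≤k , f′)) = ℕₚ.≤-trans (ℤₚ.drop‿+≤+ (lin 3 (λ m n m′ → m :≡ n :+ κ 3 ⇒ m :≤ m′ :+ κ 3 ⇒ ⊢ n :≤ m′) (+ m) (+ n) (+ m′) m≡
                        (ℤ.+≤+ (min (m′ ℕ.+ 3) (fit-map ψ {S} f′))))) m′≤k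

    generic : Result
    generic = decide (search (λ _ → yes tt) (interiorPoints S))
      where
        decide : (Σ Pt λ p → p ∈ interiorPoints S × ⊤) ⊎ (∀ p → p ∈ interiorPoints S → ¬ ⊤) → Result
        decide (inj₁ (p , p∈ , _)) = solid-case p (∈-interiorPoints⁻ S p∈) (leastFit Δ)
        decide (inj₂ none) = hollow-case noInt (hollow-outcome S full (noInt⇒hollow noInt))
          where
            noInt : ∀ p → ¬ Int S p
            noInt p i = none p (∈-interiorPoints⁺ S i) tt

open MainTheorem
open StandardPolygons
open LongEdgeSizes

theorem3 : (S : List Pt) → TwoDim (Poly S) →
  -- case 1
  ((a b : ℕ) → ((a ≡ 1 × b ≡ 1) ⊎ (2 ℕ.≤ a × b ℕ.≤ a)) → Poly S ≃ Trap a b →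
    LS (Inner (Poly S)) (ℤ.- + 2)
    × (a ≡ b → LS (Poly S) (+ (ℕ.suc a)))
    × (b ℕ.< a → LS (Poly S) (+ a)))
  -- case 2
  × (Poly S ≃ Tri2 → LS (Inner (Poly S)) (ℤ.- + 2) × LS (Poly S) (+ 2))
  -- case 3
  × (Poly S ≃ Tri42 → LS (Inner (Poly S)) (+ 0) × LS (Poly S) (+ 4))
  -- case 4
  × ((a b : ℕ) → 2 ℕ.≤ a → 2 ℕ.≤ b → Poly S ≃ Rect a b →
    LS (Inner (Poly S)) (+ (a ℕ.+ b) ℤ.- + 4) × LS (Poly S) (+ (a ℕ.+ b)))
  -- case 5
  × ((α β γ α' β' γ' : ℚ) (k k' : ℕ) →
    IsEdge (Poly S) α β γ → IsEdge (Inner (Poly S)) α' β' γ' →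
    ParallelDist1 (Face (Poly S) α β γ) (Face (Inner (Poly S)) α' β' γ') →
    LatCount (Face (Poly S) α β γ) k → LatCount (Face (Inner (Poly S)) α' β' γ') k' →
    k' ℕ.+ 4 ℕ.≤ k →
    LS (Inner (Poly S)) (+ k' ℤ.- + 1) × LS (Poly S) (+ k ℤ.- + 1))
  -- generic case
  × (¬ ((Σ ℕ λ a → Σ ℕ λ b → ((a ≡ 1 × b ≡ 1) ⊎ (2 ℕ.≤ a × b ℕ.≤ a)) × Poly S ≃ Trap a b)
        ⊎ Poly S ≃ Tri2
        ⊎ Poly S ≃ Tri42
        ⊎ (Σ ℕ λ a → Σ ℕ λ b → 2 ℕ.≤ a × 2 ℕ.≤ b × Poly S ≃ Rect a b)
        ⊎ (Σ ℚ λ α → Σ ℚ λ β → Σ ℚ λ γ → Σ ℚ λ α' → Σ ℚ λ β' → Σ ℚ λ γ' →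
           Σ ℕ λ k → Σ ℕ λ k' →
           IsEdge (Poly S) α β γ × IsEdge (Inner (Poly S)) α' β' γ'
           × ParallelDist1 (Face (Poly S) α β γ) (Face (Inner (Poly S)) α' β' γ')
           × LatCount (Face (Poly S) α β γ) k × LatCount (Face (Inner (Poly S)) α' β' γ') k'
           × k' ℕ.+ 4 ℕ.≤ k))
    → Σ ℤ λ n → LS (Inner (Poly S)) n × LS (Poly S) (n ℤ.+ + 3))
theorem3 S two =
    (λ a b _ → case₁ S a b)
  , case₂ S
  , case₃ S
  , case₄ S
  , (λ α β γ α' β' γ' k k' E E' par count count' gap → Case₅.sizes₅ S E E' count count' gap par)
  , λ regular → Generic.generic S (twoDim⇒triangle S two) λ e → regular (exceptional⇒exception S e)
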